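{- Let $1\le a\le b\le c$ be integers, let $k=a+b+c$, let $d=\gcd(b-a,c-b)$ (with the convention $\gcd(0,0)=0$), and define \[ f(a,b,c)=\begin{cases} 1/4, & \text{if } a=1,\ \gcd(a,b,c)=1 \text{ and } d=1;\\ 6-4\sqrt{2}, & \text{if } a\ge 2,\ \gcd(a,b,c)=1 \text{ and } d=1;\\ 4/9, & \text{if } \gcd(a,b,c)=1 \text{ and } d\ge 3 \text{ is odd};\\ 1/2, & \text{otherwise.} \end{cases} \] Let $M=\max\left\{f(a,b,c),\ 1-\left(\frac{b+c}{k}\right)^2,\ \left(\frac{a+b}{k}\right)^2\right\}$. Then \[ t_1(n,K_{a,b,c})=(M+o(1))\binom n2, \] i.e. for every $\gamma>0$ there is $n_0$ such that for every $n\ge n_0$ with $k\mid n$ we have $\left|t_1(n,K_{a,b,c})-M\binom n2\right|\le \gamma\binom n2$.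
   Context: A $3$-graph $H$ is a pair $(V,E)$ with $E\subseteq\binom V3$. For a vertex $v$, $\deg_H(v)$ is the number of edges containing $v$, and $\delta_1(H)=\min_v \deg_H(v)$ is the minimum vertex degree. $K_{a,b,c}$ denotes the complete $3$-partite $3$-graph with parts of sizes $a,b,c$ (vertex set $X\cup Y\cup Z$, $|X|=a,|Y|=b,|Z|=c$, edges all triples with one vertex in each part). For a $3$-graph $F$, an $F$-factor (perfect $F$-tiling) of $H$ is a collection of vertex-disjoint copies of $F$ in $H$ covering all vertices of $H$. For $n$ divisible by $|V(F)|$, $t_1(n,F)$ is the smallest integer $t$ such that every $3$-graph $H$ on $n$ vertices with $\delta_1(H)\ge t$ contains an $F$-factor. -}

module Defs where

open import Data.Nat as ℕ using (ℕ; zero; suc; _∸_; _%_)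
open import Data.Nat.GCD using (gcd)
open import Data.Nat.Combinatorics using (_C_)
open import Data.Bool using (Bool; true; false; if_then_else_; _∧_; not)
open import Data.Fin as Fin using (Fin; toℕ)
open import Data.List using (List; []; _∷_; cartesianProduct)
open import Data.Fin using () renaming (_≟_ to _≟F_)
open import Data.Integer using (+_)
open import Data.Rational using (ℚ; 0ℚ; 1ℚ; _/_; _+_; _*_; _-_; -_; _≤_; _<_)
open import Data.Product using (Σ; _×_; _,_; ∃-syntax)
open import Data.Sum using (_⊎_)
open import Relation.Binary.PropositionalEquality using (_≡_)
open import Relation.Nullary using (¬_; does)
open import Data.List using (List)
open import Data.Fin.Base using (Fin)
import Data.List as L

-- 3-graphs on vertex set Fin n.
-- A 3-graph is a symmetric Boolean function on triples; only triples of
-- pairwise distinct vertices are meaningful (values on other triples are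
-- never consulted below).

record ThreeGraph (n : ℕ) : Set where
  field
    edge  : Fin n → Fin n → Fin n → Bool
    sym₁₂ : ∀ x y z → edge x y z ≡ edge y x z
    sym₂₃ : ∀ x y z → edge x y z ≡ edge x z y
open ThreeGraph public

countTrue : ∀ {A : Set} → (A → Bool) → List A → ℕ
countTrue p []       = 0
countTrue p (x ∷ xs) = if p x then suc (countTrue p xs) else countTrue p xs

degree : ∀ {n} → ThreeGraph n → Fin n → ℕ
degree {n} H v =
  countTrue
    (λ { (x , y) → does (toℕ x ℕ.<? toℕ y) ∧ not (does (x ≟F v))
                    ∧ not (does (y ≟F v)) ∧ edge H v x y })
    (cartesianProduct (L.allFin n) (L.allFin n))

MinDegGE : ∀ {n} → ThreeGraph n → ℕ → Set
MinDegGE H t = ∀ v → t ℕ.≤ degree H v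

partSize : ℕ → ℕ → ℕ → Fin 3 → ℕ
partSize a b c Fin.zero                      = a
partSize a b c (Fin.suc Fin.zero)            = b
partSize a b c (Fin.suc (Fin.suc Fin.zero))  = c

KFactor : ℕ → ℕ → ℕ → ∀ {n} → ThreeGraph n → Set
KFactor a b c {n} H =
  Σ ℕ λ m → Σ (Fin n → Fin m) λ copy → Σ (Fin n → Fin 3) λ part →
    (∀ (i : Fin m) (j : Fin 3) →
       countTrue (λ v → does (copy v ≟F i) ∧ does (part v ≟F j)) (L.allFin n)
         ≡ partSize a b c j)
    × (∀ (x y z : Fin n) (i : Fin m) →
         copy x ≡ i → copy y ≡ i → copy z ≡ i →
         part x ≡ Fin.zero → part y ≡ Fin.suc Fin.zero →
         part z ≡ Fin.suc (Fin.suc Fin.zero) →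
         edge H x y z ≡ true)

Forces : ℕ → ℕ → ℕ → ℕ → ℕ → Set
Forces a b c n t = ∀ (H : ThreeGraph n) → MinDegGE H t → KFactor a b c H

IsT1 : ℕ → ℕ → ℕ → ℕ → ℕ → Set
IsT1 a b c n t = Forces a b c n t × (∀ t′ → t′ ℕ.< t → ¬ Forces a b c n t′)

-- Numbers p + q√2 with p, q ∈ ℚ (needed for 6 - 4√2).

record Surd : Set where
  constructor _+√2·_
  field
    rat  : ℚ
    coef : ℚ

Nonneg√ : ℚ → ℚ → Set
Nonneg√ p q =
     (0ℚ ≤ p × 0ℚ ≤ q)
  ⊎ (0ℚ ≤ p × q < 0ℚ × ((1ℚ + 1ℚ) * (q * q)) ≤ p * p)
  ⊎ (p < 0ℚ × 0ℚ < q × p * p ≤ ((1ℚ + 1ℚ) * (q * q)))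

_≤ˢ_ : Surd → ℚ → Set
(p +√2· q) ≤ˢ r = Nonneg√ (r - p) (- q)

_ˢ≥_ : Surd → ℚ → Set
(p +√2· q) ˢ≥ r = Nonneg√ (p - r) q

scaleˢ : ℚ → Surd → Surd
scaleˢ s (p +√2· q) = (s * p) +√2· (s * q)

ℕtoℚ : ℕ → ℚ
ℕtoℚ m = (+ m) / 1

-- m / n as a rational (n = 0 never occurs below since k ≥ 1)
frac : ℕ → ℕ → ℚ
frac m zero    = 0ℚ
frac m (suc n) = (+ m) / suc n

gcd3 : ℕ → ℕ → ℕ → ℕ
gcd3 a b c = gcd a (gcd b c)

dval : ℕ → ℕ → ℕ → ℕ
dval a b c = gcd (b ∸ a) (c ∸ b)

fval : ℕ → ℕ → ℕ → Surd
fval a b c =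
  if does (gcd3 a b c ℕ.≟ 1)
  then (if does (dval a b c ℕ.≟ 1)
        then (if does (a ℕ.≟ 1)
              then (frac 1 4 +√2· 0ℚ)
              else (ℕtoℚ 6 +√2· (- ℕtoℚ 4)))
        else (if does (3 ℕ.≤? dval a b c) ∧ does (dval a b c % 2 ℕ.≟ 1)
              then (frac 4 9 +√2· 0ℚ)
              else (frac 1 2 +√2· 0ℚ)))
  else (frac 1 2 +√2· 0ℚ)

q₂ : ℕ → ℕ → ℕ → ℚ
q₂ a b c = 1ℚ - frac (b ℕ.+ c) (a ℕ.+ b ℕ.+ c) * frac (b ℕ.+ c) (a ℕ.+ b ℕ.+ c)

q₃ : ℕ → ℕ → ℕ → ℚ
q₃ a b c = frac (a ℕ.+ b) (a ℕ.+ b ℕ.+ c) * frac (a ℕ.+ b) (a ℕ.+ b ℕ.+ c)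

-- M = max{f, q₂, q₃}; comparisons of M·N with a rational r:
-- M·N ≤ r  iff each of the three candidates times N is ≤ r (N ≥ 0);
-- r ≤ M·N  iff some candidate times N is ≥ r.
MN≤ : ℕ → ℕ → ℕ → ℕ → ℚ → Set
MN≤ a b c N r =
  scaleˢ (ℕtoℚ N) (fval a b c) ≤ˢ r
  × q₂ a b c * ℕtoℚ N ≤ r
  × q₃ a b c * ℕtoℚ N ≤ r

≤MN : ℕ → ℕ → ℕ → ℕ → ℚ → Set
≤MN a b c N r =
  scaleˢ (ℕtoℚ N) (fval a b c) ˢ≥ r
  ⊎ r ≤ q₂ a b c * ℕtoℚ N
  ⊎ r ≤ q₃ a b c * ℕtoℚ N

{-# OPTIONS --safe #-}

-- Upper bound.  Let θ = P/Q exceed the three terms of M.  Cut the n = N k vertices into N blocks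
-- of k ordered vertices and call a block real if it spans a copy of K_{a,b,c}.  While some block F
-- is not real, one more block can be made real, as follows.  By a second moment argument the edges
-- across a random sample of boundedly many blocks form, after a few blocks are discarded, a
-- "pattern" in which every slot, and every vertex of F, has link density above θ.  Only boundedly
-- many patterns exist, so by Erdős's theorem on partite hypergraphs H contains a t-fold blow-up of
-- one of them, for any constant t.  The blow-up together with F has an exact K_{a,b,c}-factor, so
-- its blocks can be rearranged into real ones.
--
-- The exact factor is found by counting how often each slot of the pattern is used.  Copies placed
-- on pairs yz of a link with small b x_y + a x_z, where x is the excess usage, keep the usage
-- within a bounded distance of the mean; such light pairs exist because θ exceeds the two space
-- barriers 1 − ((b+c)/k)² and ((a+b)/k)².  The bounded error is corrected because the usage
-- vectors of copies generate all integer vectors of the right sum; here d and the densities 1/4,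
-- 4/9, 1/2 enter.  Finally a vertex of F is covered by a copy that uses it once; for a ≥ 2 this
-- needs an edge of its link in the shadow of the pattern, whence 6 − 4√2.
--
-- Lower bound.  Six graphs without a factor: all triples meeting a small set, or meeting it twice
-- (space); three divisibility constructions on two classes; and, for a ≥ 2, a vertex whose
-- link A × B avoids the pairs covered by the other edges.

module Submission where

open import Defs
import Algebra.Properties.Semiring.Sum
open import Data.Bool using (Bool; true; false; if_then_else_; _∧_; _∨_; not)
open import Data.Bool.Properties using () renaming (_≟_ to _≟B_)
open import Data.Empty using (⊥; ⊥-elim)
open import Data.Fin using (Fin; zero; suc; toℕ; fromℕ<; inject≤; splitAt; join; _↑ˡ_; _↑ʳ_; combine; remQuot)
  renaming (_≟_ to _≟F_)
open import Data.Fin.Properties using (any?; all?; toℕ-injective; suc-injective; toℕ<n; toℕ-fromℕ<; inject≤-injective;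
  remQuot-combine; combine-remQuot; combine-injective; splitAt-↑ˡ; splitAt-↑ʳ; splitAt-join; join-splitAt)
open import Data.Integer as ℤ using (ℤ) renaming (+_ to pos)
import Data.Integer.Properties as ℤP
import Data.Integer.Tactic.RingSolver
open import Data.List as L using (List; []; _∷_; _++_; length)
open import Data.Nat
  using (ℕ; >-nonZero; >-nonZero⁻¹; zero; suc; _≤_; _<_; _+_; _*_; _∸_; _^_; _⊔_; _/_; _%_; ⌊_/2⌋; _≤?_; _<?_; z≤n; s≤s; s≤s⁻¹; z<s; ∣_-_∣)
  renaming (_≟_ to _≟ℕ_)
open import Data.Nat.Divisibility using (_∣_; divides; ∣1⇒≡1; ∣m+n∣m⇒∣n; m∣m*n; ∣m∣n⇒∣m+n; ∣-trans)
open import Data.Nat.DivMod using (m≡m%n+[m/n]*n; m%n<n; m/n*n≤m)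
open import Data.Nat.GCD using (gcd; module Bézout; gcd-GCD; gcd[m,n]∣m; gcd[m,n]∣n)
open import Data.Nat.Properties hiding (_≟_; _≤?_; _<?_; suc-injective)
import Data.Nat.Tactic.RingSolver
open import Data.Product using (Σ; ∃; ∃-syntax; ∃₂; _×_; _,_; proj₁; proj₂)
open import Data.Rational as ℚ using (ℚ; 0ℚ; 1ℚ; *≤*; *<*)
import Data.Rational.Properties as ℚP
import Data.Rational.Unnormalised as ℚᵘ
import Data.Rational.Unnormalised.Properties as ℚᵘP
open import Data.Sum using (_⊎_; inj₁; inj₂; [_,_]′)
open import Data.Vec using (Vec; []; _∷_; lookup; removeAt; tabulate)
open import Data.Vec.Properties using (lookup∘tabulate)
open import Function using (_∘_; id; case_of_)
import Level
open import Relation.Binary.Definitions using (tri<; tri≈; tri>)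
open import Relation.Binary.PropositionalEquality
  using (_≡_; _≢_; refl; sym; trans; cong; cong₂; subst; subst₂; _≗_; subst-subst-sym; module ≡-Reasoning)
open import Relation.Nullary using (¬_; Dec; yes; no; does; contradiction)
open import Relation.Nullary.Decidable using (dec-true; dec-false; dec⇒maybe; ¬?; decidable-stable; _×-dec_; _→-dec_)
open import Tactic.RingSolver.Core.AlmostCommutativeRing using (AlmostCommutativeRing; fromCommutativeRing)
open import Tactic.RingSolver.Core.Expression using (Expr; Κ; Ι; ⊝_) renaming (_⊕_ to _⊕ᵉ_; _⊗_ to _⊗ᵉ_)
import Tactic.RingSolver.NonReflective as NonReflective

-- Densities are fractions P/Q of ordered pairs, a degree condition reads P n² ≤ Q · 2 deg, and the
-- estimates stay in ℕ. No almost perfect tiling and no absorbing set is prepared: the factor of the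
-- blow-up together with F is exact, so dissolving these blocks and regrouping their vertices leaves
-- every other block untouched. The price is that all slots must be used equally often, without
-- error. Near-equality comes from a potential argument: each new copy puts its largest part on the
-- least used slot, and the two space barriers are the two ends of a segment on which a convex
-- quadratic is compared with θ. A second obstacle is the order of quantifiers: the blow-up size
-- must be fixed before N, while the pattern is seen only afterwards; hence patterns are encoded as
-- bit vectors of bounded length. The constant 6 - 4√2 is the smaller root of θ² - 12θ + 4. This
-- polynomial replaces √θ in the estimates, because (2 + θ)/4 < √θ exactly when it is negative.

module S = Algebra.Properties.Semiring.Sum +-*-semiring

-- Ring identities

data Tm (A : Set) : Set where
  var : ℕ → Tm A
  con : A → Tm A
  _:+_ _:*_ : Tm A → Tm A → Tm A
  ⊖_ : Tm A → Tm A

infix 4 _:=_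
infixl 6 _:+_ _:-_
infixl 7 _:*_
infix 8 ⊖_

_:-_ : ∀ {A} → Tm A → Tm A → Tm A
s :- t = s :+ (⊖ t)

_:=_ : ∀ {A} → Tm A → Tm A → Tm A × Tm A
s := t = s , t

-- The library's normaliser on explicit syntax, whose proof terms are much smaller than those
-- of the library's macro.
module RingSolver (R : AlmostCommutativeRing Level.0ℓ Level.0ℓ) where
  private
    module R = AlmostCommutativeRing R
    module Ops = NonReflective.Ops R

    A : Set
    A = R.Carrier

  variable′ : ∀ n → ℕ → Expr A n
  variable′ zero _ = Κ R.0#
  variable′ (suc n) i = Ι (fin n i)
    where
    fin : ∀ n → ℕ → Fin (suc n)
    fin (suc n) (suc i) = suc (fin n i)
    fin _ _ = zero

  expr : ∀ {n} → Tm A → Expr A n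
  expr (var i) = variable′ _ i
  expr (con c) = Κ c
  expr (s :+ t) = expr s ⊕ᵉ expr t
  expr (s :* t) = expr s ⊗ᵉ expr t
  expr (⊖ t) = ⊝ expr t

  Equation : ℕ → Set
  Equation zero = Tm A × Tm A
  Equation (suc n) = Tm A → Equation n

  close : ∀ n → Equation n → Tm A × Tm A
  close zero e = e
  close (suc n) f = close n (f (var n))

  Holds : ∀ (n : ℕ) {m} → Tm A × Tm A → Vec A m → Set
  Holds zero (s , t) ρ = Ops.⟦ expr s ⟧ ρ R.≈ Ops.⟦ expr t ⟧ ρ
  Holds (suc n) e ρ = (x : A) → Holds n e (x ∷ ρ)

  Normalised : ∀ (n : ℕ) {m} → Tm A × Tm A → Vec A m → Set
  Normalised zero (s , t) ρ = Ops.⟦ expr s ⇓⟧ ρ R.≈ Ops.⟦ expr t ⇓⟧ ρ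
  Normalised (suc n) e ρ = {x : A} → Normalised n e (x ∷ ρ)

  valid : ∀ (n : ℕ) {m} e (ρ : Vec A m) → Normalised n e ρ → Holds n e ρ
  valid zero (s , t) ρ h = R.trans (R.sym (Ops.correct (expr s) ρ)) (R.trans h (Ops.correct (expr t) ρ))
  valid (suc n) e ρ h x = valid n e (x ∷ ρ) h

  solve : ∀ n (f : Equation n) → Normalised n (close n f) [] → Holds n (close n f) []
  solve n f = valid n (close n f) []

open RingSolver Data.Nat.Tactic.RingSolver.ring using () renaming (solve to ℕ-solve)
open RingSolver Data.Integer.Tactic.RingSolver.ring using () renaming (solve to ℤ-solve)
open RingSolver (fromCommutativeRing ℚP.+-*-commutativeRing (λ x → dec⇒maybe (0ℚ ℚP.≟ x))) using () renaming (solve to ℚ-solve)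

module Identities where

  count-above-ring₁ : ∀ b s d K W → b * s + K + (d + b * 0 + b * (1 + W)) + 0 ≡ d + b * (1 + W) + (K + b * s)
  count-above-ring₁ = ℕ-solve 5 (λ b s d K W → b :* s :+ K :+ (d :+ b :* con 0 :+ b :* (con 1 :+ W)) :+ con 0 := d :+ b :* (con 1 :+ W) :+ (K :+
    b :* s)) refl

  count-above-ring₂ : ∀ d b t → d + b + b * t ≡ d + b * (1 + t)
  count-above-ring₂ = ℕ-solve 3 (λ d b t → d :+ b :+ b :* t := d :+ b :* (con 1 :+ t)) refl

  convex-bound-ring₁ : ∀ A B q′ p′ r → A * q′ + B * (p′ + r) + 0 ≡ B * r + (A * q′ + B * p′)
  convex-bound-ring₁ = ℕ-solve 5 (λ A B q′ p′ r → A :* q′ :+ B :* (p′ :+ r) :+ con 0 := B :* r :+ (A :* q′ :+ B :* p′)) refl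

  convex-bound-ring₂ : ∀ A B N → A * (B * N) ≡ B * (A * N)
  convex-bound-ring₂ = ℕ-solve 3 (λ A B N → A :* (B :* N) := B :* (A :* N)) refl

  convex-bound-ring₃ : ∀ A q′ r p′ → A * q′ * (A * q′) + r * p′ * (A * A) ≡ A * q′ * (A * q′) + r * (A * A) * p′
  convex-bound-ring₃ = ℕ-solve 4 (λ A q′ r p′ → A :* q′ :* (A :* q′) :+ r :* p′ :* (A :* A) := A :* q′ :* (A :* q′) :+ r :* (A :* A) :* p′) refl

  convex-bound-ring₄ : ∀ B p′ r → B * r * (B * r) + r * p′ * (B * B) ≡ p′ * r * (B * B) + r * r * (B * B)
  convex-bound-ring₄ = ℕ-solve 3 (λ B p′ r → B :* r :* (B :* r) :+ r :* p′ :* (B :* B) := p′ :* r :* (B :* B) :+ r :* r :* (B :* B)) refl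

  convex-bound-ring₅ : ∀ A P N → A * A * (P * (N * N)) ≡ P * ((A * N) * (A * N))
  convex-bound-ring₅ = ℕ-solve 3 (λ A P N → A :* A :* (P :* (N :* N)) := P :* ((A :* N) :* (A :* N))) refl

  convex-bound-ring₆ : ∀ A Q ℓ → A * A * (Q * ℓ) ≡ Q * (A * A * ℓ)
  convex-bound-ring₆ = ℕ-solve 3 (λ A Q ℓ → A :* A :* (Q :* ℓ) := Q :* (A :* A :* ℓ)) refl

  convex-bound-ring₇ : ∀ A ℓ p → A * A * (ℓ + p * p) ≡ A * A * ℓ + A * p * (A * p)
  convex-bound-ring₇ = ℕ-solve 3 (λ A ℓ p → A :* A :* (ℓ :+ p :* p) := A :* A :* ℓ :+ A :* p :* (A :* p)) refl

  convex-bound-ring₈ : ∀ A N p q → A * A * (2 * (N * p) + q * q) ≡ 2 * ((A * N) * (A * p)) + A * q * (A * q)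
  convex-bound-ring₈ = ℕ-solve 4 (λ A N p q → A :* A :* (con 2 :* (N :* p) :+ q :* q) := con 2 :* ((A :* N) :* (A :* p)) :+ A :* q :* (A :* q)) refl

  convex-bound-ring₉ : ∀ A P ρ Q p q r B y → (ρ * p + r) * ((ρ * p + r) * (P * (ρ * ρ)) + Q * (A * A * (ρ * p))) + ((ρ * ρ) * (Q * y + Q * (2 *
    ((ρ * p + r) * (A * p)) + A * q * (A * q))) + Q * ((ρ * p) * r * (B * B) + r * r * (B * B))) + 0 ≡ (ρ * p + r) * (Q * (2 * (ρ * A * (ρ * p))
    + r * (B * B))) + ((ρ * ρ) * (P * ((ρ * p + r) * (ρ * p + r)) + Q * (y + A * p * (A * p))) + Q * (A * (ρ * q) * (A * (ρ * q)) + r * (A * A)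
    * (ρ * p)))
  convex-bound-ring₉ = ℕ-solve 9 (λ A P ρ Q p q r B y → (ρ :* p :+ r) :* ((ρ :* p :+ r) :* (P :* (ρ :* ρ)) :+ Q :* (A :* A :* (ρ :* p))) :+ ((ρ
    :* ρ) :* (Q :* y :+ Q :* (con 2 :* ((ρ :* p :+ r) :* (A :* p)) :+ A :* q :* (A :* q))) :+ Q :* ((ρ :* p) :* r :* (B :* B) :+ r :* r :* (B :*
    B))) :+ con 0 := (ρ :* p :+ r) :* (Q :* (con 2 :* (ρ :* A :* (ρ :* p)) :+ r :* (B :* B))) :+ ((ρ :* ρ) :* (P :* ((ρ :* p :+ r) :* (ρ :* p :+
    r)) :+ Q :* (y :+ A :* p :* (A :* p))) :+ Q :* (A :* (ρ :* q) :* (A :* (ρ :* q)) :+ r :* (A :* A) :* (ρ :* p)))) refl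

  convex-bound-ring₁₀ : ∀ Q ρ A p r B P → (Q * (2 * (ρ * A * p) + r * (B * B)) + (p + r)) + (p * (P * (ρ * ρ) + Q * (A * A)) + r * (P * (ρ *
    ρ))) + 0 ≡ ((p + r) * (P * (ρ * ρ)) + Q * (A * A * p)) + (p * (1 + 2 * (Q * (ρ * A))) + r * (1 + Q * (B * B)))
  convex-bound-ring₁₀ = ℕ-solve 7 (λ Q ρ A p r B P → (Q :* (con 2 :* (ρ :* A :* p) :+ r :* (B :* B)) :+ (p :+ r)) :+ (p :* (P :* (ρ :* ρ) :+ Q
    :* (A :* A)) :+ r :* (P :* (ρ :* ρ))) :+ con 0 := ((p :+ r) :* (P :* (ρ :* ρ)) :+ Q :* (A :* A :* p)) :+ (p :* (con 1 :+ con 2 :* (Q :* (ρ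
    :* A))) :+ r :* (con 1 :+ Q :* (B :* B)))) refl

  light-pair-ring₁ : ∀ a b M u v → (a + b) * (M * (b * u + a * v)) ≡ b * ((a + b) * (M * u)) + a * ((a + b) * (M * v))
  light-pair-ring₁ = ℕ-solve 5 (λ a b M u v → (a :+ b) :* (M :* (b :* u :+ a :* v)) := b :* ((a :+ b) :* (M :* u)) :+ a :* ((a :+ b) :* (M :*
    v))) refl

  light-pair-ring₂ : ∀ a b sA sP W v → a * sA + b * sP + (v + b * W + a * W) + 0 ≡ v + (b * sP + (a + b) * W + a * sA)
  light-pair-ring₂ = ℕ-solve 6 (λ a b sA sP W v → a :* sA :+ b :* sP :+ (v :+ b :* W :+ a :* W) :+ con 0 := v :+ (b :* sP :+ (a :+ b) :* W :+ a
    :* sA)) refl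

  light-pair-ring₃ : ∀ a s M x → a * (s * (M * x)) ≡ a * (s * M) * x
  light-pair-ring₃ = ℕ-solve 4 (λ a s M x → a :* (s :* (M :* x)) := a :* (s :* M) :* x) refl

  light-pair-ring₄ : ∀ r k C X → r * k * (C * X) ≡ r * k * X * C
  light-pair-ring₄ = ℕ-solve 4 (λ r k C X → r :* k :* (C :* X) := r :* k :* X :* C) refl

  light-pair-ring₅ : ∀ a b R ρ p q → R * (ρ * (a * (p + q) + b * p)) ≡ a * R * (ρ * q) + (a + b) * R * (ρ * p)
  light-pair-ring₅ = ℕ-solve 6 (λ a b R ρ p q → R :* (ρ :* (a :* (p :+ q) :+ b :* p)) := a :* R :* (ρ :* q) :+ (a :+ b) :* R :* (ρ :* p)) refl

  light-pair-ring₆ : ∀ a b R N → R * (a * ((a + b) * (R * N))) ≡ a * R * ((a + b) * R * N)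
  light-pair-ring₆ = ℕ-solve 4 (λ a b R N → R :* (a :* ((a :+ b) :* (R :* N))) := a :* R :* ((a :+ b) :* R :* N)) refl

  light-pair-ring₇ : ∀ a b R N ρ p q → (a + b) * (ρ * p) + a * ((a + b) * (R * N)) + ρ * (a * q) ≡ (a + b) * (a * R * N) + ρ * (a * (p + q) + b * p)
  light-pair-ring₇ = ℕ-solve 7 (λ a b R N ρ p q → (a :+ b) :* (ρ :* p) :+ a :* ((a :+ b) :* (R :* N)) :+ ρ :* (a :* q) := (a :+ b) :* (a :* R :*
    N) :+ ρ :* (a :* (p :+ q) :+ b :* p)) refl

  Pρ²-ring : ∀ P k R → P * ((R * k) * (R * k)) ≡ R * R * (P * (k * k))
  Pρ²-ring = ℕ-solve 3 (λ P k R → P :* ((R :* k) :* (R :* k)) := R :* R :* (P :* (k :* k))) refl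

  c₁⁰-ring : ∀ Q P a s → 1 + 2 * (Q * ((a + s) * a)) + (P * ((a + s) * (a + s)) + Q * (s * s)) + 0 ≡ P * ((a + s) * (a + s)) + Q * (a * a) + (1
    + Q * ((a + s) * (a + s)))
  c₁⁰-ring = ℕ-solve 4 (λ Q P a s → con 1 :+ con 2 :* (Q :* ((a :+ s) :* a)) :+ (P :* ((a :+ s) :* (a :+ s)) :+ Q :* (s :* s)) :+ con 0 := P :*
    ((a :+ s) :* (a :+ s)) :+ Q :* (a :* a) :+ (con 1 :+ Q :* ((a :+ s) :* (a :+ s)))) refl

  c₁′-ring : ∀ a Q T k → 1 + 2 * (Q * ((2 * T * k) * (a * (1 + 2 * T)))) + ((2 * T * (1 + 2 * T)) * (T + Q * (a * a)) + T) + (2 * (T * T) + T +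
    Q * (a * a) * (1 + 2 * T)) ≡ (2 * T * (2 * T) * T + Q * (a * (1 + 2 * T) * (a * (1 + 2 * T)))) + ((2 * T * (1 + 2 * T)) * (1 + 2 * (Q * (k *
    a))) + 1)
  c₁′-ring = ℕ-solve 4 (λ a Q T k → con 1 :+ con 2 :* (Q :* ((con 2 :* T :* k) :* (a :* (con 1 :+ con 2 :* T)))) :+ ((con 2 :* T :* (con 1 :+
    con 2 :* T)) :* (T :+ Q :* (a :* a)) :+ T) :+ (con 2 :* (T :* T) :+ T :+ Q :* (a :* a) :* (con 1 :+ con 2 :* T)) := (con 2 :* T :* (con 2 :*
    T) :* T :+ Q :* (a :* (con 1 :+ con 2 :* T) :* (a :* (con 1 :+ con 2 :* T)))) :+ ((con 2 :* T :* (con 1 :+ con 2 :* T)) :* (con 1 :+ con 2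
    :* (Q :* (k :* a))) :+ con 1)) refl

  c₂′-ring : ∀ B Q T → 1 + Q * (B * (1 + 2 * T) * (B * (1 + 2 * T))) + (1 + 2 * T) * (1 + 2 * T) * T + 3 * T ≡ 2 * T * (2 * T) * T + (1 + 2 * T)
    * (1 + 2 * T) * (1 + Q * (B * B))
  c₂′-ring = ℕ-solve 3 (λ B Q T → con 1 :+ Q :* (B :* (con 1 :+ con 2 :* T) :* (B :* (con 1 :+ con 2 :* T))) :+ (con 1 :+ con 2 :* T) :* (con 1
    :+ con 2 :* T) :* T :+ con 3 :* T := con 2 :* T :* (con 2 :* T) :* T :+ (con 1 :+ con 2 :* T) :* (con 1 :+ con 2 :* T) :* (con 1 :+ Q :* (B
    :* B))) refl

  cover-arith₀-ring₁ : ∀ e δ x → δ + 4 * x + (6 * x + 3 * e) + 3 * x ≡ 2 * e + (e + δ + x + 3 * (4 * x))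
  cover-arith₀-ring₁ = ℕ-solve 3 (λ e δ x → δ :+ con 4 :* x :+ (con 6 :* x :+ con 3 :* e) :+ con 3 :* x := con 2 :* e :+ (e :+ δ :+ x :+ con 3
    :* (con 4 :* x))) refl

  cover-arith₀-ring₂ : ∀ e δ x → 1 + (2 * (e * e) + (e + 2 * δ + 2 * x) * (e + 2 * δ + 2 * x) + 3 * (6 * (x * (e + δ + x))) + δ * (2 * e)) + 2 ≡
    0 + (16 * (x * (e + δ + x)) + 3 * (1 + ((e + δ + x) * (e + δ + x) + x * x)) + δ * (δ + 4 * x))
  cover-arith₀-ring₂ = ℕ-solve 3 (λ e δ x → con 1 :+ (con 2 :* (e :* e) :+ (e :+ con 2 :* δ :+ con 2 :* x) :* (e :+ con 2 :* δ :+ con 2 :* x) :+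
    con 3 :* (con 6 :* (x :* (e :+ δ :+ x))) :+ δ :* (con 2 :* e)) :+ con 2 := con 0 :+ (con 16 :* (x :* (e :+ δ :+ x)) :+ con 3 :* (con 1 :+
    ((e :+ δ :+ x) :* (e :+ δ :+ x) :+ x :* x)) :+ δ :* (δ :+ con 4 :* x))) refl

  cover-arith-ring₁ : ∀ P N → P * (N * N) ≡ N * (P * N)
  cover-arith-ring₁ = ℕ-solve 2 (λ P N → P :* (N :* N) := N :* (P :* N)) refl

  cover-arith-ring₂ : ∀ Q N m → Q * (N * m) ≡ N * (Q * m)
  cover-arith-ring₂ = ℕ-solve 3 (λ Q N m → Q :* (N :* m) := N :* (Q :* m)) refl

  cover-arith-ring₃ : ∀ P Q → 4 * Q * Q + 12 * (P * Q) + (P * P + 1) ≡ 4 * Q * (3 * P) + (1 + (4 * (Q * Q) + P * P))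
  cover-arith-ring₃ = ℕ-solve 2 (λ P Q → con 4 :* Q :* Q :+ con 12 :* (P :* Q) :+ (P :* P :+ con 1) := con 4 :* Q :* (con 3 :* P) :+ (con 1 :+
    (con 4 :* (Q :* Q) :+ P :* P))) refl

  cover-arith-ring₄ : ∀ P Q N h → N * N + (2 * Q + P) * N * ((2 * Q + P) * N) + (N * N * (12 * (P * Q)) + 16 * Q * (Q * (h * h))) + 0 ≡ 4 * (Q *
    h) * (4 * (Q * h)) + (N * N * (1 + (4 * (Q * Q) + P * P)) + 16 * Q * (P * (N * N)))
  cover-arith-ring₄ = ℕ-solve 4 (λ P Q N h → N :* N :+ (con 2 :* Q :+ P) :* N :* ((con 2 :* Q :+ P) :* N) :+ (N :* N :* (con 12 :* (P :* Q)) :+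
    con 16 :* Q :* (Q :* (h :* h))) :+ con 0 := con 4 :* (Q :* h) :* (con 4 :* (Q :* h)) :+ (N :* N :* (con 1 :+ (con 4 :* (Q :* Q) :+ P :* P))
    :+ con 16 :* Q :* (P :* (N :* N)))) refl

  cover-arith-ring₅ : ∀ P Q m h → 2 * (Q * (m + h)) + (2 * Q + P) * (m + h) ≡ 4 * (Q * m) + 4 * (Q * h) + P * (m + h)
  cover-arith-ring₅ = ℕ-solve 4 (λ P Q m h → con 2 :* (Q :* (m :+ h)) :+ (con 2 :* Q :+ P) :* (m :+ h) := con 4 :* (Q :* m) :+ con 4 :* (Q :* h)
    :+ P :* (m :+ h)) refl

  cover-arith-ring₆ : ∀ a d s x → a + (d + s) + x ≡ a + d + x + s
  cover-arith-ring₆ = ℕ-solve 4 (λ a d s x → a :+ (d :+ s) :+ x := a :+ d :+ x :+ s) refl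

  cover-arith-ring₇ : ∀ P Q N → (2 * Q + P) * N ≡ 2 * (Q * N) + P * N
  cover-arith-ring₇ = ℕ-solve 3 (λ P Q N → (con 2 :* Q :+ P) :* N := con 2 :* (Q :* N) :+ P :* N) refl

  cover-arith-ring₈ : ∀ a d x → d + (a + d + x + x) ≡ a + 2 * d + 2 * x
  cover-arith-ring₈ = ℕ-solve 3 (λ a d x → d :+ (a :+ d :+ x :+ x) := a :+ con 2 :* d :+ con 2 :* x) refl

  cover-arith-ring₉ : ∀ P Q N m h z → 16 * (P * N * (2 * (Q * N))) + 16 * Q * (Q * z + Q * (2 * (m * m) + h * h)) + 0 ≡ 2 * (4 * (Q * m) * (4 *
    (Q * m))) + 4 * (Q * h) * (4 * (Q * h)) + 16 * Q * (2 * (P * (N * N)) + Q * z)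
  cover-arith-ring₉ = ℕ-solve 6 (λ P Q N m h z → con 16 :* (P :* N :* (con 2 :* (Q :* N))) :+ con 16 :* Q :* (Q :* z :+ Q :* (con 2 :* (m :* m)
    :+ h :* h)) :+ con 0 := con 2 :* (con 4 :* (Q :* m) :* (con 4 :* (Q :* m))) :+ con 4 :* (Q :* h) :* (con 4 :* (Q :* h)) :+ con 16 :* Q :*
    (con 2 :* (P :* (N :* N)) :+ Q :* z)) refl

  cover-arith-ring₁₀ : ∀ P Q N → N * N + (2 * (Q * N) * (2 * (Q * N)) + P * N * (P * N)) + N * N * (12 * (P * Q)) + 0 ≡ 6 * (P * N * (2 * (Q *
    N))) + N * N * (1 + (4 * (Q * Q) + P * P))
  cover-arith-ring₁₀ = ℕ-solve 3 (λ P Q N → N :* N :+ (con 2 :* (Q :* N) :* (con 2 :* (Q :* N)) :+ P :* N :* (P :* N)) :+ N :* N :* (con 12 :*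
    (P :* Q)) :+ con 0 := con 6 :* (P :* N :* (con 2 :* (Q :* N))) :+ N :* N :* (con 1 :+ (con 4 :* (Q :* Q) :+ P :* P))) refl

  cover-arith-ring₁₁ : ∀ N Q → 2 * N * Q ≡ 2 * (Q * N)
  cover-arith-ring₁₁ = ℕ-solve 2 (λ N Q → con 2 :* N :* Q := con 2 :* (Q :* N)) refl

  cover-arith-ring₁₂ : ∀ N P → 2 * N * (3 * P) ≡ 6 * (P * N)
  cover-arith-ring₁₂ = ℕ-solve 2 (λ N P → con 2 :* N :* (con 3 :* P) := con 6 :* (P :* N)) refl

  half-<-ring : ∀ Q s → 4 * (Q * (s * s)) ≡ Q * (2 * s * (2 * s))
  half-<-ring = ℕ-solve 2 (λ Q s → con 4 :* (Q :* (s :* s)) := Q :* (con 2 :* s :* (con 2 :* s))) refl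

  unbalanced-ring₁ : ∀ P Q M X → Q * (2 * M * (2 * M)) + M * M + (M * M * (9 * P) + 9 * (Q * X)) + 0 ≡ Q * (9 * X) + (M * M * (1 + 4 * Q) + 9 *
    (P * (M * M)))
  unbalanced-ring₁ = ℕ-solve 4 (λ P Q M X → Q :* (con 2 :* M :* (con 2 :* M)) :+ M :* M :+ (M :* M :* (con 9 :* P) :+ con 9 :* (Q :* X)) :+ con
    0 := Q :* (con 9 :* X) :+ (M :* M :* (con 1 :+ con 4 :* Q) :+ con 9 :* (P :* (M :* M)))) refl

  unbalanced-ring₂ : ∀ α β → 1 + 2 * β + 3 * α + 0 ≡ α + (1 + 2 * (α + β))
  unbalanced-ring₂ = ℕ-solve 2 (λ α β → con 1 :+ con 2 :* β :+ con 3 :* α :+ con 0 := α :+ (con 1 :+ con 2 :* (α :+ β))) refl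

  unbalanced-ring₃ : ∀ α → 9 * (α * α) ≡ 3 * α * (3 * α)
  unbalanced-ring₃ = ℕ-solve 1 (λ α → con 9 :* (α :* α) := con 3 :* α :* (con 3 :* α)) refl

  unbalanced-ring₄ : ∀ β o → 1 + 9 * (2 * ((2 * β + o) * β)) + (6 * (β * o) + 4 * (o * o)) ≡ 0 + (1 + 2 * (2 * β + o + β) * (2 * (2 * β + o + β)))
  unbalanced-ring₄ = ℕ-solve 2 (λ β o → con 1 :+ con 9 :* (con 2 :* ((con 2 :* β :+ o) :* β)) :+ (con 6 :* (β :* o) :+ con 4 :* (o :* o)) := con
    0 :+ (con 1 :+ con 2 :* (con 2 :* β :+ o :+ β) :* (con 2 :* (con 2 :* β :+ o :+ β)))) refl

  In-neg-ring : ∀ v n → n ≡ ℤ.- v ℤ.+ (v ℤ.+ n)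
  In-neg-ring = ℤ-solve 2 (λ v n → n := ⊖ v :+ (v :+ n)) refl

  In-add-ring : ∀ v w n m → (v ℤ.+ n) ℤ.+ (w ℤ.+ m) ≡ (v ℤ.+ w) ℤ.+ (n ℤ.+ m)
  In-add-ring = ℤ-solve 4 (λ v w n m → (v :+ n) :+ (w :+ m) := (v :+ w) :+ (n :+ m)) refl

  In-mul-ring : ∀ n v → v ℤ.+ n ℤ.* v ≡ (ℤ.1ℤ ℤ.+ n) ℤ.* v
  In-mul-ring = ℤ-solve 2 (λ n v → v :+ n :* v := (con ℤ.1ℤ :+ n) :* v) refl

  ≈-sym-ring : ∀ x y → ℤ.- (x ℤ.- y) ≡ y ℤ.- x
  ≈-sym-ring = ℤ-solve 2 (λ x y → ⊖ (x :- y) := y :- x) refl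

  ≈-trans-ring : ∀ x y z → (x ℤ.- y) ℤ.+ (y ℤ.- z) ≡ x ℤ.- z
  ≈-trans-ring = ℤ-solve 3 (λ x y z → (x :- y) :+ (y :- z) := x :- z) refl

  In-edge-ring : ∀ a b c x y z → x ℤ.+ a ℤ.* x ℤ.+ b ℤ.* y ℤ.+ c ℤ.* z ≡ ((ℤ.1ℤ ℤ.+ a) ℤ.* x ℤ.+ b ℤ.* y ℤ.+ c ℤ.* z) ℤ.+ ℤ.0ℤ
  In-edge-ring = ℤ-solve 6 (λ a b c x y z → x :+ a :* x :+ b :* y :+ c :* z := ((con ℤ.1ℤ :+ a) :* x :+ b :* y :+ c :* z) :+ con ℤ.0ℤ) refl

  share-ring : ∀ a b c i j y z → i ℤ.+ a ℤ.* i ℤ.+ b ℤ.* y ℤ.+ c ℤ.* z ≡ (i ℤ.- j) ℤ.+ (j ℤ.+ a ℤ.* i ℤ.+ b ℤ.* y ℤ.+ c ℤ.* z)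
  share-ring = ℤ-solve 7 (λ a b c i j y z → i :+ a :* i :+ b :* y :+ c :* z := (i :- j) :+ (j :+ a :* i :+ b :* y :+ c :* z)) refl

  Mul-gcd-ring₁ : ∀ d z → d ℤ.+ z ℤ.+ ℤ.- z ≡ d
  Mul-gcd-ring₁ = ℤ-solve 2 (λ d z → d :+ z :+ ⊖ z := d) refl

  Mul-gcd-ring₂ : ∀ d z → d ℤ.+ z ℤ.+ ℤ.- z ≡ d
  Mul-gcd-ring₂ = ℤ-solve 2 (λ d z → d :+ z :+ ⊖ z := d) refl

  edge-p-ring : ∀ a p c x y z → (a ℤ.* y ℤ.+ (a ℤ.+ p) ℤ.* x ℤ.+ c ℤ.* z) ℤ.- (a ℤ.* x ℤ.+ (a ℤ.+ p) ℤ.* y ℤ.+ c ℤ.* z) ≡ p ℤ.* (x ℤ.- y)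
  edge-p-ring = ℤ-solve 6 (λ a p c x y z → (a :* y :+ (a :+ p) :* x :+ c :* z) :- (a :* x :+ (a :+ p) :* y :+ c :* z) := p :* (x :- y)) refl

  edge-q-ring : ∀ a b q x y z → (a ℤ.* z ℤ.+ b ℤ.* y ℤ.+ (b ℤ.+ q) ℤ.* x) ℤ.- (a ℤ.* z ℤ.+ b ℤ.* x ℤ.+ (b ℤ.+ q) ℤ.* y) ≡ q ℤ.* (x ℤ.- y)
  edge-q-ring = ℤ-solve 6 (λ a b q x y z → (a :* z :+ b :* y :+ (b :+ q) :* x) :- (a :* z :+ b :* x :+ (b :+ q) :* y) := q :* (x :- y)) refl

  In-class-ring : ∀ a b c x y z u v w → (a ℤ.* x ℤ.+ b ℤ.* y ℤ.+ c ℤ.* z) ℤ.- a ℤ.* (x ℤ.- u) ℤ.- b ℤ.* (y ℤ.- v) ℤ.- c ℤ.* (z ℤ.- w) ≡ a ℤ.* u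
    ℤ.+ b ℤ.* v ℤ.+ c ℤ.* w
  In-class-ring = ℤ-solve 9 (λ a b c x y z u v w → (a :* x :+ b :* y :+ c :* z) :- a :* (x :- u) :- b :* (y :- v) :- c :* (z :- w) := a :* u :+
    b :* v :+ c :* w) refl

  Mul-class-ring : ∀ n x y i k → n ℤ.* (x ℤ.- y) ℤ.- n ℤ.* (x ℤ.- i) ℤ.+ n ℤ.* (y ℤ.- k) ≡ n ℤ.* (i ℤ.- k)
  Mul-class-ring = ℤ-solve 5 (λ n x y i k → n :* (x :- y) :- n :* (x :- i) :+ n :* (y :- k) := n :* (i :- k)) refl

  diff-ring₁ : ∀ x y → x ≡ x ℤ.* ℤ.1ℤ ℤ.+ y ℤ.* ℤ.0ℤ
  diff-ring₁ = ℤ-solve 2 (λ x y → x := x :* con ℤ.1ℤ :+ y :* con ℤ.0ℤ) refl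

  diff-ring₂ : ∀ x y → y ≡ x ℤ.* ℤ.0ℤ ℤ.+ y ℤ.* ℤ.1ℤ
  diff-ring₂ = ℤ-solve 2 (λ x y → y := x :* con ℤ.0ℤ :+ y :* con ℤ.1ℤ) refl

  from₀-ring : ∀ a p q x y → (a ℤ.* y ℤ.+ (a ℤ.+ p) ℤ.* x ℤ.+ (a ℤ.+ p ℤ.+ q) ℤ.* x) ℤ.- (a ℤ.* (x ℤ.* ℤ.1ℤ ℤ.+ y ℤ.* ℤ.0ℤ) ℤ.+ (a ℤ.+ p) ℤ.* (x
    ℤ.* ℤ.1ℤ ℤ.+ y ℤ.* ℤ.0ℤ) ℤ.+ (a ℤ.+ p ℤ.+ q) ℤ.* (x ℤ.* ℤ.1ℤ ℤ.+ y ℤ.* ℤ.0ℤ)) ≡ ℤ.- a ℤ.* (x ℤ.- y)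
  from₀-ring = ℤ-solve 5 (λ a p q x y → (a :* y :+ (a :+ p) :* x :+ (a :+ p :+ q) :* x) :- (a :* (x :* con ℤ.1ℤ :+ y :* con ℤ.0ℤ) :+ (a :+ p) :*
    (x :* con ℤ.1ℤ :+ y :* con ℤ.0ℤ) :+ (a :+ p :+ q) :* (x :* con ℤ.1ℤ :+ y :* con ℤ.0ℤ)) := ⊖ a :* (x :- y)) refl

  from₂-ring₁ : ∀ a p q x y → (a ℤ.* y ℤ.+ (a ℤ.+ p) ℤ.* x ℤ.+ (a ℤ.+ p ℤ.+ q) ℤ.* x) ℤ.- (a ℤ.* (x ℤ.* ℤ.1ℤ ℤ.+ y ℤ.* ℤ.0ℤ) ℤ.+ (a ℤ.+ p) ℤ.*
    (x ℤ.* ℤ.0ℤ ℤ.+ y ℤ.* ℤ.1ℤ) ℤ.+ (a ℤ.+ p ℤ.+ q) ℤ.* (x ℤ.* ℤ.0ℤ ℤ.+ y ℤ.* ℤ.1ℤ)) ≡ (a ℤ.+ pos 2 ℤ.* p ℤ.+ q) ℤ.* (x ℤ.- y)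
  from₂-ring₁ = ℤ-solve 5 (λ a p q x y → (a :* y :+ (a :+ p) :* x :+ (a :+ p :+ q) :* x) :- (a :* (x :* con ℤ.1ℤ :+ y :* con ℤ.0ℤ) :+ (a :+ p)
    :* (x :* con ℤ.0ℤ :+ y :* con ℤ.1ℤ) :+ (a :+ p :+ q) :* (x :* con ℤ.0ℤ :+ y :* con ℤ.1ℤ)) := (a :+ con (pos 2) :* p :+ q) :* (x :- y)) refl

  from₂-ring₂ : ∀ a p q → a ℤ.+ pos 2 ℤ.* p ℤ.+ q ℤ.+ ℤ.- (pos 2 ℤ.* p) ℤ.+ ℤ.- q ≡ a
  from₂-ring₂ = ℤ-solve 3 (λ a p q → a :+ con (pos 2) :* p :+ q :+ ⊖ (con (pos 2) :* p) :+ ⊖ q := a) refl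

  from₃-ring₁ : ∀ a p q x y → (a ℤ.* y ℤ.+ (a ℤ.+ p) ℤ.* x ℤ.+ (a ℤ.+ p ℤ.+ q) ℤ.* x) ℤ.- (a ℤ.* (x ℤ.* ℤ.0ℤ ℤ.+ y ℤ.* ℤ.1ℤ) ℤ.+ (a ℤ.+ p) ℤ.*
    (x ℤ.* ℤ.0ℤ ℤ.+ y ℤ.* ℤ.1ℤ) ℤ.+ (a ℤ.+ p ℤ.+ q) ℤ.* (x ℤ.* ℤ.0ℤ ℤ.+ y ℤ.* ℤ.1ℤ)) ≡ (pos 2 ℤ.* a ℤ.+ pos 2 ℤ.* p ℤ.+ q) ℤ.* (x ℤ.- y)
  from₃-ring₁ = ℤ-solve 5 (λ a p q x y → (a :* y :+ (a :+ p) :* x :+ (a :+ p :+ q) :* x) :- (a :* (x :* con ℤ.0ℤ :+ y :* con ℤ.1ℤ) :+ (a :+ p)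
    :* (x :* con ℤ.0ℤ :+ y :* con ℤ.1ℤ) :+ (a :+ p :+ q) :* (x :* con ℤ.0ℤ :+ y :* con ℤ.1ℤ)) := (con (pos 2) :* a :+ con (pos 2) :* p :+ q) :*
    (x :- y)) refl

  from₃-ring₂ : ∀ a p q → pos 2 ℤ.* a ℤ.+ pos 2 ℤ.* p ℤ.+ q ℤ.+ ℤ.- (pos 2 ℤ.* p) ℤ.+ ℤ.- q ≡ pos 2 ℤ.* a
  from₃-ring₂ = ℤ-solve 3 (λ a p q → con (pos 2) :* a :+ con (pos 2) :* p :+ q :+ ⊖ (con (pos 2) :* p) :+ ⊖ q := con (pos 2) :* a) refl

  from₃-ring₃ : ∀ a e → a ℤ.* (ℤ.1ℤ ℤ.+ pos 2 ℤ.* e) ℤ.+ ℤ.- (e ℤ.* (pos 2 ℤ.* a)) ≡ a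
  from₃-ring₃ = ℤ-solve 2 (λ a e → a :* (con ℤ.1ℤ :+ con (pos 2) :* e) :+ ⊖ (e :* (con (pos 2) :* a)) := a) refl

  connected₁-ring : ∀ m u v → 1 + 2 * m + (2 * u + 2 * v) + 1 ≡ 2 * (u + v) + (1 + m + (1 + m))
  connected₁-ring = ℕ-solve 3 (λ m u v → con 1 :+ con 2 :* m :+ (con 2 :* u :+ con 2 :* v) :+ con 1 := con 2 :* (u :+ v) :+ (con 1 :+ m :+ (con
    1 :+ m))) refl

  three-meet-ring₁ : ∀ x → 3 * x ≡ x + x + x
  three-meet-ring₁ = ℕ-solve 1 (λ x → con 3 :* x := x :+ x :+ x) refl

  three-meet-ring₂ : ∀ Q x y z → Q * x + Q * y + Q * z ≡ Q * (x + y + z)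
  three-meet-ring₂ = ℕ-solve 4 (λ Q x y z → Q :* x :+ Q :* y :+ Q :* z := Q :* (x :+ y :+ z)) refl

  tf-ring : ∀ x y → x * y + y * x ≡ 2 * (x * y)
  tf-ring = ℕ-solve 2 (λ x y → x :* y :+ y :* x := con 2 :* (x :* y)) refl

  not-split-ring : ∀ α β → 2 * α + 2 * β ≡ α + β + (α + β)
  not-split-ring = ℕ-solve 2 (λ α β → con 2 :* α :+ con 2 :* β := α :+ β :+ (α :+ β)) refl

  sum-shift-ring₁ : ∀ μ x → (μ + x) * (μ + x) ≡ μ * μ + 2 * μ * x + x * x
  sum-shift-ring₁ = ℕ-solve 2 (λ μ x → (μ :+ x) :* (μ :+ x) := μ :* μ :+ con 2 :* μ :* x :+ x :* x) refl

  sum-shift-ring₂ : ∀ n μ X Y → n * (n * (μ * μ) + 2 * μ * X + Y) ≡ n * μ * (n * μ) + 2 * (n * μ * X) + n * Y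
  sum-shift-ring₂ = ℕ-solve 4 (λ n μ X Y → n :* (n :* (μ :* μ) :+ con 2 :* μ :* X :+ Y) := n :* μ :* (n :* μ) :+ con 2 :* (n :* μ :* X) :+ n :*
    Y) refl

  Spread⇒close-ring₁ : ∀ D S φ → D + (S + φ + (S + φ)) + 0 ≡ D + 2 * S + 2 * φ
  Spread⇒close-ring₁ = ℕ-solve 3 (λ D S φ → D :+ (S :+ φ :+ (S :+ φ)) :+ con 0 := D :+ con 2 :* S :+ con 2 :* φ) refl

  Spread⇒close-ring₂ : ∀ φ Y → Y + Y + 2 * φ ≡ 2 * φ + (Y + Y)
  Spread⇒close-ring₂ = ℕ-solve 2 (λ φ Y → Y :+ Y :+ con 2 :* φ := con 2 :* φ :+ (Y :+ Y)) refl

  s₂′-ring : ∀ u g → (u + g) * (u + g) ≡ u * u + 2 * (u * g) + g * g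
  s₂′-ring = ℕ-solve 2 (λ u g → (u :+ g) :* (u :+ g) := u :* u :+ con 2 :* (u :* g) :+ g :* g) refl

  gain-ring : ∀ n S k μ t G X → n * (S + 2 * (k * μ + t) + G) + (n * μ + X) * (n * μ + X) + k * k + 2 * (k * X) + n * (k * k) + 0 ≡ n * S + (n *
    μ + X + k) * (n * μ + X + k) + 2 * (n * t) + n * (k * k) + n * G
  gain-ring = ℕ-solve 7 (λ n S k μ t G X → n :* (S :+ con 2 :* (k :* μ :+ t) :+ G) :+ (n :* μ :+ X) :* (n :* μ :+ X) :+ k :* k :+ con 2 :* (k :*
    X) :+ n :* (k :* k) :+ con 0 := n :* S :+ (n :* μ :+ X :+ k) :* (n :* μ :+ X :+ k) :+ con 2 :* (n :* t) :+ n :* (k :* k) :+ n :* G) refl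

  large-ring₁ : ∀ R₀ n t k X → (1 + R₀) * (n * t + n * (k * k)) + (R₀ * k * X + k * X) + k ≡ (1 + R₀) * (k * X) + ((1 + R₀) * n * t + k * (1 +
    (1 + R₀) * n * k))
  large-ring₁ = ℕ-solve 5 (λ R₀ n t k X → (con 1 :+ R₀) :* (n :* t :+ n :* (k :* k)) :+ (R₀ :* k :* X :+ k :* X) :+ k := (con 1 :+ R₀) :* (k :*
    X) :+ ((con 1 :+ R₀) :* n :* t :+ k :* (con 1 :+ (con 1 :+ R₀) :* n :* k))) refl

  large-ring₂ : ∀ a b c d e f n k → 1 + a + b + (d + e + 2 * f + n * (k * k) + 2 * c + k * k) + n * (k * k) ≡ d + e + (a + b + k * k + 2 * c + 2
    * (f + n * (k * k)) + 1)
  large-ring₂ = ℕ-solve 8 (λ a b c d e f n k → con 1 :+ a :+ b :+ (d :+ e :+ con 2 :* f :+ n :* (k :* k) :+ con 2 :* c :+ k :* k) :+ n :* (k :*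
    k) := d :+ e :+ (a :+ b :+ k :* k :+ con 2 :* c :+ con 2 :* (f :+ n :* (k :* k)) :+ con 1)) refl

  small-ring₁ : ∀ m X → m * m + 2 * (m * X) + X * X ≡ (m + X) * (m + X)
  small-ring₁ = ℕ-solve 2 (λ m X → m :* m :+ con 2 :* (m :* X) :+ X :* X := (m :+ X) :* (m :+ X)) refl

  small-ring₂ : ∀ a b c d e f g k h → a + (d + e + 2 * f + g + 2 * c + (b + h)) + k * k ≡ e + (h + g) + (a + b + k * k + 2 * c + 2 * f + d)
  small-ring₂ = ℕ-solve 9 (λ a b c d e f g k h → a :+ (d :+ e :+ con 2 :* f :+ g :+ con 2 :* c :+ (b :+ h)) :+ k :* k := e :+ (h :+ g) :+ (a :+
    b :+ k :* k :+ con 2 :* c :+ con 2 :* f :+ d)) refl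

  step-ring : ∀ a b c d φ φ′ K → a + (c + d + (b + (K + φ)) + (1 + φ′)) + 0 ≡ d + (K + φ′) + (1 + a + b + c + φ)
  step-ring = ℕ-solve 7 (λ a b c d φ φ′ K → a :+ (c :+ d :+ (b :+ (K :+ φ)) :+ (con 1 :+ φ′)) :+ con 0 := d :+ (K :+ φ′) :+ (con 1 :+ a :+ b :+
    c :+ φ)) refl

  sum-usage-ring : ∀ w a b c p q r s → w * (p + a * q + b * r + c * s) ≡ p * w + a * (q * w) + b * (r * w) + c * (s * w)
  sum-usage-ring = ℕ-solve 8 (λ w a b c p q r s → w :* (p :+ a :* q :+ b :* r :+ c :* s) := p :* w :+ a :* (q :* w) :+ b :* (r :* w) :+ c :* (s
    :* w)) refl

  sum-usage-1-ring : ∀ a b c → 1 + a * 1 + b * 1 + c * 1 ≡ 1 + a + b + c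
  sum-usage-1-ring = ℕ-solve 3 (λ a b c → con 1 :+ a :* con 1 :+ b :* con 1 :+ c :* con 1 := con 1 :+ a :+ b :+ c) refl

  light-step-ring : ∀ a b c μ y z → μ + z + a * (μ + z) + b * (μ + y) + c * μ ≡ (1 + a + b + c) * μ + (b * y + (1 + a) * z)
  light-step-ring = ℕ-solve 6 (λ a b c μ y z → μ :+ z :+ a :* (μ :+ z) :+ b :* (μ :+ y) :+ c :* μ := (con 1 :+ a :+ b :+ c) :* μ :+ (b :* y :+
    (con 1 :+ a) :* z)) refl

  covering-ring₁ : ∀ b c → b * 1 + c * 1 + 1 ≡ 1 + 0 + b + c
  covering-ring₁ = ℕ-solve 2 (λ b c → b :* con 1 :+ c :* con 1 :+ con 1 := con 1 :+ con 0 :+ b :+ c) refl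

  covering-ring₂ : ∀ a b c → a * 1 + b * 1 + c * 1 + 1 ≡ 1 + a + b + c
  covering-ring₂ = ℕ-solve 3 (λ a b c → a :* con 1 :+ b :* con 1 :+ c :* con 1 :+ con 1 := con 1 :+ a :+ b :+ c) refl

  swap-in-ring : ∀ x y n → (x ℤ.- y ℤ.+ n) ℤ.+ y ≡ n ℤ.+ x
  swap-in-ring = ℤ-solve 3 (λ x y n → (x :- y :+ n) :+ y := n :+ x) refl

  rebalance-ring₁ : ∀ f g t u P N e o → f * P + g * N + u * e + t * o + (u * P + t * N) ≡ (f + u) * P + (g + t) * N + u * e + t * o
  rebalance-ring₁ = ℕ-solve 8 (λ f g t u P N e o → f :* P :+ g :* N :+ u :* e :+ t :* o :+ (u :* P :+ t :* N) := (f :+ u) :* P :+ (g :+ t) :* N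
    :+ u :* e :+ t :* o) refl

  rebalance-ring₂ : ∀ κ t u P N e o → (κ + t) * P + (κ + u) * N + u * e + t * o ≡ κ * P + κ * N + t * (P + o) + u * (N + e)
  rebalance-ring₂ = ℕ-solve 7 (λ κ t u P N e o → (κ :+ t) :* P :+ (κ :+ u) :* N :+ u :* e :+ t :* o := κ :* P :+ κ :* N :+ t :* (P :+ o) :+ u :*
    (N :+ e)) refl

  rebalance-ring₃ : ∀ κ t u P N e o → κ * P + κ * N + t * (N + e) + u * (P + o) ≡ κ * P + κ * N + t * e + u * o + (u * P + t * N)
  rebalance-ring₃ = ℕ-solve 7 (λ κ t u P N e o → κ :* P :+ κ :* N :+ t :* (N :+ e) :+ u :* (P :+ o) := κ :* P :+ κ :* N :+ t :* e :+ u :* o :+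
    (u :* P :+ t :* N)) refl

  tiling-ring₁ : ∀ x β s k → x + β * k + s * k + k ≡ x + k * 1 + β * k + s * k
  tiling-ring₁ = ℕ-solve 4 (λ x β s k → x :+ β :* k :+ s :* k :+ k := x :+ k :* con 1 :+ β :* k :+ s :* k) refl

  tiling-ring₂ : ∀ β s k → k * k + β * k + s * k ≡ (s + (k + β)) * k
  tiling-ring₂ = ℕ-solve 3 (λ β s k → k :* k :+ β :* k :+ s :* k := (s :+ (k :+ β)) :* k) refl

  tiling-ring₃ : ∀ m t k → (1 + m * t) * k ≡ m * k * t + k
  tiling-ring₃ = ℕ-solve 3 (λ m t k → (con 1 :+ m :* t) :* k := m :* k :* t :+ k) refl

  tiling-ring₄ : ∀ c l f u → c + (l + f) + u ≡ c + l + (f + u)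
  tiling-ring₄ = ℕ-solve 4 (λ c l f u → c :+ (l :+ f) :+ u := c :+ l :+ (f :+ u)) refl

  tiling-ring₅ : ∀ c l b t → c + l + (b + t) ≡ t + (c + b + l)
  tiling-ring₅ = ℕ-solve 4 (λ c l b t → c :+ l :+ (b :+ t) := t :+ (c :+ b :+ l)) refl

  homogenize-ring : ∀ p w → p * w + p * w ≡ (2 * p) * w
  homogenize-ring = ℕ-solve 2 (λ p w → p :* w :+ p :* w := (con 2 :* p) :* w) refl

  blow-up-ring₁ : ∀ N M C d h → M * N + (2 * (C * d) + (2 * C * M * h + N * M)) + 0 ≡ M * (2 * C * h) + (2 * (N * M) + 2 * C * d)
  blow-up-ring₁ = ℕ-solve 5 (λ N M C d h → M :* N :+ (con 2 :* (C :* d) :+ (con 2 :* C :* M :* h :+ N :* M)) :+ con 0 := M :* (con 2 :* C :* h)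
    :+ (con 2 :* (N :* M) :+ con 2 :* C :* d)) refl

  blow-up-ring₂ : ∀ C t M w S → 4 * C * t * M + (2 * (2 * C * S) + 4 * C * (4 * C * t * w + M * t)) + 0 ≡ 4 * C * t * (4 * C * w) + (2 * (4 * C
    * t * M) + 4 * C * S)
  blow-up-ring₂ = ℕ-solve 5 (λ C t M w S → con 4 :* C :* t :* M :+ (con 2 :* (con 2 :* C :* S) :+ con 4 :* C :* (con 4 :* C :* t :* w :+ M :*
    t)) :+ con 0 := con 4 :* C :* t :* (con 4 :* C :* w) :+ (con 2 :* (con 4 :* C :* t :* M) :+ con 4 :* C :* S)) refl

  lin-remove-ring : ∀ a b c → a + (b + c) ≡ b + (a + c)
  lin-remove-ring = ℕ-solve 3 (λ a b c → a :+ (b :+ c) := b :+ (a :+ c)) refl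

  moment₁-ring : ∀ N M F m → N * (M * F) + N * (m * F * M) ≡ (1 + m) * F * (N * M)
  moment₁-ring = ℕ-solve 4 (λ N M F m → N :* (M :* F) :+ N :* (m :* F :* M) := (con 1 :+ m) :* F :* (N :* M)) refl

  moment₂-ring₁ : ∀ a b → (a + b) * (a + b) ≡ a * a + 2 * a * b + b * b
  moment₂-ring₁ = ℕ-solve 2 (λ a b → (a :+ b) :* (a :+ b) := a :* a :+ con 2 :* a :* b :+ b :* b) refl

  moment₂-ring₂ : ∀ N M G F M₁ M₂ m K → N * N * (M * G + 2 * F * M₁ + N * M₂) + (N * N * M * (N * (K * K)) + 2 * F * N * (m * F * M) + N * (m *
    m * (F * F) * M + m * (N * N * M) * (K * K))) + F * F * (N * M) ≡ (1 + m) * (1 + m) * (F * F) * (N * M) + (1 + m) * (N * N * (N * M)) * (K *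
    K) + (N * N * M * G + 2 * F * N * (N * M₁) + N * (N * N * M₂))
  moment₂-ring₂ = ℕ-solve 8 (λ N M G F M₁ M₂ m K → N :* N :* (M :* G :+ con 2 :* F :* M₁ :+ N :* M₂) :+ (N :* N :* M :* (N :* (K :* K)) :+ con 2
    :* F :* N :* (m :* F :* M) :+ N :* (m :* m :* (F :* F) :* M :+ m :* (N :* N :* M) :* (K :* K))) :+ F :* F :* (N :* M) := (con 1 :+ m) :*
    (con 1 :+ m) :* (F :* F) :* (N :* M) :+ (con 1 :+ m) :* (N :* N :* (N :* M)) :* (K :* K) :+ (N :* N :* M :* G :+ con 2 :* F :* N :* (N :*
    M₁) :+ N :* (N :* N :* M₂))) refl

  variance-ring₁ : ∀ N l m F → 2 * (N * l * (m * F)) ≡ 2 * (m * F) * N * l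
  variance-ring₁ = ℕ-solve 4 (λ N l m F → con 2 :* (N :* l :* (m :* F)) := con 2 :* (m :* F) :* N :* l) refl

  variance-ring₂ : ∀ N l → N * l * (N * l) ≡ N * N * (l * l)
  variance-ring₂ = ℕ-solve 2 (λ N l → N :* l :* (N :* l) := N :* N :* (l :* l)) refl

  variance-ring₃ : ∀ V a b c → V + (a + b + c) + 0 ≡ a + b + (V + c)
  variance-ring₃ = ℕ-solve 4 (λ V a b c → V :+ (a :+ b :+ c) :+ con 0 := a :+ b :+ (V :+ c)) refl

  variance-ring₄ : ∀ M₂ N M m F K → m * m * (F * F) * M + m * (N * N * M) * (K * K) + (N * N * M₂ + M * (m * F * (m * F))) ≡ m * (N * N * M) *
    (K * K) + (N * N * M₂ + 2 * (m * F) * (m * F * M))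
  variance-ring₄ = ℕ-solve 6 (λ M₂ N M m F K → m :* m :* (F :* F) :* M :+ m :* (N :* N :* M) :* (K :* K) :+ (N :* N :* M₂ :+ M :* (m :* F :* (m
    :* F))) := m :* (N :* N :* M) :* (K :* K) :+ (N :* N :* M₂ :+ con 2 :* (m :* F) :* (m :* F :* M))) refl

  deviation-ring₁ : ∀ m N l b → m * (N * l + b) ≡ N * (m * l) + m * b
  deviation-ring₁ = ℕ-solve 4 (λ m N l b → m :* (N :* l :+ b) := N :* (m :* l) :+ m :* b) refl

  deviation-ring₂ : ∀ N t a b → N * (t + a) + b ≡ N * t + (N * a + b)
  deviation-ring₂ = ℕ-solve 4 (λ N t a b → N :* (t :+ a) :+ b := N :* t :+ (N :* a :+ b)) refl

  ΣD²-ring₁ : ∀ x y d → (x + y) * (x + y) + 0 + d ≡ x * x + y * y + (d + 2 * (x * y))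
  ΣD²-ring₁ = ℕ-solve 3 (λ x y d → (x :+ y) :* (x :+ y) :+ con 0 :+ d := x :* x :+ y :* y :+ (d :+ con 2 :* (x :* y))) refl

  ΣD²-ring₂ : ∀ x y → x * x + y * y + (x * x + y * y) ≡ 2 * (x * x) + 2 * (y * y) + 0
  ΣD²-ring₂ = ℕ-solve 2 (λ x y → x :* x :+ y :* y :+ (x :* x :+ y :* y) := con 2 :* (x :* x) :+ con 2 :* (y :* y) :+ con 0) refl

  ΣD²-ring₃ : ∀ N m a b → 2 * (N * a * (N * a)) + 2 * (m * b * (m * b)) ≡ 2 * (N * N) * (a * a) + 2 * (m * m) * (b * b)
  ΣD²-ring₃ = ℕ-solve 4 (λ N m a b → con 2 :* (N :* a :* (N :* a)) :+ con 2 :* (m :* b :* (m :* b)) := con 2 :* (N :* N) :* (a :* a) :+ con 2 :*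
    (m :* m) :* (b :* b)) refl

  ΣD²-ring₄ : ∀ m N M κ X Y → 2 * (N * N) * X + 2 * (m * m) * Y + (2 * (N * N) * ((1 + m) * ((1 + m) * (N * (m * (N * N * M) * (κ * κ))))) + 2 *
    (m * m) * ((1 + m) * (N * N * (N * M)) * (N * κ * (N * κ)))) + 2 * (1 + m) * (3 * m + 2) * (N * N * N * N * N * M) * (κ * κ) ≡ 4 * ((1 + m)
    * (1 + m) * (1 + m) * (N * N * (N * N) * (N * M)) * (κ * κ)) + (2 * (N * N) * X + 2 * (m * m) * Y)
  ΣD²-ring₄ = ℕ-solve 6 (λ m N M κ X Y → con 2 :* (N :* N) :* X :+ con 2 :* (m :* m) :* Y :+ (con 2 :* (N :* N) :* ((con 1 :+ m) :* ((con 1 :+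
    m) :* (N :* (m :* (N :* N :* M) :* (κ :* κ))))) :+ con 2 :* (m :* m) :* ((con 1 :+ m) :* (N :* N :* (N :* M)) :* (N :* κ :* (N :* κ)))) :+
    con 2 :* (con 1 :+ m) :* (con 3 :* m :+ con 2) :* (N :* N :* N :* N :* N :* M) :* (κ :* κ) := con 4 :* ((con 1 :+ m) :* (con 1 :+ m) :* (con
    1 :+ m) :* (N :* N :* (N :* N) :* (N :* M)) :* (κ :* κ)) :+ (con 2 :* (N :* N) :* X :+ con 2 :* (m :* m) :* Y)) refl

  chebyshev-ring₁ : ∀ c d → c * d * (c * d) ≡ c * c * (d * d)
  chebyshev-ring₁ = ℕ-solve 2 (λ c d → c :* d :* (c :* d) := c :* c :* (d :* d)) refl

  chebyshev-ring₂ : ∀ m N κ v → m * m * m * (N * N * (N * N)) * (κ * κ) * (m * v) ≡ N * N * (m * m) * κ * (N * N * (m * m) * κ) * v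
  chebyshev-ring₂ = ℕ-solve 4 (λ m N κ v → m :* m :* m :* (N :* N :* (N :* N)) :* (κ :* κ) :* (m :* v) := N :* N :* (m :* m) :* κ :* (N :* N :*
    (m :* m) :* κ) :* v) refl

  chebyshev-ring₃ : ∀ m N κ c M → c * c * (4 * (m * m * m * (N * N * (N * N) * M) * (κ * κ))) ≡ m * m * m * (N * N * (N * N)) * (κ * κ) * (4 *
    (c * c) * M)
  chebyshev-ring₃ = ℕ-solve 5 (λ m N κ c M → c :* c :* (con 4 :* (m :* m :* m :* (N :* N :* (N :* N) :* M) :* (κ :* κ))) := m :* m :* m :* (N :*
    N :* (N :* N)) :* (κ :* κ) :* (con 4 :* (c :* c) :* M)) refl

  part-sizes-ring₁ : ∀ a b c → 1 + a * 1 + b * 0 + c * 0 ≡ 1 + a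
  part-sizes-ring₁ = ℕ-solve 3 (λ a b c → con 1 :+ a :* con 1 :+ b :* con 0 :+ c :* con 0 := con 1 :+ a) refl

  part-sizes-ring₂ : ∀ a b c → 0 + a * 0 + b * 1 + c * 0 ≡ b
  part-sizes-ring₂ = ℕ-solve 3 (λ a b c → con 0 :+ a :* con 0 :+ b :* con 1 :+ c :* con 0 := b) refl

  part-sizes-ring₃ : ∀ a b c → 0 + a * 0 + b * 0 + c * 1 ≡ c
  part-sizes-ring₃ = ℕ-solve 3 (λ a b c → con 0 :+ a :* con 0 :+ b :* con 0 :+ c :* con 1 := c) refl

  R≡-ring : ∀ k m t → k + m * k * t ≡ (1 + m * t) * k
  R≡-ring = ℕ-solve 3 (λ k m t → k :+ m :* k :* t := (con 1 :+ m :* t) :* k) refl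

  dense⇒tiled-ring : ∀ u b c → u + b * 0 + c * 0 ≡ u
  dense⇒tiled-ring = ℕ-solve 3 (λ u b c → u :+ b :* con 0 :+ c :* con 0 := u) refl

  sample-arith-ring₁ : ∀ Q P κ N H T μ₀ μ C → N * N * (C * (μ₀ * μ) * ((1 + P) * κ)) + (C * (μ₀ * μ) * (Q * (H + 3 * (N * κ))) + Q * (C * (N *
    (N * T)) + N * N * (μ * μ) * κ) + N * (μ₀ * μ) * κ * N) + 0 ≡ N * N * (Q * (C * T) + Q * (μ * μ) * κ + μ₀ * μ * κ) + (C * (μ₀ * μ) * ((1 +
    P) * (N * N * κ)) + Q * (C * (μ₀ * (μ * H))) + N * (μ₀ * μ) * κ * (3 * Q * C))
  sample-arith-ring₁ = ℕ-solve 9 (λ Q P κ N H T μ₀ μ C → N :* N :* (C :* (μ₀ :* μ) :* ((con 1 :+ P) :* κ)) :+ (C :* (μ₀ :* μ) :* (Q :* (H :+ con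
    3 :* (N :* κ))) :+ Q :* (C :* (N :* (N :* T)) :+ N :* N :* (μ :* μ) :* κ) :+ N :* (μ₀ :* μ) :* κ :* N) :+ con 0 := N :* N :* (Q :* (C :* T)
    :+ Q :* (μ :* μ) :* κ :+ μ₀ :* μ :* κ) :+ (C :* (μ₀ :* μ) :* ((con 1 :+ P) :* (N :* N :* κ)) :+ Q :* (C :* (μ₀ :* (μ :* H))) :+ N :* (μ₀ :*
    μ) :* κ :* (con 3 :* Q :* C))) refl

  sample-arith-ring₂ : ∀ Q B m μ₀ μ → 2 * (Q * ((4 * Q + 2) * (B * m))) + Q * (μ * μ) + μ₀ * μ + (2 * (4 * Q + 2) * (Q * B) * (2 * μ) + (2 * Q +
    1) * μ * μ₀ + Q * μ * (2 * μ₀)) + 0 ≡ (4 * Q + 2) * (μ₀ * μ) + (2 * (4 * Q + 2) * (Q * B) * m + (2 * Q + 1) * μ * (8 * (Q * B)) + Q * μ * μ)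
  sample-arith-ring₂ = ℕ-solve 5 (λ Q B m μ₀ μ → con 2 :* (Q :* ((con 4 :* Q :+ con 2) :* (B :* m))) :+ Q :* (μ :* μ) :+ μ₀ :* μ :+ (con 2 :*
    (con 4 :* Q :+ con 2) :* (Q :* B) :* (con 2 :* μ) :+ (con 2 :* Q :+ con 1) :* μ :* μ₀ :+ Q :* μ :* (con 2 :* μ₀)) :+ con 0 := (con 4 :* Q :+
    con 2) :* (μ₀ :* μ) :+ (con 2 :* (con 4 :* Q :+ con 2) :* (Q :* B) :* m :+ (con 2 :* Q :+ con 1) :* μ :* (con 8 :* (Q :* B)) :+ Q :* μ :* μ)) refl

  sample-arith-ring₃ : ∀ Q P κ T G B m m′ μ₀ μ → (4 * Q + 2) * (P * (m′ * m′ * κ)) + (Q * ((4 * Q + 2) * T) + Q * (μ * μ) * κ + μ₀ * μ * κ + (4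
    * Q + 2) * Q * (G + 2 * (B * m * κ)) + (4 * Q + 2) * P * κ * (μ₀ * μ) + κ * ((4 * Q + 2) * (μ₀ * μ))) + 0 ≡ (4 * Q + 2) * (Q * G) + ((4 * Q
    + 2) * (μ₀ * μ) * ((1 + P) * κ) + (4 * Q + 2) * Q * T + (4 * Q + 2) * P * κ * (m′ * m′) + κ * (2 * (Q * ((4 * Q + 2) * (B * m))) + Q * (μ *
    μ) + μ₀ * μ))
  sample-arith-ring₃ = ℕ-solve 10 (λ Q P κ T G B m m′ μ₀ μ → (con 4 :* Q :+ con 2) :* (P :* (m′ :* m′ :* κ)) :+ (Q :* ((con 4 :* Q :+ con 2) :*
    T) :+ Q :* (μ :* μ) :* κ :+ μ₀ :* μ :* κ :+ (con 4 :* Q :+ con 2) :* Q :* (G :+ con 2 :* (B :* m :* κ)) :+ (con 4 :* Q :+ con 2) :* P :* κ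
    :* (μ₀ :* μ) :+ κ :* ((con 4 :* Q :+ con 2) :* (μ₀ :* μ))) :+ con 0 := (con 4 :* Q :+ con 2) :* (Q :* G) :+ ((con 4 :* Q :+ con 2) :* (μ₀ :*
    μ) :* ((con 1 :+ P) :* κ) :+ (con 4 :* Q :+ con 2) :* Q :* T :+ (con 4 :* Q :+ con 2) :* P :* κ :* (m′ :* m′) :+ κ :* (con 2 :* (Q :* ((con
    4 :* Q :+ con 2) :* (B :* m))) :+ Q :* (μ :* μ) :+ μ₀ :* μ))) refl

  ΣI-ring : ∀ N k c Y → N * (k * (4 * (c * c) * Y)) ≡ 4 * (k * (c * c)) * (N * Y)
  ΣI-ring = ℕ-solve 4 (λ N k c Y → N :* (k :* (con 4 :* (c :* c) :* Y)) := con 4 :* (k :* (c :* c)) :* (N :* Y)) refl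

  ΣE-ring : ∀ k c X → k * (4 * (c * c) * X) ≡ 4 * (k * (c * c)) * X
  ΣE-ring = ℕ-solve 3 (λ k c X → k :* (con 4 :* (c :* c) :* X) := con 4 :* (k :* (c :* c)) :* X) refl

  Σcost-ring : ∀ m A K N Y I E → 3 * m * (2 * ((1 + m) * (I + K * (Y + m * Y)) + K * E)) + (6 * (1 + m) * (4 * A * (N * Y)) + 24 * (A * (N * Y))
    * m + 6 * K * (4 * A * (N * Y)) + m * (N * Y) * K + K * (N * Y) * m + K * m * Y * N) + 0 ≡ 3 * m * (K * (N * Y)) + (6 * (1 + m) * (m * I) +
    24 * (A * (N * Y)) * 1 + 6 * K * (m * E) + m * (N * Y) * (48 * A) + K * (N * Y) * (24 * A) + K * m * Y * (6 * ((1 + m) * (1 + m))))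
  Σcost-ring = ℕ-solve 7 (λ m A K N Y I E → con 3 :* m :* (con 2 :* ((con 1 :+ m) :* (I :+ K :* (Y :+ m :* Y)) :+ K :* E)) :+ (con 6 :* (con 1
    :+ m) :* (con 4 :* A :* (N :* Y)) :+ con 24 :* (A :* (N :* Y)) :* m :+ con 6 :* K :* (con 4 :* A :* (N :* Y)) :+ m :* (N :* Y) :* K :+ K :*
    (N :* Y) :* m :+ K :* m :* Y :* N) :+ con 0 := con 3 :* m :* (K :* (N :* Y)) :+ (con 6 :* (con 1 :+ m) :* (m :* I) :+ con 24 :* (A :* (N :*
    Y)) :* con 1 :+ con 6 :* K :* (m :* E) :+ m :* (N :* Y) :* (con 48 :* A) :+ K :* (N :* Y) :* (con 24 :* A) :+ K :* m :* Y :* (con 6 :* ((con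
    1 :+ m) :* (con 1 :+ m))))) refl

  many-good-ring₁ : ∀ K b → K * (2 * b) ≡ 2 * (K * b)
  many-good-ring₁ = ℕ-solve 2 (λ K b → K :* (con 2 :* b) := con 2 :* (K :* b)) refl

  many-good-ring₂ : ∀ G b → G + b + (G + b) + 0 ≡ 2 * G + 2 * b
  many-good-ring₂ = ℕ-solve 2 (λ G b → G :+ b :+ (G :+ b) :+ con 0 := con 2 :* G :+ con 2 :* b) refl

  sum-drop-ring₁ : ∀ F G m′ B C → F + (G + (m′ + B) * C) + 0 ≡ F + G + (m′ * C + B * C)
  sum-drop-ring₁ = ℕ-solve 5 (λ F G m′ B C → F :+ (G :+ (m′ :+ B) :* C) :+ con 0 := F :+ G :+ (m′ :* C :+ B :* C)) refl

  sum-drop-ring₂ : ∀ m F′ G′ B C → m * C + (F′ + G′ + B * C) ≡ F′ + B * C + (G′ + m * C)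
  sum-drop-ring₂ = ℕ-solve 5 (λ m F′ G′ B C → m :* C :+ (F′ :+ G′ :+ B :* C) := F′ :+ B :* C :+ (G′ :+ m :* C)) refl

  link≤-ring₁ : ∀ x → x + x + x ≡ 3 * x
  link≤-ring₁ = ℕ-solve 1 (λ x → x :+ x :+ x := con 3 :* x) refl

  link≤-ring₂ : ∀ k x y z → k * (k * (x + y + z)) ≡ k * k * x + k * k * y + k * k * z
  link≤-ring₂ = ℕ-solve 4 (λ k x y z → k :* (k :* (x :+ y :+ z)) := k :* k :* x :+ k :* k :* y :+ k :* k :* z) refl

  drop-≤-ring : ∀ G m B κ → G + m * (B * κ) + B * (m * κ) ≡ G + 2 * (B * m * κ)
  drop-≤-ring = ℕ-solve 4 (λ G m B κ → G :+ m :* (B :* κ) :+ B :* (m :* κ) := G :+ con 2 :* (B :* m :* κ)) refl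

  dense-at-ring₁ : ∀ P m k → P * (m * k * (m * k)) ≡ P * (m * m * (k * k))
  dense-at-ring₁ = ℕ-solve 3 (λ P m k → P :* (m :* k :* (m :* k)) := P :* (m :* m :* (k :* k))) refl

  dense-at-ring₂ : ∀ P N k → (1 + P) * (N * N * (k * k)) ≡ (1 + P) * (N * k * (N * k))
  dense-at-ring₂ = ℕ-solve 3 (λ P N k → (con 1 :+ P) :* (N :* N :* (k :* k)) := (con 1 :+ P) :* (N :* k :* (N :* k))) refl

  Good-slack-ring₁ : ∀ κ Q → 1 + κ + 12 * Q + 9 + 1 ≡ 1 + κ + 12 * Q + 10
  Good-slack-ring₁ = ℕ-solve 2 (λ κ Q → con 1 :+ κ :+ con 12 :* Q :+ con 9 :+ con 1 := con 1 :+ κ :+ con 12 :* Q :+ con 10) refl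

  Good-slack-ring₂ : ∀ Q g u v w P → 1 + Q * g * u + (g * (P * v + Q * w) + g) + 0 ≡ P * g * v + (1 + Q * g * u + Q * g * w + g)
  Good-slack-ring₂ = ℕ-solve 6 (λ Q g u v w P → con 1 :+ Q :* g :* u :+ (g :* (P :* v :+ Q :* w) :+ g) :+ con 0 := P :* g :* v :+ (con 1 :+ Q :*
    g :* u :+ Q :* g :* w :+ g)) refl

  Good-slack-ring₃ : ∀ Q g u v w P′ → (1 + P′) * v + (1 + Q * g * u + Q * g * w + g) ≡ P′ * v + Q * g * w + (g * (1 + Q * u) + (1 + v))
  Good-slack-ring₃ = ℕ-solve 6 (λ Q g u v w P′ → (con 1 :+ P′) :* v :+ (con 1 :+ Q :* g :* u :+ Q :* g :* w :+ g) := P′ :* v :+ Q :* g :* w :+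
    (g :* (con 1 :+ Q :* u) :+ (con 1 :+ v))) refl

  Good-slack-ring₄ : ∀ Q g P P′ → 1 + (4 * (Q * g * (Q * g)) + P′ * P′) + (g * g * (12 * (P * Q)) + g * g) + 2 * P′ ≡ 1 + 4 * (Q * g * (Q * g))
    + P′ * P′ + (12 * (P * g * (Q * g)) + g * g) + 2 * P′
  Good-slack-ring₄ = ℕ-solve 4 (λ Q g P P′ → con 1 :+ (con 4 :* (Q :* g :* (Q :* g)) :+ P′ :* P′) :+ (g :* g :* (con 12 :* (P :* Q)) :+ g :* g)
    :+ con 2 :* P′ := con 1 :+ con 4 :* (Q :* g :* (Q :* g)) :+ P′ :* P′ :+ (con 12 :* (P :* g :* (Q :* g)) :+ g :* g) :+ con 2 :* P′) refl

  Good-slack-ring₅ : ∀ Q g P′ → 1 + 4 * (Q * g * (Q * g)) + P′ * P′ + (12 * ((1 + P′) * (Q * g)) + g * g) + 2 * P′ ≡ 12 * (P′ * (Q * g)) + (g *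
    g + 4 * (Q * g * (Q * g)) + (1 + P′) * (1 + P′) + g * (12 * Q))
  Good-slack-ring₅ = ℕ-solve 3 (λ Q g P′ → con 1 :+ con 4 :* (Q :* g :* (Q :* g)) :+ P′ :* P′ :+ (con 12 :* ((con 1 :+ P′) :* (Q :* g)) :+ g :*
    g) :+ con 2 :* P′ := con 12 :* (P′ :* (Q :* g)) :+ (g :* g :+ con 4 :* (Q :* g :* (Q :* g)) :+ (con 1 :+ P′) :* (con 1 :+ P′) :+ g :* (con
    12 :* Q))) refl

  Good-slack-ring₆ : ∀ Q g P P′ → 12 * (P′ * (Q * g)) + (g * g + 4 * (Q * g * (Q * g)) + P * g * (P * g) + g * (12 * Q)) ≡ 12 * (P′ * (Q * g)) +
    (g * g * (1 + (4 * (Q * Q) + P * P)) + g * (12 * Q))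
  Good-slack-ring₆ = ℕ-solve 4 (λ Q g P P′ → con 12 :* (P′ :* (Q :* g)) :+ (g :* g :+ con 4 :* (Q :* g :* (Q :* g)) :+ P :* g :* (P :* g) :+ g
    :* (con 12 :* Q)) := con 12 :* (P′ :* (Q :* g)) :+ (g :* g :* (con 1 :+ (con 4 :* (Q :* Q) :+ P :* P)) :+ g :* (con 12 :* Q))) refl

  upper-bound-ring₁ : ∀ g P m → g * (P * m) ≡ P * g * m
  upper-bound-ring₁ = ℕ-solve 3 (λ g P m → g :* (P :* m) := P :* g :* m) refl

  upper-bound-ring₂ : ∀ g Q m → g * (Q * m) ≡ Q * g * m
  upper-bound-ring₂ = ℕ-solve 3 (λ g Q m → g :* (Q :* m) := Q :* g :* m) refl

  degree≥-ring₁ : ∀ n → n * 1 + n * 1 + n * 1 ≡ 3 * n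
  degree≥-ring₁ = ℕ-solve 1 (λ n → n :* con 1 :+ n :* con 1 :+ n :* con 1 := con 3 :* n) refl

  degree≥-ring₂ : ∀ x y z → x * (y * z) ≡ z * (y * x)
  degree≥-ring₂ = ℕ-solve 3 (λ x y z → x :* (y :* z) := z :* (y :* x)) refl

  lower₁-ring₁ : ∀ s x → s + (x + 1) ≡ s + 1 + x
  lower₁-ring₁ = ℕ-solve 2 (λ s x → s :+ (x :+ con 1) := s :+ con 1 :+ x) refl

  lower₁-ring₂ : ∀ s s′ → s′ * s′ + (s * s + 2 * (s * s′)) ≡ s′ * s′ + 0 + (s′ * s + 0) + (s * s′ + 0) + (s * s + 0)
  lower₁-ring₂ = ℕ-solve 2 (λ s s′ → s′ :* s′ :+ (s :* s :+ con 2 :* (s :* s′)) := s′ :* s′ :+ con 0 :+ (s′ :* s :+ con 0) :+ (s :* s′ :+ con 0)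
    :+ (s :* s :+ con 0)) refl

  lower₁-ring₃ : ∀ s s′ → s * s + 2 * (s * s′) ≡ 0 + (s′ * s + 0) + (s * s′ + 0) + (s * s + 0)
  lower₁-ring₃ = ℕ-solve 2 (λ s s′ → s :* s :+ con 2 :* (s :* s′) := con 0 :+ (s′ :* s :+ con 0) :+ (s :* s′ :+ con 0) :+ (s :* s :+ con 0)) refl

  lower₁-ring₄ : ∀ s s′ → (s + s′) * (s + s′) ≡ s * s + 2 * (s * s′) + s′ * s′
  lower₁-ring₄ = ℕ-solve 2 (λ s s′ → (s :+ s′) :* (s :+ s′) := s :* s :+ con 2 :* (s :* s′) :+ s′ :* s′) refl

  lower₁-ring₅ : ∀ N a x V t → (a + x) * (a + x) * (V + (N * x + 1) * (N * x + 1)) + (a + x) * (a + x) * (2 * t + 3 * (N * (a + x))) + (a + x) *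
    (a + x) * (2 * (N * a)) ≡ x * x * (N * (a + x) * (N * (a + x))) + (a + x) * (a + x) * (2 * t + 5 * (N * (a + x))) + (a + x) * (a + x) * (1 + V)
  lower₁-ring₅ = ℕ-solve 5 (λ N a x V t → (a :+ x) :* (a :+ x) :* (V :+ (N :* x :+ con 1) :* (N :* x :+ con 1)) :+ (a :+ x) :* (a :+ x) :* (con
    2 :* t :+ con 3 :* (N :* (a :+ x))) :+ (a :+ x) :* (a :+ x) :* (con 2 :* (N :* a)) := x :* x :* (N :* (a :+ x) :* (N :* (a :+ x))) :+ (a :+
    x) :* (a :+ x) :* (con 2 :* t :+ con 5 :* (N :* (a :+ x))) :+ (a :+ x) :* (a :+ x) :* (con 1 :+ V)) refl

  lower₂-ring₁ : ∀ x N k → x * x * (N * k * (N * k)) ≡ k * k * (N * x * (N * x))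
  lower₂-ring₁ = ℕ-solve 3 (λ x N k → x :* x :* (N :* k :* (N :* k)) := k :* k :* (N :* x :* (N :* x))) refl

  lower₂-ring₂ : ∀ s x → s + (x + 1) ≡ s + 1 + x
  lower₂-ring₂ = ℕ-solve 2 (λ s x → s :+ (x :+ con 1) := s :+ con 1 :+ x) refl

  lower₂-ring₃ : ∀ s s′ → s′ * s + s * s′ + s * s ≡ 0 + (s′ * s + 0) + (s * s′ + 0) + (s * s + 0)
  lower₂-ring₃ = ℕ-solve 2 (λ s s′ → s′ :* s :+ s :* s′ :+ s :* s := con 0 :+ (s′ :* s :+ con 0) :+ (s :* s′ :+ con 0) :+ (s :* s :+ con 0)) refl

  lower₂-ring₄ : ∀ x → x ≡ x + 0
  lower₂-ring₄ = ℕ-solve 1 (λ x → x := x :+ con 0) refl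

  lower₂-ring₅ : ∀ k s t x → k * k * ((s + 1) * (s + 1)) + k * k * (2 * t + 3 * (s + 1 + x)) + k * k * (2 * x + 2) ≡ k * k * (2 * t + 5 * (s + 1
    + x)) + k * k * (1 + s * s)
  lower₂-ring₅ = ℕ-solve 4 (λ k s t x → k :* k :* ((s :+ con 1) :* (s :+ con 1)) :+ k :* k :* (con 2 :* t :+ con 3 :* (s :+ con 1 :+ x)) :+ k :*
    k :* (con 2 :* x :+ con 2) := k :* k :* (con 2 :* t :+ con 5 :* (s :+ con 1 :+ x)) :+ k :* k :* (con 1 :+ s :* s)) refl

  large-ring₃ : ∀ h w → 1 + h + w ≡ h + (w + 1)
  large-ring₃ = ℕ-solve 2 (λ h w → con 1 :+ h :+ w := h :+ (w :+ con 1)) refl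

  square-ring₁ : ∀ w → 1 + (w + 1 + (w + 1)) ≡ 2 * w + 3
  square-ring₁ = ℕ-solve 1 (λ w → con 1 :+ (w :+ con 1 :+ (w :+ con 1)) := con 2 :* w :+ con 3) refl

  square-ring₂ : ∀ w n → (2 * w + 3) * (2 * w + 3) + (6 * n + 9 * n) + 0 ≡ 4 * (w * w) + 15 * n + (6 * (2 * w) + 9 * 1)
  square-ring₂ = ℕ-solve 2 (λ w n → (con 2 :* w :+ con 3) :* (con 2 :* w :+ con 3) :+ (con 6 :* n :+ con 9 :* n) :+ con 0 := con 4 :* (w :* w)
    :+ con 15 :* n :+ (con 6 :* (con 2 :* w) :+ con 9 :* con 1)) refl

  lower₃-ring₁ : ∀ s s′ → s * s ≡ 0 * (s′ * s′) + 0 * (s′ * s) + 0 * (s * s′) + (s * s + 0)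
  lower₃-ring₁ = ℕ-solve 2 (λ s s′ → s :* s := con 0 :* (s′ :* s′) :+ con 0 :* (s′ :* s) :+ con 0 :* (s :* s′) :+ (s :* s :+ con 0)) refl

  lower₃-ring₂ : ∀ s s′ → s′ * s′ ≡ s′ * s′ + 0 + 0 + 0 + 0
  lower₃-ring₂ = ℕ-solve 2 (λ s s′ → s′ :* s′ := s′ :* s′ :+ con 0 :+ con 0 :+ con 0 :+ con 0) refl

  lower₃-ring₃ : ∀ a b c → 1 * a + 1 * b + 1 * c ≡ 0 + (a + b + c) * 1
  lower₃-ring₃ = ℕ-solve 3 (λ a b c → con 1 :* a :+ con 1 :* b :+ con 1 :* c := con 0 :+ (a :+ b :+ c) :* con 1) refl

  lower₃-ring₄ : ∀ W t n → 4 * W + 15 * n + 4 * (2 * t + 3 * n) + (29 * n + 4) ≡ 4 * (2 * t + 14 * n) + 4 * (1 + W)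
  lower₃-ring₄ = ℕ-solve 3 (λ W t n → con 4 :* W :+ con 15 :* n :+ con 4 :* (con 2 :* t :+ con 3 :* n) :+ (con 29 :* n :+ con 4) := con 4 :*
    (con 2 :* t :+ con 14 :* n) :+ con 4 :* (con 1 :+ W)) refl

  lower₄-ring₁ : ∀ a b → 1 * a + 1 * b + 0 ≡ a + b
  lower₄-ring₁ = ℕ-solve 2 (λ a b → con 1 :* a :+ con 1 :* b :+ con 0 := a :+ b) refl

  lower₄-ring₂ : ∀ a c → 1 * a + 0 + 1 * c ≡ a + c
  lower₄-ring₂ = ℕ-solve 2 (λ a c → con 1 :* a :+ con 0 :+ con 1 :* c := a :+ c) refl

  lower₄-ring₃ : ∀ b c → 0 + 1 * b + 1 * c ≡ b + c
  lower₄-ring₃ = ℕ-solve 2 (λ b c → con 0 :+ con 1 :* b :+ con 1 :* c := b :+ c) refl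

  lower₄-ring₄ : ∀ s s′ → s′ * s + s * s′ ≡ 0 + (s′ * s + 0) + (s * s′ + 0) + 0
  lower₄-ring₄ = ℕ-solve 2 (λ s s′ → s′ :* s :+ s :* s′ := con 0 :+ (s′ :* s :+ con 0) :+ (s :* s′ :+ con 0) :+ con 0) refl

  lower₄-ring₅ : ∀ s s′ → s′ * s′ + s * s ≡ s′ * s′ + 0 + 0 + 0 + (s * s + 0)
  lower₄-ring₅ = ℕ-solve 2 (λ s s′ → s′ :* s′ :+ s :* s := s′ :* s′ :+ con 0 :+ con 0 :+ con 0 :+ (s :* s :+ con 0)) refl

  lower₄-ring₆ : ∀ W t n → 4 * W + 15 * n + 2 * (2 * t + 3 * n) + (7 * n + 2) ≡ 2 * (2 * t + 14 * n) + 2 * (1 + 2 * W)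
  lower₄-ring₆ = ℕ-solve 3 (λ W t n → con 4 :* W :+ con 15 :* n :+ con 2 :* (con 2 :* t :+ con 3 :* n) :+ (con 7 :* n :+ con 2) := con 2 :* (con
    2 :* t :+ con 14 :* n) :+ con 2 :* (con 1 :+ con 2 :* W)) refl

  lower₅-ring₁ : ∀ h w → 1 + h + w ≡ h + (w + 1)
  lower₅-ring₁ = ℕ-solve 2 (λ h w → con 1 :+ h :+ w := h :+ (w :+ con 1)) refl

  lower₅-ring₂ : ∀ h → 2 * (3 * h + 2) ≡ 3 * (2 * h) + 4
  lower₅-ring₂ = ℕ-solve 1 (λ h → con 2 :* (con 3 :* h :+ con 2) := con 3 :* (con 2 :* h) :+ con 4) refl

  lower₅-ring₃ : ∀ w → 3 * (w + 1) + 4 ≡ 3 * w + 7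
  lower₅-ring₃ = ℕ-solve 1 (λ w → con 3 :* (w :+ con 1) :+ con 4 := con 3 :* w :+ con 7) refl

  lower₅-ring₄ : ∀ n → 4 * (n * n) ≡ 2 * n * (2 * n)
  lower₅-ring₄ = ℕ-solve 1 (λ n → con 4 :* (n :* n) := con 2 :* n :* (con 2 :* n)) refl

  lower₅-ring₅ : ∀ w n → (3 * w + 7) * (3 * w + 7) + (42 * n + 49 * n) + 0 ≡ 9 * (w * w) + 91 * n + (42 * w + 49 * 1)
  lower₅-ring₅ = ℕ-solve 2 (λ w n → (con 3 :* w :+ con 7) :* (con 3 :* w :+ con 7) :+ (con 42 :* n :+ con 49 :* n) :+ con 0 := con 9 :* (w :* w)
    :+ con 91 :* n :+ (con 42 :* w :+ con 49 :* con 1)) refl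

  lower₅-ring₆ : ∀ a d → 1 * a + 0 + 0 ≡ a + d * 0
  lower₅-ring₆ = ℕ-solve 2 (λ a d → con 1 :* a :+ con 0 :+ con 0 := a :+ d :* con 0) refl

  lower₅-ring₇ : ∀ b → 0 + 1 * b + 0 ≡ b
  lower₅-ring₇ = ℕ-solve 1 (λ b → con 0 :+ con 1 :* b :+ con 0 := b) refl

  lower₅-ring₈ : ∀ c → 0 + 0 + 1 * c ≡ c
  lower₅-ring₈ = ℕ-solve 1 (λ c → con 0 :+ con 0 :+ con 1 :* c := c) refl

  lower₅-ring₉ : ∀ a q q′ d → a + q * d + q′ * d ≡ a + d * (q + q′)
  lower₅-ring₉ = ℕ-solve 4 (λ a q q′ d → a :+ q :* d :+ q′ :* d := a :+ d :* (q :+ q′)) refl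

  lower₅-ring₁₀ : ∀ s s′ → s′ * s′ ≡ s′ * s′ + 0 + 0 + 0 + 0
  lower₅-ring₁₀ = ℕ-solve 2 (λ s s′ → s′ :* s′ := s′ :* s′ :+ con 0 :+ con 0 :+ con 0 :+ con 0) refl

  lower₅-ring₁₁ : ∀ s s′ → 2 * s * s′ ≡ 0 + (s′ * s + 0) + (s * s′ + 0) + 0
  lower₅-ring₁₁ = ℕ-solve 2 (λ s s′ → con 2 :* s :* s′ := con 0 :+ (s′ :* s :+ con 0) :+ (s :* s′ :+ con 0) :+ con 0) refl

  lower₅-ring₁₂ : ∀ W t n → 9 * W + 91 * n + 9 * (2 * t + 3 * n) + (8 * n + 9) ≡ 9 * (2 * t + 14 * n) + 9 * (1 + W)
  lower₅-ring₁₂ = ℕ-solve 3 (λ W t n → con 9 :* W :+ con 91 :* n :+ con 9 :* (con 2 :* t :+ con 3 :* n) :+ (con 8 :* n :+ con 9) := con 9 :*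
    (con 2 :* t :+ con 14 :* n) :+ con 9 :* (con 1 :+ W)) refl

  lower₆-ring₁ : ∀ x C → 1 + (x + (x + C)) ≡ 1 + 2 * x + C
  lower₆-ring₁ = ℕ-solve 2 (λ x C → con 1 :+ (x :+ (x :+ C)) := con 1 :+ con 2 :* x :+ C) refl

  lower₆-ring₂ : ∀ x C → 2 * (x * x) + (1 + (x + (x + C))) * (1 + (x + (x + C))) + (2 * x + 2) ≡ 2 * (1 + (x + (x + C))) + (x + C) * (x + C) +
    (1 + (x * x + 2 * (x * (1 + (x + (x + C))))))
  lower₆-ring₂ = ℕ-solve 2 (λ x C → con 2 :* (x :* x) :+ (con 1 :+ (x :+ (x :+ C))) :* (con 1 :+ (x :+ (x :+ C))) :+ (con 2 :* x :+ con 2) :=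
    con 2 :* (con 1 :+ (x :+ (x :+ C))) :+ (x :+ C) :* (x :+ C) :+ (con 1 :+ (x :* x :+ con 2 :* (x :* (con 1 :+ (x :+ (x :+ C))))))) refl

  lower₆-ring₃ : ∀ x C → 2 * (x * x) ≡ (0 * (1 * 1) + (0 * (1 * x) + (0 * (1 * x) + 0 * (1 * C)))) + ((0 * (x * 1) + (0 * (x * x) + (1 * (x * x)
    + 0 * (x * C)))) + ((0 * (x * 1) + (1 * (x * x) + (0 * (x * x) + 0 * (x * C)))) + (0 * (C * 1) + (0 * (C * x) + (0 * (C * x) + 0 * (C * C))))))
  lower₆-ring₃ = ℕ-solve 2 (λ x C → con 2 :* (x :* x) := (con 0 :* (con 1 :* con 1) :+ (con 0 :* (con 1 :* x) :+ (con 0 :* (con 1 :* x) :+ con 0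
    :* (con 1 :* C)))) :+ ((con 0 :* (x :* con 1) :+ (con 0 :* (x :* x) :+ (con 1 :* (x :* x) :+ con 0 :* (x :* C)))) :+ ((con 0 :* (x :* con 1)
    :+ (con 1 :* (x :* x) :+ (con 0 :* (x :* x) :+ con 0 :* (x :* C)))) :+ (con 0 :* (C :* con 1) :+ (con 0 :* (C :* x) :+ (con 0 :* (C :* x) :+
    con 0 :* (C :* C))))))) refl

  lower₆-ring₄ : ∀ x C → (x + C) * (x + C) + 0 + (2 * x) ≡ (0 * (1 * 1) + (0 * (1 * x) + (1 * (1 * x) + 0 * (1 * C)))) + ((0 * (x * 1) + (1 * (x
    * x) + (0 * (x * x) + 1 * (x * C)))) + ((1 * (x * 1) + (0 * (x * x) + (0 * (x * x) + 0 * (x * C)))) + (0 * (C * 1) + (1 * (C * x) + (0 * (C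
    * x) + 1 * (C * C)))))) + 0
  lower₆-ring₄ = ℕ-solve 2 (λ x C → (x :+ C) :* (x :+ C) :+ con 0 :+ (con 2 :* x) := (con 0 :* (con 1 :* con 1) :+ (con 0 :* (con 1 :* x) :+
    (con 1 :* (con 1 :* x) :+ con 0 :* (con 1 :* C)))) :+ ((con 0 :* (x :* con 1) :+ (con 1 :* (x :* x) :+ (con 0 :* (x :* x) :+ con 1 :* (x :*
    C)))) :+ ((con 1 :* (x :* con 1) :+ (con 0 :* (x :* x) :+ (con 0 :* (x :* x) :+ con 0 :* (x :* C)))) :+ (con 0 :* (C :* con 1) :+ (con 1 :*
    (C :* x) :+ (con 0 :* (C :* x) :+ con 1 :* (C :* C)))))) :+ con 0) refl

  lower₆-ring₅ : ∀ x C → (x + C) * (x + C) + 0 + (2 * x) ≡ (0 * (1 * 1) + (1 * (1 * x) + (0 * (1 * x) + 0 * (1 * C)))) + ((1 * (x * 1) + (0 * (x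
    * x) + (0 * (x * x) + 0 * (x * C)))) + ((0 * (x * 1) + (0 * (x * x) + (1 * (x * x) + 1 * (x * C)))) + (0 * (C * 1) + (0 * (C * x) + (1 * (C
    * x) + 1 * (C * C)))))) + 0
  lower₆-ring₅ = ℕ-solve 2 (λ x C → (x :+ C) :* (x :+ C) :+ con 0 :+ (con 2 :* x) := (con 0 :* (con 1 :* con 1) :+ (con 1 :* (con 1 :* x) :+
    (con 0 :* (con 1 :* x) :+ con 0 :* (con 1 :* C)))) :+ ((con 1 :* (x :* con 1) :+ (con 0 :* (x :* x) :+ (con 0 :* (x :* x) :+ con 0 :* (x :*
    C)))) :+ ((con 0 :* (x :* con 1) :+ (con 0 :* (x :* x) :+ (con 1 :* (x :* x) :+ con 1 :* (x :* C)))) :+ (con 0 :* (C :* con 1) :+ (con 0 :*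
    (C :* x) :+ (con 1 :* (C :* x) :+ con 1 :* (C :* C)))))) :+ con 0) refl

  lower₆-ring₆ : ∀ x C → (x + C) * (x + C) + 0 + (x * x + 2 * (x * C)) ≡ (0 * (1 * 1) + (0 * (1 * x) + (0 * (1 * x) + 0 * (1 * C)))) + ((0 * (x
    * 1) + (1 * (x * x) + (0 * (x * x) + 1 * (x * C)))) + ((0 * (x * 1) + (0 * (x * x) + (1 * (x * x) + 1 * (x * C)))) + (0 * (C * 1) + (1 * (C
    * x) + (1 * (C * x) + 1 * (C * C)))))) + 0
  lower₆-ring₆ = ℕ-solve 2 (λ x C → (x :+ C) :* (x :+ C) :+ con 0 :+ (x :* x :+ con 2 :* (x :* C)) := (con 0 :* (con 1 :* con 1) :+ (con 0 :*
    (con 1 :* x) :+ (con 0 :* (con 1 :* x) :+ con 0 :* (con 1 :* C)))) :+ ((con 0 :* (x :* con 1) :+ (con 1 :* (x :* x) :+ (con 0 :* (x :* x) :+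
    con 1 :* (x :* C)))) :+ ((con 0 :* (x :* con 1) :+ (con 0 :* (x :* x) :+ (con 1 :* (x :* x) :+ con 1 :* (x :* C)))) :+ (con 0 :* (C :* con
    1) :+ (con 1 :* (C :* x) :+ (con 1 :* (C :* x) :+ con 1 :* (C :* C)))))) :+ con 0) refl

  lower₆-ring₇ : ∀ x t n → 2 * ((1 + x) * (1 + x)) + (2 * t + 5 * n + 2 * n) + (2 * n + 1) ≡ 2 * t + 9 * n + (1 + 2 * (x * x) + 2 * (1 + 2 * x))
  lower₆-ring₇ = ℕ-solve 3 (λ x t n → con 2 :* ((con 1 :+ x) :* (con 1 :+ x)) :+ (con 2 :* t :+ con 5 :* n :+ con 2 :* n) :+ (con 2 :* n :+ con
    1) := con 2 :* t :+ con 9 :* n :+ (con 1 :+ con 2 :* (x :* x) :+ con 2 :* (con 1 :+ con 2 :* x))) refl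

  lower₆-ring₈ : ∀ n V t → 1 + (2 * n + V) + (2 * t + 3 * n) + 0 ≡ 2 * t + 5 * n + (1 + V)
  lower₆-ring₈ = ℕ-solve 3 (λ n V t → con 1 :+ (con 2 :* n :+ V) :+ (con 2 :* t :+ con 3 :* n) :+ con 0 := con 2 :* t :+ con 5 :* n :+ (con 1 :+
    V)) refl

  ℕtoℚ-+-ring : ∀ m n → (m ℤ.* pos 1 ℤ.+ n ℤ.* pos 1) ℤ.* pos 1 ≡ (m ℤ.+ n) ℤ.* (pos 1 ℤ.* pos 1)
  ℕtoℚ-+-ring = ℤ-solve 2 (λ m n → (m :* con (pos 1) :+ n :* con (pos 1)) :* con (pos 1) := (m :+ n) :* (con (pos 1) :* con (pos 1))) refl

  ℕtoℚ-*-ring : ∀ m n → m ℤ.* n ℤ.* pos 1 ≡ (m ℤ.* n) ℤ.* (pos 1 ℤ.* pos 1)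
  ℕtoℚ-*-ring = ℤ-solve 2 (λ m n → m :* n :* con (pos 1) := (m :* n) :* (con (pos 1) :* con (pos 1))) refl

  frac-cancel-ring : ∀ d m → d ℤ.* m ℤ.* pos 1 ≡ m ℤ.* (pos 1 ℤ.* d)
  frac-cancel-ring = ℤ-solve 2 (λ d m → d :* m :* con (pos 1) := m :* (con (pos 1) :* d)) refl

  sub-≤-ring : ∀ q r → q ℚ.+ r ℚ.- r ≡ q
  sub-≤-ring = ℚ-solve 2 (λ q r → q :+ r :- r := q) refl

  below-ring₁ : ∀ q x g n → q ℚ.* x ℚ.* (g ℚ.* n) ≡ q ℚ.* g ℚ.* (x ℚ.* n)
  below-ring₁ = ℚ-solve 4 (λ q x g n → q :* x :* (g :* n) := q :* g :* (x :* n)) refl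

  below-ring₂ : ∀ q g t γ n → q ℚ.* (g ℚ.* t ℚ.+ g ℚ.* γ ℚ.* n) ≡ q ℚ.* g ℚ.* (t ℚ.+ γ ℚ.* n)
  below-ring₂ = ℚ-solve 5 (λ q g t γ n → q :* (g :* t :+ g :* γ :* n) := q :* g :* (t :+ γ :* n)) refl

  below-ℕ-ring : ∀ g t γ n → g ℚ.* t ℚ.+ n ℚ.* (g ℚ.* γ) ≡ g ℚ.* (t ℚ.+ γ ℚ.* n)
  below-ℕ-ring = ℚ-solve 4 (λ g t γ n → g :* t :+ n :* (g :* γ) := g :* (t :+ γ :* n)) refl

  above-ring : ∀ q g x γ n → q ℚ.* x ℚ.* (g ℚ.* n) ℚ.+ q ℚ.* (g ℚ.* γ ℚ.* n) ≡ q ℚ.* g ℚ.* (x ℚ.* n ℚ.+ γ ℚ.* n)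
  above-ring = ℚ-solve 5 (λ q g x γ n → q :* x :* (g :* n) :+ q :* (g :* γ :* n) := q :* g :* (x :* n :+ γ :* n)) refl

  four-ring : ∀ n f → n ℚ.* (ℚ.- f) ≡ ℚ.- (f ℚ.* n)
  four-ring = ℚ-solve 2 (λ n f → n :* (⊖ f) := ⊖ (f :* n)) refl

  surd-below-ring₁ : ∀ n f → ℚ.- (n ℚ.* (ℚ.- f)) ≡ f ℚ.* n
  surd-below-ring₁ = ℚ-solve 2 (λ n f → ⊖ (n :* (⊖ f)) := f :* n) refl

  surd-below-ring₂ : ∀ r m → m ℚ.- r ≡ ℚ.- (r ℚ.- m)
  surd-below-ring₂ = ℚ-solve 2 (λ r m → m :- r := ⊖ (r :- m)) refl

  surd-below-ring₃ : ∀ r m → (m ℚ.- r) ℚ.* (m ℚ.- r) ≡ (r ℚ.- m) ℚ.* (r ℚ.- m)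
  surd-below-ring₃ = ℚ-solve 2 (λ r m → (m :- r) :* (m :- r) := (r :- m) :* (r :- m)) refl

  surd-below-ring₄ : ∀ N → 32 * (N * N) ≡ 2 * (4 * N * (4 * N))
  surd-below-ring₄ = ℕ-solve 1 (λ N → con 32 :* (N :* N) := con 2 :* (con 4 :* N :* (con 4 :* N))) refl

  surd-above-ring₁ : ∀ x y → x ℚ.+ y ℚ.- y ≡ x
  surd-above-ring₁ = ℚ-solve 2 (λ x y → x :+ y :- y := x) refl

  surd-above-ring₂ : ∀ G t γ n s → (s ℚ.* (G ℚ.* n) ℚ.+ n ℚ.* (G ℚ.* γ)) ℚ.- G ℚ.* t ≡ G ℚ.* (n ℚ.* s ℚ.- (t ℚ.- γ ℚ.* n))
  surd-above-ring₂ = ℚ-solve 5 (λ G t γ n s → (s :* (G :* n) :+ n :* (G :* γ)) :- G :* t := G :* (n :* s :- (t :- γ :* n))) refl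

  surd-above-ring₃ : ∀ J N → J * J * (N * N) ≡ J * N * (J * N)
  surd-above-ring₃ = ℕ-solve 2 (λ J N → J :* J :* (N :* N) := J :* N :* (J :* N)) refl

  surd-above-ring₄ : ∀ g p → g ℚ.* p ℚ.* (g ℚ.* p) ≡ g ℚ.* g ℚ.* (p ℚ.* p)
  surd-above-ring₄ = ℚ-solve 2 (λ g p → g :* p :* (g :* p) := g :* g :* (p :* p)) refl

  surd-above-ring₅ : ∀ G N → 32 * (G * G) * (N * N) ≡ G * G * (2 * (4 * N * (4 * N)))
  surd-above-ring₅ = ℕ-solve 2 (λ G N → con 32 :* (G :* G) :* (N :* N) := G :* G :* (con 2 :* (con 4 :* N :* (con 4 :* N)))) refl

  surd-above-ring₆ : ∀ x → x ℚ.* x ≡ (ℚ.- x) ℚ.* (ℚ.- x)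
  surd-above-ring₆ = ℚ-solve 1 (λ x → x :* x := (⊖ x) :* (⊖ x)) refl

  pairs-ring₁ : ∀ n x → 2 * (n + x) + (1 + n) ≡ 2 * x + n + 2 * n + 1
  pairs-ring₁ = ℕ-solve 2 (λ n x → con 2 :* (n :+ x) :+ (con 1 :+ n) := con 2 :* x :+ n :+ con 2 :* n :+ con 1) refl

  pairs-ring₂ : ∀ n → n * n + 2 * n + 1 ≡ (1 + n) * (1 + n)
  pairs-ring₂ = ℕ-solve 1 (λ n → n :* n :+ con 2 :* n :+ con 1 := (con 1 :+ n) :* (con 1 :+ n)) refl

  below-int-ring : ∀ p q g n t N → 2 * (p * (g * N)) + (g * (q * (2 * t + 14 * n)) + q * (2 * N + n)) + g * p * n ≡ 2 * (q * (g * t + N)) + (g *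
    (p * (2 * N + n)) + q * ((1 + 14 * g) * n))
  below-int-ring = ℕ-solve 6 (λ p q g n t N → con 2 :* (p :* (g :* N)) :+ (g :* (q :* (con 2 :* t :+ con 14 :* n)) :+ q :* (con 2 :* N :+ n)) :+
    g :* p :* n := con 2 :* (q :* (g :* t :+ N)) :+ (g :* (p :* (con 2 :* N :+ n)) :+ q :* ((con 1 :+ con 14 :* g) :* n))) refl

  above-int-ring : ∀ p q g n t N → 4 * (q * (g * t)) + ((2 * g * p + q) * (2 * N + n) + 2 * (2 * g * q) + q * (2 * N + n) + 2 * g * n * q + 4 *
    g * q * n) + 1 ≡ 4 * (p * (g * N) + q * N) + (1 + 2 * (2 * g * q * t) + q * ((6 * g + 2) * n) + 2 * g * n * p + 4 * g * q * 1)
  above-int-ring = ℕ-solve 6 (λ p q g n t N → con 4 :* (q :* (g :* t)) :+ ((con 2 :* g :* p :+ q) :* (con 2 :* N :+ n) :+ con 2 :* (con 2 :* g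
    :* q) :+ q :* (con 2 :* N :+ n) :+ con 2 :* g :* n :* q :+ con 4 :* g :* q :* n) :+ con 1 := con 4 :* (p :* (g :* N) :+ q :* N) :+ (con 1 :+
    con 2 :* (con 2 :* g :* q :* t) :+ q :* ((con 6 :* g :+ con 2) :* n) :+ con 2 :* g :* n :* p :+ con 4 :* g :* q :* con 1)) refl

  above-surd-int-ring : ∀ P j G n t N → 2 * (G * t + (1 + j) * N) + (P * (2 * N + n) + 2 * G + 3 * (2 * N + n) + 2 * N * (6 * G) + n * (6 * G) +
    3 * G * n) + (G + 1) ≡ 2 * (6 * (G * N) + 4 * N) + (1 + 2 * (G * t) + 3 * ((1 + 3 * G) * n) + 2 * N * (P + j) + n * P + 3 * G * 1)
  above-surd-int-ring = ℕ-solve 6 (λ P j G n t N → con 2 :* (G :* t :+ (con 1 :+ j) :* N) :+ (P :* (con 2 :* N :+ n) :+ con 2 :* G :+ con 3 :*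
    (con 2 :* N :+ n) :+ con 2 :* N :* (con 6 :* G) :+ n :* (con 6 :* G) :+ con 3 :* G :* n) :+ (G :+ con 1) := con 2 :* (con 6 :* (G :* N) :+
    con 4 :* N) :+ (con 1 :+ con 2 :* (G :* t) :+ con 3 :* ((con 1 :+ con 3 :* G) :* n) :+ con 2 :* N :* (P :+ j) :+ n :* P :+ con 3 :* G :* con
    1)) refl

  surd-square-ring₁ : ∀ N w → 6 * N + w + 0 ≡ w + 4 * N + 2 * N
  surd-square-ring₁ = ℕ-solve 2 (λ N w → con 6 :* N :+ w :+ con 0 := w :+ con 4 :* N :+ con 2 :* N) refl

  surd-square-ring₂ : ∀ N → 4 * N * (4 * N) + 0 + 16 * (N * N) ≡ 32 * (N * N) + 0
  surd-square-ring₂ = ℕ-solve 1 (λ N → con 4 :* N :* (con 4 :* N) :+ con 0 :+ con 16 :* (N :* N) := con 32 :* (N :* N) :+ con 0) refl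

  surd-square-ring₃ : ∀ N → 6 * N ≡ 3 * (2 * N)
  surd-square-ring₃ = ℕ-solve 1 (λ N → con 6 :* N := con 3 :* (con 2 :* N)) refl

  surd-square-ring₄ : ∀ w δ → 3 * (w + δ) ≡ w + (3 * δ + 2 * w)
  surd-square-ring₄ = ℕ-solve 2 (λ w δ → con 3 :* (w :+ δ) := w :+ (con 3 :* δ :+ con 2 :* w)) refl

  surd-square-ring₅ : ∀ w δ → (3 * δ + 2 * w) * (3 * δ + 2 * w) + (4 * w * (w + δ)) + 0 ≡ 8 * ((w + δ) * (w + δ)) + δ * δ
  surd-square-ring₅ = ℕ-solve 2 (λ w δ → (con 3 :* δ :+ con 2 :* w) :* (con 3 :* δ :+ con 2 :* w) :+ (con 4 :* w :* (w :+ δ)) :+ con 0 := con 8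
    :* ((w :+ δ) :* (w :+ δ)) :+ δ :* δ) refl

  surd-square-ring₆ : ∀ N → 8 * (2 * N * (2 * N)) ≡ 32 * (N * N)
  surd-square-ring₆ = ℕ-solve 1 (λ N → con 8 :* (con 2 :* N :* (con 2 :* N)) := con 32 :* (N :* N)) refl

  surd-square-ring₇ : ∀ x n → 2 * (x * n) * (2 * (x * n)) ≡ 4 * (x * x) * (n * n)
  surd-square-ring₇ = ℕ-solve 2 (λ x n → con 2 :* (x :* n) :* (con 2 :* (x :* n)) := con 4 :* (x :* x) :* (n :* n)) refl

  surd-square-ring₈ : ∀ w δ η → δ * δ + (4 * w * (w + δ + η) + η * δ) + (η * δ + η * η) ≡ 4 * w * (w + δ) + ((δ + η) * (δ + η) + η * (4 * w))
  surd-square-ring₈ = ℕ-solve 3 (λ w δ η → δ :* δ :+ (con 4 :* w :* (w :+ δ :+ η) :+ η :* δ) :+ (η :* δ :+ η :* η) := con 4 :* w :* (w :+ δ) :+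
    ((δ :+ η) :* (δ :+ η) :+ η :* (con 4 :* w))) refl

  ratio-<-ring : ∀ u Q′ Q → u * Q′ * Q ≡ u * Q * Q′
  ratio-<-ring = ℕ-solve 3 (λ u Q′ Q → u :* Q′ :* Q := u :* Q :* Q′) refl

  ratio-trans-ring : ∀ a b c → a * b * c ≡ a * c * b
  ratio-trans-ring = ℕ-solve 3 (λ a b c → a :* b :* c := a :* c :* b) refl

  C₃-mono-ring₁ : ∀ P Q Q′ → 4 * (Q * Q′ * (Q * Q′)) + P * Q′ * (P * Q′) ≡ (4 * (Q * Q) + P * P) * (Q′ * Q′)
  C₃-mono-ring₁ = ℕ-solve 3 (λ P Q Q′ → con 4 :* (Q :* Q′ :* (Q :* Q′)) :+ P :* Q′ :* (P :* Q′) := (con 4 :* (Q :* Q) :+ P :* P) :* (Q′ :* Q′)) refl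

  C₃-mono-ring₂ : ∀ P Q Q′ → 12 * (P * Q′ * (Q * Q′)) ≡ 12 * (P * Q) * (Q′ * Q′)
  C₃-mono-ring₂ = ℕ-solve 3 (λ P Q Q′ → con 12 :* (P :* Q′ :* (Q :* Q′)) := con 12 :* (P :* Q) :* (Q′ :* Q′)) refl

  C₃-mono-ring₃ : ∀ P′ Q Q′ → Q * Q * (1 + (4 * (Q′ * Q′) + P′ * P′)) ≡ Q * Q + (4 * (Q * Q′ * (Q * Q′)) + P′ * Q * (P′ * Q))
  C₃-mono-ring₃ = ℕ-solve 3 (λ P′ Q Q′ → Q :* Q :* (con 1 :+ (con 4 :* (Q′ :* Q′) :+ P′ :* P′)) := Q :* Q :+ (con 4 :* (Q :* Q′ :* (Q :* Q′)) :+
    P′ :* Q :* (P′ :* Q))) refl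

  C₃-mono-ring₄ : ∀ P′ Q Q′ → Q * Q * (12 * (P′ * Q′)) ≡ 12 * (P′ * Q * (Q * Q′))
  C₃-mono-ring₄ = ℕ-solve 3 (λ P′ Q Q′ → Q :* Q :* (con 12 :* (P′ :* Q′)) := con 12 :* (P′ :* Q :* (Q :* Q′))) refl

  C₃-mono-ring₅ : ∀ x z δ → 1 + (4 * (z * z) + (x + δ) * (x + δ)) + (12 * (x * z) + 2 * δ * (2 * z)) + (8 * (δ * z) + δ * δ) ≡ 12 * ((x + δ) *
    z) + (1 + (4 * (z * z) + x * x) + 2 * δ * (x + δ))
  C₃-mono-ring₅ = ℕ-solve 3 (λ x z δ → con 1 :+ (con 4 :* (z :* z) :+ (x :+ δ) :* (x :+ δ)) :+ (con 12 :* (x :* z) :+ con 2 :* δ :* (con 2 :*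
    z)) :+ (con 8 :* (δ :* z) :+ δ :* δ) := con 12 :* ((x :+ δ) :* z) :+ (con 1 :+ (con 4 :* (z :* z) :+ x :* x) :+ con 2 :* δ :* (x :+ δ))) refl

  C₃-from-ring : ∀ P Q → 1 + (4 * (Q * Q) + P * P) + (Q * (9 * P) + P * (2 * Q) + Q) + P * Q ≡ 12 * (P * Q) + (Q * (1 + 4 * Q) + P * P + 1)
  C₃-from-ring = ℕ-solve 2 (λ P Q → con 1 :+ (con 4 :* (Q :* Q) :+ P :* P) :+ (Q :* (con 9 :* P) :+ P :* (con 2 :* Q) :+ Q) :+ P :* Q := con 12
    :* (P :* Q) :+ (Q :* (con 1 :+ con 4 :* Q) :+ P :* P :+ con 1)) refl

  ratio-strict-ring : ∀ p q g → p * (2 * g * q) ≡ q * (2 * g * p)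
  ratio-strict-ring = ℕ-solve 3 (λ p q g → p :* (con 2 :* g :* q) := q :* (con 2 :* g :* p)) refl

  rep₂-ring₁ : ∀ k f o → k ℚ.* k ℚ.* (o ℚ.- f ℚ.* f) ≡ k ℚ.* k ℚ.* o ℚ.- (k ℚ.* f) ℚ.* (k ℚ.* f)
  rep₂-ring₁ = ℚ-solve 3 (λ k f o → k :* k :* (o :- f :* f) := k :* k :* o :- (k :* f) :* (k :* f)) refl

  rep₂-ring₂ : ∀ x y → x ℚ.+ y ℚ.- y ≡ x
  rep₂-ring₂ = ℚ-solve 2 (λ x y → x :+ y :- y := x) refl

  rep₃-ring : ∀ k f → k ℚ.* k ℚ.* (f ℚ.* f) ≡ (k ℚ.* f) ℚ.* (k ℚ.* f)
  rep₃-ring = ℚ-solve 2 (λ k f → k :* k :* (f :* f) := (k :* f) :* (k :* f)) refl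

  surd-case-ring₁ : ∀ G → 32 * (G * G) + 0 + 4 * (G * G) ≡ 6 * G * (6 * G) + 0
  surd-case-ring₁ = ℕ-solve 1 (λ G → con 32 :* (G :* G) :+ con 0 :+ con 4 :* (G :* G) := con 6 :* G :* (con 6 :* G) :+ con 0) refl

  surd-case-ring₂ : ∀ G → 4 * G * (4 * G) + 16 * (G * G) ≡ 32 * (G * G)
  surd-case-ring₂ = ℕ-solve 1 (λ G → con 4 :* G :* (con 4 :* G) :+ con 16 :* (G :* G) := con 32 :* (G :* G)) refl

  surd-case-ring₃ : ∀ G → 6 * G ≡ 4 * G + 2 * G
  surd-case-ring₃ = ℕ-solve 1 (λ G → con 6 :* G := con 4 :* G :+ con 2 :* G) refl

  surd-case-ring₄ : ∀ P G j → 1 + (4 * (G * G) + P * P) + 32 * (G * G) + 0 ≡ 1 + P * P + 6 * G * (6 * G)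
  surd-case-ring₄ = ℕ-solve 3 (λ P G j → con 1 :+ (con 4 :* (G :* G) :+ P :* P) :+ con 32 :* (G :* G) :+ con 0 := con 1 :+ P :* P :+ con 6 :* G
    :* (con 6 :* G)) refl

  surd-case-ring₅ : ∀ P j → 1 + P * P + (P + j) * (P + j) ≡ 1 + j * j + 2 * (P * (P + j))
  surd-case-ring₅ = ℕ-solve 2 (λ P j → con 1 :+ P :* P :+ (P :+ j) :* (P :+ j) := con 1 :+ j :* j :+ con 2 :* (P :* (P :+ j))) refl

  surd-case-ring₆ : ∀ P G j → 1 + j * j + 2 * (P * (6 * G)) ≡ 12 * (P * G) + (1 + j * j)
  surd-case-ring₆ = ℕ-solve 3 (λ P G j → con 1 :+ j :* j :+ con 2 :* (P :* (con 6 :* G)) := con 12 :* (P :* G) :+ (con 1 :+ j :* j)) refl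

  surd-case-ring₇ : ∀ G → G + 23 * G ≡ 4 * (6 * G)
  surd-case-ring₇ = ℕ-solve 1 (λ G → G :+ con 23 :* G := con 4 :* (con 6 :* G)) refl

  surd-case-ring₈ : ∀ j → 4 * j * (4 * j) ≡ 16 * (j * j)
  surd-case-ring₈ = ℕ-solve 1 (λ j → con 4 :* j :* (con 4 :* j) := con 16 :* (j :* j)) refl

  surd-case-ring₉ : ∀ G → 16 * (32 * (G * G)) + 0 + 17 * (G * G) ≡ 23 * G * (23 * G) + 0
  surd-case-ring₉ = ℕ-solve 1 (λ G → con 16 :* (con 32 :* (G :* G)) :+ con 0 :+ con 17 :* (G :* G) := con 23 :* G :* (con 23 :* G) :+ con 0) refl

  surd-case-ring₁₀ : ∀ g w t n N → 2 * (g * w) + (g * (2 * t + 9 * n) + (2 * N + n)) + 0 ≡ 2 * (g * t + N) + (g * (2 * w) + (1 + 9 * g) * n)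
  surd-case-ring₁₀ = ℕ-solve 5 (λ g w t n N → con 2 :* (g :* w) :+ (g :* (con 2 :* t :+ con 9 :* n) :+ (con 2 :* N :+ n)) :+ con 0 := con 2 :*
    (g :* t :+ N) :+ (g :* (con 2 :* w) :+ (con 1 :+ con 9 :* g) :* n)) refl

  4Q<9P-ring : ∀ P Q → 1 + 4 * Q + 4 * (2 * P) + (3 + P) ≡ 9 * P + 4 * (1 + Q)
  4Q<9P-ring = ℕ-solve 2 (λ P Q → con 1 :+ con 4 :* Q :+ con 4 :* (con 2 :* P) :+ (con 3 :+ P) := con 9 :* P :+ con 4 :* (con 1 :+ Q)) refl

  even-differences-ring : ∀ x z → 2 * x + z ≡ x + (x + z)
  even-differences-ring = ℕ-solve 2 (λ x z → con 2 :* x :+ z := x :+ (x :+ z)) refl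

  θ-good-ring : ∀ p Q s → p * Q + Q * s ≡ Q * (p + s)
  θ-good-ring = ℕ-solve 3 (λ p Q s → p :* Q :+ Q :* s := Q :* (p :+ s)) refl

  threshold-≤-ring : ∀ Q t → 2 * (Q * (1 + t)) ≡ Q * (2 * t) + 2 * Q
  threshold-≤-ring = ℕ-solve 2 (λ Q t → con 2 :* (Q :* (con 1 :+ t)) := Q :* (con 2 :* t) :+ con 2 :* Q) refl

  ∣-∣-sq-ring₁ : ∀ m o → o * o + 2 * (m * (m + o)) ≡ m * m + (m + o) * (m + o)
  ∣-∣-sq-ring₁ = ℕ-solve 2 (λ m o → o :* o :+ con 2 :* (m :* (m :+ o)) := m :* m :+ (m :+ o) :* (m :+ o)) refl

  ∣-∣-sq-ring₂ : ∀ m o → o * o + 2 * ((m + o) * m) ≡ (m + o) * (m + o) + m * m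
  ∣-∣-sq-ring₂ = ℕ-solve 2 (λ m o → o :* o :+ con 2 :* ((m :+ o) :* m) := (m :+ o) :* (m :+ o) :+ m :* m) refl

open Identities

-- Sums over finite sets

module Sums where

  -- Every nonlinear estimate is certified in this way: L ≤ R is a nonnegative combination of
  -- the hypotheses, and the identity is checked by a ring solver.
  cert : ∀ {X Y L R} s → X + R + s ≡ Y + L → L ≤ R → X ≤ Y
  cert {X} {Y} {L} {R} s e h = +-cancelʳ-≤ R X Y
    (≤-trans (m≤m+n (X + R) s) (≤-trans (≤-reflexive e) (+-monoʳ-≤ Y h)))

  infixl 6 _⊕_
  _⊕_ : ∀ {a b c d} → a ≤ b → c ≤ d → a + c ≤ b + d
  _⊕_ = +-mono-≤

  infixr 7 _⊛_
  _⊛_ : ∀ {a b} c → a ≤ b → c * a ≤ c * b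
  c ⊛ h = *-monoʳ-≤ c h

  sq-mono : ∀ {a b} → a ≤ b → a * a ≤ b * b
  sq-mono h = *-mono-≤ h h

  sq-cancel-< : ∀ {a b} → a * a < b * b → a < b
  sq-cancel-< {a} {b} h with b ≤? a
  ... | yes p = contradiction h (≤⇒≯ (sq-mono p))
  ... | no p = ≰⇒> p

  ⟦_⟧ : Bool → ℕ
  ⟦ true ⟧ = 1
  ⟦ false ⟧ = 0

  ⟦⟧≤1 : ∀ b → ⟦ b ⟧ ≤ 1
  ⟦⟧≤1 true = ≤-refl
  ⟦⟧≤1 false = z≤n

  ⟦⟧-pos : ∀ {b} → 0 < ⟦ b ⟧ → b ≡ true
  ⟦⟧-pos {true} _ = refl

  ⟦⟧-mono : ∀ {b b′} → (b ≡ true → b′ ≡ true) → ⟦ b ⟧ ≤ ⟦ b′ ⟧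
  ⟦⟧-mono {true} h rewrite h refl = ≤-refl
  ⟦⟧-mono {false} _ = z≤n

  ⟦⟧-cover : ∀ {b m} → (b ≡ true → 1 ≤ m) → ⟦ b ⟧ ≤ m
  ⟦⟧-cover {true} h = h refl
  ⟦⟧-cover {false} _ = z≤n

  ⟦∧⟧ : ∀ x y → ⟦ x ∧ y ⟧ ≡ ⟦ x ⟧ * ⟦ y ⟧
  ⟦∧⟧ true y = sym (+-identityʳ _)
  ⟦∧⟧ false y = refl

  ⟦not⟧ : ∀ x → ⟦ x ⟧ + ⟦ not x ⟧ ≡ 1
  ⟦not⟧ true = refl
  ⟦not⟧ false = refl

  ∧-true : ∀ {x y} → x ∧ y ≡ true → x ≡ true × y ≡ true
  ∧-true {true} {true} _ = refl , refl

  bool-iff : ∀ {x y} → (x ≡ true → y ≡ true) → (y ≡ true → x ≡ true) → x ≡ y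
  bool-iff {true} {y} f g = sym (f refl)
  bool-iff {false} {true} f g = g refl
  bool-iff {false} {false} f g = refl

  not-true : ∀ {x} → not x ≡ true → x ≡ true → ⊥
  not-true {true} () _
  not-true {false} _ ()

  true? : ∀ b → Dec (b ≡ true)
  true? true = yes refl
  true? false = no λ ()

  does-true : ∀ {P : Set} (d : Dec P) → does d ≡ true → P
  does-true (yes p) _ = p

  does-false : ∀ {P : Set} (d : Dec P) → does d ≡ false → ¬ P
  does-false (no p) _ = p

  infix 5 _==_
  abstract
    _==_ : ∀ {n} → Fin n → Fin n → Bool
    i == j = does (i ≟F j)

    ==-refl : ∀ {n} (i : Fin n) → (i == i) ≡ true
    ==-refl i = dec-true (i ≟F i) refl

    ==-≢ : ∀ {n} {i j : Fin n} → i ≢ j → (i == j) ≡ false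
    ==-≢ {i = i} {j} = dec-false (i ≟F j)

    ==-sound : ∀ {n} {i j : Fin n} → (i == j) ≡ true → i ≡ j
    ==-sound {i = i} {j} = does-true (i ≟F j)

    ==-sym : ∀ {n} (i j : Fin n) → (i == j) ≡ (j == i)
    ==-sym i j = bool-iff (λ e → dec-true (j ≟F i) (sym (==-sound e))) (λ e → dec-true (i ≟F j) (sym (==-sound e)))

    ==-suc : ∀ {n} (i j : Fin n) → (Fin.suc i == Fin.suc j) ≡ (i == j)
    ==-suc i j = bool-iff (λ e → dec-true (i ≟F j) (suc-injective (==-sound e)))
      (λ e → dec-true (Fin.suc i ≟F suc j) (cong suc (==-sound e)))

    ==-does : ∀ {n} (i j : Fin n) → (i == j) ≡ does (i ≟F j)
    ==-does i j = refl

  abstract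
    -- abstract, so that unification sees through a sum to its summand
    sum : ∀ {n} → (Fin n → ℕ) → ℕ
    sum = S.sum

    sum-nil : (f : Fin 0 → ℕ) → sum f ≡ 0
    sum-nil f = refl

    sum-suc : ∀ {n} (f : Fin (suc n) → ℕ) → sum f ≡ f zero + sum (f ∘ suc)
    sum-suc f = refl

    sum-cong-≗ : ∀ {n} {f g : Fin n → ℕ} → f ≗ g → sum f ≡ sum g
    sum-cong-≗ = S.sum-cong-≗

    sum-mono : ∀ {n} {f g : Fin n → ℕ} → (∀ i → f i ≤ g i) → sum f ≤ sum g
    sum-mono {zero} h = z≤n
    sum-mono {suc n} h = +-mono-≤ (h zero) (sum-mono (h ∘ suc))

    sum-mono-< : ∀ {n} {f g : Fin n → ℕ} → (∀ i → f i ≤ g i) → ∀ i → f i < g i → sum f < sum g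
    sum-mono-< h zero l = +-mono-<-≤ l (sum-mono (h ∘ suc))
    sum-mono-< h (suc i) l = +-mono-≤-< (h zero) (sum-mono-< (h ∘ suc) i l)

    sum-const : ∀ n c → sum {n} (λ _ → c) ≡ n * c
    sum-const zero c = refl
    sum-const (suc n) c = cong (c +_) (sum-const n c)

    sum-pigeon : ∀ {n} (f g : Fin n → ℕ) → sum f < sum g → ∃ λ i → f i < g i
    sum-pigeon {suc n} f g h with f zero <? g zero
    ... | yes p = zero , p
    ... | no p with sum-pigeon (f ∘ suc) (g ∘ suc) (+-cancelˡ-< (f zero) _ _ (<-≤-trans h (+-monoˡ-≤ _ (≮⇒≥ p))))
    ...   | i , q = suc i , q

    sum-+ : ∀ {n} (f g : Fin n → ℕ) → sum (λ i → f i + g i) ≡ sum f + sum g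
    sum-+ = S.∑-distrib-+

    sum-*ˡ : ∀ {n} c (f : Fin n → ℕ) → sum (λ i → c * f i) ≡ c * sum f
    sum-*ˡ c f = sym (S.*-distribˡ-sum c f)

    sum-*ʳ : ∀ {n} c (f : Fin n → ℕ) → sum (λ i → f i * c) ≡ sum f * c
    sum-*ʳ c f = sym (S.*-distribʳ-sum c f)

    sum-swap : ∀ {m n} (f : Fin m → Fin n → ℕ) → sum (λ i → sum (f i)) ≡ sum (λ j → sum (λ i → f i j))
    sum-swap = S.∑-comm

    sum-delta : ∀ {n} (j : Fin n) (f : Fin n → ℕ) → sum (λ i → ⟦ i == j ⟧ * f i) ≡ f j
    sum-delta {suc n} zero f = trans (cong₂ _+_ (+-identityʳ (f zero)) (trans (sum-const n 0) (*-zeroʳ n))) (+-identityʳ _)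
    sum-delta {suc n} (suc j) f = trans (sum-cong-≗ λ i → cong (λ b → ⟦ b ⟧ * f (suc i)) (==-suc i j)) (sum-delta j (f ∘ suc))

    term≤sum : ∀ {n} (f : Fin n → ℕ) i → f i ≤ sum f
    term≤sum f zero = m≤m+n _ _
    term≤sum f (suc i) = ≤-trans (term≤sum (f ∘ suc) i) (m≤n+m _ _)

    count≤1 : ∀ {n} (p : Fin n → Bool) → (∀ i j → p i ≡ true → p j ≡ true → i ≡ j) → sum (λ i → ⟦ p i ⟧) ≤ 1
    count≤1 {zero} p h = z≤n
    count≤1 {suc n} p h with p zero in e
    ... | true = s≤s (≤-reflexive (trans (sum-cong-≗ λ i → z i) (trans (sum-const n 0) (*-zeroʳ n))))
      where z : ∀ i → ⟦ p (suc i) ⟧ ≡ 0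
            z i with p (suc i) in e′
            ... | false = refl
            ... | true with h zero (suc i) e e′
            ... | ()
    ... | false = count≤1 (p ∘ suc) λ i j a b → suc-injective (h (suc i) (suc j) a b)

    sum-split : ∀ m {n} (f : Fin (m + n) → ℕ) → sum f ≡ sum (λ i → f (i ↑ˡ n)) + sum (λ j → f (m ↑ʳ j))
    sum-split zero f = refl
    sum-split (suc m) f = trans (cong (f zero +_) (sum-split m (f ∘ suc))) (sym (+-assoc (f zero) _ _))

    extract : ∀ {n} m (p : Fin n → Bool) → m ≤ sum (λ i → ⟦ p i ⟧) →
      Σ (Fin m → Fin n) λ f → (∀ {i j} → f i ≡ f j → i ≡ j) × (∀ i → p (f i) ≡ true)
    extract zero p h = (λ ()) , (λ { {()} }) , λ ()
    extract {suc n} (suc m) p h with p zero in e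
    ... | false with extract (suc m) (p ∘ suc) h
    ...   | f , inj , ok = suc ∘ f , (λ q → inj (suc-injective q)) , ok
    extract {suc n} (suc m) p h | true with extract m (p ∘ suc) (s≤s⁻¹ h)
    ...   | f , inj , ok = g , ginj , gok
      where
      g : Fin (suc m) → Fin (suc n)
      g zero = zero
      g (suc i) = suc (f i)
      ginj : ∀ {i j} → g i ≡ g j → i ≡ j
      ginj {zero} {zero} _ = refl
      ginj {suc i} {suc j} q = cong suc (inj (suc-injective q))
      gok : ∀ i → p (g i) ≡ true
      gok zero = e
      gok (suc i) = ok i

  sum-≤const : ∀ {n} {f : Fin n → ℕ} {c} → (∀ i → f i ≤ c) → sum f ≤ n * c
  sum-≤const {n} {c = c} h = ≤-trans (sum-mono h) (≤-reflexive (sum-const n c))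

  sum-prod : ∀ {m n} (f : Fin m → ℕ) (g : Fin n → ℕ) → sum (λ i → sum λ j → f i * g j) ≡ sum f * sum g
  sum-prod f g = trans (sum-cong-≗ λ i → sum-*ˡ (f i) g) (sum-*ʳ (sum g) f)

  sum-δ : ∀ {n} (j : Fin n) → sum (λ i → ⟦ i == j ⟧) ≡ 1
  sum-δ j = trans (sum-cong-≗ λ i → sym (*-identityʳ _)) (sum-delta j (λ _ → 1))

  sum-δ′ : ∀ {n} (j : Fin n) → sum (λ i → ⟦ j == i ⟧) ≡ 1
  sum-δ′ j = trans (sum-cong-≗ λ i → cong ⟦_⟧ (==-sym j i)) (sum-δ j)

  sum-reindex-≤ : ∀ {m n} (f : Fin m → Fin n) → (∀ {i j} → f i ≡ f j → i ≡ j) → (F : Fin n → ℕ) →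
    sum (F ∘ f) ≤ sum F
  sum-reindex-≤ f inj F = begin
    sum (λ i → F (f i)) ≡⟨ sum-cong-≗ (λ i → sym (sum-delta (f i) F)) ⟩
    sum (λ i → sum λ v → ⟦ v == f i ⟧ * F v) ≡⟨ sum-swap _ ⟩
    sum (λ v → sum λ i → ⟦ v == f i ⟧ * F v) ≡⟨ sum-cong-≗ (λ v → sum-*ʳ (F v) _) ⟩
    sum (λ v → sum (λ i → ⟦ v == f i ⟧) * F v) ≤⟨ sum-mono (λ v → *-monoˡ-≤ (F v)
       (count≤1 (λ i → v == f i) λ i j a b → inj (trans (sym (==-sound a)) (==-sound b)))) ⟩
    sum (λ v → 1 * F v) ≡⟨ sum-cong-≗ (λ v → +-identityʳ (F v)) ⟩
    sum F ∎ where open ≤-Reasoning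

  -- If v were missed, the indicator of the complement of v would have a larger sum after reindexing
  -- than before.
  injective⇒surjective : ∀ {n} (f : Fin n → Fin n) → (∀ {i j} → f i ≡ f j → i ≡ j) → ∀ v → ∃ λ i → f i ≡ v
  injective⇒surjective {n} f inj v with any? (λ i → f i ≟F v)
  ... | yes p = p
  ... | no p = contradiction (sum-reindex-≤ f inj (λ w → ⟦ not (w == v) ⟧)) (<⇒≱ lt)
    where
    hit : ∀ i → ⟦ not (f i == v) ⟧ ≡ 1
    hit i rewrite ==-≢ {i = f i} {v} (λ e → p (i , e)) = refl
    lt : sum (λ w → ⟦ not (w == v) ⟧) < sum (λ i → ⟦ not (f i == v) ⟧)
    lt = subst₂ _<_ refl (sym (sum-cong-≗ hit)) (sum-mono-< (λ w → ⟦⟧≤1 (not (w == v))) v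
      (subst (λ b → ⟦ not b ⟧ < 1) (sym (==-refl v)) ≤-refl))

  sum-reindex : ∀ {n} (f : Fin n → Fin n) → (∀ {i j} → f i ≡ f j → i ≡ j) → (F : Fin n → ℕ) →
    sum (F ∘ f) ≡ sum F
  sum-reindex {n} f inj F = ≤-antisym (sum-reindex-≤ f inj F)
    (≤-trans (≤-reflexive (sum-cong-≗ λ v → cong F (sym (proj₂ (injective⇒surjective f inj v)))))
      (sum-reindex-≤ g (λ {i} {j} e → trans (sym (s i)) (trans (cong f e) (s j))) (F ∘ f)))
    where
    g : Fin n → Fin n
    g v = proj₁ (injective⇒surjective f inj v)
    s : ∀ v → f (g v) ≡ v
    s v = proj₂ (injective⇒surjective f inj v)

  sum-combine : ∀ m {n} (f : Fin (m * n) → ℕ) → sum f ≡ sum (λ i → sum λ j → f (combine {m} {n} i j))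
  sum-combine zero f = trans (sum-nil f) (sym (sum-nil _))
  sum-combine (suc m) {n} f = trans (sum-split n f) (trans (cong (sum (λ j → f (j ↑ˡ (m * n))) +_) (sum-combine m (λ j → f (n ↑ʳ j))))
    (sym (sum-suc _)))

  argmin : ∀ {n} (u : Fin (suc n) → ℕ) → ∃ λ v → ∀ i → u v ≤ u i
  argmin {zero} u = zero , λ { zero → ≤-refl }
  argmin {suc n} u with argmin (u ∘ suc)
  ... | v , h with u zero ≤? u (suc v)
  ...   | yes p = zero , λ { zero → ≤-refl ; (suc i) → ≤-trans p (h i) }
  ...   | no p = suc v , λ { zero → <⇒≤ (≰⇒> p) ; (suc i) → h i }

  argmax : ∀ {n} (u : Fin (suc n) → ℕ) → ∃ λ v → ∀ i → u i ≤ u v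
  argmax {zero} u = zero , λ { zero → ≤-refl }
  argmax {suc n} u with argmax (u ∘ suc)
  ... | v , h with u (suc v) ≤? u zero
  ...   | yes p = zero , λ { zero → ≤-refl ; (suc i) → ≤-trans (h i) p }
  ...   | no p = suc v , λ { zero → <⇒≤ (≰⇒> p) ; (suc i) → h i }

  -- The binomial formula without truncated subtraction; the variances below are expanded through
  -- it.
  ∣-∣-sq : ∀ m n → ∣ m - n ∣ * ∣ m - n ∣ + 2 * (m * n) ≡ m * m + n * n
  ∣-∣-sq m n with ≤-total m n
  ... | inj₁ h with m≤n⇒∃[o]m+o≡n h
  ...   | o , refl rewrite ∣m-m+n∣≡n m o = ∣-∣-sq-ring₁ m o
  ∣-∣-sq m n | inj₂ h with m≤n⇒∃[o]m+o≡n h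
  ...   | o , refl rewrite ∣-∣-comm (n + o) n | ∣m-m+n∣≡n n o = ∣-∣-sq-ring₂ n o

open Sums

count-below : ∀ W V → sum {W} (λ τ → ⟦ does (toℕ τ <? V) ⟧) ≤ V
count-below zero V = ≤-trans (≤-reflexive (sum-nil _)) z≤n
count-below (suc W) zero = ≤-reflexive (trans (sum-cong-≗ λ τ → refl) (trans (sum-const (suc W) 0) (*-zeroʳ W)))
count-below (suc W) (suc V) = subst (_≤ suc V) (sym (sum-suc _)) (s≤s (≤-trans (≤-reflexive (sum-cong-≗ λ τ → refl)) (count-below W V)))

count-≤ : ∀ {n} (p : Fin n → Bool) → sum (λ i → ⟦ p i ⟧) ≤ n
count-≤ {n} p = ≤-trans (sum-≤const (λ i → ⟦⟧≤1 (p i))) (≤-reflexive (*-identityʳ n))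

-- The levels with `K ≤ d + b τ` are the topmost `s` of the `W` levels, so the lowest of them is
-- `W − s`; the inequality at that level is the second alternative.
count-above : ∀ b K W d → let s = sum {W} (λ τ → ⟦ does (K ≤? d + b * toℕ τ) ⟧) in
  (s ≡ 0) ⊎ (b * s + K ≤ d + b * W)
count-above b K zero d = inj₁ (sum-nil _)
count-above b K (suc W) d with K ≤? d + b * 0 in e
... | yes h = inj₂ (cert 0 (count-above-ring₁ b s d K W) (h ⊕ b ⊛ s≤))
  where
  s = sum {suc W} (λ τ → ⟦ does (K ≤? d + b * toℕ τ) ⟧)
  s≤ : s ≤ suc W
  s≤ = count-≤ (λ τ → does (K ≤? d + b * toℕ τ))
... | no h with count-above b K W (d + b)
...   | r = subst (λ s → (s ≡ 0) ⊎ (b * s + K ≤ d + b * suc W)) (sym es) (r′ r)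
  where
  s′ = sum {W} (λ τ → ⟦ does (K ≤? d + b + b * toℕ τ) ⟧)
  es : sum {suc W} (λ τ → ⟦ does (K ≤? d + b * toℕ τ) ⟧) ≡ s′
  es = trans (sum-suc _) (cong₂ _+_ (cong ⟦_⟧ (dec-false (K ≤? d + b * 0) h))
         (sum-cong-≗ λ τ → cong (λ v → ⟦ does (K ≤? v) ⟧) (sym (count-above-ring₂ d b (toℕ τ)))))
  r′ : (s′ ≡ 0) ⊎ (b * s′ + K ≤ d + b + b * W) → (s′ ≡ 0) ⊎ (b * s′ + K ≤ d + b * suc W)
  r′ (inj₁ z) = inj₁ z
  r′ (inj₂ z) = inj₂ (≤-trans z (≤-reflexive (count-above-ring₂ d b W)))

-- Light pairs in a dense link

-- The quadratic 2hp + p² + q² is convex along the line A q + B p = A B N, and both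
-- endpoints of that line are excluded by the hypotheses c₁ and c₂.
convex-bound : ∀ {N P Q ρ A B p q ℓ r} → A ≤ B →
  2 * (Q * (ρ * A)) < P * (ρ * ρ) + Q * (A * A) → Q * (B * B) < P * (ρ * ρ) →
  A * N ≡ ρ * p + r → A * (ρ * q) + B * (ρ * p) ≤ A * (B * N) → 0 < A * N →
  P * (N * N) ≤ Q * ℓ → ℓ + p * p ≤ 2 * (N * p) + q * q → ⊥
convex-bound {N} {P} {Q} {ρ} {A} {B} {p} {q} {ℓ} {r} A≤B c₁ c₂ eN hl N>0 hd hℓ = <-irrefl refl (<-≤-trans final bound)
  where
  p′ = ρ * p
  q′ = ρ * q
  aq : A * q′ ≤ B * r
  aq = cert 0 (convex-bound-ring₁ A B q′ p′ r) (≤-trans hl (≤-reflexive (trans (convex-bound-ring₂ A B N) (cong (B *_) eN))))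
  -- `A ≤ B` is the convexity: along the line the second derivative of 2Np - p² + q² has the sign of
  -- B² - A².
  conv : A * q′ * (A * q′) + r * (A * A) * p′ ≤ p′ * r * (B * B) + r * r * (B * B)
  conv = subst₂ _≤_ (convex-bound-ring₃ A q′ r p′) (convex-bound-ring₄ B p′ r) (sq-mono aq ⊕ (r * p′) ⊛ sq-mono A≤B)
  n′ = p′ + r
  h₁ : P * (n′ * n′) ≤ Q * (A * A * ℓ)
  h₁ = subst₂ _≤_ (trans (convex-bound-ring₅ A P N) (cong (λ z → P * (z * z)) eN)) (convex-bound-ring₆ A Q ℓ) ((A * A) ⊛ hd)
  h₂ : A * A * ℓ + A * p * (A * p) ≤ 2 * (n′ * (A * p)) + A * q * (A * q)
  h₂ = subst₂ _≤_ (convex-bound-ring₇ A ℓ p) (trans (convex-bound-ring₈ A N p q) (cong (λ z → 2 * (z * (A * p)) + A * q * (A * q)) eN)) ((A * A) ⊛ hℓ)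
  big : n′ * (n′ * (P * (ρ * ρ)) + Q * (A * A * p′)) ≤ n′ * (Q * (2 * (ρ * A * p′) + r * (B * B)))
  big = cert 0 (convex-bound-ring₉ A P ρ Q p q r B (A * A * ℓ)) ((ρ * ρ) ⊛ (h₁ ⊕ Q ⊛ h₂) ⊕ Q ⊛ conv)
  n′>0 : 0 < n′
  n′>0 = subst (0 <_) eN N>0
  bound : n′ * (P * (ρ * ρ)) + Q * (A * A * p′) ≤ Q * (2 * (ρ * A * p′) + r * (B * B))
  bound = *-cancelˡ-≤ n′ {{>-nonZero n′>0}} big
  final : Q * (2 * (ρ * A * p′) + r * (B * B)) < n′ * (P * (ρ * ρ)) + Q * (A * A * p′)
  final = <-≤-trans (m<m+n _ n′>0) (cert 0 (convex-bound-ring₁₀ Q ρ A p′ r B P) (p′ ⊛ c₁ ⊕ r ⊛ c₂))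

-- Here l says that a pair is in the link, u and v that its ends lie in the upper set, d and e that
-- they lie in the middle set. A link pair with no end in the upper set has both ends in the middle
-- one, and u + v - uv marks the pairs with an end in the upper set. Summation gives ℓ + p² ≤ 2Np +
-- q².
pair-cover : ∀ l u v d e → (l ≡ true → u ≡ false → v ≡ false → d ≡ true × e ≡ true) →
  ⟦ l ⟧ + ⟦ u ⟧ * ⟦ v ⟧ ≤ ⟦ u ⟧ + ⟦ v ⟧ + ⟦ d ⟧ * ⟦ e ⟧
pair-cover true true true d e h = s≤s (s≤s z≤n)
pair-cover true true false d e h = s≤s z≤n
pair-cover true false true d e h = s≤s z≤n
pair-cover true false false d e h with h refl refl refl
... | refl , refl = ≤-refl
pair-cover false true true d e h = s≤s z≤n
pair-cover false true false d e h = z≤n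
pair-cover false false v d e h = z≤n

module LightPair (a b P Q k R₀ R : ℕ) (a≥1 : 1 ≤ a) (R₀>0 : 0 < R₀) (R>0 : 0 < R) (k>0 : 0 < k) (P>0 : 0 < P)
  (c₁′ : 2 * (Q * (R₀ * k * (a * R))) < P * (R₀ * k * (R₀ * k)) + Q * (a * R * (a * R)))
  (c₂′ : Q * ((a + b) * R * ((a + b) * R)) < P * (R₀ * k * (R₀ * k))) where

  private
    ρ : ℕ
    ρ = R₀ * k

  -- Layer-cake: for each level τ the heavy vertices split into p ≤ A (above the level, and
  -- so far above it that any partner will do), and some level has few of both.
  light-pair : ∀ {N} (L : Fin N → Fin N → Bool) → (∀ y z → L y z ≡ L z y) →
    P * (N * N) ≤ Q * sum (λ y → sum λ z → ⟦ L y z ⟧) → 0 < N → (x : Fin N → ℕ) →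
    ∃₂ λ y z → L y z ≡ true × R * N * (b * x y + a * x z) ≤ R₀ * k * sum x
  light-pair {N} L Lsym hd N>0 x
    with any? (λ y → any? λ z → true? (L y z) ×-dec (R * N * (b * x y + a * x z) ≤? R₀ * k * sum x))
  ... | yes (y , z , h) = y , z , h
  ... | no none = ⊥-elim (convex-bound {N} {P} {Q} {ρ} {a * R} {(a + b) * R} {p τ} {q τ} {ℓ} {r}
          (*-monoˡ-≤ R (m≤m+n a b)) c₁′ c₂′ (sym (m+[n∸m]≡n p≤)) line (*-mono-≤ (*-mono-≤ a≥1 R>0) N>0) hd pairs)
    where
    X W ℓ : ℕ
    X = sum x
    W = R₀ * k * X
    ℓ = sum (λ y → sum λ z → ⟦ L y z ⟧)
    V : Fin N → ℕ
    V y = (a + b) * (R * N * x y)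
    H : ∀ y z → L y z ≡ true → (a + b) * W < b * V y + a * V z
    H y z e = <-≤-trans (*-monoʳ-< (a + b) {{>-nonZero (≤-trans a≥1 (m≤m+n a b))}} (≰⇒> λ le → none (y , z , e , le)))
      (≤-reflexive (light-pair-ring₁ a b (R * N) (x y) (x z)))
    inA inP inD : Fin W → Fin N → Bool
    -- The two thresholds are tied by `a V z + b τ = (a + b) W`: if z stays below the upper one,
    -- heaviness of the edge yz forces `τ < V y`.
    inA τ y = does (toℕ τ <? V y)
    inP τ y = does ((a + b) * W ≤? a * V y + b * toℕ τ)
    inD τ y = inA τ y ∧ not (inP τ y)
    P⇒A : ∀ τ y → inP τ y ≡ true → inA τ y ≡ true
    P⇒A τ y e = dec-true (toℕ τ <? V y) (≰⇒> λ V≤τ → <⇒≱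
       (≤-<-trans (+-monoˡ-≤ (b * toℕ τ) (a ⊛ V≤τ))
         (subst (_< (a + b) * W) (*-distribʳ-+ (toℕ τ) a b)
            (*-monoʳ-< (a + b) {{>-nonZero (≤-trans a≥1 (m≤m+n a b))}} (toℕ<n τ))))
       (does-true (_ ≤? _) e))
    A≡P+D : ∀ τ y → ⟦ inA τ y ⟧ ≡ ⟦ inP τ y ⟧ + ⟦ inD τ y ⟧
    A≡P+D τ y with inA τ y | inP τ y | P⇒A τ y
    ... | true | true | _ = refl
    ... | true | false | _ = refl
    ... | false | false | _ = refl
    ... | false | true | f = case f refl of λ ()
    p q : Fin W → ℕ
    p τ = sum (λ y → ⟦ inP τ y ⟧)
    q τ = sum (λ y → ⟦ inD τ y ⟧)
    -- Over all levels a vertex costs at most `a V y`: it enters the upper set only if `V y > W`,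
    -- and then `a (V y − W)` pays for its upper levels.
    col : ∀ y → sum (λ τ → a * ⟦ inA τ y ⟧ + b * ⟦ inP τ y ⟧) ≤ a * V y
    col y = subst (_≤ a * V y) (sym (trans (sum-+ _ _) (cong₂ _+_ (sum-*ˡ a _) (sum-*ˡ b _)))) (go (count-above b ((a + b) * W) W (a * V y)))
      where
      sA = sum (λ τ → ⟦ inA τ y ⟧)
      sP = sum (λ τ → ⟦ inP τ y ⟧)
      go : (sP ≡ 0) ⊎ (b * sP + (a + b) * W ≤ a * V y + b * W) → a * sA + b * sP ≤ a * V y
      go (inj₁ e) rewrite e | *-zeroʳ b | +-identityʳ (a * sA) = a ⊛ count-below W (V y)
      go (inj₂ h) = cert 0 (light-pair-ring₂ a b sA sP W (a * V y)) (h ⊕ a ⊛ count-≤ (λ τ → inA τ y))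
    f : Fin W → ℕ
    f τ = ρ * (a * (p τ + q τ) + b * p τ)
    C : ℕ
    C = a * ((a + b) * (R * N))
    fsum : sum f ≤ W * C
    fsum = begin
      sum f ≡⟨ sum-*ˡ ρ _ ⟩
      ρ * sum (λ τ → a * (p τ + q τ) + b * p τ) ≡⟨ cong (ρ *_) (sum-cong-≗ λ τ →
         cong₂ _+_ (cong (a *_) (trans (sym (sum-+ _ _)) (sum-cong-≗ λ y → sym (A≡P+D τ y)))) refl) ⟩
      ρ * sum (λ τ → a * sum (λ y → ⟦ inA τ y ⟧) + b * p τ) ≡⟨ cong (ρ *_) (sum-cong-≗ λ τ →
         sym (trans (sum-+ _ _) (cong₂ _+_ (sum-*ˡ a _) (sum-*ˡ b _)))) ⟩
      ρ * sum (λ τ → sum λ y → a * ⟦ inA τ y ⟧ + b * ⟦ inP τ y ⟧) ≡⟨ cong (ρ *_) (sum-swap _) ⟩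
      ρ * sum (λ y → sum λ τ → a * ⟦ inA τ y ⟧ + b * ⟦ inP τ y ⟧) ≤⟨ ρ ⊛ sum-mono col ⟩
      ρ * sum (λ y → a * ((a + b) * (R * N * x y))) ≡⟨ cong (ρ *_) (trans (sum-cong-≗ λ y → light-pair-ring₃ (a) (a + b) (R * N) (x y)) (sum-*ˡ C x)) ⟩
      ρ * (C * X) ≡⟨ light-pair-ring₄ R₀ k C X ⟩
      W * C ∎
      where
      open ≤-Reasoning
    ℓ>0 : 0 < Q * ℓ
    ℓ>0 = <-≤-trans (*-mono-≤ P>0 (*-mono-≤ N>0 N>0)) hd
    -- At least one level exists: without any excess every edge of the link is light, and the
    -- density provides an edge.
    W>0 : 0 < W
    W>0 = n≢0⇒n>0 λ e → absurd e (sum-pigeon (λ _ → 0) _ (subst (_< ℓ) (sym (trans (sum-const N 0) (*-zeroʳ N)))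
        (n≢0⇒n>0 λ z → <-irrefl refl (subst (0 <_) (trans (cong (Q *_) z) (*-zeroʳ Q)) ℓ>0))))
      where
      absurd : W ≡ 0 → ∃ (λ y → 0 < sum (λ z → ⟦ L y z ⟧)) → ⊥
      absurd e (y , hy) with sum-pigeon (λ _ → 0) _ (subst (_< sum (λ z → ⟦ L y z ⟧)) (sym (trans (sum-const N 0) (*-zeroʳ N))) hy)
      ... | z , hz = none (y , z , ⟦⟧-pos hz , subst (_≤ W) (sym zero′) z≤n)
        where
        X0 : X ≡ 0
        X0 = m*n≡0⇒m≡0 X (R₀ * k) {{m*n≢0 R₀ k {{>-nonZero R₀>0}} {{>-nonZero k>0}}}} (trans (*-comm X (R₀ * k)) e)
        x0 : ∀ i → x i ≡ 0
        x0 i = n≤0⇒n≡0 (≤-trans (term≤sum x i) (≤-reflexive X0))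
        zero′ : R * N * (b * x y + a * x z) ≡ 0
        zero′ rewrite x0 y | x0 z | *-zeroʳ b | *-zeroʳ a = *-zeroʳ (R * N)
    level : ∃ λ τ → f τ < suc C
    level = sum-pigeon f (λ _ → suc C) (≤-<-trans fsum (subst (W * C <_) (sym (trans (sum-const W (suc C)) (*-suc W C))) (m<n+m _ W>0)))
    τ : Fin W
    τ = proj₁ level
    line₀ : ρ * (a * (p τ + q τ) + b * p τ) ≤ C
    line₀ = s≤s⁻¹ (proj₂ level)
    line : a * R * (ρ * q τ) + (a + b) * R * (ρ * p τ) ≤ a * R * ((a + b) * R * N)
    line = subst₂ _≤_ (light-pair-ring₅ a b R ρ (p τ) (q τ)) (light-pair-ring₆ a b R N) (R ⊛ line₀)
    p≤ : ρ * p τ ≤ a * R * N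
    p≤ = *-cancelˡ-≤ (a + b) {{>-nonZero (≤-trans a≥1 (m≤m+n a b))}}
      (cert (ρ * (a * q τ)) (light-pair-ring₇ a b R N ρ (p τ) (q τ)) line₀)
    r : ℕ
    r = a * R * N ∸ ρ * p τ
    key : ∀ τ y z → L y z ≡ true → inP τ z ≡ false → inA τ y ≡ true
    key τ y z e pz = dec-true (toℕ τ <? V y) (≰⇒> λ V≤τ → does-false (_ ≤? _) pz
      (<⇒≤ (<-≤-trans (H y z e) (subst (_≤ a * V z + b * toℕ τ) (+-comm (a * V z) (b * V y)) (+-monoʳ-≤ (a * V z) (b ⊛ V≤τ))))))
    pw : ∀ τ y z → ⟦ L y z ⟧ + ⟦ inP τ y ⟧ * ⟦ inP τ z ⟧ ≤ ⟦ inP τ y ⟧ + ⟦ inP τ z ⟧ + ⟦ inD τ y ⟧ * ⟦ inD τ z ⟧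
    pw τ y z = pair-cover (L y z) (inP τ y) (inP τ z) _ _ λ e eu ev →
      cong₂ (λ s t → s ∧ not t) (key τ y z e ev) eu , cong₂ (λ s t → s ∧ not t) (key τ z y (trans (Lsym z y) e) eu) ev
    pairs : ℓ + p τ * p τ ≤ 2 * (N * p τ) + q τ * q τ
    pairs = subst₂ _≤_
      (trans (sum-cong-≗ λ y → sum-+ _ _) (trans (sum-+ _ _) (cong (ℓ +_) (sum-prod _ _))))
      (trans (sum-cong-≗ λ y → trans (sum-+ _ _) (cong₂ _+_ (sum-+ _ _) refl))
        (trans (sum-+ _ _) (cong₂ _+_ (trans (sum-+ _ _) (trans (cong₂ _+_
          (trans (sum-cong-≗ λ y → sum-const N _) (sum-*ˡ N _)) (sum-const N _)) (cong (N * p τ +_) (sym (+-identityʳ (N * p τ)))))) (sum-prod _ _))))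
      (sum-mono λ y → sum-mono λ z → pw τ y z)

-- The slack in the hypotheses c₁ and c₂ survives passing from k to ρ = k R₀ with R₀ large.
module Light (a b c P Q : ℕ) (a≥1 : 1 ≤ a)
  (c₁ : Q * ((a + b + c) * (a + b + c)) < P * ((a + b + c) * (a + b + c)) + Q * ((b + c) * (b + c)))
  (c₂ : Q * ((a + b) * (a + b)) < P * ((a + b + c) * (a + b + c))) where

  k R₀ R ρ T : ℕ
  k = a + b + c
  T = P * (k * k)
  -- The hypotheses have slack 1 on the scale of T, and (T - 1)(2T + 1)² < T(2T)²; so the relative
  -- loss 1/R₀ is absorbed.
  R₀ = 2 * T
  R = suc R₀
  ρ = R₀ * k

  T>0 : 0 < T
  T>0 = ≤-<-trans z≤n c₂

  Pρ² : P * (ρ * ρ) ≡ R₀ * R₀ * T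
  Pρ² = Pρ²-ring P k R₀

  c₁⁰ : suc (2 * (Q * (k * a))) ≤ T + Q * (a * a)
  c₁⁰ = cert 0 (trans (cong (λ k → suc (2 * (Q * (k * a))) + (P * (k * k) + Q * ((b + c) * (b + c))) + 0) (+-assoc a b c))
          (trans (c₁⁰-ring Q P a (b + c)) (cong (λ k → P * (k * k) + Q * (a * a) + (1 + Q * (k * k))) (sym (+-assoc a b c))))) c₁

  c₁′ : 2 * (Q * (ρ * (a * R))) < P * (ρ * ρ) + Q * (a * R * (a * R))
  c₁′ = cert (2 * (T * T) + T + Q * (a * a) * R)
     (trans (c₁′-ring a Q T k) (cong (λ z → z + Q * (a * R * (a * R)) + (R₀ * R * suc (2 * (Q * (k * a))) + 1)) (sym Pρ²)))
     ((R₀ * R) ⊛ c₁⁰ ⊕ T>0)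

  c₂′ : Q * ((a + b) * R * ((a + b) * R)) < P * (ρ * ρ)
  c₂′ = cert (3 * T) (trans (c₂′-ring (a + b) Q T) (cong (λ z → z + R * R * suc (Q * ((a + b) * (a + b)))) (sym Pρ²))) ((R * R) ⊛ c₂)

  k>0 : 0 < k
  k>0 = ≤-trans a≥1 (≤-trans (m≤m+n a b) (m≤m+n (a + b) c))

  P>0 : 0 < P
  P>0 = n≢0⇒n>0 λ e → <-irrefl refl (subst (λ P → 0 < P * (k * k)) e T>0)

  open LightPair a b P Q k R₀ R a≥1 (<-≤-trans T>0 (m≤m+n T _)) z<s k>0 P>0 c₁′ c₂′ public

-- Write θ = P/Q and μ = m/N. The convex quadratic 2μ² + (1 - μ)² lies below 2θ at both ends of θ ≤
-- μ ≤ (2 - θ)/4: the difference is (3θ - 1)(θ - 1) at the left end and (3/16)(θ² - 12θ + 4) at the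
-- right end. Up to the factor QN the numbers e, x and e + δ + x are 4μ, θ and 2, and δ measures the
-- distance from the right end.
cover-arith₀ : ∀ e δ x → 16 * (x * (e + δ + x)) ≤ 2 * (e * e) + (e + 2 * δ + 2 * x) * (e + 2 * δ + 2 * x) →
  (e + δ + x) * (e + δ + x) + x * x < 6 * (x * (e + δ + x)) → 4 * x ≤ e → e + δ + x ≤ 6 * x → ⊥
cover-arith₀ e δ x hA hB hC hD = 1+n≰n (cert {1} {0} 2 (cover-arith₀-ring₂ e δ x) (hA ⊕ 3 ⊛ hB ⊕ δ ⊛ small))
  where
  small : δ + 4 * x ≤ 2 * e
  small = cert (3 * x) (cover-arith₀-ring₁ e δ x) (hD ⊕ 3 ⊛ hC)

-- With e = 4Qm, x = PN and 4Qh = (2Q + P)N + δ one has 2QN = e + δ + x.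
cover-arith : ∀ {P Q} m h {ℓ e} → 4 * (Q * Q) + P * P < 12 * (P * Q) → 0 < m + h →
  P * ((m + h) * (m + h)) ≤ Q * ℓ → P * ((m + h) * (m + h)) ≤ Q * e → e ≤ h * h → ℓ ≤ (m + h) * m → ℓ + e ≤ 2 * (m * m) + h * h → ⊥
cover-arith {P} {Q} m h {ℓ} {e} c₃ N>0 hℓ he e≤ ℓ≤ both = cover-arith₀ (4 * (Q * m)) δ x hA hB hC hD
  where
  N x δ : ℕ
  N = m + h
  x = P * N
  δ = 4 * (Q * h) ∸ (2 * Q + P) * N
  hC : 4 * x ≤ 4 * (Q * m)
  hC = 4 ⊛ *-cancelˡ-≤ N {{>-nonZero N>0}} (subst₂ _≤_ (cover-arith-ring₁ P N) (cover-arith-ring₂ Q N m) (≤-trans hℓ (Q ⊛ ℓ≤)))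
  Q>0 : 0 < Q
  Q>0 = n≢0⇒n>0 λ { refl → <⇒≱ c₃ (≤-trans (≤-reflexive (trans (cong (12 *_) (*-zeroʳ P)) refl)) z≤n) }
  Q<3P : Q ≤ 3 * P
  Q<3P = *-cancelˡ-≤ (4 * Q) {{>-nonZero (<-≤-trans Q>0 (m≤m+n Q _))}} (cert (P * P + 1) (cover-arith-ring₃ P Q) c₃)
  -- A rational substitute for h ≥ √θ N: by `c₃` the number (2 + θ)/4 lies below √θ.
  big : (2 * Q + P) * N ≤ 4 * (Q * h)
  big = <⇒≤ (sq-cancel-< (≤-trans (+-monoˡ-≤ _ N²>0) (cert 0 (cover-arith-ring₄ P Q N h) ((N * N) ⊛ c₃ ⊕ (16 * Q) ⊛ ≤-trans he (Q ⊛ e≤)))))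
    where
    N²>0 : 1 ≤ N * N
    N²>0 = *-mono-≤ N>0 N>0
  h≡ : 4 * (Q * h) ≡ 4 * (Q * m) + 2 * δ + 2 * x
  2QN : 2 * (Q * N) ≡ 4 * (Q * m) + δ + x
  2QN = +-cancelʳ-≡ ((2 * Q + P) * N) _ _ (trans (cover-arith-ring₅ P Q m h) (trans (cong (λ z → 4 * (Q * m) + z + x) (sym (m∸n+n≡m big))) (cover-arith-ring₆ (4 * (Q * m)) δ ((2 * Q + P) * N) x)))
  h≡ = trans (sym (m∸n+n≡m big)) (trans (cong (δ +_) (cover-arith-ring₇ P Q N)) (trans (cong (λ z → δ + (z + x)) 2QN) (cover-arith-ring₈ (4 * (Q * m)) δ x)))
  hA : 16 * (x * (4 * (Q * m) + δ + x)) ≤ 2 * (4 * (Q * m) * (4 * (Q * m))) + (4 * (Q * m) + 2 * δ + 2 * x) * (4 * (Q * m) + 2 * δ + 2 * x)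
  hA = subst₂ (λ u v → 16 * (x * u) ≤ 2 * (4 * (Q * m) * (4 * (Q * m))) + v * v) 2QN h≡
    (cert 0 (cover-arith-ring₉ P Q N m h (ℓ + e)) ((16 * Q) ⊛ (hsum ⊕ Q ⊛ both)))
    where
    hsum : 2 * (P * (N * N)) ≤ Q * (ℓ + e)
    hsum = subst₂ _≤_ (cong (P * (N * N) +_) (sym (+-identityʳ _))) (sym (*-distribˡ-+ Q ℓ e)) (hℓ ⊕ he)
  hB : (4 * (Q * m) + δ + x) * (4 * (Q * m) + δ + x) + x * x < 6 * (x * (4 * (Q * m) + δ + x))
  hB = subst (λ u → u * u + x * x < 6 * (x * u)) 2QN (≤-trans (+-monoˡ-≤ _ (*-mono-≤ N>0 N>0)) (cert 0 (cover-arith-ring₁₀ P Q N) ((N * N) ⊛ c₃)))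
  hD : 4 * (Q * m) + δ + x ≤ 6 * x
  hD = subst (_≤ 6 * x) 2QN (subst₂ _≤_ (cover-arith-ring₁₁ N Q) (cover-arith-ring₁₂ N P) ((2 * N) ⊛ Q<3P))

-- Fix a vertex. Here b, u, v say that yz and the pairs from this vertex to y and to z lie outside
-- the shadow, e is the link of the vertex, and g says that both pairs from it lie in the shadow.
-- Since l and e exclude each other through b, the left side is at most 1. After summation the first
-- two terms are at most m² each, as m is the maximum degree, and the last is h².
cover-pair : ∀ l b e g u v → (l ≡ true → b ≡ true) → (e ≡ true → b ≡ false) → (e ≡ true → g ≡ true) →
  (u ≡ false → v ≡ false → g ≡ true) → ⟦ l ⟧ + ⟦ e ⟧ ≤ ⟦ u ⟧ * ⟦ b ⟧ + ⟦ v ⟧ * ⟦ b ⟧ + ⟦ g ⟧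
cover-pair true b true g u v h₁ h₂ h₃ h₄ = case trans (sym (h₁ refl)) (h₂ refl) of λ ()
cover-pair true b false g true v h₁ h₂ h₃ h₄ rewrite h₁ refl = s≤s z≤n
cover-pair true b false g false true h₁ h₂ h₃ h₄ rewrite h₁ refl = s≤s z≤n
cover-pair true b false g false false h₁ h₂ h₃ h₄ rewrite h₄ refl refl = s≤s z≤n
cover-pair false b true g u v h₁ h₂ h₃ h₄ rewrite h₃ refl = m≤n+m 1 _
cover-pair false b false g u v h₁ h₂ h₃ h₄ = z≤n

-- A dense link meets the shadow

link : ∀ {N} → (Fin N → Fin N → Bool) → ℕ
link L = sum λ y → sum λ z → ⟦ L y z ⟧

module _ {N} (E : Fin (suc N) → Fin (suc N) → Fin (suc N) → Bool)
  (E₁₂ : ∀ x y z → E x y z ≡ E y x z) (E₂₃ : ∀ x y z → E x y z ≡ E x z y) where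

  private
    G : Fin (suc N) → Fin (suc N) → Bool
    G y z = does (any? λ i → true? (E i y z))
    G-intro : ∀ i y z → E i y z ≡ true → G y z ≡ true
    G-intro i y z e = dec-true (any? λ i → true? (E i y z)) (i , e)
    G-sym : ∀ y z → G y z ≡ G z y
    G-sym y z = bool-iff (λ e → let i , h = does-true (any? λ i → true? (E i y z)) e in G-intro i z y (trans (E₂₃ i z y) h))
                         (λ e → let i , h = does-true (any? λ i → true? (E i z y)) e in G-intro i y z (trans (E₂₃ i y z) h))
    B : Fin (suc N) → Fin (suc N) → Bool
    B y z = not (G y z)

  -- If a dense L avoids the shadow G, compare L with the link of a vertex u of
  -- maximum degree m outside the shadow.
  shadow-meets : ∀ {P Q} → 4 * (Q * Q) + P * P < 12 * (P * Q) →
    (∀ v → P * (suc N * suc N) ≤ Q * link (E v)) →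
    (L : Fin (suc N) → Fin (suc N) → Bool) → P * (suc N * suc N) ≤ Q * link L →
    ∃ λ y → ∃ λ z → L y z ≡ true × ∃ λ i → E i y z ≡ true
  shadow-meets {P} {Q} c₃ hE L hL with any? (λ y → any? λ z → true? (L y z) ×-dec any? λ i → true? (E i y z))
  ... | yes h = h
  ... | no none = ⊥-elim (cover-arith {P} {Q} m h {link L} {link (E u)} c₃ (subst (0 <_) (sym mh) z<s)
      (subst (λ n → P * (n * n) ≤ Q * link L) (sym mh) hL) (subst (λ n → P * (n * n) ≤ Q * link (E u)) (sym mh) (hE u)) e≤
      (subst (λ n → link L ≤ n * m) (sym mh) ℓ≤) both)
    where
    best : ∃ λ u → ∀ v → sum (λ z → ⟦ B v z ⟧) ≤ sum (λ z → ⟦ B u z ⟧)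
    best = argmax (λ v → sum (λ z → ⟦ B v z ⟧))
    u : Fin (suc N)
    u = proj₁ best
    m h : ℕ
    m = sum (λ z → ⟦ B u z ⟧)
    h = sum (λ z → ⟦ G u z ⟧)
    mh : m + h ≡ suc N
    mh = trans (sym (sum-+ _ _)) (trans (sum-cong-≗ λ z → trans (+-comm ⟦ B u z ⟧ _) (⟦not⟧ (G u z))) (trans (sum-const (suc N) 1) (*-identityʳ _)))
    L⇒B : ∀ y z → L y z ≡ true → B y z ≡ true
    L⇒B y z e = cong not (dec-false (any? λ i → true? (E i y z)) λ w → none (y , z , e , w))
    ℓ≤ : link L ≤ suc N * m
    ℓ≤ = ≤-trans (sum-mono λ y → sum-mono λ z → ⟦⟧-mono (L⇒B y z)) (sum-≤const (proj₂ best))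
    E⇒G : ∀ u y z → E u y z ≡ true → (G u y ∧ G u z) ≡ true
    E⇒G u y z e = cong₂ _∧_ (G-intro z u y (trans (E₁₂ z u y) (trans (E₂₃ u z y) e)))
                           (G-intro y u z (trans (E₁₂ y u z) e))
    e≤ : link (E u) ≤ h * h
    e≤ = ≤-trans (sum-mono λ y → sum-mono λ z → ⟦⟧-mono (E⇒G u y z))
      (≤-reflexive (trans (sum-cong-≗ λ y → sum-cong-≗ λ z → ⟦∧⟧ (G u y) (G u z)) (sum-prod _ _)))
    pw : ∀ u y z → ⟦ L y z ⟧ + ⟦ E u y z ⟧ ≤ ⟦ B u y ⟧ * ⟦ B y z ⟧ + ⟦ B u z ⟧ * ⟦ B y z ⟧ + ⟦ G u y ∧ G u z ⟧
    pw u y z = cover-pair (L y z) (B y z) (E u y z) (G u y ∧ G u z) (B u y) (B u z) (L⇒B y z)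
      (λ e → cong not (G-intro u y z e)) (E⇒G u y z) (λ p q → cong₂ _∧_ (not-false p) (not-false q))
      where
      not-false : ∀ {b} → not b ≡ false → b ≡ true
      not-false {true} _ = refl
    deg : sum (λ y → sum λ z → ⟦ B u y ⟧ * ⟦ B y z ⟧) ≤ m * m
    deg = ≤-trans (sum-mono λ y → ≤-trans (≤-reflexive (sum-*ˡ ⟦ B u y ⟧ _)) (⟦ B u y ⟧ ⊛ proj₂ best y))
      (≤-reflexive (sum-*ʳ m _))
    deg′ : sum (λ y → sum λ z → ⟦ B u z ⟧ * ⟦ B y z ⟧) ≤ m * m
    deg′ = ≤-trans (≤-reflexive (trans (sum-swap _) (sum-cong-≗ λ z → sum-cong-≗ λ y → cong (λ b → ⟦ B u z ⟧ * ⟦ not b ⟧) (G-sym y z)))) deg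
    both : link L + link (E u) ≤ 2 * (m * m) + h * h
    both = begin
      link L + link (E u) ≡⟨ trans (sym (sum-+ _ _)) (sum-cong-≗ λ y → sym (sum-+ _ _)) ⟩
      sum (λ y → sum λ z → ⟦ L y z ⟧ + ⟦ E u y z ⟧) ≤⟨ sum-mono (λ y → sum-mono λ z → pw u y z) ⟩
      sum (λ y → sum λ z → ⟦ B u y ⟧ * ⟦ B y z ⟧ + ⟦ B u z ⟧ * ⟦ B y z ⟧ + ⟦ G u y ∧ G u z ⟧)
        ≡⟨ trans (sum-cong-≗ λ y → trans (sum-+ _ _) (cong₂ _+_ (sum-+ _ _) refl)) (trans (sum-+ _ _) (cong₂ _+_ (sum-+ _ _) refl)) ⟩
      sum (λ y → sum λ z → ⟦ B u y ⟧ * ⟦ B y z ⟧) + sum (λ y → sum λ z → ⟦ B u z ⟧ * ⟦ B y z ⟧) + sum (λ y → sum λ z → ⟦ G u y ∧ G u z ⟧)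
        ≤⟨ +-mono-≤ (+-mono-≤ deg deg′) (≤-reflexive (trans (sum-cong-≗ λ y → sum-cong-≗ λ z → ⟦∧⟧ (G u y) (G u z)) (sum-prod _ _))) ⟩
      m * m + m * m + h * h ≡⟨ cong (λ z → m * m + z + h * h) (sym (+-identityʳ (m * m))) ⟩
      2 * (m * m) + h * h ∎
      where open ≤-Reasoning

pigeon₂ : ∀ {m n} (f : Fin m → Fin n → ℕ) → m * n < sum (λ y → sum λ z → f y z) → ∃ λ y → ∃ λ z → 1 < f y z
pigeon₂ {m} {n} f h with sum-pigeon (λ _ → n) (λ y → sum λ z → f y z) (subst (_< sum (λ y → sum λ z → f y z)) (sym (sum-const m n)) h)
... | y , hy with sum-pigeon (λ _ → 1) (f y) (subst (_< sum (f y)) (sym (trans (sum-const n 1) (*-identityʳ n))) hy)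
...   | z , hz = y , z , hz

both-true : ∀ {u v} → 1 < ⟦ u ⟧ + ⟦ v ⟧ → u ≡ true × v ≡ true
both-true {true} {true} _ = refl , refl
both-true {true} {false} (s≤s ())
both-true {false} {true} (s≤s ())

two-true : ∀ {u v w} → 1 < ⟦ u ⟧ + ⟦ v ⟧ + ⟦ w ⟧ → (u ≡ true × v ≡ true) ⊎ (u ≡ true × w ≡ true) ⊎ (v ≡ true × w ≡ true)
two-true {true} {true} {_} _ = inj₁ (refl , refl)
two-true {true} {false} {true} _ = inj₂ (inj₁ (refl , refl))
two-true {false} {true} {true} _ = inj₂ (inj₂ (refl , refl))
two-true {true} {false} {false} (s≤s ())
two-true {false} {true} {false} (s≤s ())
two-true {false} {false} {true} (s≤s ())

dense-< : ∀ n {P Q M S} → 0 < M → Q < n * P → n * (P * (M * M)) ≤ Q * S → M * M < S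
dense-< n {P} {Q} {M} {S} M>0 h hS = *-cancelˡ-< Q _ _ (<-≤-trans (≤-trans (+-monoˡ-≤ (Q * (M * M)) (*-mono-≤ M>0 M>0)) (*-monoˡ-≤ (M * M) h))
  (≤-trans (≤-reflexive (*-assoc n P (M * M))) hS))

half-< : ∀ {P Q M s} → 0 < M → Q < 4 * P → P * (M * M) ≤ Q * (s * s) → M < 2 * s
half-< {P} {Q} {M} {s} M>0 h hs = sq-cancel-< (dense-< 4 {P} {Q} {M} M>0 h (≤-trans (4 ⊛ hs) (≤-reflexive (half-<-ring Q s))))

-- At α = 2(α + β)/3 both α² and 2αβ equal 4/9 of (α + β)². Below that point α² is smaller, beyond
-- it 2αβ decreases.
unbalanced : ∀ {P Q α β} → 0 < α + β → 4 * Q < 9 * P →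
  P * ((α + β) * (α + β)) ≤ Q * (2 * (α * β)) → P * ((α + β) * (α + β)) ≤ Q * (α * α) → ⊥
unbalanced {P} {Q} {α} {β} M>0 h h₁ h₂ = go (m≤n⇒∃[o]m+o≡n (<⇒≤ α>2β))
  where
  scale : ∀ {X} → P * ((α + β) * (α + β)) ≤ Q * X → 2 * (α + β) * (2 * (α + β)) < 9 * X
  scale {X} hX = *-cancelˡ-< Q _ _ (<-≤-trans (m<m+n _ (*-mono-≤ M>0 M>0)) (cert 0 (unbalanced-ring₁ P Q (α + β) X) (((α + β) * (α + β)) ⊛ h ⊕ 9 ⊛ hX)))
  α>2β : 2 * β < α
  α>2β = cert 0 (unbalanced-ring₂ α β) (sq-cancel-< (<-≤-trans (scale h₂) (≤-reflexive (unbalanced-ring₃ α))))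
  go : (∃ λ o → 2 * β + o ≡ α) → ⊥
  go (o , refl) = 1+n≰n (cert {1} {0} (6 * (β * o) + 4 * (o * o)) (unbalanced-ring₄ β o) (scale h₁))

-- The lattice of usage vectors

-- The three ways in which the density P/Q makes the lattice of usage vectors connected.
Connecting : (P Q a b c : ℕ) → Set
Connecting P Q a b c =
  (dval a b c ≡ 1 × Q < 4 * P)
  ⊎ (gcd3 a b c ≡ 1 × (∃ λ e → dval a b c ≡ 1 + 2 * e) × 4 * Q < 9 * P)
  ⊎ Q < 2 * P

module Lattice (a′ b c : ℕ) (a≤b : suc a′ ≤ b) (b≤c : b ≤ c) {M₀ : ℕ} (E : Fin (suc M₀) → Fin (suc M₀) → Fin (suc M₀) → Bool)
  (E₁₂ : ∀ x y z → E x y z ≡ E y x z) (E₂₃ : ∀ x y z → E x y z ≡ E x z y) where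

  M a k : ℕ
  M = suc M₀
  a = suc a′
  k = a + b + c

  -- The copy of K_{a,b,c} in a blow-up of E with parts {x₁, x₂, …, x₂}, {y, …, y}, {z, …, z}.
  record Gen : Set where
    constructor gen
    field
      {x₁ x₂ y z} : Fin M
      e₁ : E x₁ y z ≡ true
      e₂ : E x₂ y z ≡ true

  usage : Gen → Fin M → ℕ
  usage (gen {x₁} {x₂} {y} {z} _ _) j = ⟦ x₁ == j ⟧ + a′ * ⟦ x₂ == j ⟧ + b * ⟦ y == j ⟧ + c * ⟦ z == j ⟧

  us : List Gen → Fin M → ℕ
  us [] j = 0
  us (g ∷ gs) j = usage g j + us gs j

  us-++ : ∀ gs hs j → us (gs ++ hs) j ≡ us gs j + us hs j
  us-++ [] hs j = refl
  us-++ (g ∷ gs) hs j = trans (cong (usage g j +_) (us-++ gs hs j)) (sym (+-assoc (usage g j) (us gs j) (us hs j)))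

  -- Membership in the lattice generated by the usage vectors. The witness is a pair of lists of
  -- copies, because the later correction works with nonnegative multiplicities and so must be able
  -- to add negative generators as copies of their own.
  record In (v : Fin M → ℤ) : Set where
    constructor mkIn
    field
      plus minus : List Gen
      balance : ∀ l → pos (us plus l) ≡ v l ℤ.+ pos (us minus l)

  In-cong : ∀ {v w} → (∀ l → v l ≡ w l) → In v → In w
  In-cong e (mkIn P N h) = mkIn P N λ l → trans (h l) (cong (ℤ._+ pos (us N l)) (e l))

  In-neg : ∀ {v} → In v → In (λ l → ℤ.- v l)
  In-neg {v} (mkIn P N h) = mkIn N P λ l → trans (In-neg-ring (v l) (pos (us N l))) (cong (λ z → ℤ.- v l ℤ.+ z) (sym (h l)))

  In-add : ∀ {v w} → In v → In w → In (λ l → v l ℤ.+ w l)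
  In-add {v} {w} (mkIn P N h) (mkIn P′ N′ h′) = mkIn (P ++ P′) (N ++ N′) λ l →
    trans (cong pos (us-++ P P′ l)) (trans (ℤP.pos-+ (us P l) (us P′ l)) (trans (cong₂ ℤ._+_ (h l) (h′ l))
      (trans (In-add-ring (v l) (w l) (pos (us N l)) (pos (us N′ l))) (cong (ℤ._+_ (v l ℤ.+ w l)) (sym (trans (cong pos (us-++ N N′ l)) (ℤP.pos-+ (us N l) (us N′ l))))))))

  In-sub : ∀ {v w} → In v → In w → In (λ l → v l ℤ.- w l)
  In-sub p q = In-add p (In-neg q)

  In-zero : In (λ _ → ℤ.0ℤ)
  In-zero = mkIn [] [] λ l → refl

  In-mul : ∀ {v} n → In v → In (λ l → pos n ℤ.* v l)
  In-mul {v} zero p = In-cong (λ l → sym (ℤP.*-zeroˡ (v l))) In-zero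
  In-mul {v} (suc n) p = In-cong (λ l → In-mul-ring (pos n) (v l)) (In-add p (In-mul n p))

  δ : Fin M → Fin M → ℤ
  δ i l = pos ⟦ i == l ⟧

  infix 4 _≈_
  _≈_ : Fin M → Fin M → Set
  i ≈ j = In (λ l → δ i l ℤ.- δ j l)

  ≈-sym : ∀ {i j} → i ≈ j → j ≈ i
  ≈-sym {i} {j} p = In-cong (λ l → ≈-sym-ring (δ i l) (δ j l)) (In-neg p)

  ≈-trans : ∀ {i j l} → i ≈ j → j ≈ l → i ≈ l
  ≈-trans {i} {j} {l} p q = In-cong (λ m → ≈-trans-ring (δ i m) (δ j m) (δ l m)) (In-add p q)

  pos-usage : ∀ p q u v w x → pos (u + p * v + q * w + c * x) ≡ pos u ℤ.+ pos p ℤ.* pos v ℤ.+ pos q ℤ.* pos w ℤ.+ pos c ℤ.* pos x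
  pos-usage p q u v w x = trans (ℤP.pos-+ (u + p * v + q * w) (c * x)) (cong₂ ℤ._+_ (trans (ℤP.pos-+ (u + p * v) (q * w))
     (cong₂ ℤ._+_ (trans (ℤP.pos-+ u (p * v)) (cong (ℤ._+_ (pos u)) (ℤP.pos-* p v))) (ℤP.pos-* q w))) (ℤP.pos-* c x))

  In-edge : ∀ {x y z} → E x y z ≡ true → In (λ l → pos a ℤ.* δ x l ℤ.+ pos b ℤ.* δ y l ℤ.+ pos c ℤ.* δ z l)
  In-edge {x} {y} {z} e = mkIn (gen e e ∷ []) [] λ l → trans (cong pos (+-identityʳ (usage (gen e e) l)))
     (trans (pos-usage a′ b _ _ _ _) (In-edge-ring (pos a′) (pos b) (pos c) (δ x l) (δ y l) (δ z l)))

  -- The two copies differ only in `x₁`, which occupies a single vertex. This is why a copy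
  -- distinguishes one vertex of its small part from the other `a′`.
  share : ∀ {i j y z} → E i y z ≡ true → E j y z ≡ true → i ≈ j
  share {i} {j} {y} {z} p q = mkIn (gen p p ∷ []) (gen q p ∷ []) λ l →
     trans (cong pos (+-identityʳ (usage (gen p p) l))) (trans (pos-usage a′ b _ _ _ _)
     (trans (share-ring (pos a′) (pos b) (pos c) (δ i l) (δ j l) (δ y l) (δ z l))
       (cong (ℤ._+_ (δ i l ℤ.- δ j l)) (sym (trans (cong pos (+-identityʳ (usage (gen q p) l))) (pos-usage a′ b _ _ _ _))))))

  -- For fixed i and j these multipliers form a subgroup of ℤ, so i ≈ j follows from multipliers
  -- with greatest common divisor 1.
  record Mul (i j : Fin M) (n : ℤ) : Set where
    constructor mkMul
    field unMul : In (λ l → n ℤ.* (δ i l ℤ.- δ j l))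
  open Mul

  p q : ℕ
  p = b ∸ a
  q = c ∸ b

  b≡ : pos b ≡ pos a ℤ.+ pos p
  b≡ = trans (cong pos (sym (m+[n∸m]≡n a≤b))) (ℤP.pos-+ a p)

  c≡ : pos c ≡ pos a ℤ.+ pos p ℤ.+ pos q
  c≡ = trans (cong pos (sym (m+[n∸m]≡n b≤c))) (trans (ℤP.pos-+ b q) (cong (ℤ._+ pos q) b≡))

  module _ {i j : Fin M} where
    Mul-cong : ∀ {m n} → m ≡ n → Mul i j m → Mul i j n
    Mul-cong refl h = h

    Mul-add : ∀ {m n} → Mul i j m → Mul i j n → Mul i j (m ℤ.+ n)
    Mul-add {m} {n} (mkMul h) (mkMul h′) = mkMul (In-cong (λ l → sym (ℤP.*-distribʳ-+ (δ i l ℤ.- δ j l) m n)) (In-add h h′))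

    Mul-neg : ∀ {m} → Mul i j m → Mul i j (ℤ.- m)
    Mul-neg {m} (mkMul h) = mkMul (In-cong (λ l → ℤP.neg-distribˡ-* m (δ i l ℤ.- δ j l)) (In-neg h))

    Mul-mul : ∀ {m} n → Mul i j m → Mul i j (pos n ℤ.* m)
    Mul-mul {m} n (mkMul h) = mkMul (In-cong (λ l → sym (ℤP.*-assoc (pos n) m (δ i l ℤ.- δ j l))) (In-mul n h))

    Mul-gcd : ∀ m n → Mul i j (pos m) → Mul i j (pos n) → Mul i j (pos (gcd m n))
    Mul-gcd m n hm hn with Bézout.identity (gcd-GCD m n)
    ... | Bézout.+- x y eq = Mul-cong (s (gcd m n) x y m n eq) (Mul-add (Mul-mul x hm) (Mul-neg (Mul-mul y hn)))
      where
      s : ∀ d x y m n → d + y * n ≡ x * m → pos x ℤ.* pos m ℤ.+ ℤ.- (pos y ℤ.* pos n) ≡ pos d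
      s d x y m n e = trans (cong₂ (λ u v → u ℤ.+ ℤ.- v) (trans (sym (ℤP.pos-* x m)) (trans (cong pos (sym e)) (ℤP.pos-+ d (y * n)))) (sym (ℤP.pos-* y n))) (Mul-gcd-ring₁ (pos d) (pos (y * n)))
    ... | Bézout.-+ x y eq = Mul-cong (s (gcd m n) x y m n eq) (Mul-add (Mul-mul y hn) (Mul-neg (Mul-mul x hm)))
      where
      s : ∀ d x y m n → d + x * m ≡ y * n → pos y ℤ.* pos n ℤ.+ ℤ.- (pos x ℤ.* pos m) ≡ pos d
      s d x y m n e = trans (cong₂ (λ u v → u ℤ.+ ℤ.- v) (trans (sym (ℤP.pos-* y n)) (trans (cong pos (sym e)) (ℤP.pos-+ d (x * m)))) (sym (ℤP.pos-* x m))) (Mul-gcd-ring₂ (pos d) (pos (x * m)))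

    Mul-one : Mul i j (pos 1) → i ≈ j
    Mul-one (mkMul h) = In-cong (λ l → ℤP.*-identityˡ _) h

  rot : ∀ {x y z} → E x y z ≡ true → E z x y ≡ true
  rot {x} {y} {z} e = trans (E₁₂ z x y) (trans (E₂₃ x z y) e)

  swap₁₂ : ∀ {x y z} → E x y z ≡ true → E y x z ≡ true
  swap₁₂ {x} {y} {z} e = trans (E₁₂ y x z) e

  -- Exchange x and y between the parts of sizes a and b; exchanging them between the parts of sizes
  -- b and c gives `edge-q`. Hence d is a multiplier along every edge.
  edge-p : ∀ {x y z} → E x y z ≡ true → Mul x y (pos p)
  edge-p {x} {y} {z} e = mkMul (In-cong (λ l → trans (cong (λ b → (pos a ℤ.* δ y l ℤ.+ b ℤ.* δ x l ℤ.+ pos c ℤ.* δ z l) ℤ.- (pos a ℤ.* δ x l ℤ.+ b ℤ.* δ y l ℤ.+ pos c ℤ.* δ z l)) b≡)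
       (edge-p-ring (pos a) (pos p) (pos c) (δ x l) (δ y l) (δ z l))) (In-sub (In-edge (swap₁₂ e)) (In-edge e)))

  edge-q : ∀ {x y z} → E x y z ≡ true → Mul x y (pos q)
  edge-q {x} {y} {z} e = mkMul (In-cong (λ l → trans (cong (λ c → (pos a ℤ.* δ z l ℤ.+ pos b ℤ.* δ y l ℤ.+ c ℤ.* δ x l) ℤ.- (pos a ℤ.* δ z l ℤ.+ pos b ℤ.* δ x l ℤ.+ c ℤ.* δ y l)) (trans c≡ (cong (ℤ._+ pos q) (sym b≡))))
       (edge-q-ring (pos a) (pos b) (pos q) (δ x l) (δ y l) (δ z l))) (In-sub (In-edge (rot (swap₁₂ e))) (In-edge (rot e))))

  -- An edge is typed by the classes of its three vertices. Once some edge meets both classes, p and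
  -- q are multipliers between ι and κ; as b = a + p and c = a + p + q, the multiplier a then
  -- suffices, and it comes from comparing edges of two types.
  module TwoClasses (cl : Fin M → Bool) (ι κ : Fin M) (hι : ∀ j → cl j ≡ true → j ≈ ι) (hκ : ∀ j → cl j ≡ false → j ≈ κ)
    (g : gcd3 a b c ≡ 1) (e₀ : ℕ) (odd : dval a b c ≡ 1 + 2 * e₀) where

    Edge : Bool → Bool → Bool → Set
    Edge u v w = ∃ λ x → ∃ λ y → ∃ λ z → E x y z ≡ true × cl x ≡ u × cl y ≡ v × cl z ≡ w

    rep : Bool → Fin M
    rep true = ι
    rep false = κ

    cl≈ : ∀ u j → cl j ≡ u → j ≈ rep u
    cl≈ true = hι
    cl≈ false = hκ

    In-class : ∀ {u v w} → Edge u v w → In (λ l → pos a ℤ.* δ (rep u) l ℤ.+ pos b ℤ.* δ (rep v) l ℤ.+ pos c ℤ.* δ (rep w) l)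
    In-class {u} {v} {w} (x , y , z , e , eu , ev , ew) = In-cong (λ l → In-class-ring (pos a) (pos b) (pos c) (δ x l) (δ y l) (δ z l) (δ (rep u) l) (δ (rep v) l) (δ (rep w) l))
      (In-sub (In-sub (In-sub (In-edge e) (In-mul a (cl≈ u x eu))) (In-mul b (cl≈ v y ev))) (In-mul c (cl≈ w z ew)))

    Mul-class : ∀ {x y n} → cl x ≡ true → cl y ≡ false → Mul x y (pos n) → Mul ι κ (pos n)
    Mul-class {x} {y} {n} ex ey (mkMul h) = mkMul (In-cong (λ l → Mul-class-ring (pos n) (δ x l) (δ y l) (δ ι l) (δ κ l))
      (In-add (In-sub h (In-mul n (hι x ex))) (In-mul n (hκ y ey))))

    module _ (t₁ : Edge false true true) where
      Mp : Mul ι κ (pos p)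
      Mp = let x , y , z , e , ex , ey , ez = t₁ in Mul-class ey ex (edge-p (swap₁₂ e))

      Mq : Mul ι κ (pos q)
      Mq = let x , y , z , e , ex , ey , ez = t₁ in Mul-class ey ex (edge-q (swap₁₂ e))

      Ma⇒ : Mul ι κ (pos a) → ι ≈ κ
      Ma⇒ Ma = Mul-one (subst (λ n → Mul ι κ (pos n)) g (Mul-gcd a (gcd b c) Ma (Mul-gcd b c Mb (Mul-cong (sym c≡) (Mul-add (Mul-add Ma Mp) Mq)))))
        where
        Mb : Mul ι κ (pos b)
        Mb = Mul-cong (sym b≡) (Mul-add Ma Mp)

      -- The usage vector of an edge with one vertex in the class of κ minus that of an edge of type
      -- u, v, w. The multiplier is given as a polynomial in a, p, q, so that one ring identity
      -- settles each type.
      diff : ∀ {u v w} (n : ℤ → ℤ → ℤ → ℤ) → Edge u v w → (∀ a p q x y →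
         (a ℤ.* y ℤ.+ (a ℤ.+ p) ℤ.* x ℤ.+ (a ℤ.+ p ℤ.+ q) ℤ.* x) ℤ.- (a ℤ.* (x ℤ.* pos ⟦ u ⟧ ℤ.+ y ℤ.* pos ⟦ not u ⟧) ℤ.+ (a ℤ.+ p) ℤ.* (x ℤ.* pos ⟦ v ⟧ ℤ.+ y ℤ.* pos ⟦ not v ⟧) ℤ.+ (a ℤ.+ p ℤ.+ q) ℤ.* (x ℤ.* pos ⟦ w ⟧ ℤ.+ y ℤ.* pos ⟦ not w ⟧)) ≡ n a p q ℤ.* (x ℤ.- y))
         → Mul ι κ (n (pos a) (pos p) (pos q))
      diff {u} {v} {w} n t s = mkMul (In-cong (λ l → trans (cong₂ (λ b c → (pos a ℤ.* δ κ l ℤ.+ b ℤ.* δ ι l ℤ.+ c ℤ.* δ ι l) ℤ.- (pos a ℤ.* δ (rep u) l ℤ.+ b ℤ.* δ (rep v) l ℤ.+ c ℤ.* δ (rep w) l)) b≡ c≡)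
          (trans (cong (λ z → (pos a ℤ.* δ κ l ℤ.+ (pos a ℤ.+ pos p) ℤ.* δ ι l ℤ.+ (pos a ℤ.+ pos p ℤ.+ pos q) ℤ.* δ ι l) ℤ.- z)
             (cong₂ ℤ._+_ (cong₂ ℤ._+_ (cong (pos a ℤ.*_) (r u l)) (cong ((pos a ℤ.+ pos p) ℤ.*_) (r v l))) (cong ((pos a ℤ.+ pos p ℤ.+ pos q) ℤ.*_) (r w l))))
             (s (pos a) (pos p) (pos q) (δ ι l) (δ κ l)))) (In-sub (In-class t₁) (In-class t)))
        where
        r : ∀ u l → δ (rep u) l ≡ δ ι l ℤ.* pos ⟦ u ⟧ ℤ.+ δ κ l ℤ.* pos ⟦ not u ⟧
        r true l = diff-ring₁ (δ ι l) (δ κ l)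
        r false l = diff-ring₂ (δ ι l) (δ κ l)

      from₀ : Edge true true true → ι ≈ κ
      from₀ t = Ma⇒ (Mul-cong (ℤP.neg-involutive (pos a)) (Mul-neg (diff (λ a p q → ℤ.- a) t from₀-ring)))

      from₂ : Edge true false false → ι ≈ κ
      from₂ t = Ma⇒ (Mul-cong (from₂-ring₂ (pos a) (pos p) (pos q)) (Mul-add (Mul-add (diff (λ a p q → a ℤ.+ pos 2 ℤ.* p ℤ.+ q) t from₂-ring₁) (Mul-neg (Mul-mul 2 Mp))) (Mul-neg Mq)))

      from₃ : Edge false false false → ι ≈ κ
      -- This comparison yields only `2a`, and oddness completes it: with `d = 1 + 2 e₀` one has
      -- `a d − e₀ (2a) = a`.
      from₃ t = Ma⇒ (Mul-cong (trans (cong (λ d → pos a ℤ.* d ℤ.+ ℤ.- (pos e₀ ℤ.* (pos 2 ℤ.* pos a))) od) (from₃-ring₃ (pos a) (pos e₀)))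
                     (Mul-add (Mul-mul a (Mul-gcd p q Mp Mq)) (Mul-neg (Mul-mul e₀ M2a))))
        where
        M2a : Mul ι κ (pos 2 ℤ.* pos a)
        M2a = Mul-cong (from₃-ring₂ (pos a) (pos p) (pos q)) (Mul-add (Mul-add (diff (λ a p q → pos 2 ℤ.* a ℤ.+ pos 2 ℤ.* p ℤ.+ q) t from₃-ring₁) (Mul-neg (Mul-mul 2 Mp))) (Mul-neg Mq))
        od : pos (gcd p q) ≡ ℤ.1ℤ ℤ.+ pos 2 ℤ.* pos e₀
        od = trans (cong pos odd) (trans (ℤP.pos-+ 1 (2 * e₀)) (cong (ℤ._+_ ℤ.1ℤ) (ℤP.pos-* 2 e₀)))

  module _ {P Q : ℕ} (hE : ∀ v → P * (M * M) ≤ Q * link (E v)) where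

    private
      near : Fin M → Fin M → Bool
      near i y = does (any? λ z → true? (E i y z))

      near-intro : ∀ i y z → E i y z ≡ true → near i y ≡ true
      near-intro i y z e = dec-true (any? λ z → true? (E i y z)) (z , e)

      near-half : Q < 4 * P → ∀ i → M < 2 * sum (λ y → ⟦ near i y ⟧)
      near-half h i = half-< {P} {Q} {M} {sum (λ y → ⟦ near i y ⟧)} z<s h (≤-trans (hE i) (Q ⊛ ≤-trans
        (sum-mono λ y → sum-mono λ z → ⟦⟧-mono {E i y z} {near i y ∧ near i z} λ e → cong₂ _∧_ (near-intro i y z e) (near-intro i z y (trans (E₂₃ i z y) e)))
        (≤-reflexive (trans (sum-cong-≗ λ y → sum-cong-≗ λ z → ⟦∧⟧ (near i y) (near i z)) (sum-prod _ _)))))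

      edge⇒≈ : dval a b c ≡ 1 → ∀ {x y z} → E x y z ≡ true → x ≈ y
      edge⇒≈ d {x} {y} e = Mul-one (subst (λ n → Mul x y (pos n)) d (Mul-gcd p q (edge-p e) (edge-q e)))

      -- A link lies in the square of the set of neighbours, so density above 1/4 makes that set
      -- larger than M/2. Two such sets meet, and for d = 1 the vertices of an edge are equivalent.
      connected₁ : dval a b c ≡ 1 → Q < 4 * P → ∀ i j → i ≈ j
      connected₁ d h i j = from (sum-pigeon (λ _ → 1) (λ y → ⟦ near i y ⟧ + ⟦ near j y ⟧)
           (subst₂ _<_ (sym (trans (sum-const M 1) (*-identityʳ M))) (sym (sum-+ (λ y → ⟦ near i y ⟧) (λ y → ⟦ near j y ⟧))) (avg (sum λ y → ⟦ near i y ⟧) (sum λ y → ⟦ near j y ⟧) (near-half h i) (near-half h j))))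
        where
        avg : ∀ {m} u v → m < 2 * u → m < 2 * v → m < u + v
        avg {m} u v h h′ = *-cancelˡ-< 2 _ _ (cert 1 (connected₁-ring m u v) (h ⊕ h′))
        from : (∃ λ y → 1 < ⟦ near i y ⟧ + ⟦ near j y ⟧) → i ≈ j
        from (y , hy) =
          let u , v = both-true {near i y} {near j y} hy
              _ , e = does-true (any? λ z → true? (E i y z)) u
              _ , e′ = does-true (any? λ z → true? (E j y z)) v
          in ≈-trans (edge⇒≈ d e) (≈-sym (edge⇒≈ d e′))

      -- Two links of density above 1/2 share a pair, over which the two vertices can be exchanged.
      connected₃ : Q < 2 * P → ∀ i j → i ≈ j
      connected₃ h i j = from (pigeon₂ (λ y z → ⟦ E i y z ⟧ + ⟦ E j y z ⟧) (subst (M * M <_) (sym (trans (sum-cong-≗ λ y → sum-+ _ _) (sum-+ _ _)))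
            (dense-< 2 {P} {Q} {M} z<s h (≤-trans (≤-reflexive (cong (P * (M * M) +_) (+-identityʳ _))) (≤-trans (+-mono-≤ (hE i) (hE j)) (≤-reflexive (sym (*-distribˡ-+ Q _ _))))))))
        where
        from : (∃ λ y → ∃ λ z → 1 < ⟦ E i y z ⟧ + ⟦ E j y z ⟧) → i ≈ j
        from (y , z , hy) = let u , v = both-true {E i y z} {E j y z} hy in share u v

      meet : Fin M → Fin M → Set
      meet i j = ∃ λ y → ∃ λ z → E i y z ≡ true × E j y z ≡ true

      meet? : ∀ i j → Dec (meet i j)
      meet? i j = any? λ y → any? λ z → true? (E i y z) ×-dec true? (E j y z)

      meet⇒≈ : ∀ {i j} → meet i j → i ≈ j
      meet⇒≈ (_ , _ , u , v) = share u v

      -- Three links of density above 1/3 cannot be pairwise disjoint; hence ≈ has at most two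
      -- classes.
      three-meet : Q < 3 * P → ∀ i j l → meet i j ⊎ meet i l ⊎ meet j l
      three-meet h i j l = from (pigeon₂ (λ y z → ⟦ E i y z ⟧ + ⟦ E j y z ⟧ + ⟦ E l y z ⟧)
         (subst (M * M <_) (sym (trans (sum-cong-≗ λ y → trans (sum-+ _ _) (cong₂ _+_ (sum-+ _ _) refl)) (trans (sum-+ _ _) (cong₂ _+_ (sum-+ _ _) refl))))
            (dense-< 3 {P} {Q} {M} z<s h (≤-trans (≤-reflexive (three-meet-ring₁ (P * (M * M)))) (≤-trans (+-mono-≤ (+-mono-≤ (hE i) (hE j)) (hE l))
              (≤-reflexive (three-meet-ring₂ Q (link (E i)) (link (E j)) (link (E l)))))))))
        where
        from : (∃ λ y → ∃ λ z → 1 < ⟦ E i y z ⟧ + ⟦ E j y z ⟧ + ⟦ E l y z ⟧) → meet i j ⊎ meet i l ⊎ meet j l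
        from (y , z , hy) = [ (λ (u , v) → inj₁ (y , z , u , v)) , [ (λ (u , v) → inj₂ (inj₁ (y , z , u , v))) , (λ (u , v) → inj₂ (inj₂ (y , z , u , v))) ]′ ]′ (two-true {E i y z} {E j y z} {E l y z} hy)

      module _ (cl : Fin M → Bool) (ι κ : Fin M) (eι : cl ι ≡ true) (eκ : cl κ ≡ false) (h : 4 * Q < 9 * P) where

        Edge : Bool → Bool → Bool → Set
        Edge u v w = ∃ λ x → ∃ λ y → ∃ λ z → E x y z ≡ true × cl x ≡ u × cl y ≡ v × cl z ≡ w

        α β : ℕ
        α = sum λ j → ⟦ cl j ⟧
        β = sum λ j → ⟦ not (cl j) ⟧

        αβ : M ≡ α + β
        αβ = trans (sym (trans (sum-const M 1) (*-identityʳ M))) (trans (sum-cong-≗ λ j → sym (⟦not⟧ (cl j))) (sum-+ _ _))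

        classes-ind : ∀ v (S : Bool → Bool → Bool) → (∀ y z → E v y z ≡ true → S (cl y) (cl z) ≡ true) → ∀ {s} →
          sum (λ y → sum λ z → ⟦ S (cl y) (cl z) ⟧) ≡ s → P * ((α + β) * (α + β)) ≤ Q * s
        classes-ind v S hS refl = subst (λ n → P * (n * n) ≤ Q * sum (λ y → sum λ z → ⟦ S (cl y) (cl z) ⟧)) αβ
          (≤-trans (hE v) (Q ⊛ sum-mono λ y → sum-mono λ z → ⟦⟧-mono (hS y z)))

        tt : sum (λ y → sum λ z → ⟦ cl y ∧ cl z ⟧) ≡ α * α
        tt = trans (sum-cong-≗ λ y → sum-cong-≗ λ z → ⟦∧⟧ (cl y) (cl z)) (sum-prod _ _)

        ff : sum (λ y → sum λ z → ⟦ not (cl y) ∧ not (cl z) ⟧) ≡ β * β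
        ff = trans (sum-cong-≗ λ y → sum-cong-≗ λ z → ⟦∧⟧ (not (cl y)) (not (cl z))) (sum-prod _ _)

        xor : Bool → Bool → Bool
        xor true b = not b
        xor false b = b

        tf : sum (λ y → sum λ z → ⟦ xor (cl y) (cl z) ⟧) ≡ 2 * (α * β)
        tf = trans (sum-cong-≗ λ y → sum-cong-≗ λ z → s (cl y) (cl z)) (trans (sum-cong-≗ λ y → sum-+ _ _) (trans (sum-+ _ _)
             (trans (cong₂ _+_ (sum-prod _ _) (sum-prod _ _)) (tf-ring α β))))
          where
          s : ∀ u v → ⟦ xor u v ⟧ ≡ ⟦ u ⟧ * ⟦ not v ⟧ + ⟦ not u ⟧ * ⟦ v ⟧
          s true true = refl
          s true false = refl
          s false true = refl
          s false false = refl

        -- If every edge had exactly one vertex in the class of κ or none of the excluded types were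
        -- replaced, the link of ι would consist of mixed pairs and the link of κ of pairs inside
        -- the class of ι, so their sizes would be at most 2αβ and α².
        not-only₁ : ¬ Edge true true true → ¬ Edge true false false → ¬ Edge false false false → ⊥
        not-only₁ n₀ n₂ n₃ = unbalanced {P} {Q} {α} {β} (subst (0 <_) αβ z<s) h
          (classes-ind ι xor f tf) (classes-ind κ _∧_ g tt)
          where
          f : ∀ y z → E ι y z ≡ true → xor (cl y) (cl z) ≡ true
          f y z e with cl y in ey | cl z in ez
          ... | true | true = ⊥-elim (n₀ (ι , y , z , e , eι , ey , ez))
          ... | true | false = refl
          ... | false | true = refl
          ... | false | false = ⊥-elim (n₂ (ι , y , z , e , eι , ey , ez))
          g : ∀ y z → E κ y z ≡ true → (cl y ∧ cl z) ≡ true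
          g y z e with cl y in ey | cl z in ez
          ... | true | true = refl
          ... | true | false = ⊥-elim (n₂ (y , κ , z , swap₁₂ e , ey , eκ , ez))
          ... | false | true = ⊥-elim (n₂ (z , κ , y , rot e , ez , eκ , ey))
          ... | false | false = ⊥-elim (n₃ (κ , y , z , e , eκ , ey , ez))

        -- If no edge meets both classes, every link lies in the square of one class, so each class
        -- has more than half of the vertices.
        not-split : ¬ Edge false true true → ¬ Edge true false false → ⊥
        not-split n₁ n₂ = <-irrefl refl (<-≤-trans (+-mono-< (half-< {P} {Q} {α + β} {α} (subst (0 <_) αβ z<s) Q<4P (classes-ind ι _∧_ f tt))
             (half-< {P} {Q} {α + β} {β} (subst (0 <_) αβ z<s) Q<4P (classes-ind κ (λ u v → not u ∧ not v) g ff))) (≤-reflexive (not-split-ring α β)))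
          where
          Q<4P : Q < 4 * P
          Q<4P = *-cancelˡ-< 4 _ _ (<-≤-trans h (≤-trans (*-monoˡ-≤ P (m≤m+n 9 7)) (≤-reflexive (*-assoc 4 4 P))))
          f : ∀ y z → E ι y z ≡ true → (cl y ∧ cl z) ≡ true
          f y z e with cl y in ey | cl z in ez
          ... | true | true = refl
          ... | true | false = ⊥-elim (n₁ (z , ι , y , rot e , ez , eι , ey))
          ... | false | true = ⊥-elim (n₁ (y , ι , z , swap₁₂ e , ey , eι , ez))
          ... | false | false = ⊥-elim (n₂ (ι , y , z , e , eι , ey , ez))
          g : ∀ y z → E κ y z ≡ true → (not (cl y) ∧ not (cl z)) ≡ true
          g y z e with cl y in ey | cl z in ez
          ... | false | false = refl
          ... | true | false = ⊥-elim (n₂ (y , κ , z , swap₁₂ e , ey , eκ , ez))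
          ... | false | true = ⊥-elim (n₂ (z , κ , y , rot e , ez , eκ , ey))
          ... | true | true = ⊥-elim (n₁ (κ , y , z , e , eκ , ey , ez))

        Edge? : ∀ u v w → Dec (Edge u v w)
        Edge? u v w = any? λ x → any? λ y → any? λ z → true? (E x y z) ×-dec (cl x ≟B u) ×-dec (cl y ≟B v) ×-dec (cl z ≟B w)

        module _ (hι : ∀ j → cl j ≡ true → j ≈ ι) (hκ : ∀ j → cl j ≡ false → j ≈ κ)
          (g : gcd3 a b c ≡ 1) (odd : ∃ λ e → dval a b c ≡ 1 + 2 * e) where

          via₁ : Edge false true true → ι ≈ κ
          via₁ t₁ = from (Edge? true true true) (Edge? true false false) (Edge? false false false)
            where
            from : Dec (Edge true true true) → Dec (Edge true false false) → Dec (Edge false false false) → ι ≈ κ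
            from (yes t) _ _ = TwoClasses.from₀ cl ι κ hι hκ g (proj₁ odd) (proj₂ odd) t₁ t
            from (no _) (yes t) _ = TwoClasses.from₂ cl ι κ hι hκ g (proj₁ odd) (proj₂ odd) t₁ t
            from (no _) (no _) (yes t) = TwoClasses.from₃ cl ι κ hι hκ g (proj₁ odd) (proj₂ odd) t₁ t
            from (no n₀) (no n₂) (no n₃) = ⊥-elim (not-only₁ n₀ n₂ n₃)

      connected₂ : gcd3 a b c ≡ 1 → (∃ λ e → dval a b c ≡ 1 + 2 * e) → 4 * Q < 9 * P → ∀ i → i ≈ zero
      connected₂ g odd h i = ≈-sym (root (meet? zero i))
        where
        Q<3P : Q < 3 * P
        Q<3P = *-cancelˡ-< 4 _ _ (<-≤-trans h (≤-trans (*-monoˡ-≤ P (m≤m+n 9 3)) (≤-reflexive (*-assoc 4 3 P))))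
        cl : Fin M → Bool
        cl j = does (meet? zero j)
        -- Three copies of the same link meet, which just says that the link of the root is
        -- nonempty.
        cl0 : cl zero ≡ true
        cl0 = dec-true (meet? zero zero) ([ id , [ id , id ]′ ]′ (three-meet Q<3P zero zero zero))
        hι : ∀ j → cl j ≡ true → j ≈ zero
        hι j e = ≈-sym (meet⇒≈ (does-true (meet? zero j) e))
        -- If neither j nor i meets the root, the remaining alternative for the three links is that
        -- j and i meet.
        hκ : ¬ meet zero i → ∀ j → cl j ≡ false → j ≈ i
        hκ n j e = [ (λ m → ⊥-elim (does-false (meet? zero j) e m)) , [ (λ m → ⊥-elim (n m)) , meet⇒≈ ]′ ]′ (three-meet Q<3P zero j i)
        cl′ : Fin M → Bool
        cl′ j = not (cl j)
        not-flip : ∀ {x y} → not x ≡ y → x ≡ not y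
        not-flip {true} {false} _ = refl
        not-flip {false} {true} _ = refl
        split : (n : ¬ meet zero i) (eκ : cl i ≡ false) → Dec (Edge cl zero i cl0 eκ h false true true) → Dec (Edge cl zero i cl0 eκ h true false false) → zero ≈ i
        split n eκ (yes t) _ = via₁ cl zero i cl0 eκ h hι (hκ n) g odd t
        -- The mixed edge has one vertex in the class of the root; exchanging the names of the
        -- classes reduces it to the previous case.
        split n eκ (no _) (yes (x , y , z , e , ex , ey , ez)) = ≈-sym (via₁ cl′ i zero (cong not eκ) (cong not cl0) h (λ j e → hκ n j (not-flip e)) (λ j e → hι j (not-flip e)) g odd
                     (x , y , z , e , cong not ex , cong not ey , cong not ez))
        split n eκ (no n₁) (no n₂) = ⊥-elim (not-split cl zero i cl0 eκ h n₁ n₂)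
        root : Dec (meet zero i) → zero ≈ i
        root (yes m) = meet⇒≈ m
        root (no n) = split n eκ (Edge? cl zero i cl0 eκ h false true true) (Edge? cl zero i cl0 eκ h true false false)
          where
          eκ : cl i ≡ false
          eκ = dec-false (meet? zero i) n

    connected : Connecting P Q a b c → ∀ i j → i ≈ j
    connected (inj₁ (d , h)) = connected₁ d h
    connected (inj₂ (inj₁ (g , o , h))) i j = ≈-trans (connected₂ g o h i) (≈-sym (connected₂ g o h j))
    connected (inj₂ (inj₂ h)) = connected₃ h

-- Exact tilings of patterns

sum-sq≤ : ∀ {n} (f : Fin n → ℕ) → sum (λ i → f i * f i) ≤ sum f * sum f
sum-sq≤ f = ≤-trans (sum-mono λ i → f i ⊛ term≤sum f i) (≤-reflexive (sum-*ʳ (sum f) f))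

n≤n*n : ∀ n → n ≤ n * n
n≤n*n zero = z≤n
n≤n*n (suc n) = m≤m*n (suc n) (suc n)

sum-shift : ∀ {n} μ (x : Fin n → ℕ) → n * sum (λ i → (μ + x i) * (μ + x i)) ≡
  (n * μ) * (n * μ) + 2 * (n * μ * sum x) + n * sum (λ i → x i * x i)
sum-shift {n} μ x = trans (cong (n *_) (trans (sum-cong-≗ λ i → sum-shift-ring₁ μ (x i))
    (trans (sum-+ _ _) (cong₂ _+_ (trans (sum-+ _ _) (cong₂ _+_ (sum-const n _) (sum-*ˡ (2 * μ) x))) refl))))
  (sum-shift-ring₂ n μ (sum x) (sum (λ i → x i * x i)))

-- n Σu² - (Σu)² is n² times the variance, hence unchanged when a constant is added to u. It is the
-- potential of the process that adds copies.
Spread : ∀ {n} → (Fin n → ℕ) → ℕ → Set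
Spread {n} u φ = n * sum (λ i → u i * u i) ≤ sum u * sum u + φ

Spread-cong : ∀ {n} {u v : Fin n → ℕ} {φ} → (∀ i → u i ≡ v i) → Spread u φ → Spread v φ
Spread-cong {n} {φ = φ} e = subst₂ (λ s t → n * s ≤ t * t + φ) (sum-cong-≗ λ i → cong₂ _*_ (e i) (e i)) (sum-cong-≗ e)

-- The sum of all squared differences is twice the potential, so at most 2φ, and a natural number is
-- at most its square.
Spread⇒close : ∀ {n} (u : Fin n → ℕ) φ → Spread u φ → ∀ i j → u i ≤ u j + 2 * φ
Spread⇒close {n} u φ h i j = ≤-trans (m≤n+∣m-n∣ (u i) (u j)) (+-monoʳ-≤ (u j) (≤-trans (n≤n*n _)
    (≤-trans (term≤sum (λ j → ∣ u i - u j ∣ * ∣ u i - u j ∣) j) (≤-trans (term≤sum (λ i → sum λ j → ∣ u i - u j ∣ * ∣ u i - u j ∣) i) D≤))))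
  where
  D : ℕ
  D = sum λ i → sum λ j → ∣ u i - u j ∣ * ∣ u i - u j ∣
  eq : D + 2 * (sum u * sum u) ≡ n * sum (λ i → u i * u i) + n * sum (λ i → u i * u i)
  eq = trans (cong (D +_) (trans (cong (2 *_) (sym (sum-prod u u))) (trans (sym (sum-*ˡ 2 _)) (sum-cong-≗ λ i → sym (sum-*ˡ 2 _)))))
    (trans (sym (sum-+ _ _)) (trans (sum-cong-≗ λ i → trans (sym (sum-+ _ _)) (trans (sum-cong-≗ λ j → ∣-∣-sq (u i) (u j)) (sum-+ _ _)))
    (trans (sum-+ _ _) (cong₂ _+_ (trans (sum-cong-≗ λ i → sum-const n _) (sum-*ˡ n _)) (sum-const n _)))))
  D≤ : D ≤ 2 * φ
  D≤ = cert 0 (trans (Spread⇒close-ring₁ D S φ) (trans (cong (_+ 2 * φ) eq) (Spread⇒close-ring₂ φ Y))) (h ⊕ h)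
    where
    S Y : ℕ
    S = sum u * sum u
    Y = n * sum (λ i → u i * u i)

-- One step of the process, for u = μ + x plus a copy g with light pair weight t.
module SpreadStep {n} (u g x : Fin n → ℕ) (μ k t R₀ : ℕ) (u≡ : ∀ i → u i ≡ μ + x i)
  (Σg : sum g ≡ k) (Σug : sum (λ i → u i * g i) ≡ k * μ + t) (k>0 : 0 < k)
  (light : suc R₀ * n * t ≤ R₀ * k * sum x) where

  R K : ℕ
  R = suc R₀
  K = n * (R * n * k * (R * n * k)) + n * (k * k)

  private
    X S₁ S₂ S₁′ S₂′ G : ℕ
    X = sum x
    S₁ = sum u
    S₂ = sum (λ i → u i * u i)
    S₁′ = sum (λ i → u i + g i)
    S₂′ = sum (λ i → (u i + g i) * (u i + g i))
    G = sum (λ i → g i * g i)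
    s₁ : S₁ ≡ n * μ + X
    s₁ = trans (sum-cong-≗ u≡) (trans (sum-+ _ _) (cong (_+ X) (sum-const n μ)))
    s₁′ : S₁′ ≡ S₁ + k
    s₁′ = trans (sum-+ u g) (cong (S₁ +_) Σg)
    s₂′ : S₂′ ≡ S₂ + 2 * (k * μ + t) + G
    s₂′ = trans (sum-cong-≗ λ i → s₂′-ring (u i) (g i)) (trans (sum-+ _ _) (cong (_+ G) (trans (sum-+ _ _) (cong (S₂ +_) (trans (sum-*ˡ 2 _) (cong (2 *_) Σug))))))
    G≤ : G ≤ k * k
    G≤ = subst (λ k → G ≤ k * k) Σg (sum-sq≤ g)
    gain : n * S₂′ + S₁ * S₁ + k * k + 2 * (k * X) ≤ n * S₂ + S₁′ * S₁′ + 2 * (n * t) + n * (k * k)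
    gain = subst₂ (λ s s′ → n * s + S₁ * S₁ + k * k + 2 * (k * X) ≤ n * S₂ + s′ * s′ + 2 * (n * t) + n * (k * k)) (sym s₂′) (sym s₁′)
      (subst (λ s → n * (S₂ + 2 * (k * μ + t) + G) + s * s + k * k + 2 * (k * X) ≤ n * S₂ + (s + k) * (s + k) + 2 * (n * t) + n * (k * k)) (sym s₁)
        (cert 0 (gain-ring n S₂ k μ t G X) (n ⊛ G≤)))
    nt≤kX : n * t ≤ k * X
    nt≤kX = *-cancelˡ-≤ R (≤-trans (≤-reflexive (sym (*-assoc R n t))) (≤-trans light (≤-trans (≤-reflexive (*-assoc R₀ k X)) (*-monoˡ-≤ (k * X) (n≤1+n R₀)))))

  -- A step changes the potential by at most 2(nt - kX) + nk². Lightness gives nt ≤ (R₀/R) kX, hence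
  -- a drift of -2kX/R, which beats the second-order term nk² once X > R n k. For smaller X the
  -- potential is bounded outright, and that bound is `K`.
  large : R * n * k < X → suc (n * S₂′) + S₁ * S₁ ≤ n * S₂ + S₁′ * S₁′
  large h = cert (n * (k * k)) (large-ring₂ (n * S₂′) (S₁ * S₁) (k * X) (n * S₂) (S₁′ * S₁′) (n * t) n k) (gain ⊕ 2 ⊛ drop ⊕ *-mono-≤ k>0 k>0)
    where
    drop : n * t + n * (k * k) ≤ k * X
    drop = *-cancelˡ-≤ R (cert k (large-ring₁ R₀ n t k X) (light ⊕ k ⊛ h))

  small : X ≤ R * n * k → n * S₂′ ≤ S₁′ * S₁′ + K
  small h = cert (k * k) (small-ring₂ (n * S₂′) (S₁ * S₁) (k * X) (n * S₂) (S₁′ * S₁′) (n * t) (n * (k * k)) k (n * (R * n * k * (R * n * k))))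
      (gain ⊕ 2 ⊛ nt≤kX ⊕ spread)
    where
    spread : n * S₂ ≤ S₁ * S₁ + n * (R * n * k * (R * n * k))
    spread = begin
      n * S₂ ≡⟨ cong (n *_) (sum-cong-≗ λ i → cong₂ _*_ (u≡ i) (u≡ i)) ⟩
      n * sum (λ i → (μ + x i) * (μ + x i)) ≡⟨ sum-shift μ x ⟩
      (n * μ) * (n * μ) + 2 * (n * μ * X) + n * sum (λ i → x i * x i) ≤⟨ +-mono-≤ (m≤m+n _ (X * X)) (n ⊛ ≤-trans (sum-sq≤ x) (sq-mono h)) ⟩
      (n * μ) * (n * μ) + 2 * (n * μ * X) + X * X + n * (R * n * k * (R * n * k)) ≡⟨ cong (_+ n * (R * n * k * (R * n * k))) (small-ring₁ (n * μ) X) ⟩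
      (n * μ + X) * (n * μ + X) + n * (R * n * k * (R * n * k)) ≡⟨ cong (λ s → s * s + n * (R * n * k * (R * n * k))) (sym s₁) ⟩
      S₁ * S₁ + n * (R * n * k * (R * n * k)) ∎
      where
      open ≤-Reasoning

  step : ∀ φ → Spread u (K + φ) → Spread (λ i → u i + g i) (K + (φ ∸ 1))
  step φ hφ with R * n * k <? X
  ... | yes h = cert 0 (step-ring (n * S₂′) (S₁ * S₁) (n * S₂) (S₁′ * S₁′) φ (φ ∸ 1) K) (large h ⊕ hφ ⊕ pred φ)
    where
    pred : ∀ φ → φ ≤ suc (φ ∸ 1)
    pred zero = z≤n
    pred (suc φ) = ≤-refl
  ... | no h = ≤-trans (small (≮⇒≥ h)) (+-monoʳ-≤ (S₁′ * S₁′) (m≤m+n K (φ ∸ 1)))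

-- The density conditions under which every pattern has a balanced tiling.
Good : (P Q a b c : ℕ) → Set
Good P Q a b c =
  Q * ((a + b + c) * (a + b + c)) < P * ((a + b + c) * (a + b + c)) + Q * ((b + c) * (b + c))
  × Q * ((a + b) * (a + b)) < P * ((a + b + c) * (a + b + c))
  × (a ≡ 1 ⊎ 4 * (Q * Q) + P * P < 12 * (P * Q))
  × Connecting P Q a b c

-- E is the pattern on the slots of the sampled blocks, and `L q` is the link into it of the q-th
-- vertex of the block F that is to become real.
module Pattern (a′ b c P Q : ℕ) (a≤b : suc a′ ≤ b) (b≤c : b ≤ c) (good : Good P Q (suc a′) b c)
  {M₀ : ℕ} (E : Fin (suc M₀) → Fin (suc M₀) → Fin (suc M₀) → Bool)
  (E₁₂ : ∀ x y z → E x y z ≡ E y x z) (E₂₃ : ∀ x y z → E x y z ≡ E x z y)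
  (hE : ∀ v → P * (suc M₀ * suc M₀) ≤ Q * link (E v))
  (L : Fin (suc a′ + b + c) → Fin (suc M₀) → Fin (suc M₀) → Bool)
  (hL : ∀ q → P * (suc M₀ * suc M₀) ≤ Q * link (L q)) where

  open Lattice a′ b c a≤b b≤c E E₁₂ E₂₃ public
  open Light a b c P Q (s≤s z≤n) (proj₁ good) (proj₁ (proj₂ good)) using (R₀; R; light-pair; k>0; P>0)

  sum-usage : ∀ (w : Fin M → ℕ) g → let open Gen g in sum (λ j → w j * usage g j) ≡ w x₁ + a′ * w x₂ + b * w y + c * w z
  sum-usage w (gen {x₁} {x₂} {y} {z} _ _) = trans (sum-cong-≗ λ j → sum-usage-ring (w j) a′ b c ⟦ x₁ == j ⟧ ⟦ x₂ == j ⟧ ⟦ y == j ⟧ ⟦ z == j ⟧)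
    (trans (sum-+ _ _) (cong₂ _+_ (trans (sum-+ _ _) (cong₂ _+_ (trans (sum-+ _ _) (cong₂ _+_ (one x₁) (many a′ x₂))) (many b y))) (many c z)))
    where
    one : ∀ x → sum (λ j → ⟦ x == j ⟧ * w j) ≡ w x
    one x = trans (sum-cong-≗ λ j → cong (λ b → ⟦ b ⟧ * w j) (==-sym x j)) (sum-delta x w)
    many : ∀ n x → sum (λ j → n * (⟦ x == j ⟧ * w j)) ≡ n * w x
    many n x = trans (sum-*ˡ n _) (cong (n *_) (one x))

  sum-usage-1 : ∀ g → sum (usage g) ≡ k
  sum-usage-1 g = trans (sum-cong-≗ λ j → sym (*-identityˡ (usage g j))) (trans (sum-usage (λ _ → 1) g) (sum-usage-1-ring a′ b c))

  sum-us : ∀ gs → sum (us gs) ≡ length gs * k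
  sum-us [] = trans (sum-const M 0) (*-zeroʳ M)
  sum-us (g ∷ gs) = trans (sum-+ _ _) (cong₂ _+_ (sum-usage-1 g) (sum-us gs))

  abstract
    K : ℕ
    K = M * (R * M * k * (R * M * k)) + M * (k * k)

    light-step : ∀ (u : Fin M → ℕ) φ → Spread u (K + φ) → ∃ λ g → Spread (λ i → u i + usage g i) (K + (φ ∸ 1))
    light-step u φ h = go (argmin u)
      where
      go : (∃ λ v → ∀ i → u v ≤ u i) → ∃ λ g → Spread (λ i → u i + usage g i) (K + (φ ∸ 1))
      go (v , min) = go′ (light-pair (E v) (E₂₃ v) (hE v) z<s x)
        where
        x : Fin M → ℕ
        x i = u i ∸ u v
        u≡ : ∀ i → u i ≡ u v + x i
        u≡ i = sym (m+[n∸m]≡n (min i))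
        go′ : (∃₂ λ y z → E v y z ≡ true × R * M * (b * x y + a * x z) ≤ R₀ * k * sum x) → ∃ λ g → Spread (λ i → u i + usage g i) (K + (φ ∸ 1))
        go′ (y , z , e , l) = g , SpreadStep.step u (usage g) x (u v) k (b * x y + a * x z) R₀ u≡ (sum-usage-1 g) Σug k>0 l φ h
          where
          -- The least used slot v receives the part of size c; the ends y and z of the light pair
          -- receive the parts of sizes b and a.
          e′ : E z y v ≡ true
          e′ = trans (E₂₃ z y v) (trans (E₁₂ z v y) (trans (E₂₃ v z y) e))
          g : Gen
          g = gen e′ e′
          Σug : sum (λ i → u i * usage g i) ≡ k * u v + (b * x y + a * x z)
          Σug = trans (sum-usage u g) (trans (cong₂ (λ s t → s + a′ * s + b * t + c * u v) (u≡ z) (u≡ y)) (light-step-ring a′ b c (u v) (x y) (x z)))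

  -- The number of steps is prescribed, because the total number of copies has to come out right.
  -- Each step lowers the excess over K by one until it is 0, and later steps keep it there.
  light-run : ∀ s φ (u : Fin M → ℕ) → φ ≤ s → Spread u (K + φ) → ∃ λ gs → length gs ≡ s × Spread (λ i → u i + us gs i) K
  light-run zero zero u _ h = [] , refl , Spread-cong (λ i → sym (+-identityʳ (u i))) (subst (Spread u) (+-identityʳ K) h)
  light-run (suc s) φ u l h =
    let g , h′ = light-step u φ h
        gs , len , h″ = light-run s (φ ∸ 1) (λ i → u i + usage g i) (∸-monoˡ-≤ 1 l) h′
    in g ∷ gs , cong suc len , Spread-cong (λ i → +-assoc (u i) (usage g i) (us gs i)) h″

  E⁺ : Fin k ⊎ Fin M → Fin M → Fin M → Bool
  E⁺ (inj₁ q) = L q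
  E⁺ (inj₂ i) = E i

  record Copy : Set where
    constructor copy
    field
      x₁ x₂ : Fin k ⊎ Fin M
      y z : Fin M
      e₁ : E⁺ x₁ y z ≡ true
      e₂ : E⁺ x₂ y z ≡ true

  isExt : Fin k ⊎ Fin M → Fin k → ℕ
  isExt (inj₁ p) q = ⟦ p == q ⟧
  isExt (inj₂ _) q = 0

  isInt : Fin k ⊎ Fin M → Fin M → ℕ
  isInt (inj₁ _) j = 0
  isInt (inj₂ i) j = ⟦ i == j ⟧

  ext : Copy → Fin k → ℕ
  ext (copy x₁ x₂ y z _ _) q = isExt x₁ q + a′ * isExt x₂ q

  int : Copy → Fin M → ℕ
  int (copy x₁ x₂ y z _ _) j = isInt x₁ j + a′ * isInt x₂ j + b * ⟦ y == j ⟧ + c * ⟦ z == j ⟧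

  exts : List Copy → Fin k → ℕ
  exts [] q = 0
  exts (g ∷ gs) q = ext g q + exts gs q

  ints : List Copy → Fin M → ℕ
  ints [] j = 0
  ints (g ∷ gs) j = int g j + ints gs j

  internal : List Gen → List Copy
  internal [] = []
  internal (gen {x₁} {x₂} {y} {z} e₁ e₂ ∷ gs) = copy (inj₂ x₁) (inj₂ x₂) y z e₁ e₂ ∷ internal gs

  ints-internal : ∀ gs j → ints (internal gs) j ≡ us gs j
  ints-internal [] j = refl
  ints-internal (g ∷ gs) j = cong (usage g j +_) (ints-internal gs j)

  exts-internal : ∀ gs q → exts (internal gs) q ≡ 0
  exts-internal [] q = refl
  exts-internal (g ∷ gs) q = trans (cong (_+ exts (internal gs) q) (*-zeroʳ a′)) (exts-internal gs q)

  -- The vertex q takes the single position `x₁`. For a ≥ 2 the other `a′` positions are filled by a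
  -- slot i whose link contains the same pair yz. For a = 1 there are no such positions, and `x₂` is
  -- a placeholder of multiplicity 0.
  covering : ∀ q → ∃ λ cp → (∀ q′ → ext cp q′ ≡ ⟦ q == q′ ⟧) × (sum (int cp) + 1 ≡ k)
  covering q with proj₁ (proj₂ (proj₂ good))
  ... | inj₁ refl = from (pigeon₁ link>0)
    where
    link>0 : 0 < link (L q)
    link>0 = n≢0⇒n>0 λ e → <-irrefl refl (<-≤-trans (*-mono-≤ P>0 (*-mono-≤ (z<s {M₀}) (z<s {M₀}))) (≤-trans (hL q) (≤-reflexive (trans (cong (Q *_) e) (*-zeroʳ Q)))))
    pigeon₁ : 0 < link (L q) → ∃ λ y → ∃ λ z → L q y z ≡ true
    pigeon₁ h with sum-pigeon (λ _ → 0) (λ y → sum λ z → ⟦ L q y z ⟧) (subst (_< link (L q)) (sym (trans (sum-const M 0) (*-zeroʳ M))) h)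
    ... | y , hy with sum-pigeon (λ _ → 0) (λ z → ⟦ L q y z ⟧) (subst (_< sum (λ z → ⟦ L q y z ⟧)) (sym (trans (sum-const M 0) (*-zeroʳ M))) hy)
    ...   | z , hz = y , z , ⟦⟧-pos hz
    from : (∃ λ y → ∃ λ z → L q y z ≡ true) → ∃ λ cp → (∀ q′ → ext cp q′ ≡ ⟦ q == q′ ⟧) × (sum (int cp) + 1 ≡ k)
    from (y , z , e) = copy (inj₁ q) (inj₁ q) y z e e , (λ q′ → +-identityʳ ⟦ q == q′ ⟧) ,
      trans (cong (_+ 1) (trans (sum-+ _ _) (cong₂ _+_ (trans (sum-*ˡ b _) (cong (b *_) (sum-δ′ y))) (trans (sum-*ˡ c _) (cong (c *_) (sum-δ′ z)))))) (covering-ring₁ b c)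
  ... | inj₂ c₃ with shadow-meets E E₁₂ E₂₃ {P} {Q} c₃ hE (L q) (hL q)
  ...   | y , z , e , i , e′ = copy (inj₁ q) (inj₂ i) y z e e′ , (λ q′ → trans (cong (⟦ q == q′ ⟧ +_) (*-zeroʳ a′)) (+-identityʳ _)) ,
      trans (cong (_+ 1) (trans (sum-+ _ _) (cong₂ _+_ (trans (sum-+ _ _) (cong₂ _+_ (trans (sum-*ˡ a′ _) (cong (a′ *_) (sum-δ′ i))) (trans (sum-*ˡ b _) (cong (b *_) (sum-δ′ y))))) (trans (sum-*ˡ c _) (cong (c *_) (sum-δ′ z)))))) (covering-ring₂ a′ b c)

  covers : ∀ {n} → (Fin n → Copy) → List Copy → List Copy
  covers {zero} f rest = rest
  covers {suc n} f rest = f zero ∷ covers (f ∘ suc) rest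

  exts-covers : ∀ {n} (f : Fin n → Copy) rest q → exts (covers f rest) q ≡ sum (λ i → ext (f i) q) + exts rest q
  exts-covers {zero} f rest q = cong (_+ exts rest q) (sym (sum-nil _))
  exts-covers {suc n} f rest q = trans (cong (ext (f zero) q +_) (exts-covers (f ∘ suc) rest q))
    (trans (sym (+-assoc (ext (f zero) q) _ _)) (cong (_+ exts rest q) (sym (sum-suc _))))

  ints-covers : ∀ {n} (f : Fin n → Copy) rest j → ints (covers f rest) j ≡ sum (λ i → int (f i) j) + ints rest j
  ints-covers {zero} f rest j = cong (_+ ints rest j) (sym (sum-nil _))
  ints-covers {suc n} f rest j = trans (cong (int (f zero) j +_) (ints-covers (f ∘ suc) rest j))
    (trans (sym (+-assoc (int (f zero) j) _ _)) (cong (_+ ints rest j) (sym (sum-suc _))))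

  rep : ℕ → List Gen → List Gen
  rep zero gs = []
  rep (suc n) gs = gs ++ rep n gs

  us-rep : ∀ n gs j → us (rep n gs) j ≡ n * us gs j
  us-rep zero gs j = refl
  us-rep (suc n) gs j = trans (us-++ gs (rep n gs) j) (cong (us gs j +_) (us-rep n gs j))

  flat : ∀ {n} → (Fin n → List Gen) → List Gen
  flat {zero} h = []
  flat {suc n} h = h zero ++ flat (h ∘ suc)

  us-flat : ∀ {n} (h : Fin n → List Gen) j → us (flat h) j ≡ sum (λ i → us (h i) j)
  us-flat {zero} h j = sym (sum-nil _)
  us-flat {suc n} h j = trans (us-++ (h zero) (flat (h ∘ suc)) j) (trans (cong (us (h zero) j +_) (us-flat (h ∘ suc) j)) (sym (sum-suc _)))

  private
    conn : ∀ i j → i ≈ j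
    conn = connected {P} {Q} hE (proj₂ (proj₂ (proj₂ good)))

    plus minus : Fin M → List Gen
    plus i = In.plus (conn i zero)
    minus i = In.minus (conn i zero)

    swap-in : ∀ i l → us (plus i) l + ⟦ zero {M₀} == l ⟧ ≡ us (minus i) l + ⟦ i == l ⟧
    swap-in i l = ℤP.+-injective (trans (ℤP.pos-+ (us (plus i) l) _) (trans (cong (ℤ._+ δ zero l) (In.balance (conn i zero) l))
        (trans (swap-in-ring (δ i l) (δ zero l) (pos (us (minus i) l))) (sym (ℤP.pos-+ (us (minus i) l) _)))))

  weave : (Fin M → ℕ) → (Fin M → ℕ) → List Gen
  weave f g = flat λ i → rep (f i) (plus i) ++ rep (g i) (minus i)

  us-weave : ∀ f g l → us (weave f g) l ≡ sum (λ i → f i * us (plus i) l + g i * us (minus i) l)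
  us-weave f g l = trans (us-flat (λ i → rep (f i) (plus i) ++ rep (g i) (minus i)) l) (sum-cong-≗ λ i → trans (us-++ (rep (f i) (plus i)) (rep (g i) (minus i)) l) (cong₂ _+_ (us-rep (f i) (plus i) l) (us-rep (g i) (minus i) l)))

  -- Trading copies of minus i for copies of plus i moves weight from the root to i.
  rebalance : ∀ κ t (u : Fin M → ℕ) → (∀ i → u i ≤ t + κ) → (∀ i → t ≤ u i + κ) → sum u ≡ M * t → ∀ l →
    us (weave (λ i → κ + t ∸ u i) (λ i → κ + u i ∸ t)) l + u l ≡ us (weave (λ _ → κ) (λ _ → κ)) l + t
  rebalance κ t u hu ht U l = +-cancelʳ-≡ (M * t * o) _ _ (begin
    W + u l + M * t * o
      ≡⟨ cong₂ (λ x y → W + x + y) (sym (trans (sum-cong-≗ λ i → *-comm (u i) ⟦ i == l ⟧) (sum-delta l u))) (trans (*-assoc M t o) (sym (sum-const M (t * o)))) ⟩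
    W + sum (λ i → u i * ⟦ i == l ⟧) + sum (λ i → t * o)
      ≡⟨ cong₂ _+_ (cong₂ _+_ (us-weave (λ i → κ + t ∸ u i) (λ i → κ + u i ∸ t) l) refl) refl ⟩
    sum (λ i → (κ + t ∸ u i) * pl i + (κ + u i ∸ t) * mi i) + sum (λ i → u i * ⟦ i == l ⟧) + sum (λ i → t * o)
      ≡⟨ trans (cong₂ _+_ (sym (sum-+ _ _)) refl) (sym (sum-+ _ _)) ⟩
    sum (λ i → (κ + t ∸ u i) * pl i + (κ + u i ∸ t) * mi i + u i * ⟦ i == l ⟧ + t * o)
      ≡⟨ sum-cong-≗ pw ⟩
    sum (λ i → κ * pl i + κ * mi i + t * ⟦ i == l ⟧ + u i * o)
      ≡⟨ trans (sum-+ _ _) (cong₂ _+_ (sum-+ _ _) refl) ⟩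
    sum (λ i → κ * pl i + κ * mi i) + sum (λ i → t * ⟦ i == l ⟧) + sum (λ i → u i * o)
      ≡⟨ cong₂ _+_ (cong₂ _+_ (sym (us-weave (λ _ → κ) (λ _ → κ) l)) (trans (sum-*ˡ t _) (trans (cong (t *_) (sum-δ l)) (*-identityʳ t)))) (trans (sum-*ʳ o u) (cong (_* o) U)) ⟩
    us (weave (λ _ → κ) (λ _ → κ)) l + t + M * t * o ∎)
    where
    open ≡-Reasoning
    W o : ℕ
    W = us (weave (λ i → κ + t ∸ u i) (λ i → κ + u i ∸ t)) l
    o = ⟦ zero {M₀} == l ⟧
    pl mi : Fin M → ℕ
    pl i = us (plus i) l
    mi i = us (minus i) l
    pw : ∀ i → (κ + t ∸ u i) * pl i + (κ + u i ∸ t) * mi i + u i * ⟦ i == l ⟧ + t * o ≡ κ * pl i + κ * mi i + t * ⟦ i == l ⟧ + u i * o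
    pw i = trade {f = κ + t ∸ u i} {g = κ + u i ∸ t} (m∸n+n≡m (≤-trans (hu i) (≤-reflexive (+-comm t κ)))) (m∸n+n≡m (≤-trans (ht i) (≤-reflexive (+-comm (u i) κ)))) (swap-in i l)
      where
      trade : ∀ {f g κ t u P N e o} → f + u ≡ κ + t → g + t ≡ κ + u → P + o ≡ N + e →
        f * P + g * N + u * e + t * o ≡ κ * P + κ * N + t * e + u * o
      trade {f} {g} {κ} {t} {u} {P} {N} {e} {o} h₁ h₂ h₃ = +-cancelʳ-≡ (u * P + t * N) _ _
        (trans (rebalance-ring₁ f g t u P N e o) (trans (cong₂ (λ x y → x * P + y * N + u * e + t * o) h₁ h₂)
        (trans (rebalance-ring₂ κ t u P N e o) (trans (cong₂ (λ x y → κ * P + κ * N + t * x + u * y) h₃ (sym h₃)) (rebalance-ring₃ κ t u P N e o)))))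

  tiling : ∀ m → M ≡ m * k → ∃ λ t → ∃ λ cs → (∀ q → exts cs q ≡ 1) × (∀ j → ints cs j ≡ t)
  tiling m Mm = t , cs , exts≡ , ints≡
    where
    cov : Fin k → Copy
    cov q = proj₁ (covering q)
    κ : ℕ
    κ = 2 * K
    -- The base contains every exchange κ times in both directions. The correction replaces these
    -- multiplicities by κ ± (t - u i), which stay nonnegative because u deviates from t by at most
    -- κ.
    base : List Gen
    base = weave (λ _ → κ) (λ _ → κ)
    cu u₀ : Fin M → ℕ
    cu j = sum λ q → int (cov q) j
    u₀ j = cu j + us base j
    φ t s : ℕ
    φ = M * sum (λ i → u₀ i * u₀ i)
    -- The k external vertices and t vertices for each of the M = m k slots make up 1 + m t copies.
    -- This t is large enough that, besides the k covering copies and the base, at least φ light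
    -- copies remain.
    t = φ + k + length base
    s = 1 + m * t ∸ (k + length base)
    m>0 : 0 < m
    m>0 = n≢0⇒n>0 λ e → case trans Mm (cong (_* k) e) of λ ()
    t≤ : t ≤ m * t
    t≤ = m≤n*m t m {{>-nonZero m>0}}
    s+ : s + (k + length base) ≡ 1 + m * t
    s+ = m∸n+n≡m (≤-trans (≤-trans (m≤n+m _ φ) (≤-reflexive (sym (+-assoc φ k (length base))))) (≤-trans t≤ (n≤1+n _)))
    φ≤s : φ ≤ s
    φ≤s = +-cancelʳ-≤ (k + length base) φ s (≤-trans (≤-reflexive (sym (+-assoc φ k (length base)))) (≤-trans t≤ (≤-trans (n≤1+n _) (≤-reflexive (sym s+)))))
    run : ∃ λ gs → length gs ≡ s × Spread (λ i → u₀ i + us gs i) K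
    run = light-run s φ u₀ φ≤s (≤-trans (m≤n+m φ K) (m≤n+m (K + φ) (sum u₀ * sum u₀)))
    light : List Gen
    light = proj₁ run
    u : Fin M → ℕ
    u i = u₀ i + us light i
    Σcu : sum cu + k * 1 ≡ k * k
    Σcu = trans (cong₂ _+_ (sum-swap _) (sym (sum-const k 1))) (trans (sym (sum-+ _ _)) (trans (sum-cong-≗ λ q → proj₂ (proj₂ (covering q))) (sum-const k k)))
    U : sum u ≡ M * t
    U = +-cancelʳ-≡ k _ _ (trans (cong (_+ k) (trans (sum-+ _ _) (cong₂ _+_ (trans (sum-+ cu (us base)) (cong (sum cu +_) (sum-us base))) (trans (sum-us light) (cong (_* k) (proj₁ (proj₂ run)))))))
       (trans (tiling-ring₁ (sum cu) (length base) s k) (trans (cong (λ z → z + length base * k + s * k) Σcu) (trans (tiling-ring₂ (length base) s k)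
       (trans (cong (_* k) s+) (trans (tiling-ring₃ m t k) (cong (λ z → z * t + k) (sym Mm))))))))
    close : ∀ i j → u i ≤ u j + κ
    close = Spread⇒close u K (proj₂ (proj₂ run))
    hu : ∀ i → u i ≤ t + κ
    hu i = below (sum-pigeon u (λ _ → suc t) (subst₂ _<_ (sym U) (sym (sum-const M (suc t))) (*-monoʳ-< M (n<1+n t))))
      where
      below : (∃ λ j → u j < suc t) → u i ≤ t + κ
      below (j , hj) = ≤-trans (close i j) (+-monoˡ-≤ κ (s≤s⁻¹ hj))
    ht : ∀ i → t ≤ u i + κ
    ht i = above (sum-pigeon (λ _ → t) (λ j → suc (u j)) (subst₂ _<_ (sym (sum-const M t)) (sym (trans (sum-+ (λ _ → 1) u) (cong₂ _+_ (trans (sum-const M 1) (*-identityʳ M)) U))) (m<n+m _ (z<s {M₀}))))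
      where
      above : (∃ λ j → t < suc (u j)) → t ≤ u i + κ
      above (j , hj) = ≤-trans (s≤s⁻¹ hj) (close j i)
    fix : List Gen
    fix = weave (λ i → κ + t ∸ u i) (λ i → κ + u i ∸ t)
    cs : List Copy
    cs = covers cov (internal (light ++ fix))
    exts≡ : ∀ q → exts cs q ≡ 1
    exts≡ q = trans (exts-covers cov (internal (light ++ fix)) q) (trans (cong₂ _+_ (trans (sum-cong-≗ λ p → proj₁ (proj₂ (covering p)) q) (sum-δ q)) (exts-internal (light ++ fix) q)) refl)
    ints≡ : ∀ j → ints cs j ≡ t
    ints≡ j = trans (ints-covers cov (internal (light ++ fix)) j) (trans (cong (cu j +_) (trans (ints-internal (light ++ fix) j) (us-++ light fix j)))
      (+-cancelʳ-≡ (u j) _ _ (trans (tiling-ring₄ (cu j) (us light j) (us fix j) (u j)) (trans (cong (λ z → cu j + us light j + z) (rebalance κ t u hu ht U j)) (tiling-ring₅ (cu j) (us light j) (us base j) t)))))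

-- Partite blow-ups and concentration

vsum : ∀ {N} m → (Vec (Fin N) m → ℕ) → ℕ
vsum zero f = f []
vsum (suc m) f = sum λ x → vsum m λ s → f (x ∷ s)

vsum-mono : ∀ {N} m {f g : Vec (Fin N) m → ℕ} → (∀ s → f s ≤ g s) → vsum m f ≤ vsum m g
vsum-mono zero h = h []
vsum-mono (suc m) h = sum-mono λ x → vsum-mono m λ s → h (x ∷ s)

vsum-cong : ∀ {N} m {f g : Vec (Fin N) m → ℕ} → (∀ s → f s ≡ g s) → vsum m f ≡ vsum m g
vsum-cong zero h = h []
vsum-cong (suc m) h = sum-cong-≗ λ x → vsum-cong m λ s → h (x ∷ s)

vsum-+ : ∀ {N} m (f g : Vec (Fin N) m → ℕ) → vsum m (λ s → f s + g s) ≡ vsum m f + vsum m g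
vsum-+ zero f g = refl
vsum-+ (suc m) f g = trans (sum-cong-≗ λ x → vsum-+ m (λ s → f (x ∷ s)) (λ s → g (x ∷ s))) (sum-+ _ _)

vsum-*ˡ : ∀ {N} m c (f : Vec (Fin N) m → ℕ) → vsum m (λ s → c * f s) ≡ c * vsum m f
vsum-*ˡ zero c f = refl
vsum-*ˡ (suc m) c f = trans (sum-cong-≗ λ x → vsum-*ˡ m c (λ s → f (x ∷ s))) (sum-*ˡ c _)

vsum-const : ∀ N m c → vsum {N} m (λ _ → c) ≡ N ^ m * c
vsum-const N zero c = sym (+-identityʳ c)
vsum-const N (suc m) c = trans (sum-cong-≗ λ x → vsum-const N m c) (trans (sum-const N _) (sym (*-assoc N (N ^ m) c)))

vsum-sum : ∀ {N n} m (f : Fin n → Vec (Fin N) m → ℕ) → vsum m (λ s → sum λ i → f i s) ≡ sum (λ i → vsum m (f i))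
vsum-sum zero f = refl
vsum-sum (suc m) f = trans (sum-cong-≗ λ x → vsum-sum m λ i s → f i (x ∷ s)) (sum-swap _)

vsum-pigeon : ∀ {N} m (f g : Vec (Fin N) m → ℕ) → vsum m f < vsum m g → ∃ λ s → f s < g s
vsum-pigeon zero f g h = [] , h
vsum-pigeon (suc m) f g h with sum-pigeon (λ x → vsum m λ s → f (x ∷ s)) (λ x → vsum m λ s → g (x ∷ s)) h
... | x , hx with vsum-pigeon m (λ s → f (x ∷ s)) (λ s → g (x ∷ s)) hx
...   | s , hs = x ∷ s , hs

vcount : ∀ {N} m → (Vec (Fin N) m → Bool) → ℕ
vcount m W = vsum m λ s → ⟦ W s ⟧

vcount-witness : ∀ {N} m (W : Vec (Fin N) m → Bool) → 0 < vcount m W → ∃ λ s → W s ≡ true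
vcount-witness {N} m W h with vsum-pigeon m (λ _ → 0) (λ s → ⟦ W s ⟧) (subst (_< vcount m W) (sym (trans (vsum-const N m 0) (*-zeroʳ (N ^ m)))) h)
... | s , hs = s , ⟦⟧-pos hs

-- The n properties are settled one after another, each time keeping the more frequent value at the
-- cost of a factor 2.
homogenize : ∀ {N} m n (φ : Fin n → Vec (Fin N) m → Bool) (W : Vec (Fin N) m → Bool) →
  ∃ λ W′ → (∀ s → W′ s ≡ true → W s ≡ true) × (∀ i s s′ → W′ s ≡ true → W′ s′ ≡ true → φ i s ≡ φ i s′)
    × vcount m W ≤ 2 ^ n * vcount m W′
homogenize m zero φ W = W , (λ s e → e) , (λ ()) , ≤-reflexive (sym (+-identityʳ _))
homogenize {N} m (suc n) φ W = go (≤-total (vcount m W₀) (vcount m W₁))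
  where
  W₁ W₀ : Vec (Fin N) m → Bool
  W₁ s = W s ∧ φ zero s
  W₀ s = W s ∧ not (φ zero s)
  split : vcount m W ≡ vcount m W₁ + vcount m W₀
  split = trans (vsum-cong m λ s → pw (W s) (φ zero s)) (vsum-+ m _ _)
    where
    pw : ∀ w p → ⟦ w ⟧ ≡ ⟦ w ∧ p ⟧ + ⟦ w ∧ not p ⟧
    pw false p = refl
    pw true true = refl
    pw true false = refl
  refine : ∀ {x y z} (V : Vec (Fin N) m → Bool) → x ≡ y + z → y ≤ vcount m V → z ≤ vcount m V → (∀ s → V s ≡ true → W s ≡ true) →
    (∀ s s′ → V s ≡ true → V s′ ≡ true → φ zero s ≡ φ zero s′) →
    ∃ λ W′ → (∀ s → W′ s ≡ true → W s ≡ true) × (∀ i s s′ → W′ s ≡ true → W′ s′ ≡ true → φ i s ≡ φ i s′)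
    × x ≤ 2 ^ suc n * vcount m W′
  refine {x} V e hy hz sub same =
    let W′ , sub′ , same′ , big = homogenize m n (φ ∘ suc) V
    in W′ , (λ s w → sub s (sub′ s w)) , (λ { zero s s′ w w′ → same s s′ (sub′ s w) (sub′ s′ w′) ; (suc i) → same′ i }) ,
       ≤-trans (≤-reflexive e) (≤-trans (+-mono-≤ (≤-trans hy big) (≤-trans hz big)) (≤-reflexive (homogenize-ring (2 ^ n) (vcount m W′))))
  go : vcount m W₀ ≤ vcount m W₁ ⊎ vcount m W₁ ≤ vcount m W₀ →
    ∃ λ W′ → (∀ s → W′ s ≡ true → W s ≡ true) × (∀ i s s′ → W′ s ≡ true → W′ s′ ≡ true → φ i s ≡ φ i s′)
    × vcount m W ≤ 2 ^ suc n * vcount m W′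
  go (inj₁ h) = refine W₁ split ≤-refl h (λ s e → proj₁ (∧-true {W s} e))
    (λ s s′ e e′ → trans (proj₂ (∧-true {W s} e)) (sym (proj₂ (∧-true {W s′} e′))))
  go (inj₂ h) = refine W₀ split h ≤-refl (λ s e → proj₁ (∧-true {W s} e))
    (λ s s′ e e′ → not-inj (trans (proj₂ (∧-true {W s} e)) (sym (proj₂ (∧-true {W s′} e′)))))
    where
    not-inj : ∀ {x y} → not x ≡ not y → x ≡ y
    not-inj {true} {true} _ = refl
    not-inj {false} {false} _ = refl

Boxed : ∀ {N m t} → (Vec (Fin N) m → Bool) → (Fin m → Fin t → Fin N) → Set
Boxed {m = m} W T = ∀ s → (∀ i → ∃ λ j → lookup s i ≡ T i j) → W s ≡ true

-- Erdős: a dense m-partite m-graph contains a complete one with parts of size t.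
blow-up : ∀ m t C → 0 < t → ∃ λ N₀ → ∀ N → N₀ ≤ N → ∀ (W : Vec (Fin N) m → Bool) → N ^ m ≤ C * vcount m W →
  ∃ λ (T : Fin m → Fin t → Fin N) → (∀ i {j j′} → T i j ≡ T i j′ → j ≡ j′) × Boxed W T
blow-up zero t C t>0 = 0 , λ N _ W h → (λ ()) , (λ ()) , λ { [] _ → ⟦⟧-pos (n≢0⇒n>0 λ e → <-irrefl refl (≤-trans h (≤-reflexive (trans (cong (C *_) e) (*-zeroʳ C))))) }
blow-up (suc m) t C t>0 with blow-up m t (4 * C * 2 ^ (4 * C * t)) t>0
... | N₁ , ih = suc (2 * C * ℓ) ⊔ N₁ , main
  where
  ℓ C′ : ℕ
  -- Each of the ℓ heavy vertices is joined to at least 1/(2C) of the tails, so a tail has on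
  -- average at least 2t neighbours among them, and at least 1/(4C) of all tails have t of them.
  ℓ = 4 * C * t
  C′ = 4 * C * 2 ^ ℓ
  main : ∀ N → suc (2 * C * ℓ) ⊔ N₁ ≤ N → ∀ (W : Vec (Fin N) (suc m) → Bool) → N ^ suc m ≤ C * vcount (suc m) W →
    ∃ λ (T : Fin (suc m) → Fin t → Fin N) → (∀ i {j j′} → T i j ≡ T i j′ → j ≡ j′) × Boxed W T
  main N hN W dense = finish (extract ℓ heavy ℓ≤)
    where
    N>2Cℓ : 2 * C * ℓ < N
    N>2Cℓ = m⊔n≤o⇒m≤o (suc (2 * C * ℓ)) N₁ hN
    N>0 : 0 < N
    N>0 = ≤-<-trans z≤n N>2Cℓ
    Nᵐ : ℕ
    Nᵐ = N ^ m
    Nᵐ>0 : 0 < Nᵐ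
    Nᵐ>0 = >-nonZero⁻¹ Nᵐ {{m^n≢0 N m {{>-nonZero N>0}}}}
    C>0 : 0 < C
    C>0 = n≢0⇒n>0 λ { refl → <⇒≱ (*-mono-≤ N>0 Nᵐ>0) dense }
    deg : Fin N → ℕ
    deg x = vsum m λ s → ⟦ W (x ∷ s) ⟧
    deg≤ : ∀ x → deg x ≤ Nᵐ
    deg≤ x = ≤-trans (vsum-mono m λ s → ⟦⟧≤1 (W (x ∷ s))) (≤-reflexive (trans (vsum-const N m 1) (*-identityʳ Nᵐ)))
    heavy : Fin N → Bool
    heavy x = does (Nᵐ ≤? 2 * C * deg x)
    h : ℕ
    h = sum λ x → ⟦ heavy x ⟧
    split : ∀ x → 2 * C * deg x ≤ 2 * C * Nᵐ * ⟦ heavy x ⟧ + Nᵐ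
    split x = go (Nᵐ ≤? 2 * C * deg x)
      where
      go : (d : Dec (Nᵐ ≤ 2 * C * deg x)) → 2 * C * deg x ≤ 2 * C * Nᵐ * ⟦ does d ⟧ + Nᵐ
      go (yes _) = ≤-trans ((2 * C) ⊛ deg≤ x) (≤-trans (≤-reflexive (sym (*-identityʳ (2 * C * Nᵐ)))) (m≤m+n _ Nᵐ))
      go (no n) = ≤-trans (<⇒≤ (≰⇒> n)) (m≤n+m Nᵐ _)
    ℓ≤ : ℓ ≤ h
    ℓ≤ = *-cancelˡ-≤ (2 * C) {{>-nonZero (<-≤-trans C>0 (m≤m+n C _))}} (≤-trans (<⇒≤ N>2Cℓ) (*-cancelˡ-≤ Nᵐ {{>-nonZero Nᵐ>0}}
        (cert 0 (blow-up-ring₁ N Nᵐ C (sum deg) h) (2 ⊛ dense ⊕ total))))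
      where
      total : 2 * C * sum deg ≤ 2 * C * Nᵐ * h + N * Nᵐ
      total = subst₂ _≤_ (sum-*ˡ (2 * C) deg) (trans (sum-+ _ _) (cong₂ _+_ (sum-*ˡ (2 * C * Nᵐ) _) (sum-const N Nᵐ))) (sum-mono split)
    finish : (Σ (Fin ℓ → Fin N) λ f → (∀ {i j} → f i ≡ f j → i ≡ j) × (∀ i → heavy (f i) ≡ true)) →
      ∃ λ (T : Fin (suc m) → Fin t → Fin N) → (∀ i {j j′} → T i j ≡ T i j′ → j ≡ j′) × Boxed W T
    finish (X , Xinj , Xheavy) = assemble (homogenize m ℓ φ tail)
      where
      φ : Fin ℓ → Vec (Fin N) m → Bool
      φ i s = W (X i ∷ s)
      tail : Vec (Fin N) m → Bool
      tail s = does (t ≤? sum λ i → ⟦ φ i s ⟧)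
      pw : ∀ s → sum (λ i → ⟦ φ i s ⟧) ≤ ℓ * ⟦ tail s ⟧ + t
      pw s = go (t ≤? sum λ i → ⟦ φ i s ⟧)
        where
        go : (d : Dec (t ≤ sum λ i → ⟦ φ i s ⟧)) → sum (λ i → ⟦ φ i s ⟧) ≤ ℓ * ⟦ does d ⟧ + t
        go (yes _) = ≤-trans (sum-≤const (λ i → ⟦⟧≤1 (φ i s))) (m≤m+n _ t)
        go (no n) = ≤-trans (<⇒≤ (≰⇒> n)) (m≤n+m t _)
      w : ℕ
      w = vcount m tail
      w-big : Nᵐ ≤ 4 * C * w
      w-big = *-cancelˡ-≤ ℓ {{>-nonZero (*-mono-≤ (*-mono-≤ {1} {4} (s≤s z≤n) C>0) t>0)}} (cert 0 (blow-up-ring₂ C t Nᵐ w Σφ) (2 ⊛ lo ⊕ (4 * C) ⊛ hi))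
        where
        Σφ : ℕ
        Σφ = sum λ i → deg (X i)
        lo : ℓ * Nᵐ ≤ 2 * C * Σφ
        lo = subst₂ _≤_ (sum-const ℓ Nᵐ) (sum-*ˡ (2 * C) _) (sum-mono λ i → does-true (Nᵐ ≤? 2 * C * deg (X i)) (Xheavy i))
        hi : Σφ ≤ ℓ * w + Nᵐ * t
        hi = subst₂ _≤_ (vsum-sum m (λ i s → ⟦ φ i s ⟧)) (trans (vsum-+ m _ _) (cong₂ _+_ (vsum-*ˡ m ℓ _) (vsum-const N m t))) (vsum-mono m pw)
      assemble : (∃ λ W′ → (∀ s → W′ s ≡ true → tail s ≡ true) × (∀ i s s′ → W′ s ≡ true → W′ s′ ≡ true → φ i s ≡ φ i s′) × w ≤ 2 ^ ℓ * vcount m W′) →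
        ∃ λ (T : Fin (suc m) → Fin t → Fin N) → (∀ i {j j′} → T i j ≡ T i j′ → j ≡ j′) × Boxed W T
      assemble (W′ , sub , same , big) = join′ (vcount-witness m W′ W′>0)
        where
        W′big : Nᵐ ≤ C′ * vcount m W′
        W′big = ≤-trans w-big (≤-trans ((4 * C) ⊛ big) (≤-reflexive (sym (*-assoc (4 * C) (2 ^ ℓ) (vcount m W′)))))
        W′>0 : 0 < vcount m W′
        W′>0 = n≢0⇒n>0 λ e → <⇒≱ Nᵐ>0 (≤-trans W′big (≤-reflexive (trans (cong (C′ *_) e) (*-zeroʳ C′))))
        -- All tails in `W′` have the same neighbours among the `X i`, so t neighbours of one tail
        -- serve as the new class for all.
        join′ : (∃ λ s → W′ s ≡ true) → ∃ λ (T : Fin (suc m) → Fin t → Fin N) → (∀ i {j j′} → T i j ≡ T i j′ → j ≡ j′) × Boxed W T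
        join′ (s₀ , e₀) =
          let f , finj , fok = extract t (λ i → φ i s₀) (does-true (t ≤? sum λ i → ⟦ φ i s₀ ⟧) (sub s₀ e₀))
              T′ , T′inj , box = ih N (m⊔n≤o⇒n≤o (suc (2 * C * ℓ)) N₁ hN) W′ W′big
          in (λ { zero → X ∘ f ; (suc i) → T′ i }) , (λ { zero e → finj (Xinj e) ; (suc i) → T′inj i }) ,
             λ { (x ∷ s) h → let j , ej = h zero in
               trans (cong (λ y → W (y ∷ s)) ej) (trans (same (f j) s s₀ (box s (λ i → h (suc i))) e₀) (fok j)) }

lin : ∀ {N m} → (Fin N → ℕ) → Vec (Fin N) m → ℕ
lin g [] = 0
lin g (x ∷ s) = g x + lin g s

lin-sum : ∀ {N m} (g : Fin N → ℕ) (s : Vec (Fin N) m) → lin g s ≡ sum (λ j → g (lookup s j))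
lin-sum g [] = sym (sum-nil _)
lin-sum g (x ∷ s) = trans (cong (g x +_) (lin-sum g s)) (sym (sum-suc _))

lin-remove : ∀ {N m} (g : Fin N → ℕ) (s : Vec (Fin N) (suc m)) j → lin g s ≡ g (lookup s j) + lin g (removeAt s j)
lin-remove g (x ∷ s) zero = refl
lin-remove g (x ∷ y ∷ s) (suc j) = trans (cong (g x +_) (lin-remove g (y ∷ s) j)) (lin-remove-ring (g x) (g (lookup (y ∷ s) j)) _)

cauchy : ∀ {n} (u : Fin n → ℕ) → sum u * sum u ≤ n * sum (λ i → u i * u i)
cauchy {n} u = *-cancelˡ-≤ 2 (≤-trans (m≤n+m _ D) (≤-reflexive (trans eq (cong (λ z → n * S + z) (sym (+-identityʳ (n * S)))))))
  where
  D S : ℕ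
  D = sum λ i → sum λ j → ∣ u i - u j ∣ * ∣ u i - u j ∣
  S = sum (λ i → u i * u i)
  eq : D + 2 * (sum u * sum u) ≡ n * S + n * S
  eq = trans (cong (D +_) (trans (cong (2 *_) (sym (sum-prod u u))) (trans (sym (sum-*ˡ 2 _)) (sum-cong-≗ λ i → sym (sum-*ˡ 2 _)))))
    (trans (sym (sum-+ _ _)) (trans (sum-cong-≗ λ i → trans (sym (sum-+ _ _)) (trans (sum-cong-≗ λ j → ∣-∣-sq (u i) (u j)) (sum-+ _ _)))
    (trans (sum-+ _ _) (cong₂ _+_ (trans (sum-cong-≗ λ i → sum-const n _) (sum-*ˡ n _)) (sum-const n _)))))

sum-select : ∀ {N} m (F : Fin N → Vec (Fin N) m → ℕ) (j : Fin (suc m)) →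
  vsum (suc m) (λ s → F (lookup s j) (removeAt s j)) ≡ sum (λ y → vsum m (F y))
sum-select m F zero = refl
sum-select (suc m) F (suc j) = trans (sum-cong-≗ λ x → sum-select m (λ y s → F y (x ∷ s)) j) (sum-swap _)

-- Taking out the j-th coordinate is a bijection from tuples to pairs of an entry and a shorter
-- tuple, so every j contributes the same amount.
sum-symmetrize : ∀ {N} m (F : Fin N → Vec (Fin N) m → ℕ) →
  vsum (suc m) (λ s → sum λ j → F (lookup s j) (removeAt s j)) ≡ suc m * sum (λ y → vsum m (F y))
sum-symmetrize m F = trans (vsum-sum (suc m) (λ j s → F (lookup s j) (removeAt s j))) (trans (sum-cong-≗ λ j → sum-select m F j) (sum-const (suc m) _))

module _ {N} (g : Fin N → ℕ) where
  private
    F : ℕ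
    F = sum g

  moment₁ : ∀ m → N * vsum m (lin g) ≡ m * F * N ^ m
  moment₁ zero = *-zeroʳ N
  moment₁ (suc m) = trans (cong (N *_) (trans (sum-cong-≗ λ x → vsum-+ m (λ _ → g x) (lin g)) (trans (sum-+ _ _)
      (cong₂ _+_ (trans (sum-cong-≗ λ x → vsum-const N m (g x)) (sum-*ˡ (N ^ m) g)) (sum-const N _)))))
    (trans (*-distribˡ-+ N (N ^ m * F) _) (trans (cong (λ z → N * (N ^ m * F) + N * z) (moment₁ m)) (moment₁-ring N (N ^ m) F m)))

  module _ (K : ℕ) (g≤ : ∀ x → g x ≤ K) where

    moment₂ : ∀ m → N * N * vsum m (λ s → lin g s * lin g s) ≤ m * m * (F * F) * N ^ m + m * (N * N * N ^ m) * (K * K)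
    moment₂ zero = ≤-reflexive (*-zeroʳ (N * N))
    moment₂ (suc m) = subst (λ z → N * N * z ≤ suc m * suc m * (F * F) * (N * N ^ m) + suc m * (N * N * (N * N ^ m)) * (K * K)) (sym expand)
      (cert (F * F * (N * N ^ m)) (moment₂-ring₂ N (N ^ m) G F M₁ M₂ m K) ((N * N * N ^ m) ⊛ G≤ ⊕ (2 * F * N) ⊛ ≤-reflexive (moment₁ m) ⊕ N ⊛ moment₂ m))
      where
      G M₁ M₂ : ℕ
      G = sum (λ x → g x * g x)
      M₁ = vsum m (lin g)
      M₂ = vsum m (λ s → lin g s * lin g s)
      G≤ : G ≤ N * (K * K)
      G≤ = sum-≤const λ x → sq-mono (g≤ x)
      expand : vsum (suc m) (λ s → lin g s * lin g s) ≡ N ^ m * G + 2 * F * M₁ + N * M₂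
      expand = trans (sum-cong-≗ λ x → trans (vsum-cong m λ s → moment₂-ring₁ (g x) (lin g s)) (trans (vsum-+ m _ _) (cong₂ _+_ (trans (vsum-+ m _ _)
          (cong₂ _+_ (vsum-const N m _) (vsum-*ˡ m (2 * g x) _))) refl)))
        (trans (sum-+ _ _) (cong₂ _+_ (trans (sum-+ _ _) (cong₂ _+_ (sum-*ˡ (N ^ m) _) (trans (sum-*ʳ M₁ _) (cong (_* M₁) (sum-*ˡ 2 g))))) (sum-const N M₂)))

    -- Sampling is with repetition, so the coordinates are independent and the variance is at most m
    -- times that of a single term. The factor N² clears the mean m F / N of its denominator.
    variance : ∀ m → vsum m (λ s → ∣ N * lin g s - m * F ∣ * ∣ N * lin g s - m * F ∣) ≤ m * (N * N * N ^ m) * (K * K)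
    variance m = cert 0 (ring V (N * vsum m (lin g)) M₂ N (N ^ m) m F K e) (moment₂ m ⊕ (2 * (m * F)) ⊛ ≤-reflexive (sym (moment₁ m)))
      where
      V M₂ : ℕ
      V = vsum m (λ s → ∣ N * lin g s - m * F ∣ * ∣ N * lin g s - m * F ∣)
      M₂ = vsum m (λ s → lin g s * lin g s)
      e : V + 2 * (m * F) * (N * vsum m (lin g)) ≡ N * N * M₂ + N ^ m * (m * F * (m * F))
      e = trans (cong (V +_) (trans (sym (*-assoc (2 * (m * F)) N _)) (trans (sym (vsum-*ˡ m (2 * (m * F) * N) _)) (vsum-cong m λ s → sym (variance-ring₁ N (lin g s) m F)))))
        (trans (sym (vsum-+ m _ _)) (trans (vsum-cong m λ s → ∣-∣-sq (N * lin g s) (m * F)) (trans (vsum-+ m _ _)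
          (cong₂ _+_ (trans (vsum-cong m λ s → variance-ring₂ N (lin g s)) (vsum-*ˡ m (N * N) _)) (vsum-const N m _)))))
      ring : ∀ V NM M₂ N M m F K → V + 2 * (m * F) * NM ≡ N * N * M₂ + M * (m * F * (m * F)) →
        V + (m * m * (F * F) * M + m * (N * N * M) * (K * K) + 2 * (m * F) * NM) + 0 ≡ m * (N * N * M) * (K * K) + (N * N * M₂ + 2 * (m * F) * (m * F * M))
      ring V NM M₂ N M m F K e = trans (variance-ring₃ V (m * m * (F * F) * M) (m * (N * N * M) * (K * K)) (2 * (m * F) * NM)) (trans (cong (λ z → m * m * (F * F) * M + m * (N * N * M) * (K * K) + z) e) (variance-ring₄ M₂ N M m F K))

-- Splitting T(s) = Σⱼ Σₗ h(sⱼ, sₗ) into rows, each row and the sum of the row means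
-- being a linear statistic, reduces its concentration to the linear case.
module Quadratic {N} (h : Fin N → Fin N → ℕ) (κ : ℕ) (h≤ : ∀ y z → h y z ≤ κ) (h-diag : ∀ y → h y y ≡ 0) (m₀ : ℕ) where

  m H : ℕ
  m = suc m₀
  H = sum λ y → sum (h y)

  T : Vec (Fin N) m → ℕ
  T s = sum λ j → lin (h (lookup s j)) s

  private
    r : Fin N → ℕ
    r y = sum (h y)

    row : Fin N → Vec (Fin N) m₀ → ℕ
    row y s = ∣ N * lin (h y) s - m₀ * r y ∣

    A b : Vec (Fin N) m → ℕ
    A s = sum λ j → row (lookup s j) (removeAt s j)
    b s = ∣ N * lin r s - m * H ∣

    D : Vec (Fin N) m → ℕ
    D s = N * A s + m₀ * b s

    below : ∀ x y → y ≤ x + ∣ x - y ∣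
    below x y = subst (λ d → y ≤ x + d) (∣-∣-comm y x) (m≤n+∣m-n∣ y x)

    -- Only deviations downwards matter. As the diagonal of h vanishes, row j may be summed over the
    -- other m₀ coordinates, which are independent of the entry at j.
    deviation : ∀ s → m₀ * (m * H) ≤ N * (N * T s) + D s
    deviation s = begin
      m₀ * (m * H) ≤⟨ m₀ ⊛ below (N * lin r s) (m * H) ⟩
      m₀ * (N * lin r s + b s) ≡⟨ deviation-ring₁ m₀ N (lin r s) (b s) ⟩
      N * (m₀ * lin r s) + m₀ * b s ≡⟨ cong (λ z → N * z + m₀ * b s) (trans (cong (m₀ *_) (lin-sum r s)) (sym (sum-*ˡ m₀ _))) ⟩
      N * sum (λ j → m₀ * r (lookup s j)) + m₀ * b s ≤⟨ +-monoˡ-≤ (m₀ * b s) (N ⊛ sum-mono λ j → below (N * lin (h (lookup s j)) (removeAt s j)) _) ⟩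
      N * sum (λ j → N * lin (h (lookup s j)) (removeAt s j) + row (lookup s j) (removeAt s j)) + m₀ * b s
        ≡⟨ cong (λ z → N * z + m₀ * b s) (trans (sum-+ _ _) (cong₂ _+_ (trans (sum-*ˡ N _) (cong (N *_) (sum-cong-≗ λ j →
             sym (trans (lin-remove (h (lookup s j)) s j) (cong (λ z → z + lin (h (lookup s j)) (removeAt s j)) (h-diag (lookup s j))))))) refl)) ⟩
      N * (N * T s + A s) + m₀ * b s ≡⟨ deviation-ring₂ N (N * T s) (A s) (m₀ * b s) ⟩
      N * (N * T s) + D s ∎
      where
      open ≤-Reasoning

    r≤ : ∀ y → r y ≤ N * κ
    r≤ y = sum-≤const (h≤ y)

    ΣA² : vsum m (λ s → A s * A s) ≤ m * (m * (N * (m₀ * (N * N * N ^ m₀) * (κ * κ))))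
    ΣA² = ≤-trans (vsum-mono m λ s → cauchy (λ j → row (lookup s j) (removeAt s j))) (≤-trans (≤-reflexive (vsum-*ˡ m m (λ s → sum λ j → row (lookup s j) (removeAt s j) * row (lookup s j) (removeAt s j)))) (m ⊛
      ≤-trans (≤-reflexive (sum-symmetrize m₀ (λ y s → row y s * row y s))) (m ⊛ sum-≤const λ y → variance (h y) κ (h≤ y) m₀)))

    Σb² : vsum m (λ s → b s * b s) ≤ m * (N * N * N ^ m) * (N * κ * (N * κ))
    Σb² = variance r (N * κ) r≤ m

    ΣD² : vsum m (λ s → D s * D s) ≤ 4 * (m * m * m * (N * N * (N * N) * N ^ m) * (κ * κ))
    ΣD² = ≤-trans (vsum-mono m λ s → sq (N * A s) (m₀ * b s)) (≤-trans (≤-reflexive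
         (trans (vsum-cong m λ s → ΣD²-ring₃ N m₀ (A s) (b s)) (trans (vsum-+ m (λ s → 2 * (N * N) * (A s * A s)) (λ s → 2 * (m₀ * m₀) * (b s * b s))) (cong₂ _+_ (vsum-*ˡ m (2 * (N * N)) (λ s → A s * A s)) (vsum-*ˡ m (2 * (m₀ * m₀)) (λ s → b s * b s))))))
         (cert (2 * (1 + m₀) * (3 * m₀ + 2) * (N * N * N * N * N * N ^ m₀) * (κ * κ)) (ΣD²-ring₄ m₀ N (N ^ m₀) κ (vsum m λ s → A s * A s) (vsum m λ s → b s * b s)) ((2 * (N * N)) ⊛ ΣA² ⊕ (2 * (m₀ * m₀)) ⊛ Σb²)))
      where
      sq : ∀ x y → (x + y) * (x + y) ≤ 2 * (x * x) + 2 * (y * y)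
      sq x y = cert (∣ x - y ∣ * ∣ x - y ∣) (trans (ΣD²-ring₁ x y (∣ x - y ∣ * ∣ x - y ∣)) (trans (cong (λ z → x * x + y * y + z) (∣-∣-sq x y)) (ΣD²-ring₂ x y))) (z≤n {0})

    chebyshev : ∀ c → 0 < N → 0 < κ → (bad : Vec (Fin N) m → Bool) → (∀ s → bad s ≡ true → N * N * (m * m) * κ ≤ c * D s) →
      m * vcount m bad ≤ 4 * (c * c) * N ^ m
    chebyshev c N>0 κ>0 bad h = *-cancelˡ-≤ X {{>-nonZero X>0}} (≤-trans (≤-reflexive (chebyshev-ring₂ m N κ (vcount m bad))) (≤-trans
        (subst₂ _≤_ (vsum-*ˡ m Y (λ s → ⟦ bad s ⟧)) (vsum-*ˡ m (c * c) (λ s → D s * D s)) (vsum-mono m pw)) (≤-trans ((c * c) ⊛ ΣD²) (≤-reflexive (chebyshev-ring₃ m N κ c (N ^ m))))))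
      where
      X Y : ℕ
      X = m * m * m * (N * N * (N * N)) * (κ * κ)
      Y = N * N * (m * m) * κ * (N * N * (m * m) * κ)
      N²>0 : 0 < N * N
      N²>0 = *-mono-≤ N>0 N>0
      X>0 : 0 < X
      X>0 = *-mono-≤ (*-mono-≤ (*-mono-≤ (*-mono-≤ {1} {m} {1} {m} (s≤s z≤n) (s≤s z≤n)) (s≤s (z≤n {m₀}))) (*-mono-≤ N²>0 N²>0)) (*-mono-≤ κ>0 κ>0)
      pw : ∀ s → Y * ⟦ bad s ⟧ ≤ c * c * (D s * D s)
      pw s = go (bad s) (h s)
        where
        go : ∀ β → (β ≡ true → N * N * (m * m) * κ ≤ c * D s) → Y * ⟦ β ⟧ ≤ c * c * (D s * D s)
        go true h = ≤-trans (≤-reflexive (*-identityʳ Y)) (≤-trans (sq-mono (h refl)) (≤-reflexive (chebyshev-ring₁ c (D s))))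
        go false h = ≤-trans (≤-reflexive (*-zeroʳ Y)) z≤n

  -- `T s` falls short of its mean m m₀ H / N² by more than m² κ / c, that is, by more than the
  -- fraction 1/c of the trivial bound m² κ.
  Light : ℕ → Vec (Fin N) m → Bool
  Light c s = not (does (c * (m₀ * (m * H)) ≤? c * (N * (N * T s)) + N * N * (m * m) * κ))

  concentrated : ∀ c → 0 < N → 0 < κ → m * vcount m (Light c) ≤ 4 * (c * c) * N ^ m
  concentrated c N>0 κ>0 = chebyshev c N>0 κ>0 (Light c) λ s e → go s (_ ≤? _) e
    where
    go : ∀ s (d : Dec (c * (m₀ * (m * H)) ≤ c * (N * (N * T s)) + N * N * (m * m) * κ)) → not (does d) ≡ true → N * N * (m * m) * κ ≤ c * D s
    go s (no n) _ = +-cancelˡ-≤ (c * (N * (N * T s))) _ _ (≤-trans (<⇒≤ (≰⇒> n)) (≤-trans (c ⊛ deviation s) (≤-reflexive (*-distribˡ-+ c _ _))))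

-- Rearranging blocks

rank-exists : ∀ {X} (p : Fin X → Bool) t → sum (λ i → ⟦ p i ⟧) ≡ t → Σ (Fin X → ℕ) λ rk →
  (∀ i → p i ≡ true → rk i < t) × (∀ i j → p i ≡ true → p j ≡ true → rk i ≡ rk j → i ≡ j)
rank-exists {X} p t refl = rk , small , inj
  where
  rk : Fin X → ℕ
  rk i = sum λ j → ⟦ does (toℕ j <? toℕ i) ∧ p j ⟧
  ∧-right : ∀ {x y} → x ∧ y ≡ true → y ≡ true
  ∧-right {true} e = e
  small : ∀ i → p i ≡ true → rk i < t
  small i e = sum-mono-< (λ j → ⟦⟧-mono ∧-right) i (subst₂ (λ x y → ⟦ x ∧ p i ⟧ < ⟦ y ⟧) (sym (dec-false (toℕ i <? toℕ i) (<-irrefl refl))) (sym e) z<s)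
  mono : ∀ i j → p i ≡ true → toℕ i < toℕ j → rk i < rk j
  mono i j e l = sum-mono-< (λ l′ → ⟦⟧-mono λ h → let u , v = ∧-true {does (toℕ l′ <? toℕ i)} h in
       cong₂ _∧_ (dec-true (toℕ l′ <? toℕ j) (<-trans (does-true (toℕ l′ <? toℕ i) u) l)) v) i
     (subst₂ (λ x y → ⟦ x ∧ p i ⟧ < ⟦ y ∧ p i ⟧) (sym (dec-false (toℕ i <? toℕ i) (<-irrefl refl))) (sym (dec-true (toℕ i <? toℕ j) l)) (subst (λ x → 0 < ⟦ x ⟧) (sym e) z<s))
  inj : ∀ i j → p i ≡ true → p j ≡ true → rk i ≡ rk j → i ≡ j
  inj i j ei ej e with <-cmp (toℕ i) (toℕ j)
  ... | tri< l _ _ = ⊥-elim (<-irrefl e (mono i j ei l))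
  ... | tri≈ _ q _ = toℕ-injective q
  ... | tri> _ _ g = ⊥-elim (<-irrefl (sym e) (mono j i ej g))

-- Positions asking for the same y are numbered in their order, so each of them receives its own one
-- of the `mult y` vertices available there.
ranking : ∀ {X Y} (ψ : Fin X → Fin Y) (mult : Fin Y → ℕ) → (∀ y → sum (λ i → ⟦ ψ i == y ⟧) ≡ mult y) →
  Σ (∀ i → Fin (mult (ψ i))) λ rk → ∀ i j → ψ i ≡ ψ j → toℕ (rk i) ≡ toℕ (rk j) → i ≡ j
ranking ψ mult h = (λ i → fromℕ< (lt i)) , λ i j e er → inj i j e (trans (sym (toℕ-fromℕ< (lt i))) (trans er (toℕ-fromℕ< (lt j))))
  where
  R : ∀ y → Σ _ λ rk → (∀ i → (ψ i == y) ≡ true → rk i < mult y) × (∀ i j → (ψ i == y) ≡ true → (ψ j == y) ≡ true → rk i ≡ rk j → i ≡ j)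
  R y = rank-exists (λ i → ψ i == y) (mult y) (h y)
  lt : ∀ i → proj₁ (R (ψ i)) i < mult (ψ i)
  lt i = proj₁ (proj₂ (R (ψ i))) i (==-refl (ψ i))
  inj : ∀ i j → ψ i ≡ ψ j → proj₁ (R (ψ i)) i ≡ proj₁ (R (ψ j)) j → i ≡ j
  inj i j e er = proj₂ (proj₂ (R (ψ i))) i j (==-refl (ψ i)) (subst (λ y → (ψ j == y) ≡ true) (sym e) (==-refl (ψ j)))
    (trans er (cong (λ y → proj₁ (R y) j) (sym e)))

module Layout (a′ b c : ℕ) where
  k : ℕ
  k = suc a′ + b + c

  head-or : ∀ {A : Set} {n} → A → A → Fin (suc n) → A
  head-or x₁ x₂ zero = x₁
  head-or x₁ x₂ (suc _) = x₂

  layout : ∀ {A : Set} → A → A → A → A → Fin k → A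
  layout x₁ x₂ y z s = [ (λ s′ → [ head-or x₁ x₂ , (λ _ → y) ]′ (splitAt (suc a′) s′)) , (λ _ → z) ]′ (splitAt (suc a′ + b) s)

  sum-layout : ∀ {A : Set} (f : A → ℕ) x₁ x₂ y z → sum (λ s → f (layout x₁ x₂ y z s)) ≡ f x₁ + a′ * f x₂ + b * f y + c * f z
  sum-layout f x₁ x₂ y z = trans (sum-split (suc a′ + b) _) (cong₂ _+_
    (trans (sum-cong-≗ λ i → cong (λ u → f (g u)) (splitAt-↑ˡ (suc a′ + b) i c)) (trans (sum-split (suc a′) _) (cong₂ _+_
      (trans (sum-suc _) (cong (f x₁ +_) (trans (sum-cong-≗ λ i → cong (λ u → f (g′ u)) (splitAt-↑ˡ (suc a′) (suc i) b)) (sum-const a′ _))))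
      (trans (sum-cong-≗ λ i → cong (λ u → f (g′ u)) (splitAt-↑ʳ (suc a′) b i)) (sum-const b _)))))
    (trans (sum-cong-≗ λ i → cong (λ u → f (g u)) (splitAt-↑ʳ (suc a′ + b) c i)) (sum-const c _)))
    where
    g′ : Fin (suc a′) ⊎ Fin b → _
    g′ = [ head-or x₁ x₂ , (λ _ → y) ]′
    g : Fin (suc a′ + b) ⊎ Fin c → _
    g = [ (λ s′ → g′ (splitAt (suc a′) s′)) , (λ _ → z) ]′

  slotPart : Fin k → Fin 3
  slotPart = layout zero zero (suc zero) (suc (suc zero))

  layout-part : ∀ {A : Set} (x₁ x₂ y z : A) s →
    (slotPart s ≡ zero × (layout x₁ x₂ y z s ≡ x₁ ⊎ layout x₁ x₂ y z s ≡ x₂))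
    ⊎ (slotPart s ≡ suc zero × layout x₁ x₂ y z s ≡ y) ⊎ (slotPart s ≡ suc (suc zero) × layout x₁ x₂ y z s ≡ z)
  layout-part x₁ x₂ y z s with splitAt (suc a′ + b) s
  ... | inj₂ _ = inj₂ (inj₂ (refl , refl))
  ... | inj₁ s′ with splitAt (suc a′) s′
  ...   | inj₂ _ = inj₂ (inj₁ (refl , refl))
  ...   | inj₁ zero = inj₁ (refl , inj₁ refl)
  ...   | inj₁ (suc _) = inj₁ (refl , inj₂ refl)

  part-sizes : ∀ j → sum (λ s → ⟦ slotPart s == j ⟧) ≡ partSize (suc a′) b c j
  part-sizes j = trans (sum-layout (λ p → ⟦ p == j ⟧) zero zero (suc zero) (suc (suc zero))) (go j)
    where
    go : ∀ j → ⟦ zero == j ⟧ + a′ * ⟦ zero == j ⟧ + b * ⟦ Fin.suc {2} zero == j ⟧ + c * ⟦ Fin.suc (suc zero) == j ⟧ ≡ partSize (suc a′) b c j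
    go zero rewrite ==-refl {3} zero | ==-≢ {3} {suc zero} {zero} (λ ()) | ==-≢ {3} {suc (suc zero)} {zero} (λ ()) = part-sizes-ring₁ a′ b c
    go (suc zero) rewrite ==-refl {3} (suc zero) | ==-≢ {3} {zero} {suc zero} (λ ()) | ==-≢ {3} {suc (suc zero)} {suc zero} (λ ()) = part-sizes-ring₂ a′ b c
    go (suc (suc zero)) rewrite ==-refl {3} (suc (suc zero)) | ==-≢ {3} {zero} {suc (suc zero)} (λ ()) | ==-≢ {3} {suc zero} {suc (suc zero)} (λ ()) = part-sizes-ring₃ a′ b c

  -- Indices x₁, x₂ of the small part (external or internal) and y, z of a copy.
  record Quad (M : ℕ) : Set where
    constructor quad
    field
      x₁ x₂ : Fin k ⊎ Fin M
      y z : Fin M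

  slots : ∀ {M} → Quad M → Fin k → Fin k ⊎ Fin M
  slots (quad x₁ x₂ y z) = layout x₁ x₂ (inj₂ y) (inj₂ z)

  isExt : ∀ {M} → Fin k ⊎ Fin M → Fin k → ℕ
  isExt (inj₁ p) q = ⟦ p == q ⟧
  isExt (inj₂ _) q = 0

  isInt : ∀ {M} → Fin k ⊎ Fin M → Fin M → ℕ
  isInt (inj₁ _) j = 0
  isInt (inj₂ i) j = ⟦ i == j ⟧

  record Balanced (M t : ℕ) : Set where
    field
      R : ℕ
      quads : Fin R → Quad M
      ext-once : ∀ q → sum (λ r → sum λ s → isExt (slots (quads r) s) q) ≡ 1
      int-t : ∀ j → sum (λ r → sum λ s → isInt (slots (quads r) s) j) ≡ t

  Valid : ∀ {M t} → (Fin k ⊎ Fin M → Fin M → Fin M → Bool) → Balanced M t → Set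
  Valid E⁺ B = ∀ r → E⁺ (x₁ (quads r)) (y (quads r)) (z (quads r)) ≡ true × E⁺ (x₂ (quads r)) (y (quads r)) (z (quads r)) ≡ true
    where
    open Balanced B
    open Quad

  Real : ∀ {n} → (Fin n → Fin n → Fin n → Bool) → (Fin k → Fin n) → Set
  Real E v = ∀ s₁ s₂ s₃ → slotPart s₁ ≡ zero → slotPart s₂ ≡ suc zero → slotPart s₃ ≡ suc (suc zero) → E (v s₁) (v s₂) (v s₃) ≡ true

  -- The block F and the m t blocks `T i j` are dissolved. A slot of the pattern stands for the t
  -- vertices at the same place of the blocks in one class of T, and every quad of the balanced list
  -- becomes a new block.
  module Realize {N m t n : ℕ} (E : Fin n → Fin n → Fin n → Bool) (β : Fin N → Fin k → Fin n)
    (β-inj : ∀ {B B′ s s′} → β B s ≡ β B′ s′ → B ≡ B′ × s ≡ s′)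
    (F : Fin N) (T : Fin m → Fin t → Fin N) (T-inj : ∀ {i i′ j j′} → T i j ≡ T i′ j′ → i ≡ i′ × j ≡ j′) (T≢F : ∀ {i j} → T i j ≢ F)
    (Bal : Balanced (m * k) t) where

    open Balanced Bal

    mult : Fin k ⊎ Fin (m * k) → ℕ
    mult (inj₁ _) = 1
    mult (inj₂ _) = t

    blockOf : (e : Fin k ⊎ Fin (m * k)) → Fin (mult e) → Fin N
    blockOf (inj₁ q) τ = F
    blockOf (inj₂ j) τ = T (proj₁ (remQuot k j)) τ

    slotOf : Fin k ⊎ Fin (m * k) → Fin k
    slotOf (inj₁ q) = q
    slotOf (inj₂ j) = proj₂ (remQuot {m} k j)

    vert : (e : Fin k ⊎ Fin (m * k)) → Fin (mult e) → Fin n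
    vert e τ = β (blockOf e τ) (slotOf e)

    vert-inj : ∀ e e′ τ τ′ → vert e τ ≡ vert e′ τ′ → e ≡ e′ × toℕ τ ≡ toℕ τ′
    vert-inj (inj₁ q) (inj₁ q′) zero zero h = cong inj₁ (proj₂ (β-inj h)) , refl
    vert-inj (inj₁ q) (inj₂ j) τ τ′ h = ⊥-elim (T≢F (sym (proj₁ (β-inj h))))
    vert-inj (inj₂ j) (inj₁ q) τ τ′ h = ⊥-elim (T≢F (proj₁ (β-inj h)))
    vert-inj (inj₂ j) (inj₂ j′) τ τ′ h =
      let eB , es = β-inj h
          ei , eτ = T-inj eB
      in cong inj₂ (trans (sym (combine-remQuot {m} k j)) (trans (cong₂ combine ei es) (combine-remQuot {m} k j′))) , cong toℕ eτ

    private
      Ix : ℕ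
      Ix = k + m * k

      ψ : Fin (R * k) → Fin k ⊎ Fin (m * k)
      ψ p = slots (quads (proj₁ (remQuot {R} k p))) (proj₂ (remQuot {R} k p))

      code : Fin k ⊎ Fin (m * k) → Fin Ix
      code = join k (m * k)

      code-inj : ∀ {e e′} → code e ≡ code e′ → e ≡ e′
      code-inj {e} {e′} h = trans (sym (splitAt-join k (m * k) e)) (trans (cong (splitAt k) h) (splitAt-join k (m * k) e′))

      is : Fin k ⊎ Fin (m * k) → Fin k ⊎ Fin (m * k) → ℕ
      is e (inj₁ q) = isExt e q
      is e (inj₂ j) = isInt e j

      is-code : ∀ e e′ → ⟦ code e == code e′ ⟧ ≡ is e e′
      is-code (inj₁ p) (inj₁ q) = cong ⟦_⟧ (bool-iff (λ h → dec (inj₁-inj (code-inj (==-sound h)))) λ h → subst (λ z → (code (inj₁ p) == code (inj₁ z)) ≡ true) (==-sound h) (==-refl (code (inj₁ p))))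
        where
        inj₁-inj : ∀ {p q : Fin k} → inj₁ {B = Fin (m * k)} p ≡ inj₁ q → p ≡ q
        inj₁-inj refl = refl
        dec : ∀ {p q : Fin k} → p ≡ q → (p == q) ≡ true
        dec {p} refl = ==-refl p
      is-code (inj₁ p) (inj₂ j) = cong ⟦_⟧ (==-≢ λ h → case code-inj {inj₁ p} {inj₂ j} h of λ ())
      is-code (inj₂ i) (inj₁ q) = cong ⟦_⟧ (==-≢ λ h → case code-inj {inj₂ i} {inj₁ q} h of λ ())
      is-code (inj₂ i) (inj₂ j) = cong ⟦_⟧ (bool-iff (λ h → dec (inj₂-inj (code-inj (==-sound h)))) λ h → subst (λ z → (code (inj₂ i) == code (inj₂ z)) ≡ true) (==-sound h) (==-refl (code (inj₂ i))))
        where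
        inj₂-inj : ∀ {p q : Fin (m * k)} → inj₂ {A = Fin k} p ≡ inj₂ q → p ≡ q
        inj₂-inj refl = refl
        dec : ∀ {p q : Fin (m * k)} → p ≡ q → (p == q) ≡ true
        dec {p} refl = ==-refl p

      total : ∀ e → sum (λ r → sum λ s → is (slots (quads r) s) e) ≡ mult e
      total (inj₁ q) = ext-once q
      total (inj₂ j) = int-t j

      code-split : ∀ y → code (splitAt k y) ≡ y
      code-split = join-splitAt k (m * k)

      count : ∀ y → sum (λ p → ⟦ code (ψ p) == y ⟧) ≡ mult (splitAt k y)
      count y = trans (sum-cong-≗ λ p → trans (cong (λ z → ⟦ code (ψ p) == z ⟧) (sym (code-split y))) (is-code (ψ p) (splitAt k y)))
        (trans (sum-combine R _) (trans (sum-cong-≗ λ r → sum-cong-≗ λ s → cong (λ rs → is (slots (quads (proj₁ rs)) (proj₂ rs)) (splitAt k y)) (remQuot-combine {R} {k} r s)) (total (splitAt k y))))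

      rk : Σ (∀ p → Fin (mult (splitAt k (code (ψ p))))) λ rk → ∀ p q → code (ψ p) ≡ code (ψ q) → toℕ (rk p) ≡ toℕ (rk q) → p ≡ q
      rk = ranking (code ∘ ψ) (mult ∘ splitAt k) count

      rank : ∀ p → Fin (mult (ψ p))
      rank p = subst (Fin ∘ mult) (splitAt-join k (m * k) (ψ p)) (proj₁ rk p)

      toℕ-subst : ∀ {e e′} (h : e ≡ e′) (i : Fin (mult e)) → toℕ (subst (Fin ∘ mult) h i) ≡ toℕ i
      toℕ-subst refl i = refl

    token : ∀ r s → Fin (mult (slots (quads r) s))
    token r s = subst (λ rs → Fin (mult (slots (quads (proj₁ rs)) (proj₂ rs)))) (remQuot-combine {R} {k} r s) (rank (combine r s))

    newBlock : Fin R → Fin k → Fin n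
    newBlock r s = vert (slots (quads r) s) (token r s)

    private
      newBlock-vert : ∀ r s → newBlock r s ≡ vert (ψ (combine r s)) (rank (combine r s))
      newBlock-vert r s = go (remQuot-combine {R} {k} r s) (rank (combine r s))
        where
        go : ∀ {rs rs′} (h : rs ≡ rs′) (i : Fin (mult (slots (quads (proj₁ rs)) (proj₂ rs)))) →
          vert (slots (quads (proj₁ rs′)) (proj₂ rs′)) (subst (λ rs → Fin (mult (slots (quads (proj₁ rs)) (proj₂ rs)))) h i) ≡ vert (slots (quads (proj₁ rs)) (proj₂ rs)) i
        go refl i = refl

    newBlock-inj : ∀ {r r′ s s′} → newBlock r s ≡ newBlock r′ s′ → r ≡ r′ × s ≡ s′
    newBlock-inj {r} {r′} {s} {s′} h =
      let eψ , eτ = vert-inj _ _ _ _ (trans (sym (newBlock-vert r s)) (trans h (newBlock-vert r′ s′)))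
          ep = proj₂ rk (combine r s) (combine r′ s′) (cong code eψ)
                 (trans (sym (toℕ-subst (splitAt-join k (m * k) (ψ (combine r s))) _)) (trans eτ (toℕ-subst (splitAt-join k (m * k) (ψ (combine r′ s′))) _)))
      in combine-injective r s r′ s′ ep

    -- Double counting of positions: k external vertices and t on each of the m k slots. So the new
    -- blocks can take over the names of the dissolved ones.
    R≡ : R ≡ suc (m * t)
    R≡ = *-cancelʳ-≡ R (suc (m * t)) k (begin
      R * k ≡⟨ sym (trans (sum-cong-≗ λ r → trans (sum-const k 1) (*-identityʳ k)) (sum-const R k)) ⟩
      sum {R} (λ r → sum {k} λ s → 1) ≡⟨ sum-cong-≗ (λ r → sum-cong-≗ λ s → one (slots (quads r) s)) ⟩
      sum (λ r → sum λ s → sum (λ q → isExt (slots (quads r) s) q) + sum (λ j → isInt (slots (quads r) s) j))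
        ≡⟨ trans (sum-cong-≗ λ r → trans (sum-+ _ _) (cong₂ _+_ (sum-swap _) (sum-swap _))) (sum-+ _ _) ⟩
      sum (λ r → sum λ q → sum λ s → isExt (slots (quads r) s) q) + sum (λ r → sum λ j → sum λ s → isInt (slots (quads r) s) j)
        ≡⟨ cong₂ _+_ (trans (sum-swap _) (trans (sum-cong-≗ ext-once) (trans (sum-const k 1) (*-identityʳ k))))
             (trans (sum-swap _) (trans (sum-cong-≗ int-t) (sum-const (m * k) t))) ⟩
      k + m * k * t ≡⟨ R≡-ring k m t ⟩
      suc (m * t) * k ∎)
      where
      open ≡-Reasoning
      one : ∀ e → 1 ≡ sum (λ q → isExt e q) + sum (λ j → isInt e j)
      one (inj₁ p) = sym (cong₂ _+_ (sum-δ′ p) (trans (sum-const (m * k) 0) (*-zeroʳ (m * k))))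
      one (inj₂ i) = sym (cong₂ _+_ (trans (sum-const k 0) (*-zeroʳ k)) (sum-δ′ i))

    sel : Fin (suc (m * t)) → Fin N
    sel zero = F
    sel (suc p) = T (proj₁ (remQuot {m} t p)) (proj₂ (remQuot {m} t p))

    sel-block : ∀ e τ → ∃ λ p → sel p ≡ blockOf e τ
    sel-block (inj₁ q) τ = zero , refl
    sel-block (inj₂ j) τ = suc (combine (proj₁ (remQuot {m} k j)) τ) , cong (λ rs → T (proj₁ rs) (proj₂ rs)) (remQuot-combine (proj₁ (remQuot {m} k j)) τ)

    private
      new : Fin (suc (m * t)) → Fin k → Fin n
      new p = newBlock (subst Fin (sym R≡) p)

      -- New blocks consist of vertices of dissolved blocks, so they cannot collide with the blocks
      -- that stay.
      new-sel : ∀ p s → ∃ λ q → ∃ λ s′ → new p s ≡ β (sel q) s′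
      new-sel p s = at (subst Fin (sym R≡) p)
        where
        at : ∀ r → ∃ λ q → ∃ λ s′ → newBlock r s ≡ β (sel q) s′
        at r = let q , e = sel-block (slots (quads r) s) (token r s) in q , slotOf (slots (quads r) s) , cong (λ B → β B (slotOf (slots (quads r) s))) (sym e)

      subst-inj : ∀ {p q} → subst Fin (sym R≡) p ≡ subst Fin (sym R≡) q → p ≡ q
      subst-inj {p} {q} h = trans (sym (subst-subst-sym R≡)) (trans (cong (subst Fin R≡) h) (subst-subst-sym R≡))

      choose : ∀ B → Dec (∃ λ p → sel p ≡ B) → Fin k → Fin n
      choose B (yes (p , _)) = new p
      choose B (no _) = β B

      choose-inj : ∀ {B B′} (d : Dec (∃ λ p → sel p ≡ B)) (d′ : Dec (∃ λ p → sel p ≡ B′)) {s s′} → choose B d s ≡ choose B′ d′ s′ → B ≡ B′ × s ≡ s′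
      choose-inj (yes (p , e)) (yes (p′ , e′)) h = let er , es = newBlock-inj h in trans (sym e) (trans (cong sel (subst-inj er)) e′) , es
      choose-inj (yes (p , e)) (no n′) {s} h = let q , s″ , eq = new-sel p s in ⊥-elim (n′ (q , proj₁ (β-inj (trans (sym eq) h))))
      choose-inj (no n) (yes (p′ , e′)) {s′ = s′} h = let q , s″ , eq = new-sel p′ s′ in ⊥-elim (n (q , proj₁ (β-inj (trans (sym eq) (sym h)))))
      choose-inj (no n) (no n′) h = β-inj h

    β′ : Fin N → Fin k → Fin n
    β′ B = choose B (any? λ p → sel p ≟F B)

    β′-inj : ∀ {B B′ s s′} → β′ B s ≡ β′ B′ s′ → B ≡ B′ × s ≡ s′
    β′-inj {B} {B′} = choose-inj (any? λ p → sel p ≟F B) (any? λ p → sel p ≟F B′)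

    Realizes : Quad (m * k) → Set
    Realizes (quad x₁ x₂ y z) = ∀ x → x ≡ x₁ ⊎ x ≡ x₂ → ∀ τ τ₂ τ₃ → E (vert x τ) (vert (inj₂ y) τ₂) (vert (inj₂ z) τ₃) ≡ true

    module _ (valid : ∀ r → Realizes (quads r)) where

      private
        new-real : ∀ r → Real E (newBlock r)
        new-real r s₁ s₂ s₃ e₁ e₂ e₃ = go (token r s₁) (token r s₂) (token r s₃)
            (first (layout-part x₁ x₂ (inj₂ y) (inj₂ z) s₁)) (second (layout-part x₁ x₂ (inj₂ y) (inj₂ z) s₂)) (third (layout-part x₁ x₂ (inj₂ y) (inj₂ z) s₃))
          where
          open Quad (quads r)
          go : ∀ {u u₂ u₃} (τ : Fin (mult u)) (τ₂ : Fin (mult u₂)) (τ₃ : Fin (mult u₃)) → u ≡ x₁ ⊎ u ≡ x₂ → u₂ ≡ inj₂ y → u₃ ≡ inj₂ z → E (vert u τ) (vert u₂ τ₂) (vert u₃ τ₃) ≡ true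
          go {u} τ τ₂ τ₃ h refl refl = valid r u h τ τ₂ τ₃
          Parts : Fin k → Fin k ⊎ Fin (m * k) → Set
          Parts s u = (slotPart s ≡ zero × (u ≡ x₁ ⊎ u ≡ x₂)) ⊎ (slotPart s ≡ suc zero × u ≡ inj₂ y) ⊎ (slotPart s ≡ suc (suc zero) × u ≡ inj₂ z)
          first : ∀ {u} → Parts s₁ u → u ≡ x₁ ⊎ u ≡ x₂
          first (inj₁ (_ , h)) = h
          first (inj₂ (inj₁ (p , _))) = case trans (sym p) e₁ of λ ()
          first (inj₂ (inj₂ (p , _))) = case trans (sym p) e₁ of λ ()
          second : ∀ {u} → Parts s₂ u → u ≡ inj₂ y
          second (inj₁ (p , _)) = case trans (sym p) e₂ of λ ()
          second (inj₂ (inj₁ (_ , h))) = h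
          second (inj₂ (inj₂ (p , _))) = case trans (sym p) e₂ of λ ()
          third : ∀ {u} → Parts s₃ u → u ≡ inj₂ z
          third (inj₁ (p , _)) = case trans (sym p) e₃ of λ ()
          third (inj₂ (inj₁ (p , _))) = case trans (sym p) e₃ of λ ()
          third (inj₂ (inj₂ (_ , h))) = h

        choose-real : ∀ B (d : Dec (∃ λ p → sel p ≡ B)) → Real E (β B) ⊎ (∃ λ p → sel p ≡ B) → Real E (choose B d)
        choose-real B (yes (p , _)) _ = new-real (subst Fin (sym R≡) p)
        choose-real B (no n) (inj₁ r) = r
        choose-real B (no n) (inj₂ p) = ⊥-elim (n p)

      β′-keeps : ∀ B → Real E (β B) → Real E (β′ B)
      β′-keeps B r = choose-real B (any? λ p → sel p ≟F B) (inj₁ r)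

      β′-F : Real E (β′ F)
      β′-F = choose-real F (any? λ p → sel p ≟F F) (inj₂ (zero , refl))

-- One blow-up size for all patterns

bounded-choice : ∀ n (P : Vec Bool n → ℕ → Set) → (∀ {v t t′} → t ≤ t′ → P v t → P v t′) → (∀ v → ∃ (P v)) → ∃ λ T → ∀ v → P v T
bounded-choice zero P mono h = let t , p = h [] in t , λ { [] → p }
bounded-choice (suc n) P mono h =
  let t₀ , p₀ = bounded-choice n (λ v → P (false ∷ v)) mono (λ v → h (false ∷ v))
      t₁ , p₁ = bounded-choice n (λ v → P (true ∷ v)) mono (λ v → h (true ∷ v))
  in t₀ ⊔ t₁ , λ { (false ∷ v) → mono (m≤m⊔n t₀ t₁) (p₀ v) ; (true ∷ v) → mono (m≤n⊔m t₀ t₁) (p₁ v) }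

module Patterns (a′ b c P Q : ℕ) (a≤b : suc a′ ≤ b) (b≤c : b ≤ c) (good : Good P Q (suc a′) b c) where
  open Layout a′ b c public

  record Dense {M : ℕ} (E⁺ : Fin k ⊎ Fin M → Fin M → Fin M → Bool) : Set where
    field
      sym₁₂′ : ∀ x y z → E⁺ (inj₂ x) y z ≡ E⁺ (inj₂ y) x z
      sym₂₃′ : ∀ x y z → E⁺ (inj₂ x) y z ≡ E⁺ (inj₂ x) z y
      dense : ∀ e → P * (M * M) ≤ Q * link (E⁺ e)

  private
    dense? : ∀ {M} (E⁺ : Fin k ⊎ Fin M → Fin M → Fin M → Bool) → Dec (Dense E⁺)
    dense? {M} E⁺ with (all? λ x → all? λ y → all? λ z → E⁺ (inj₂ x) y z ≟B E⁺ (inj₂ y) x z)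
                | (all? λ x → all? λ y → all? λ z → E⁺ (inj₂ x) y z ≟B E⁺ (inj₂ x) z y)
                | (all? λ q → P * (M * M) ≤? Q * link (E⁺ (inj₁ q))) | (all? λ i → P * (M * M) ≤? Q * link (E⁺ (inj₂ i)))
    ... | yes u | yes v | yes w | yes x = yes (record { sym₁₂′ = u ; sym₂₃′ = v ; dense = λ { (inj₁ q) → w q ; (inj₂ i) → x i } })
    ... | no n | _ | _ | _ = no λ d → n (Dense.sym₁₂′ d)
    ... | _ | no n | _ | _ = no λ d → n (Dense.sym₂₃′ d)
    ... | _ | _ | no n | _ = no λ d → n λ q → Dense.dense d (inj₁ q)
    ... | _ | _ | _ | no n = no λ d → n λ i → Dense.dense d (inj₂ i)

  Tiled : ∀ {M} (E⁺ : Fin k ⊎ Fin M → Fin M → Fin M → Bool) → ℕ → Set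
  Tiled {M} E⁺ t = Σ (Balanced M t) (Valid E⁺)

  dense⇒tiled : ∀ {M₀} m → suc M₀ ≡ m * k → (E⁺ : Fin k ⊎ Fin (suc M₀) → Fin (suc M₀) → Fin (suc M₀) → Bool) → Dense E⁺ → ∃ (Tiled E⁺)
  dense⇒tiled {M₀} m Mm E⁺ d = convert (Pt.tiling m Mm)
    where
    module Pt = Pattern a′ b c P Q a≤b b≤c good {M₀} (λ i → E⁺ (inj₂ i)) (Dense.sym₁₂′ d) (Dense.sym₂₃′ d) (λ i → Dense.dense d (inj₂ i))
      (λ q → E⁺ (inj₁ q)) (λ q → Dense.dense d (inj₁ q))
    toQuad : Pt.Copy → Quad (suc M₀)
    toQuad (Pt.copy x₁ x₂ y z _ _) = quad x₁ x₂ y z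
    E⁺-agree : ∀ e y z → Pt.E⁺ e y z ≡ E⁺ e y z
    E⁺-agree (inj₁ q) y z = refl
    E⁺-agree (inj₂ i) y z = refl
    ext-agree : ∀ e q → Pt.isExt e q ≡ isExt e q
    ext-agree (inj₁ p) q = refl
    ext-agree (inj₂ i) q = refl
    int-agree : ∀ e j → Pt.isInt e j ≡ isInt e j
    int-agree (inj₁ p) j = refl
    int-agree (inj₂ i) j = refl
    ext-sum : ∀ cp q → sum (λ s → isExt (slots (toQuad cp) s) q) ≡ Pt.ext cp q
    ext-sum (Pt.copy x₁ x₂ y z _ _) q = trans (sum-layout (λ e → isExt e q) x₁ x₂ (inj₂ y) (inj₂ z))
      (trans (cong₂ (λ u v → u + a′ * v + b * 0 + c * 0) (sym (ext-agree x₁ q)) (sym (ext-agree x₂ q))) (dense⇒tiled-ring (Pt.isExt x₁ q + a′ * Pt.isExt x₂ q) b c))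
    int-sum : ∀ cp j → sum (λ s → isInt (slots (toQuad cp) s) j) ≡ Pt.int cp j
    int-sum (Pt.copy x₁ x₂ y z _ _) j = trans (sum-layout (λ e → isInt e j) x₁ x₂ (inj₂ y) (inj₂ z))
      (cong₂ (λ u v → u + a′ * v + b * ⟦ y == j ⟧ + c * ⟦ z == j ⟧) (sym (int-agree x₁ j)) (sym (int-agree x₂ j)))
    exts-sum : ∀ cs q → sum (λ r → Pt.ext (L.lookup cs r) q) ≡ Pt.exts cs q
    exts-sum [] q = sum-nil _
    exts-sum (cp ∷ cs) q = trans (sum-suc _) (cong (Pt.ext cp q +_) (exts-sum cs q))
    ints-sum : ∀ cs j → sum (λ r → Pt.int (L.lookup cs r) j) ≡ Pt.ints cs j
    ints-sum [] j = sum-nil _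
    ints-sum (cp ∷ cs) j = trans (sum-suc _) (cong (Pt.int cp j +_) (ints-sum cs j))
    convert : (∃ λ t → ∃ λ cs → (∀ q → Pt.exts cs q ≡ 1) × (∀ j → Pt.ints cs j ≡ t)) → ∃ (Tiled E⁺)
    convert (t , cs , he , hi) = t , record
      { R = length cs ; quads = λ r → toQuad (L.lookup cs r)
      ; ext-once = λ q → trans (sum-cong-≗ λ r → ext-sum (L.lookup cs r) q) (trans (exts-sum cs q) (he q))
      ; int-t = λ j → trans (sum-cong-≗ λ r → int-sum (L.lookup cs r) j) (trans (ints-sum cs j) (hi j)) } ,
      λ r → valid (L.lookup cs r)
      where
      valid : ∀ cp → let open Quad (toQuad cp) in E⁺ x₁ y z ≡ true × E⁺ x₂ y z ≡ true
      valid (Pt.copy x₁ x₂ y z e₁ e₂) = trans (sym (E⁺-agree x₁ y z)) e₁ , trans (sym (E⁺-agree x₂ y z)) e₂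

  module _ {M : ℕ} where
    bits : ℕ
    bits = (k + M) * (M * M)

    index : Fin k ⊎ Fin M → Fin M → Fin M → Fin bits
    index e y z = combine (join k M e) (combine y z)

    unindex : Fin bits → (Fin k ⊎ Fin M) × Fin M × Fin M
    unindex i = splitAt k (proj₁ (remQuot {k + M} (M * M) i)) , remQuot {M} M (proj₂ (remQuot {k + M} (M * M) i))

    unindex-index : ∀ e y z → unindex (index e y z) ≡ (e , y , z)
    unindex-index e y z = cong₂ _,_
      (trans (cong (λ w → splitAt k (proj₁ w)) (remQuot-combine {k + M} {M * M} (join k M e) (combine y z))) (splitAt-join k M e))
      (trans (cong (λ w → remQuot {M} M (proj₂ w)) (remQuot-combine {k + M} {M * M} (join k M e) (combine y z))) (remQuot-combine {M} {M} y z))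

    decode : Vec Bool bits → Fin k ⊎ Fin M → Fin M → Fin M → Bool
    decode v e y z = lookup v (index e y z)

    encode : (Fin k ⊎ Fin M → Fin M → Fin M → Bool) → Vec Bool bits
    encode E⁺ = tabulate λ i → let e , y , z = unindex i in E⁺ e y z

    decode-encode : ∀ E⁺ e y z → decode (encode E⁺) e y z ≡ E⁺ e y z
    decode-encode E⁺ e y z = trans (lookup∘tabulate (λ i → let e , y , z = unindex i in E⁺ e y z) (index e y z))
      (cong (λ w → E⁺ (proj₁ w) (proj₁ (proj₂ w)) (proj₂ (proj₂ w))) (unindex-index e y z))

  -- Density is decidable, and every pattern agrees pointwise with one decoded from a bit vector of
  -- fixed length; so one bound on the tiling size is available before the pattern is known.
  uniform : ∀ {M₀} m → suc M₀ ≡ m * k → ∃ λ T → ∀ (E⁺ : Fin k ⊎ Fin (suc M₀) → Fin (suc M₀) → Fin (suc M₀) → Bool) → Dense E⁺ → ∃ λ t → t ≤ T × Tiled E⁺ t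
  uniform {M₀} m Mm = let T , h = bounded-choice bits Pv (λ l p d → let t , l′ , r = p d in t , ≤-trans l′ l , r) pick in T , λ E⁺ d → transport E⁺ (h (encode E⁺) (recode E⁺ d))
    where
    Pv : Vec Bool bits → ℕ → Set
    Pv v T = Dense (decode {suc M₀} v) → ∃ λ t → t ≤ T × Tiled (decode {suc M₀} v) t
    pick : ∀ v → ∃ (Pv v)
    pick v = go (dense? (decode {suc M₀} v))
      where
      go : Dec (Dense (decode {suc M₀} v)) → ∃ (Pv v)
      go (yes d) = let t , r = dense⇒tiled m Mm (decode v) d in t , λ _ → t , ≤-refl , r
      go (no n) = 0 , λ d → ⊥-elim (n d)
    recode : ∀ E⁺ → Dense E⁺ → Dense (decode {suc M₀} (encode E⁺))
    recode E⁺ d = record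
      { sym₁₂′ = λ x y z → trans (decode-encode E⁺ (inj₂ x) y z) (trans (Dense.sym₁₂′ d x y z) (sym (decode-encode E⁺ (inj₂ y) x z)))
      ; sym₂₃′ = λ x y z → trans (decode-encode E⁺ (inj₂ x) y z) (trans (Dense.sym₂₃′ d x y z) (sym (decode-encode E⁺ (inj₂ x) z y)))
      ; dense = λ e → ≤-trans (Dense.dense d e) (≤-reflexive (cong (Q *_) (sum-cong-≗ λ y → sum-cong-≗ λ z → cong ⟦_⟧ (sym (decode-encode E⁺ e y z))))) }
    transport : ∀ E⁺ {T} → (∃ λ t → t ≤ T × Tiled (decode {suc M₀} (encode E⁺)) t) → ∃ λ t → t ≤ T × Tiled E⁺ t
    transport E⁺ (t , l , B , v) = t , l , B , λ r → let h₁ , h₂ = v r in trans (sym (decode-encode E⁺ _ _ _)) h₁ , trans (sym (decode-encode E⁺ _ _ _)) h₂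

-- Passing from the sample back to N blocks costs three error terms, for pairs inside a
-- block, for the concentration, and for the discarded indices.
sample-arith : ∀ {P Q κ N H T G B m m′ μ₀ μ} → 0 < N → 3 * Q * (4 * Q + 2) ≤ N →
  suc P * (N * N * κ) ≤ Q * (H + 3 * (N * κ)) →
  (4 * Q + 2) * (μ₀ * (μ * H)) ≤ (4 * Q + 2) * (N * (N * T)) + N * N * (μ * μ) * κ →
  T ≤ G + 2 * (B * m * κ) → m′ ≤ μ₀ → μ₀ ≤ μ → μ ≤ 2 * μ₀ → m ≤ 2 * μ → 8 * (Q * B) ≤ μ₀ →
  P * (m′ * m′ * κ) ≤ Q * G
sample-arith {P} {Q} {κ} {N} {H} {T} {G} {B} {m} {m′} {μ₀} {μ} N>0 N≥ hH hT hG m′≤ μ≤ μ≤2 m≤ μ₀≥ =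
  *-cancelˡ-≤ C {{>-nonZero (subst (0 <_) (+-comm 2 (4 * Q)) z<s)}} (cert 0 (sample-arith-ring₃ Q P κ T G B m m′ μ₀ μ)
    (scaled ⊕ (C * Q) ⊛ hG ⊕ (C * P * κ) ⊛ *-mono-≤ m′≤ (≤-trans m′≤ μ≤) ⊕ κ ⊛ slack))
  where
  C : ℕ
  C = 4 * Q + 2
  scaled : C * (μ₀ * μ) * (suc P * κ) ≤ Q * (C * T) + Q * (μ * μ) * κ + μ₀ * μ * κ
  scaled = *-cancelˡ-≤ (N * N) {{m*n≢0 N N {{>-nonZero N>0}} {{>-nonZero N>0}}}}
    (cert 0 (sample-arith-ring₁ Q P κ N H T μ₀ μ C) ((C * (μ₀ * μ)) ⊛ hH ⊕ Q ⊛ hT ⊕ (N * (μ₀ * μ) * κ) ⊛ N≥))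
  slack : 2 * (Q * (C * (B * m))) + Q * (μ * μ) + μ₀ * μ ≤ C * (μ₀ * μ)
  slack = cert 0 (sample-arith-ring₂ Q B m μ₀ μ) ((2 * (4 * Q + 2) * (Q * B)) ⊛ m≤ ⊕ ((2 * Q + 1) * μ) ⊛ μ₀≥ ⊕ (Q * μ) ⊛ μ≤2)

does-not : ∀ {P : Set} (d : Dec P) → not (does d) ≡ false → P
does-not (yes p) _ = p

two-in : ∀ {n} (f : Fin n → Bool) i j → f i ≡ true → f j ≡ true → sum (λ l → ⟦ f l ⟧) ≤ 1 → i ≡ j
two-in f i j ei ej h with i ≟F j
... | yes e = e
... | no ne = ⊥-elim (<⇒≱ (subst₂ (λ u v → 1 < u + v) (sym (sum-δ i)) (sym (sum-δ j)) (s≤s (s≤s z≤n))) (≤-trans (≤-reflexive (sym (sum-+ _ _))) (≤-trans (sum-mono pw) h)))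
  where
  pw : ∀ l → ⟦ l == i ⟧ + ⟦ l == j ⟧ ≤ ⟦ f l ⟧
  pw l = go (l ≟F i) (l ≟F j)
    where
    go : Dec (l ≡ i) → Dec (l ≡ j) → ⟦ l == i ⟧ + ⟦ l == j ⟧ ≤ ⟦ f l ⟧
    go (yes refl) _ = subst₂ (λ u v → ⟦ l == l ⟧ + ⟦ u ⟧ ≤ ⟦ v ⟧) (sym (==-≢ ne)) (sym ei) (≤-trans (≤-reflexive (+-identityʳ _)) (⟦⟧≤1 _))
    go (no n) (yes refl) = subst₂ (λ u v → ⟦ u ⟧ + ⟦ l == l ⟧ ≤ ⟦ v ⟧) (sym (==-≢ n)) (sym ej) (⟦⟧≤1 _)
    go (no n) (no n′) = subst₂ (λ u v → ⟦ u ⟧ + ⟦ v ⟧ ≤ ⟦ f l ⟧) (sym (==-≢ n)) (sym (==-≢ n′)) z≤n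

-- Sampling

-- A sample S of m blocks is good when its blocks are distinct and differ from F, no
-- vertex of F is light for S, and at most B members of S contain a vertex light for the rest.
module GoodSamples {N k : ℕ} (F : Fin N) (h : Fin N → Fin k → Fin N → Fin N → ℕ) (κ : ℕ) (h≤ : ∀ x s y z → h x s y z ≤ κ)
  (h-diag : ∀ x s y → h x s y y ≡ 0) (m₀₀ c B : ℕ) (N>0 : 0 < N) (κ>0 : 0 < κ)
  (B-big : 48 * (k * (c * c)) ≤ suc B) (m-big : 24 * (k * (c * c)) ≤ suc m₀₀)
  (N-big : 6 * (suc (suc m₀₀) * suc (suc m₀₀)) ≤ N) where

  m₀ m K : ℕ
  m₀ = suc m₀₀
  m = suc m₀
  K = suc B

  -- A vertex of F is tested on all m members of the sample. A vertex of a sampled block is tested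
  -- by `QI` on the other m₀ members only, so that these stay independent of its own block.
  module QF (q : Fin k) = Quadratic (h F q) κ (h≤ F q) (h-diag F q) m₀
  module QI (y : Fin N) (s : Fin k) = Quadratic (h y s) κ (h≤ y s) (h-diag y s) m₀₀

  private
    light-int : Fin N → Vec (Fin N) m₀ → ℕ
    light-int y S = sum λ s → ⟦ QI.Light y s c S ⟧

    light-ext : Vec (Fin N) m → ℕ
    light-ext S = sum λ q → ⟦ QF.Light q c S ⟧

    clash : Fin N → Vec (Fin N) m₀ → ℕ
    clash y S = ⟦ y == F ⟧ + lin (λ x → ⟦ x == y ⟧) S

    w : Fin N → Vec (Fin N) m₀ → ℕ
    w y S = light-int y S + K * clash y S

    -- The weight K exceeds the budget B, so a single coincidence of blocks or a single light vertex
    -- of F spoils the sample, while light vertices of sampled blocks are merely counted.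
    cost : Vec (Fin N) m → ℕ
    cost S = sum (λ j → w (lookup S j) (removeAt S j)) + K * light-ext S

  good : Vec (Fin N) m → Bool
  good S = does (cost S ≤? B)

  private
    Y : ℕ
    Y = N ^ m₀

    ΣI : m₀ * sum (λ y → vsum m₀ (light-int y)) ≤ 4 * (k * (c * c)) * (N * Y)
    ΣI = ≤-trans (≤-reflexive (sym (sum-*ˡ m₀ _))) (≤-trans (sum-≤const λ y → ≤-trans
         (≤-reflexive (trans (cong (m₀ *_) (vsum-sum m₀ (λ s S → ⟦ QI.Light y s c S ⟧))) (sym (sum-*ˡ m₀ _)))) (sum-≤const λ s → QI.concentrated y s c N>0 κ>0))
         (≤-reflexive (ΣI-ring N k c Y)))

    ΣE : m₀ * vsum m light-ext ≤ 4 * (k * (c * c)) * (N * Y)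
    ΣE = ≤-trans (*-monoˡ-≤ (vsum m light-ext) (n≤1+n m₀)) (≤-trans (≤-reflexive (trans (cong (m *_) (vsum-sum m (λ q S → ⟦ QF.Light q c S ⟧))) (sym (sum-*ˡ m _))))
         (≤-trans (sum-≤const λ q → QF.concentrated q c N>0 κ>0) (≤-reflexive (ΣE-ring k c (N * Y)))))

    ΣC : sum (λ y → vsum m₀ (clash y)) ≡ Y + m₀ * Y
    ΣC = trans (sum-cong-≗ λ y → trans (vsum-+ m₀ (λ _ → ⟦ y == F ⟧) (lin (λ x → ⟦ x == y ⟧))) (cong₂ _+_ (vsum-const N m₀ ⟦ y == F ⟧) refl))
       (trans (sum-+ _ _) (cong₂ _+_ (trans (sum-*ˡ Y _) (trans (cong (Y *_) (sum-δ F)) (*-identityʳ Y)))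
         (*-cancelˡ-≡ _ _ N {{>-nonZero N>0}} (trans (sym (sum-*ˡ N _)) (trans (sum-cong-≗ λ y → trans (moment₁ (λ x → ⟦ x == y ⟧) m₀) (cong (λ z → m₀ * z * Y) (sum-δ y)))
           (trans (sum-const N _) (cong (λ z → N * (z * Y)) (*-identityʳ m₀))))))))

    Σw : sum (λ y → vsum m₀ (w y)) ≡ sum (λ y → vsum m₀ (light-int y)) + K * (Y + m₀ * Y)
    Σw = trans (sum-cong-≗ λ y → trans (vsum-+ m₀ (light-int y) (λ S → K * clash y S)) (cong (vsum m₀ (light-int y) +_) (vsum-*ˡ m₀ K (clash y))))
       (trans (sum-+ _ _) (cong (sum (λ y → vsum m₀ (light-int y)) +_) (trans (sum-*ˡ K _) (cong (K *_) ΣC))))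

    -- The average cost is at most K/2, which Markov's inequality turns into half of the samples
    -- being good. With A = k c², each kind of defect takes a third: light vertices of sampled
    -- blocks by 48A ≤ K, light vertices of F by 24A ≤ m₀, coincidences by 6m² ≤ N.
    Σcost : 2 * vsum m cost ≤ K * (N * Y)
    Σcost = *-cancelˡ-≤ (3 * m₀) (subst (λ z → 3 * m₀ * (2 * z) ≤ 3 * m₀ * (K * (N * Y))) (sym expand)
        (bound m₀ (k * (c * c)) K N Y _ _ (s≤s z≤n) ΣI ΣE B-big m-big N-big))
      where
      expand : vsum m cost ≡ m * (sum (λ y → vsum m₀ (light-int y)) + K * (Y + m₀ * Y)) + K * vsum m light-ext
      expand = trans (vsum-+ m (λ S → sum λ j → w (lookup S j) (removeAt S j)) (λ S → K * light-ext S))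
        (cong₂ _+_ (trans (sum-symmetrize m₀ w) (cong (m *_) Σw)) (vsum-*ˡ m K light-ext))
      bound : ∀ m₀ A K N Y I E → 1 ≤ m₀ → m₀ * I ≤ 4 * A * (N * Y) → m₀ * E ≤ 4 * A * (N * Y) → 48 * A ≤ K → 24 * A ≤ m₀ → 6 * (suc m₀ * suc m₀) ≤ N →
        3 * m₀ * (2 * (suc m₀ * (I + K * (Y + m₀ * Y)) + K * E)) ≤ 3 * m₀ * (K * (N * Y))
      bound m₀ A K N Y I E m₀≥ hI hE hK hm hN = cert 0 (Σcost-ring m₀ A K N Y I E)
        ((6 * (1 + m₀)) ⊛ hI ⊕ (24 * (A * (N * Y))) ⊛ m₀≥ ⊕ (6 * K) ⊛ hE ⊕ (m₀ * (N * Y)) ⊛ hK ⊕ (K * (N * Y)) ⊛ hm ⊕ (K * m₀ * Y) ⊛ hN)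

  many-good : N ^ m ≤ 2 * vcount m good
  many-good = cert 0 (ring (N ^ m) G b split) (*-cancelˡ-≤ K (≤-trans (≤-reflexive (many-good-ring₁ K b)) (≤-trans (2 ⊛ markov) Σcost)))
    where
    G b : ℕ
    G = vcount m good
    b = vsum m (λ S → ⟦ not (good S) ⟧)
    split : G + b ≡ N ^ m
    split = trans (sym (vsum-+ m (λ S → ⟦ good S ⟧) (λ S → ⟦ not (good S) ⟧))) (trans (vsum-cong m λ S → ⟦not⟧ (good S)) (trans (vsum-const N m 1) (*-identityʳ (N ^ m))))
    markov : K * b ≤ vsum m cost
    markov = ≤-trans (≤-reflexive (sym (vsum-*ˡ m K (λ S → ⟦ not (good S) ⟧)))) (vsum-mono m λ S → go S (cost S ≤? B))
      where
      go : ∀ S (d : Dec (cost S ≤ B)) → K * ⟦ not (does d) ⟧ ≤ cost S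
      go S (yes _) = ≤-trans (≤-reflexive (*-zeroʳ K)) z≤n
      go S (no n) = ≤-trans (≤-reflexive (*-identityʳ K)) (≰⇒> n)
    ring : ∀ X G b → G + b ≡ X → X + X + 0 ≡ 2 * G + 2 * b
    ring _ G b refl = many-good-ring₂ G b

  module _ (S : Vec (Fin N) m) (gS : good S ≡ true) where
    private
      cost≤ : cost S ≤ B
      cost≤ = does-true (cost S ≤? B) gS

      small⇒0 : ∀ {x} → K * x ≤ B → x ≡ 0
      small⇒0 {zero} _ = refl
      small⇒0 {suc x} h = ⊥-elim (<⇒≱ (n<1+n B) (≤-trans (m≤m*n K (suc x)) h))

      w≤ : ∀ j → w (lookup S j) (removeAt S j) ≤ B
      w≤ j = ≤-trans (term≤sum (λ j → w (lookup S j) (removeAt S j)) j) (≤-trans (m≤m+n _ _) cost≤)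

      no-clash : ∀ j → clash (lookup S j) (removeAt S j) ≡ 0
      no-clash j = small⇒0 (≤-trans (m≤n+m _ (light-int (lookup S j) (removeAt S j))) (w≤ j))

    good-≢F : ∀ j → lookup S j ≢ F
    good-≢F j e = case trans (sym (cong ⟦_⟧ (trans (cong (_== F) e) (==-refl F)))) (m+n≡0⇒m≡0 _ (no-clash j)) of λ ()

    good-distinct : ∀ i j → lookup S i ≡ lookup S j → i ≡ j
    good-distinct i j e = two-in (λ l → lookup S l == lookup S j) i j (subst (λ x → (x == lookup S j) ≡ true) (sym e) (==-refl _)) (==-refl _)
      (≤-reflexive (trans (sym (lin-sum (λ x → ⟦ x == lookup S j ⟧) S)) (trans (lin-remove (λ x → ⟦ x == lookup S j ⟧) S j)
        (cong₂ _+_ (cong ⟦_⟧ (==-refl (lookup S j))) (m+n≡0⇒n≡0 ⟦ lookup S j == F ⟧ (no-clash j))))))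

    good-ext : ∀ q → c * (m₀ * (m * QF.H q)) ≤ c * (N * (N * QF.T q S)) + N * N * (m * m) * κ
    good-ext q = does-not (_ ≤? _) (⟦⟧-zero (n≤0⇒n≡0 (≤-trans (term≤sum (λ q → ⟦ QF.Light q c S ⟧) q) (≤-reflexive (small⇒0 (≤-trans (m≤n+m (K * light-ext S) (sum λ j → w (lookup S j) (removeAt S j))) cost≤))))))
      where
      ⟦⟧-zero : ∀ {b} → ⟦ b ⟧ ≡ 0 → b ≡ false
      ⟦⟧-zero {false} _ = refl

    dark : Fin m → Bool
    dark j = does (light-int (lookup S j) (removeAt S j) ≟ℕ 0)

    many-dark : m ≤ sum (λ j → ⟦ dark j ⟧) + B
    many-dark = ≤-trans (≤-reflexive (sym (trans (sum-const m 1) (*-identityʳ m)))) (≤-trans (sum-mono pw) (≤-trans (≤-reflexive (sum-+ _ _))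
        (+-monoʳ-≤ (sum (λ j → ⟦ dark j ⟧)) (≤-trans (sum-mono λ j → m≤m+n (light-int (lookup S j) (removeAt S j)) (K * clash (lookup S j) (removeAt S j))) (≤-trans (m≤m+n _ (K * light-ext S)) cost≤)))))
      where
      pw : ∀ j → 1 ≤ ⟦ dark j ⟧ + light-int (lookup S j) (removeAt S j)
      pw j = go (light-int (lookup S j) (removeAt S j)) (_ ≟ℕ 0)
        where
        go : ∀ x (d : Dec (x ≡ 0)) → 1 ≤ ⟦ does d ⟧ + x
        go x (yes _) = s≤s z≤n
        go x (no n) = n≢0⇒n>0 n

    dark-int : ∀ j → dark j ≡ true → ∀ s → c * (m₀₀ * (m₀ * QI.H (lookup S j) s)) ≤ c * (N * (N * QI.T (lookup S j) s (removeAt S j))) + N * N * (m₀ * m₀) * κ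
    dark-int j e s = does-not (_ ≤? _) (⟦⟧-zero (n≤0⇒n≡0 (≤-trans (term≤sum (λ s → ⟦ QI.Light (lookup S j) s c (removeAt S j) ⟧) s) (≤-reflexive (does-true (_ ≟ℕ 0) e)))))
      where
      ⟦⟧-zero : ∀ {b} → ⟦ b ⟧ ≡ 0 → b ≡ false
      ⟦⟧-zero {false} _ = refl

-- Reindexing along an injection can only lower a sum of naturals; applied to C - f, this bounds the
-- loss in f.
sum-drop : ∀ {m m′} B (ι : Fin m′ → Fin m) → (∀ {i j} → ι i ≡ ι j → i ≡ j) → m ≤ m′ + B → (f : Fin m → ℕ) → ∀ C → (∀ i → f i ≤ C) →
  sum f ≤ sum (f ∘ ι) + B * C
sum-drop {m} {m′} B ι inj hm f C f≤ = cert 0 (ring (sum f) (sum (f ∘ ι)) (sum g) (sum (g ∘ ι)) m m′ B C e e′) (sum-reindex-≤ ι inj g ⊕ *-monoˡ-≤ C hm)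
  where
  g : Fin m → ℕ
  g i = C ∸ f i
  e : sum f + sum g ≡ m * C
  e = trans (sym (sum-+ f g)) (trans (sum-cong-≗ λ i → m+[n∸m]≡n (f≤ i)) (sum-const m C))
  e′ : sum (f ∘ ι) + sum (g ∘ ι) ≡ m′ * C
  e′ = trans (sym (sum-+ (f ∘ ι) (g ∘ ι))) (trans (sum-cong-≗ λ i → m+[n∸m]≡n (f≤ (ι i))) (sum-const m′ C))
  ring : ∀ F F′ G G′ m m′ B C → F + G ≡ m * C → F′ + G′ ≡ m′ * C → F + (G + (m′ + B) * C) + 0 ≡ F′ + B * C + (G′ + m * C)
  ring F F′ G G′ m m′ B C e e′ = trans (sum-drop-ring₁ F G m′ B C) (trans (cong (λ z → z + (m′ * C + B * C)) e) (trans (cong (λ z → m * C + (z + B * C)) (sym e′)) (sum-drop-ring₂ m F′ G′ B C)))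

lin-removeAt-≤ : ∀ {N m} (g : Fin N → ℕ) (S : Vec (Fin N) (suc m)) j → lin g (removeAt S j) ≤ lin g S
lin-removeAt-≤ g S j = ≤-trans (m≤n+m _ _) (≤-reflexive (sym (lin-remove g S j)))

-- The pattern induced by H on blocks β, keeping only edges across three different blocks.
module Blocks (k N : ℕ) (E : Fin (N * k) → Fin (N * k) → Fin (N * k) → Bool)
  (E₁₂ : ∀ x y z → E x y z ≡ E y x z) (E₂₃ : ∀ x y z → E x y z ≡ E x z y)
  (β : Fin N → Fin k → Fin (N * k)) (β-inj : ∀ {B B′ s s′} → β B s ≡ β B′ s′ → B ≡ B′ × s ≡ s′) where

  -- Three different blocks are required because an edge of the pattern must persist when each of
  -- its blocks is moved freely within its blow-up class; with different indices one sample can pass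
  -- through all the chosen blocks.
  pe : Fin N → Fin k → Fin N → Fin k → Fin N → Fin k → Bool
  pe A s B t C u = E (β A s) (β B t) (β C u) ∧ not (A == B) ∧ not (A == C) ∧ not (B == C)

  pe-true : ∀ {A s B t C u} → pe A s B t C u ≡ true → E (β A s) (β B t) (β C u) ≡ true × A ≢ B × A ≢ C × B ≢ C
  pe-true {A} {s} {B} {t} {C} {u} e =
    let e₁ , r₁ = ∧-true {E (β A s) (β B t) (β C u)} e
        e₂ , r₂ = ∧-true {not (A == B)} r₁
        e₃ , e₄ = ∧-true {not (A == C)} r₂
    in e₁ , ne e₂ , ne e₃ , ne e₄
    where
    ne : ∀ {X Y : Fin N} → not (X == Y) ≡ true → X ≢ Y
    ne {X} h refl = not-true h (==-refl X)

  pe-intro : ∀ {A s B t C u} → E (β A s) (β B t) (β C u) ≡ true → A ≢ B → A ≢ C → B ≢ C → pe A s B t C u ≡ true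
  pe-intro {A} {s} {B} {t} {C} {u} e n₁ n₂ n₃ = cong₂ _∧_ e (cong₂ _∧_ (cong not (==-≢ n₁)) (cong₂ _∧_ (cong not (==-≢ n₂)) (cong not (==-≢ n₃))))

  pe₁₂ : ∀ A s B t C u → pe A s B t C u ≡ pe B t A s C u
  pe₁₂ A s B t C u = bool-iff f f
    where
    f : ∀ {A s B t C u} → pe A s B t C u ≡ true → pe B t A s C u ≡ true
    f h = let e , n₁ , n₂ , n₃ = pe-true h in pe-intro (trans (E₁₂ _ _ _) e) (n₁ ∘ sym) n₃ n₂

  pe₂₃ : ∀ A s B t C u → pe A s B t C u ≡ pe A s C u B t
  pe₂₃ A s B t C u = bool-iff f f
    where
    f : ∀ {A s B t C u} → pe A s B t C u ≡ true → pe A s C u B t ≡ true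
    f h = let e , n₁ , n₂ , n₃ = pe-true h in pe-intro (trans (E₂₃ _ _ _) e) n₂ n₁ (n₃ ∘ sym)

  h : Fin N → Fin k → Fin N → Fin N → ℕ
  h A s B C = sum λ t → sum λ u → ⟦ pe A s B t C u ⟧

  κ : ℕ
  κ = k * k

  h≤ : ∀ A s B C → h A s B C ≤ κ
  h≤ A s B C = sum-≤const λ t → count≤k (λ u → pe A s B t C u)
    where
    count≤k : (p : Fin k → Bool) → sum (λ u → ⟦ p u ⟧) ≤ k
    count≤k p = ≤-trans (sum-≤const (λ u → ⟦⟧≤1 (p u))) (≤-reflexive (*-identityʳ k))

  h-diag : ∀ A s B → h A s B B ≡ 0
  h-diag A s B = trans (sum-cong-≗ λ t → trans (sum-cong-≗ λ u → z t u) (trans (sum-const k 0) (*-zeroʳ k))) (trans (sum-const k 0) (*-zeroʳ k))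
    where
    z : ∀ t u → ⟦ pe A s B t B u ⟧ ≡ 0
    z t u = n≤0⇒n≡0 (⟦⟧-cover λ e → ⊥-elim (proj₂ (proj₂ (proj₂ (pe-true e))) refl))

  private
    flat : Fin (N * k) → Fin (N * k)
    flat p = β (proj₁ (remQuot {N} k p)) (proj₂ (remQuot {N} k p))

    flat-inj : ∀ {p q} → flat p ≡ flat q → p ≡ q
    flat-inj {p} {q} e = let eB , es = β-inj e in trans (sym (combine-remQuot {N} k p)) (trans (cong₂ combine eB es) (combine-remQuot {N} k q))

  sum-blocks : (f : Fin (N * k) → ℕ) → sum f ≡ sum (λ B → sum λ s → f (β B s))
  sum-blocks f = trans (sym (sum-reindex flat flat-inj f)) (trans (sum-combine N _) (sum-cong-≗ λ B → sum-cong-≗ λ s →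
     cong (λ w → f (β (proj₁ w) (proj₂ w))) (remQuot-combine {N} {k} B s)))

  link≤ : ∀ A s → link (E (β A s)) ≤ sum (λ B → sum (h A s B)) + 3 * (N * κ)
  link≤ A s = begin
    link (E (β A s)) ≡⟨ trans (sum-blocks _) (sum-cong-≗ λ B → sum-cong-≗ λ t → sum-blocks _) ⟩
    sum (λ B → sum λ t → sum λ C → sum λ u → ⟦ E (β A s) (β B t) (β C u) ⟧) ≡⟨ sum-cong-≗ (λ B → sum-swap _) ⟩
    sum (λ B → sum λ C → sum λ t → sum λ u → ⟦ E (β A s) (β B t) (β C u) ⟧) ≤⟨ sum-mono (λ B → sum-mono λ C → inner B C) ⟩
    sum (λ B → sum λ C → h A s B C + (κ * ⟦ A == B ⟧ + κ * ⟦ A == C ⟧ + κ * ⟦ B == C ⟧))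
      ≡⟨ trans (sum-cong-≗ λ B → trans (sum-+ _ _) (cong (sum (h A s B) +_) (trans (sum-+ _ _) (cong₂ _+_ (trans (sum-+ _ _)
           (cong₂ _+_ (sum-const N _) (trans (sum-*ˡ κ _) (trans (cong (κ *_) (sum-δ′ A)) (*-identityʳ κ))))) (trans (sum-*ˡ κ _) (trans (cong (κ *_) (sum-δ′ B)) (*-identityʳ κ))))))) (sum-+ _ _) ⟩
    sum (λ B → sum (h A s B)) + sum (λ B → N * (κ * ⟦ A == B ⟧) + κ + κ)
      ≡⟨ cong (sum (λ B → sum (h A s B)) +_) (trans (sum-+ _ _) (cong₂ _+_ (trans (sum-+ _ _) (cong₂ _+_ (trans (sum-*ˡ N _) (cong (N *_) (trans (sum-*ˡ κ _) (trans (cong (κ *_) (sum-δ′ A)) (*-identityʳ κ))))) (sum-const N κ))) (sum-const N κ))) ⟩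
    sum (λ B → sum (h A s B)) + (N * κ + N * κ + N * κ) ≡⟨ cong (sum (λ B → sum (h A s B)) +_) (link≤-ring₁ (N * κ)) ⟩
    sum (λ B → sum (h A s B)) + 3 * (N * κ) ∎
    where
    open ≤-Reasoning
    pw : ∀ B t C u → ⟦ E (β A s) (β B t) (β C u) ⟧ ≤ ⟦ pe A s B t C u ⟧ + (⟦ A == B ⟧ + ⟦ A == C ⟧ + ⟦ B == C ⟧)
    pw B t C u = go (E (β A s) (β B t) (β C u)) (A == B) (A == C) (B == C)
      where
      go : ∀ e x y z → ⟦ e ⟧ ≤ ⟦ e ∧ not x ∧ not y ∧ not z ⟧ + (⟦ x ⟧ + ⟦ y ⟧ + ⟦ z ⟧)
      go false x y z = z≤n
      go true true y z = s≤s z≤n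
      go true false true z = s≤s z≤n
      go true false false true = s≤s z≤n
      go true false false false = s≤s z≤n
    inner : ∀ B C → sum (λ t → sum λ u → ⟦ E (β A s) (β B t) (β C u) ⟧) ≤ h A s B C + (κ * ⟦ A == B ⟧ + κ * ⟦ A == C ⟧ + κ * ⟦ B == C ⟧)
    inner B C = ≤-trans (sum-mono λ t → sum-mono λ u → pw B t C u) (≤-reflexive (trans (sum-cong-≗ λ t → trans (sum-+ _ _) (cong (sum (λ u → ⟦ pe A s B t C u ⟧) +_) (sum-const k _)))
      (trans (sum-+ _ _) (cong (h A s B C +_) (trans (sum-const k _) (link≤-ring₂ k ⟦ A == B ⟧ ⟦ A == C ⟧ ⟦ B == C ⟧))))))

  module Sampled (F : Fin N) {m : ℕ} where
    blk : Vec (Fin N) m → Fin k ⊎ Fin (m * k) → Fin N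
    blk S (inj₁ q) = F
    blk S (inj₂ y) = lookup S (proj₁ (remQuot {m} k y))

    sl : Fin k ⊎ Fin (m * k) → Fin k
    sl (inj₁ q) = q
    sl (inj₂ y) = proj₂ (remQuot {m} k y)

    PE : Vec (Fin N) m → Fin k ⊎ Fin (m * k) → Fin (m * k) → Fin (m * k) → Bool
    PE S e y z = pe (blk S e) (sl e) (blk S (inj₂ y)) (sl (inj₂ y)) (blk S (inj₂ z)) (sl (inj₂ z))

    module Restricted {m′} (ι : Fin m′ → Fin m) where
      ι* : Fin (m′ * k) → Fin (m * k)
      ι* y = combine (ι (proj₁ (remQuot {m′} k y))) (proj₂ (remQuot {m′} k y))

      ι⁺ : Fin k ⊎ Fin (m′ * k) → Fin k ⊎ Fin (m * k)
      ι⁺ (inj₁ q) = inj₁ q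
      ι⁺ (inj₂ y) = inj₂ (ι* y)

      E₀ : Vec (Fin N) m → Fin k ⊎ Fin (m′ * k) → Fin (m′ * k) → Fin (m′ * k) → Bool
      E₀ S e y z = PE S (ι⁺ e) (ι* y) (ι* z)

      link-E₀ : ∀ S e → link (E₀ S e) ≡ sum (λ i → sum λ j → h (blk S (ι⁺ e)) (sl (ι⁺ e)) (lookup S (ι i)) (lookup S (ι j)))
      link-E₀ S e = trans (sum-combine m′ _) (trans (sum-cong-≗ λ i → trans (sum-cong-≗ λ t → trans (sum-combine m′ _)
          (sum-cong-≗ λ j → sum-cong-≗ λ u → cong ⟦_⟧ (pt i t j u))) (sum-swap _)) refl)
        where
        rq : ∀ i t → remQuot {m} k (ι* (combine {m′} i t)) ≡ (ι i , t)
        rq i t = trans (remQuot-combine _ _) (cong (λ w → ι (proj₁ w) , proj₂ w) (remQuot-combine {m′} {k} i t))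
        pt : ∀ i t j u → E₀ S e (combine i t) (combine j u) ≡ pe (blk S (ι⁺ e)) (sl (ι⁺ e)) (lookup S (ι i)) t (lookup S (ι j)) u
        pt i t j u = cong₂ (λ v w → pe (blk S (ι⁺ e)) (sl (ι⁺ e)) (lookup S (proj₁ v)) (proj₂ v) (lookup S (proj₁ w)) (proj₂ w)) (rq i t) (rq j u)

      drop-≤ : ∀ B S A s → (∀ {i j} → ι i ≡ ι j → i ≡ j) → m′ ≤ m → m ≤ m′ + B →
        sum (λ i → lin (h A s (lookup S i)) S) ≤ sum (λ i → sum λ j → h A s (lookup S (ι i)) (lookup S (ι j))) + 2 * (B * m * κ)
      drop-≤ B S A s inj m′≤ m≤ = begin
        sum (λ i → lin (h A s (lookup S i)) S) ≡⟨ sum-cong-≗ (λ i → lin-sum (h A s (lookup S i)) S) ⟩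
        sum (λ i → sum λ j → h A s (lookup S i) (lookup S j)) ≤⟨ sum-drop B ι inj m≤ _ (m * κ) (λ i → sum-≤const λ j → h≤ A s _ _) ⟩
        sum (λ i → sum λ j → h A s (lookup S (ι i)) (lookup S j)) + B * (m * κ)
          ≤⟨ +-monoˡ-≤ _ (sum-mono λ i → sum-drop B ι inj m≤ (λ j → h A s (lookup S (ι i)) (lookup S j)) κ λ j → h≤ A s _ _) ⟩
        sum (λ i → sum (λ j → h A s (lookup S (ι i)) (lookup S (ι j))) + B * κ) + B * (m * κ)
          ≡⟨ cong (_+ B * (m * κ)) (trans (sum-+ _ _) (cong (sum (λ i → sum λ j → h A s (lookup S (ι i)) (lookup S (ι j))) +_) (sum-const m′ (B * κ)))) ⟩
        sum (λ i → sum λ j → h A s (lookup S (ι i)) (lookup S (ι j))) + m′ * (B * κ) + B * (m * κ)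
          ≤⟨ +-monoˡ-≤ _ (+-monoʳ-≤ (sum (λ i → sum λ j → h A s (lookup S (ι i)) (lookup S (ι j)))) (*-monoˡ-≤ (B * κ) m′≤)) ⟩
        sum (λ i → sum λ j → h A s (lookup S (ι i)) (lookup S (ι j))) + m * (B * κ) + B * (m * κ)
          ≡⟨ drop-≤-ring (sum (λ i → sum λ j → h A s (lookup S (ι i)) (lookup S (ι j)))) m B κ ⟩
        sum (λ i → sum λ j → h A s (lookup S (ι i)) (lookup S (ι j))) + 2 * (B * m * κ) ∎
        where
        open ≤-Reasoning

row-remove-≤ : ∀ {N m} (h : Fin N → Fin N → ℕ) (S : Vec (Fin N) (suc m)) j →
  sum (λ i → lin (h (lookup (removeAt S j) i)) (removeAt S j)) ≤ sum (λ i → lin (h (lookup S i)) S)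
row-remove-≤ h S j = ≤-trans (sum-mono λ i → lin-removeAt-≤ (h (lookup (removeAt S j) i)) S j)
  (≤-trans (≤-reflexive (sym (lin-sum (λ x → lin (h x) S) (removeAt S j)))) (≤-trans (lin-removeAt-≤ (λ x → lin (h x) S) S j) (≤-reflexive (lin-sum (λ x → lin (h x) S) S))))

-- The upper bound

countTrue-tabulate : ∀ {A : Set} {n} (p : A → Bool) (f : Fin n → A) → countTrue p (L.tabulate f) ≡ sum (λ i → ⟦ p (f i) ⟧)
countTrue-tabulate {n = zero} p f = sym (sum-nil _)
countTrue-tabulate {n = suc n} p f with p (f zero) in e
... | true = trans (cong suc (countTrue-tabulate p (f ∘ suc))) (sym (trans (sum-suc _) (cong (λ b → ⟦ b ⟧ + sum (λ i → ⟦ p (f (suc i)) ⟧)) e)))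
... | false = trans (countTrue-tabulate p (f ∘ suc)) (sym (trans (sum-suc _) (cong (λ b → ⟦ b ⟧ + sum (λ i → ⟦ p (f (suc i)) ⟧)) e)))

countTrue-++ : ∀ {A : Set} (p : A → Bool) xs ys → countTrue p (xs ++ ys) ≡ countTrue p xs + countTrue p ys
countTrue-++ p [] ys = refl
countTrue-++ p (x ∷ xs) ys with p x
... | true = cong suc (countTrue-++ p xs ys)
... | false = countTrue-++ p xs ys

countTrue-map : ∀ {A B : Set} (p : B → Bool) (f : A → B) xs → countTrue p (L.map f xs) ≡ countTrue (p ∘ f) xs
countTrue-map p f [] = refl
countTrue-map p f (x ∷ xs) with p (f x)
... | true = cong suc (countTrue-map p f xs)
... | false = countTrue-map p f xs

countTrue-product : ∀ {A B : Set} {n} (p : A × B → Bool) (f : Fin n → A) (ys : List B) →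
  countTrue p (L.cartesianProduct (L.tabulate f) ys) ≡ sum (λ i → countTrue (λ y → p (f i , y)) ys)
countTrue-product {n = zero} p f ys = sym (sum-nil _)
countTrue-product {n = suc n} p f ys = trans (countTrue-++ p (L.map (f zero ,_) ys) _)
  (trans (cong₂ _+_ (countTrue-map p (f zero ,_) ys) (countTrue-product p (f ∘ suc) ys)) (sym (sum-suc _)))

module _ {n} (H : ThreeGraph n) where
  -- The values of `edge` on degenerate triples are arbitrary; cutting them off makes links agree
  -- with degrees.
  proper : Fin n → Fin n → Fin n → Bool
  proper x y z = edge H x y z ∧ not (x == y) ∧ not (x == z) ∧ not (y == z)

  proper-edge : ∀ {x y z} → proper x y z ≡ true → edge H x y z ≡ true × x ≢ y × x ≢ z × y ≢ z
  proper-edge {x} {y} {z} e =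
    let e₁ , r₁ = ∧-true {edge H x y z} e
        e₂ , r₂ = ∧-true {not (x == y)} r₁
        e₃ , e₄ = ∧-true {not (x == z)} r₂
    in e₁ , ne e₂ , ne e₃ , ne e₄
    where
    ne : ∀ {X Y : Fin n} → not (X == Y) ≡ true → X ≢ Y
    ne {X} h refl = not-true h (==-refl X)

  proper-intro : ∀ {x y z} → edge H x y z ≡ true → x ≢ y → x ≢ z → y ≢ z → proper x y z ≡ true
  proper-intro e n₁ n₂ n₃ = cong₂ _∧_ e (cong₂ _∧_ (cong not (==-≢ n₁)) (cong₂ _∧_ (cong not (==-≢ n₂)) (cong not (==-≢ n₃))))

  proper₁₂ : ∀ x y z → proper x y z ≡ proper y x z
  proper₁₂ x y z = bool-iff f f
    where
    f : ∀ {x y z} → proper x y z ≡ true → proper y x z ≡ true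
    f h = let e , n₁ , n₂ , n₃ = proper-edge h in proper-intro (trans (sym₁₂ H _ _ _) e) (n₁ ∘ sym) n₃ n₂

  proper₂₃ : ∀ x y z → proper x y z ≡ proper x z y
  proper₂₃ x y z = bool-iff f f
    where
    f : ∀ {x y z} → proper x y z ≡ true → proper x z y ≡ true
    f h = let e , n₁ , n₂ , n₃ = proper-edge h in proper-intro (trans (sym₂₃ H _ _ _) e) n₂ n₁ (n₃ ∘ sym)

  degree-sum : ∀ v → degree H v ≡ sum (λ x → sum λ y → ⟦ does (toℕ x <? toℕ y) ⟧ * ⟦ proper v x y ⟧)
  degree-sum v = trans (countTrue-product _ id (L.allFin n)) (sum-cong-≗ λ x → trans (countTrue-tabulate _ id) (sum-cong-≗ λ y → pw x y))
    where
    pw : ∀ x y → ⟦ does (toℕ x <? toℕ y) ∧ not (does (x ≟F v)) ∧ not (does (y ≟F v)) ∧ edge H v x y ⟧ ≡ ⟦ does (toℕ x <? toℕ y) ⟧ * ⟦ proper v x y ⟧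
    pw x y = trans (cong ⟦_⟧ (bool-iff f g)) (⟦∧⟧ (does (toℕ x <? toℕ y)) (proper v x y))
      where
      f : (does (toℕ x <? toℕ y) ∧ not (does (x ≟F v)) ∧ not (does (y ≟F v)) ∧ edge H v x y) ≡ true → (does (toℕ x <? toℕ y) ∧ proper v x y) ≡ true
      f h = let l , r = ∧-true {does (toℕ x <? toℕ y)} h
                a , r′ = ∧-true {not (does (x ≟F v))} r
                b , e = ∧-true {not (does (y ≟F v))} r′
            in cong₂ _∧_ l (proper-intro e (λ q → not-true a (dec-true (x ≟F v) (sym q))) (λ q → not-true b (dec-true (y ≟F v) (sym q)))
                 λ q → <-irrefl (cong toℕ q) (does-true (toℕ x <? toℕ y) l))
      g : (does (toℕ x <? toℕ y) ∧ proper v x y) ≡ true → (does (toℕ x <? toℕ y) ∧ not (does (x ≟F v)) ∧ not (does (y ≟F v)) ∧ edge H v x y) ≡ true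
      g h = let l , r = ∧-true {does (toℕ x <? toℕ y)} h
                e , n₁ , n₂ , _ = proper-edge r
            in cong₂ _∧_ l (cong₂ _∧_ (cong not (dec-false (x ≟F v) (n₁ ∘ sym))) (cong₂ _∧_ (cong not (dec-false (y ≟F v) (n₂ ∘ sym))) e))

  link-degree : ∀ v → link (proper v) ≡ 2 * degree H v
  link-degree v = trans (sum-cong-≗ λ x → trans (sum-cong-≗ λ y → pw x y) (sum-+ _ _)) (trans (sum-+ _ _)
      (trans (cong₂ _+_ (sym (degree-sum v)) (trans (sum-swap _) (trans (sum-cong-≗ λ y → sum-cong-≗ λ x → cong (λ b → ⟦ does (toℕ y <? toℕ x) ⟧ * ⟦ b ⟧) (proper₂₃ v x y)) (sym (degree-sum v)))))
        (cong (degree H v +_) (sym (+-identityʳ _)))))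
    where
    pw : ∀ x y → ⟦ proper v x y ⟧ ≡ ⟦ does (toℕ x <? toℕ y) ⟧ * ⟦ proper v x y ⟧ + ⟦ does (toℕ y <? toℕ x) ⟧ * ⟦ proper v x y ⟧
    pw x y with <-cmp (toℕ x) (toℕ y)
    ... | tri< l _ g = sym (trans (cong₂ (λ u w → ⟦ u ⟧ * ⟦ proper v x y ⟧ + ⟦ w ⟧ * ⟦ proper v x y ⟧) (dec-true (toℕ x <? toℕ y) l) (dec-false (toℕ y <? toℕ x) g)) (trans (+-identityʳ _) (+-identityʳ _)))
    ... | tri> l _ g = sym (trans (cong₂ (λ u w → ⟦ u ⟧ * ⟦ proper v x y ⟧ + ⟦ w ⟧ * ⟦ proper v x y ⟧) (dec-false (toℕ x <? toℕ y) l) (dec-true (toℕ y <? toℕ x) g)) (+-identityʳ _))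
    ... | tri≈ l q g = trans z (sym (cong₂ (λ u w → ⟦ u ⟧ * ⟦ proper v x y ⟧ + ⟦ w ⟧ * ⟦ proper v x y ⟧) (dec-false (toℕ x <? toℕ y) l) (dec-false (toℕ y <? toℕ x) g)))
      where
      z : ⟦ proper v x y ⟧ ≡ 0
      z = n≤0⇒n≡0 (⟦⟧-cover λ e → ⊥-elim (proj₂ (proj₂ (proj₂ (proper-edge e))) (toℕ-injective q)))

-- Passing to the pattern of a sample loses a little density. Refining the denominator and lowering
-- the numerator by one makes room for this loss, since all conditions are strict.
Good-slack : ∀ {P Q a b c} → Good P Q a b c → ∃ λ P′ → ∃ λ g → suc P′ ≡ P * g × Good P′ (Q * g) a b c
Good-slack {P} {Q} {a} {b} {c} (c₁ , c₂ , c₃ , c₄) = P′ , g , sP , d₁ , d₂ , d₃ c₃ , d₄ c₄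
  where
  κ g P′ : ℕ
  κ = (a + b + c) * (a + b + c)
  -- Refinement multiplies a gap of 1 by g, and by g² in the quadratic condition. Lowering P g by 1
  -- costs κ in the space conditions, at most 9 in the connecting ones and at most 12Qg in the
  -- quadratic one.
  g = suc κ + 12 * Q + 10
  P′ = P * g ∸ 1
  P>0 : 0 < P
  P>0 = n≢0⇒n>0 λ { refl → <⇒≱ c₂ z≤n }
  sP : suc P′ ≡ P * g
  sP = m+[n∸m]≡n (*-mono-≤ P>0 (≤-trans (m≤n+m 1 (suc κ + 12 * Q + 9)) (≤-reflexive (Good-slack-ring₁ κ Q))))
  κ<g : suc κ ≤ g
  κ<g = ≤-trans (m≤m+n (suc κ) (12 * Q)) (m≤m+n _ 10)
  12Q≤g : 12 * Q ≤ g
  12Q≤g = ≤-trans (m≤n+m (12 * Q) (suc κ)) (m≤m+n _ 10)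
  10≤g : 10 ≤ g
  10≤g = m≤n+m 10 (suc κ + 12 * Q)
  rescale : ∀ u v w → Q * u < P * v + Q * w → v < g → Q * g * u < P′ * v + Q * g * w
  rescale u v w h hv = cert 0 (trans (Good-slack-ring₂ Q g u v w P) (trans (cong (λ z → z * v + (1 + Q * g * u + Q * g * w + g)) (sym sP)) (Good-slack-ring₃ Q g u v w P′))) (g ⊛ h ⊕ hv)
  rescale₀ : ∀ u v → u * Q < v * P → v < g → u * (Q * g) < v * P′
  rescale₀ u v h hv = subst₂ _<_ (*-comm (Q * g) u) (trans (cong₂ _+_ (*-comm P′ v) (*-zeroʳ (Q * g))) (+-identityʳ _))
    (rescale u v 0 (subst₂ _<_ (*-comm u Q) (sym (trans (cong₂ _+_ (*-comm P v) (*-zeroʳ Q)) (+-identityʳ _))) h) hv)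
  d₁ : Q * g * κ < P′ * κ + Q * g * ((b + c) * (b + c))
  d₁ = rescale κ κ _ c₁ κ<g
  d₂ : Q * g * ((a + b) * (a + b)) < P′ * κ
  d₂ = subst₂ _<_ (*-comm ((a + b) * (a + b)) (Q * g)) (*-comm κ P′) (rescale₀ ((a + b) * (a + b)) κ (subst₂ _<_ (*-comm Q _) (*-comm P κ) c₂) κ<g)
  d₃ : a ≡ 1 ⊎ 4 * (Q * Q) + P * P < 12 * (P * Q) → a ≡ 1 ⊎ 4 * (Q * g * (Q * g)) + P′ * P′ < 12 * (P′ * (Q * g))
  d₃ (inj₁ e) = inj₁ e
  d₃ (inj₂ h) = inj₂ (cert (2 * P′) (trans (Good-slack-ring₄ Q g P P′) (trans (cong (λ z → 1 + 4 * (Q * g * (Q * g)) + P′ * P′ + (12 * (z * (Q * g)) + g * g) + 2 * P′) (sym sP))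
      (trans (Good-slack-ring₅ Q g P′) (trans (cong (λ z → 12 * (P′ * (Q * g)) + (g * g + 4 * (Q * g * (Q * g)) + z * z + g * (12 * Q))) sP) (Good-slack-ring₆ Q g P P′)))))
      ((g * g) ⊛ h ⊕ g ⊛ 12Q≤g))
  small : ∀ {v} → v < 10 → v < g
  small h = <-≤-trans h 10≤g
  d₄ : Connecting P Q a b c → Connecting P′ (Q * g) a b c
  d₄ (inj₁ (d , h)) = inj₁ (d , subst (_< 4 * P′) (*-identityˡ (Q * g)) (rescale₀ 1 4 (subst (_< 4 * P) (sym (*-identityˡ Q)) h) (small (m≤m+n 5 5))))
  d₄ (inj₂ (inj₁ (e , o , h))) = inj₂ (inj₁ (e , o , rescale₀ 4 9 h (small ≤-refl)))
  d₄ (inj₂ (inj₂ h)) = inj₂ (inj₂ (subst (_< 2 * P′) (*-identityˡ (Q * g)) (rescale₀ 1 2 (subst (_< 2 * P) (sym (*-identityˡ Q)) h) (small (m≤m+n 3 7)))))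

-- Making one more block real

module Augment (a′ b c P Q : ℕ) (a≤b : suc a′ ≤ b) (b≤c : b ≤ c) (good₀ : Good P Q (suc a′) b c) where
  open Patterns a′ b c P Q a≤b b≤c good₀

  record Improved {N} (E : Fin (N * k) → Fin (N * k) → Fin (N * k) → Bool) (β : Fin N → Fin k → Fin (N * k)) (F : Fin N) : Set where
    field
      β⁺ : Fin N → Fin k → Fin (N * k)
      β⁺-inj : ∀ {B B′ s s′} → β⁺ B s ≡ β⁺ B′ s′ → B ≡ B′ × s ≡ s′
      keeps : ∀ B → Real E (β B) → Real E (β⁺ B)
      gains : Real E (β⁺ F)

  -- B + e + 2 blocks are sampled, of which e + 2 survive.
  module At (B e : ℕ) (B≥2 : 2 ≤ B) (e≥1 : 1 ≤ e) (B-big : 48 * (k * ((4 * Q + 2) * (4 * Q + 2))) ≤ suc B)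
    (e-big₁ : 24 * (k * ((4 * Q + 2) * (4 * Q + 2))) ≤ e) (e-big₂ : 8 * (Q * B) ≤ e) where

    m′ m₀₀ m c₀ T t nf C : ℕ
    m′ = suc (suc e)
    m₀₀ = e + B
    m = suc (suc m₀₀)
    c₀ = 4 * Q + 2

    abstract
      pattern-size : ∃ λ T → ∀ (E⁺ : Fin k ⊎ Fin (m′ * k) → Fin (m′ * k) → Fin (m′ * k) → Bool) → Dense E⁺ → ∃ λ t → t ≤ T × Tiled E⁺ t
      pattern-size = uniform {a′ + b + c + suc e * k} m′ refl

    T = proj₁ pattern-size
    -- Never 0, so that every blow-up class contains a block and `Fin t` has a default element.
    t = suc T
    nf = bits {m * k}
    -- At least half of the samples are good, and homogenising the nf entries of the pattern keeps
    -- one in `2 ^ nf` of them.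
    C = 2 * 2 ^ nf

    abstract
      blow : ∃ λ N₀ → ∀ N → N₀ ≤ N → ∀ (W : Vec (Fin N) m → Bool) → N ^ m ≤ C * vcount m W →
        ∃ λ (T : Fin m → Fin t → Fin N) → (∀ i {j j′} → T i j ≡ T i j′ → j ≡ j′) × Boxed W T
      blow = blow-up m t C z<s

    N₁ : ℕ
    N₁ = suc (proj₁ blow + 6 * (m * m) + 3 * Q * c₀)

    module Run {N : ℕ} (N≥ : N₁ ≤ N) (E : Fin (N * k) → Fin (N * k) → Fin (N * k) → Bool)
      (E₁₂ : ∀ x y z → E x y z ≡ E y x z) (E₂₃ : ∀ x y z → E x y z ≡ E x z y)
      (deg : ∀ v → suc P * (N * k * (N * k)) ≤ Q * link (E v))
      (β : Fin N → Fin k → Fin (N * k)) (β-inj : ∀ {B B′ s s′} → β B s ≡ β B′ s′ → B ≡ B′ × s ≡ s′) (F : Fin N) where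

      N>0 : 0 < N
      N>0 = <-≤-trans z<s N≥

      open Blocks k N E E₁₂ E₂₃ β β-inj
      module G = GoodSamples F h κ h≤ h-diag m₀₀ c₀ B N>0 (s≤s z≤n) B-big
        (≤-trans e-big₁ (≤-trans (m≤m+n e B) (n≤1+n m₀₀)))
        (≤-trans (≤-trans (m≤n+m _ (proj₁ blow)) (≤-trans (m≤m+n _ (3 * Q * c₀)) (n≤1+n _))) N≥)
      open Sampled F {m}

      -- The entries of the pattern as Boolean properties of the sample; once all are constant, so
      -- is the pattern.
      φ : Fin nf → Vec (Fin N) m → Bool
      φ i S = PE S (proj₁ (unindex i)) (proj₁ (proj₂ (unindex i))) (proj₂ (proj₂ (unindex i)))

      dense-at : ∀ {A s G T μ₀ μ} → c₀ * (μ₀ * (μ * sum (λ B → sum (h A s B)))) ≤ c₀ * (N * (N * T)) + N * N * (μ * μ) * κ →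
        T ≤ G + 2 * (B * m * κ) → m′ ≤ μ₀ → μ₀ ≤ μ → μ ≤ 2 * μ₀ → m ≤ 2 * μ → e ≤ μ₀ → P * (m′ * k * (m′ * k)) ≤ Q * G
      dense-at {A} {s} {G} {T} {μ₀} {μ} hT hG h₁ h₂ h₃ h₄ h₅ = ≤-trans (≤-reflexive (dense-at-ring₁ P m′ k))
        (sample-arith {P} {Q} {κ} {N} {sum (λ B → sum (h A s B))} {T} {G} {B} {m} {m′} {μ₀} {μ} N>0
          (≤-trans (≤-trans (m≤n+m _ (proj₁ blow + 6 * (m * m))) (n≤1+n _)) N≥)
          (≤-trans (≤-reflexive (dense-at-ring₂ P N k)) (≤-trans (deg (β A s)) (Q ⊛ link≤ A s))) hT hG h₁ h₂ h₃ h₄ (≤-trans e-big₂ h₅))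

      -- W consists of good samples with one common pattern. `S₀` is an arbitrary member: it fixes
      -- this pattern and the dark indices that are kept, while the box supplies the blocks.
      module WithBox (W : Vec (Fin N) m → Bool) (sub : ∀ S → W S ≡ true → G.good S ≡ true)
        (same : ∀ i S S′ → W S ≡ true → W S′ ≡ true → φ i S ≡ φ i S′)
        (Tb : Fin m → Fin t → Fin N) (Tb-inj : ∀ i {j j′} → Tb i j ≡ Tb i j′ → j ≡ j′) (box : Boxed W Tb)
        (S₀ : Vec (Fin N) m) (w₀ : W S₀ ≡ true)
        (ι : Fin m′ → Fin m) (ι-inj : ∀ {i j} → ι i ≡ ι j → i ≡ j) (ι-dark : ∀ i → G.dark S₀ (sub S₀ w₀) (ι i) ≡ true) where

        open Restricted ι

        g₀ : G.good S₀ ≡ true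
        g₀ = sub S₀ w₀

        dense₀ : Dense (E₀ S₀)
        dense₀ = record { sym₁₂′ = λ x y z → pe₁₂ _ _ _ _ _ _ ; sym₂₃′ = λ x y z → pe₂₃ _ _ _ _ _ _ ; dense = dn }
          where
          m′≤m : m′ ≤ m
          m′≤m = s≤s (s≤s (m≤m+n e B))
          dn : ∀ e → P * (m′ * k * (m′ * k)) ≤ Q * link (E₀ S₀ e)
          dn (inj₁ q) = ≤-trans (dense-at {F} {q} {T = G.QF.T q S₀} {μ₀ = G.m₀} {μ = G.m} (G.good-ext S₀ g₀ q) (drop-≤ B S₀ F q ι-inj m′≤m ≤-refl)
              (s≤s (≤-trans (≤-reflexive (+-comm 1 e)) (+-monoʳ-≤ e (≤-trans (n≤1+n 1) B≥2))))
              (n≤1+n G.m₀) (s≤s (≤-trans (m≤n+m (suc m₀₀) m₀₀) (+-monoʳ-≤ m₀₀ (m≤m+n (suc m₀₀) 0)))) (m≤m+n m _) (≤-trans (m≤m+n e B) (n≤1+n m₀₀)))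
            (≤-reflexive (cong (Q *_) (sym (link-E₀ S₀ (inj₁ q)))))
          -- The concentration for a vertex of the sample was tested without its own block; putting
          -- this block back only adds pairs.
          dn (inj₂ y) = ≤-trans (dense-at {A} {s} {T = G.QI.T A s (removeAt S₀ l)} {μ₀ = m₀₀} {μ = G.m₀} (G.dark-int S₀ g₀ l dk s)
              (≤-trans (row-remove-≤ (h A s) S₀ l) (drop-≤ B S₀ A s ι-inj m′≤m ≤-refl))
              (≤-trans (≤-reflexive (+-comm 2 e)) (+-monoʳ-≤ e B≥2)) (n≤1+n m₀₀)
              (≤-trans (≤-reflexive (+-comm 1 m₀₀)) (+-monoʳ-≤ m₀₀ (≤-trans (≤-trans e≥1 (m≤m+n e B)) (m≤m+n m₀₀ 0))))
              (s≤s (≤-trans (m≤n+m (suc m₀₀) m₀₀) (+-monoʳ-≤ m₀₀ (m≤m+n (suc m₀₀) 0)))) (m≤m+n e B))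
            (≤-reflexive (cong (Q *_) (sym (link-E₀ S₀ (inj₂ y)))))
            where
            l : Fin m
            l = proj₁ (remQuot {m} k (ι* y))
            A : Fin N
            A = lookup S₀ l
            s : Fin k
            s = proj₂ (remQuot {m} k (ι* y))
            dk : G.dark S₀ g₀ l ≡ true
            dk = subst (λ i → G.dark S₀ g₀ i ≡ true) (sym (cong proj₁ (remQuot-combine {m} {k} (ι (proj₁ (remQuot {m′} k y))) _))) (ι-dark (proj₁ (remQuot {m′} k y)))

        vec : (Fin m → Fin t) → Vec (Fin N) m
        vec τ = tabulate λ l → Tb l (τ l)

        vec-at : ∀ τ l → lookup (vec τ) l ≡ Tb l (τ l)
        vec-at τ l = lookup∘tabulate (λ l → Tb l (τ l)) l

        vec-W : ∀ τ → W (vec τ) ≡ true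
        vec-W τ = box (vec τ) λ l → τ l , vec-at τ l

        place : Fin m → Fin t → (Fin m → Fin t) → Fin m → Fin t
        place l j τ x = if x == l then j else τ x

        place-here : ∀ l j τ → place l j τ l ≡ j
        place-here l j τ = cong (λ b → if b then j else τ l) (==-refl l)

        place-there : ∀ l j τ {x} → x ≢ l → place l j τ x ≡ τ x
        place-there l j τ {x} n = cong (λ b → if b then j else τ x) (==-≢ n)

        -- For different indices one sample in the box contains both blocks, and the blocks of a
        -- good sample are distinct.
        Tb-distinct : ∀ {l l′ j j′} → Tb l j ≡ Tb l′ j′ → l ≡ l′ × j ≡ j′
        Tb-distinct {l} {l′} {j} {j′} q = go (l ≟F l′)
          where
          τ : Fin m → Fin t
          τ = place l j λ _ → j′
          go : Dec (l ≡ l′) → l ≡ l′ × j ≡ j′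
          go (yes refl) = refl , Tb-inj l q
          go (no n) = ⊥-elim (n (G.good-distinct (vec τ) (sub _ (vec-W τ)) l l′ (trans (vec-at τ l) (trans (cong (Tb l) (place-here l j _))
             (trans q (sym (trans (vec-at τ l′) (cong (Tb l′) (place-there l j _ (n ∘ sym))))))))))

        Tb≢F : ∀ {l j} → Tb l j ≢ F
        Tb≢F {l} {j} q = G.good-≢F (vec λ _ → j) (sub _ (vec-W λ _ → j)) l (trans (vec-at (λ _ → j) l) q)

        improved : (∃ λ t₀ → t₀ ≤ T × Tiled (E₀ S₀) t₀) → Improved E β F
        improved (t₀ , t₀≤ , Bal , valid) = record { β⁺ = R.β′ ; β⁺-inj = R.β′-inj ; keeps = R.β′-keeps edges ; gains = R.β′-F edges }
          where
          up : Fin t₀ → Fin t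
          up j = inject≤ j (≤-trans t₀≤ (n≤1+n T))
          T₀ : Fin m′ → Fin t₀ → Fin N
          T₀ i j = Tb (ι i) (up j)
          T₀-inj : ∀ {i i′ j j′} → T₀ i j ≡ T₀ i′ j′ → i ≡ i′ × j ≡ j′
          T₀-inj q = let el , ej = Tb-distinct q in ι-inj el , inject≤-injective _ _ _ _ ej
          module R = Realize E β β-inj F T₀ T₀-inj Tb≢F Bal
          fst : Fin (m′ * k) → Fin m′
          fst x = proj₁ (remQuot {m′} k x)
          snd : Fin (m′ * k) → Fin k
          snd x = proj₂ (remQuot {m′} k x)
          blk′ : Vec (Fin N) m → Fin k ⊎ Fin (m′ * k) → Fin N
          blk′ S (inj₁ q) = F
          blk′ S (inj₂ x) = lookup S (ι (fst x))
          E₀-eq : ∀ S e y z → E₀ S e y z ≡ pe (blk′ S e) (R.slotOf e) (lookup S (ι (fst y))) (snd y) (lookup S (ι (fst z))) (snd z)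
          E₀-eq S e y z = trans (cong (λ v → pe (proj₁ v) (proj₂ v) (blk S (inj₂ (ι* y))) (sl (inj₂ (ι* y))) (blk S (inj₂ (ι* z))) (sl (inj₂ (ι* z)))) (eq e))
             (cong₂ (λ v w → pe (blk′ S e) (R.slotOf e) (lookup S (proj₁ v)) (proj₂ v) (lookup S (proj₁ w)) (proj₂ w)) (rq y) (rq z))
            where
            rq : ∀ x → remQuot {m} k (ι* x) ≡ (ι (fst x) , snd x)
            rq x = remQuot-combine (ι (fst x)) (snd x)
            eq : ∀ e → (blk S (ι⁺ e) , sl (ι⁺ e)) ≡ (blk′ S e , R.slotOf e)
            eq (inj₁ q) = refl
            eq (inj₂ x) = cong (λ v → lookup S (proj₁ v) , proj₂ v) (rq x)
          E₀-same : ∀ S → W S ≡ true → ∀ e y z → E₀ S e y z ≡ E₀ S₀ e y z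
          E₀-same S w e y z = trans (sym (dc S)) (trans (same (index (ι⁺ e) (ι* y) (ι* z)) S S₀ w w₀) (dc S₀))
            where
            dc : ∀ S → φ (index (ι⁺ e) (ι* y) (ι* z)) S ≡ E₀ S e y z
            dc S = cong (λ w → PE S (proj₁ w) (proj₁ (proj₂ w)) (proj₂ (proj₂ w))) (unindex-index (ι⁺ e) (ι* y) (ι* z))
          at : ∀ S → W S ≡ true → ∀ e y z → E₀ S₀ e y z ≡ true → pe (blk′ S e) (R.slotOf e) (lookup S (ι (fst y))) (snd y) (lookup S (ι (fst z))) (snd z) ≡ true
          at S w e y z h = trans (sym (E₀-eq S e y z)) (trans (E₀-same S w e y z) h)
          τ₀ : ∀ e → Fin (R.mult e) → Fin t
          τ₀ (inj₁ _) _ = zero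
          τ₀ (inj₂ _) j = up j
          -- A sample of the box is routed through the requested blocks, which is possible because
          -- their indices differ. It lies in W, so it has the pattern of `S₀` and shows the edge.
          edge-at : ∀ e y z → E₀ S₀ e y z ≡ true → ∀ τ τ₂ τ₃ → E (R.vert e τ) (R.vert (inj₂ y) τ₂) (R.vert (inj₂ z) τ₃) ≡ true
          edge-at e y z h τ τ₂ τ₃ = subst (λ v → E (β v (R.slotOf e)) (β (T₀ (fst y) τ₂) (snd y)) (β (T₀ (fst z) τ₃) (snd z)) ≡ true)
              (atX e τ (proj₁ S₀-facts) (proj₁ (proj₂ S₀-facts)) λ _ → refl)
              (subst₂ (λ v w → E (β (blk′ S e) (R.slotOf e)) (β v (snd y)) (β w (snd z)) ≡ true) atY atZ (proj₁ (pe-true (at S (vec-W σ) e y z h))))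
            where
            y₁ z₁ : Fin m
            y₁ = ι (fst y)
            z₁ = ι (fst z)
            σ : Fin m → Fin t
            σ = place y₁ (up τ₂) (place z₁ (up τ₃) λ _ → τ₀ e τ)
            S : Vec (Fin N) m
            S = vec σ
            S₀-facts : blk′ S₀ e ≢ lookup S₀ y₁ × blk′ S₀ e ≢ lookup S₀ z₁ × lookup S₀ y₁ ≢ lookup S₀ z₁
            S₀-facts = proj₂ (pe-true (at S₀ w₀ e y z h))
            z≢y : z₁ ≢ y₁
            z≢y q = proj₂ (proj₂ S₀-facts) (cong (lookup S₀) (sym q))
            atY : lookup S y₁ ≡ T₀ (fst y) τ₂
            atY = trans (vec-at σ y₁) (cong (Tb y₁) (place-here y₁ (up τ₂) (place z₁ (up τ₃) λ _ → τ₀ e τ)))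
            atZ : lookup S z₁ ≡ T₀ (fst z) τ₃
            atZ = trans (vec-at σ z₁) (cong (Tb z₁) (trans (place-there y₁ (up τ₂) (place z₁ (up τ₃) λ _ → τ₀ e τ) z≢y) (place-here z₁ (up τ₃) λ _ → τ₀ e τ)))
            atX : ∀ e τ → blk′ S₀ e ≢ lookup S₀ y₁ → blk′ S₀ e ≢ lookup S₀ z₁ → (∀ l → σ l ≡ place y₁ (up τ₂) (place z₁ (up τ₃) λ _ → τ₀ e τ) l) → blk′ S e ≡ R.blockOf e τ
            atX (inj₁ q) τ _ _ _ = refl
            atX (inj₂ x) τ ny nz σ≡ = trans (vec-at σ (ι (fst x))) (cong (Tb (ι (fst x))) (trans (σ≡ (ι (fst x)))
              (trans (place-there y₁ (up τ₂) (place z₁ (up τ₃) λ _ → up τ) λ q → ny (cong (lookup S₀) q)) (place-there z₁ (up τ₃) (λ _ → up τ) λ q → nz (cong (lookup S₀) q)))))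
          edges : ∀ r → let open Quad (Balanced.quads Bal r) in ∀ x → x ≡ x₁ ⊎ x ≡ x₂ → ∀ τ τ₂ τ₃ → E (R.vert x τ) (R.vert (inj₂ y) τ₂) (R.vert (inj₂ z) τ₃) ≡ true
          edges r x (inj₁ refl) = edge-at x (Quad.y (Balanced.quads Bal r)) (Quad.z (Balanced.quads Bal r)) (proj₁ (valid r))
          edges r x (inj₂ refl) = edge-at x (Quad.y (Balanced.quads Bal r)) (Quad.z (Balanced.quads Bal r)) (proj₂ (valid r))

      improve : Improved E β F
      improve = go (homogenize m nf φ G.good)
        where
        Nᵐ>0 : 0 < N ^ m
        Nᵐ>0 = >-nonZero⁻¹ (N ^ m) {{m^n≢0 N m {{>-nonZero N>0}}}}
        go : (∃ λ W → (∀ S → W S ≡ true → G.good S ≡ true) × (∀ i S S′ → W S ≡ true → W S′ ≡ true → φ i S ≡ φ i S′) × vcount m G.good ≤ 2 ^ nf * vcount m W) → Improved E β F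
        go (W , sub , same , big) = go₁ (proj₂ blow N (≤-trans (≤-trans (m≤m+n _ _) (≤-trans (m≤m+n _ (3 * Q * c₀)) (n≤1+n _))) N≥) W dense) (vcount-witness m W W>0)
          where
          dense : N ^ m ≤ C * vcount m W
          dense = ≤-trans G.many-good (≤-trans (2 ⊛ big) (≤-reflexive (sym (*-assoc 2 (2 ^ nf) (vcount m W)))))
          W>0 : 0 < vcount m W
          W>0 = n≢0⇒n>0 λ q → <⇒≱ Nᵐ>0 (≤-trans dense (≤-reflexive (trans (cong (C *_) q) (*-zeroʳ C))))
          go₁ : (∃ λ (T : Fin m → Fin t → Fin N) → (∀ i {j j′} → T i j ≡ T i j′ → j ≡ j′) × Boxed W T) → (∃ λ S → W S ≡ true) → Improved E β F
          go₁ (Tb , Tb-inj , box) (S₀ , w₀) = go₂ (extract m′ (G.dark S₀ (sub S₀ w₀)) (+-cancelʳ-≤ B m′ _ (G.many-dark S₀ (sub S₀ w₀))))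
            where
            go₂ : (Σ (Fin m′ → Fin m) λ ι → (∀ {i j} → ι i ≡ ι j → i ≡ j) × (∀ i → G.dark S₀ (sub S₀ w₀) (ι i) ≡ true)) → Improved E β F
            go₂ (ι , ι-inj , ι-dark) = WithBox.improved W sub same Tb Tb-inj box S₀ w₀ ι ι-inj ι-dark
              (proj₂ pattern-size _ (WithBox.dense₀ W sub same Tb Tb-inj box S₀ w₀ ι ι-inj ι-dark))

  private
    A : ℕ
    A = k * ((4 * Q + 2) * (4 * Q + 2))
    B e : ℕ
    -- B is the budget that Markov's inequality asks for. Then e is chosen large for the
    -- concentration (24A) and so that B discarded blocks are negligible in the sample (8QB).
    B = 2 + 48 * A
    e = 1 + (24 * A + 8 * (Q * B))
    abstract
      improvement : ∃ λ N₁ → ∀ {N} → N₁ ≤ N → (E : Fin (N * k) → Fin (N * k) → Fin (N * k) → Bool) →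
        (∀ x y z → E x y z ≡ E y x z) → (∀ x y z → E x y z ≡ E x z y) → (∀ v → suc P * (N * k * (N * k)) ≤ Q * link (E v)) →
        (β : Fin N → Fin k → Fin (N * k)) → (∀ {B B′ s s′} → β B s ≡ β B′ s′ → B ≡ B′ × s ≡ s′) → ∀ F → Improved E β F
      improvement = At.N₁ B e B≥2 e≥1 B-big e-big₁ e-big₂ , λ N≥ E e₁₂ e₂₃ deg β β-inj F →
        At.Run.improve B e B≥2 e≥1 B-big e-big₁ e-big₂ N≥ E e₁₂ e₂₃ deg β β-inj F
        where
        B≥2 : 2 ≤ B
        B≥2 = m≤m+n 2 (48 * A)
        e≥1 : 1 ≤ e
        e≥1 = m≤m+n 1 _
        B-big : 48 * A ≤ suc B
        B-big = ≤-trans (m≤n+m (48 * A) 2) (n≤1+n B)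
        e-big₁ : 24 * A ≤ e
        e-big₁ = ≤-trans (m≤m+n (24 * A) _) (n≤1+n _)
        e-big₂ : 8 * (Q * B) ≤ e
        e-big₂ = ≤-trans (m≤n+m (8 * (Q * B)) (24 * A)) (n≤1+n _)

  module _ {N} (N≥ : proj₁ improvement ≤ N) (H : ThreeGraph (N * k)) (deg : ∀ v → suc P * (N * k * (N * k)) ≤ Q * (2 * degree H v)) where
    private
      E : Fin (N * k) → Fin (N * k) → Fin (N * k) → Bool
      E = proper H

      Tiling : Set
      Tiling = Σ (Fin N → Fin k → Fin (N * k)) λ β → (∀ {B B′ s s′} → β B s ≡ β B′ s′ → B ≡ B′ × s ≡ s′)

      real? : ∀ v → Dec (Real E v)
      real? v = all? λ s₁ → all? λ s₂ → all? λ s₃ → (slotPart s₁ ≟F zero) →-dec ((slotPart s₂ ≟F suc zero) →-dec ((slotPart s₃ ≟F suc (suc zero)) →-dec true? (E (v s₁) (v s₂) (v s₃))))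

      reals : (Fin N → Fin k → Fin (N * k)) → ℕ
      reals β = sum λ B → ⟦ does (real? (β B)) ⟧

      reals≤ : ∀ β → reals β ≤ N
      reals≤ β = ≤-trans (sum-≤const λ B → ⟦⟧≤1 (does (real? (β B)))) (≤-reflexive (*-identityʳ N))

      -- The fuel bounds the number of blocks that are not real, which drops with every improvement.
      complete : ∀ fuel → (T : Tiling) → N ≤ fuel + reals (proj₁ T) → Σ Tiling λ T → ∀ B → Real E (proj₁ T B)
      complete fuel (β , inj) h = go fuel h (any? λ F → ¬? (real? (β F)))
        where
        go : ∀ fuel → N ≤ fuel + reals β → Dec (∃ λ F → ¬ Real E (β F)) → Σ Tiling λ T → ∀ B → Real E (proj₁ T B)
        go fuel h (no n) = (β , inj) , λ B → decidable-stable (real? (β B)) λ r → n (B , r)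
        go fuel h (yes (F , nr)) = next fuel h
          where
          I : Improved E β F
          I = proj₂ improvement N≥ E (proper₁₂ H) (proper₂₃ H) (λ v → subst (λ d → suc P * (N * k * (N * k)) ≤ Q * d) (sym (link-degree H v)) (deg v)) β inj F
          more : reals β < reals (Improved.β⁺ I)
          more = sum-mono-< (λ B → ⟦⟧-mono λ r → dec-true (real? _) (Improved.keeps I B (does-true (real? _) r))) F
            (subst₂ (λ u v → ⟦ u ⟧ < ⟦ v ⟧) (sym (dec-false (real? (β F)) nr)) (sym (dec-true (real? _) (Improved.gains I))) z<s)
          next : ∀ fuel → N ≤ fuel + reals β → Σ Tiling λ T → ∀ B → Real E (proj₁ T B)
          next zero h = ⊥-elim (<⇒≱ more (≤-trans (reals≤ _) h))
          next (suc fuel) h = complete fuel (Improved.β⁺ I , Improved.β⁺-inj I) (≤-trans h (≤-trans (≤-reflexive (sym (+-suc fuel _))) (+-monoʳ-≤ fuel more)))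

      tiling : Σ Tiling λ T → ∀ B → Real E (proj₁ T B)
      -- Consecutive blocks are as good a start as any.
      tiling = complete N (combine , λ {B} {B′} {s} {s′} q → combine-injective B s B′ s′ q) (m≤m+n N _)

      β : Fin N → Fin k → Fin (N * k)
      β = proj₁ (proj₁ tiling)

      flat : Fin (N * k) → Fin (N * k)
      flat p = β (proj₁ (remQuot {N} k p)) (proj₂ (remQuot {N} k p))

      flat-inj : ∀ {p q} → flat p ≡ flat q → p ≡ q
      flat-inj {p} {q} q′ = let eB , es = proj₂ (proj₁ tiling) q′ in trans (sym (combine-remQuot {N} k p)) (trans (cong₂ combine eB es) (combine-remQuot {N} k q))

      where-is : Fin (N * k) → Fin N × Fin k
      where-is v = remQuot {N} k (proj₁ (injective⇒surjective flat flat-inj v))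

      β-where : ∀ v → β (proj₁ (where-is v)) (proj₂ (where-is v)) ≡ v
      β-where v = proj₂ (injective⇒surjective flat flat-inj v)

      where-β : ∀ B s → where-is (β B s) ≡ (B , s)
      where-β B s = let eB , es = proj₂ (proj₁ tiling) (β-where (β B s)) in cong₂ _,_ eB es

    factor : KFactor (suc a′) b c H
    factor = N , (λ v → proj₁ (where-is v)) , (λ v → slotPart (proj₂ (where-is v))) , sizes , edges
      where
      sizes : ∀ i j → countTrue (λ v → does (proj₁ (where-is v) ≟F i) ∧ does (slotPart (proj₂ (where-is v)) ≟F j)) (L.allFin (N * k)) ≡ partSize (suc a′) b c j
      sizes i j = trans (countTrue-tabulate _ id) (trans (sum-cong-≗ λ v → trans (⟦∧⟧ (does (proj₁ (where-is v) ≟F i)) _)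
           (cong₂ (λ x y → ⟦ x ⟧ * ⟦ y ⟧) (sym (==-does (proj₁ (where-is v)) i)) (sym (==-does (slotPart (proj₂ (where-is v))) j))))
        (trans (trans (sym (sum-reindex flat flat-inj _)) (trans (sum-combine N _) (sum-cong-≗ λ B → sum-cong-≗ λ s →
            cong (λ w → ⟦ proj₁ w == i ⟧ * ⟦ slotPart (proj₂ w) == j ⟧) (trans (cong (λ w → where-is (β (proj₁ w) (proj₂ w))) (remQuot-combine {N} {k} B s)) (where-β B s)))))
        (trans (sum-prod (λ B → ⟦ B == i ⟧) (λ s → ⟦ slotPart s == j ⟧)) (trans (cong₂ _*_ (sum-δ i) (part-sizes j)) (+-identityʳ _)))))
      edges : ∀ x y z i → proj₁ (where-is x) ≡ i → proj₁ (where-is y) ≡ i → proj₁ (where-is z) ≡ i →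
         slotPart (proj₂ (where-is x)) ≡ zero → slotPart (proj₂ (where-is y)) ≡ suc zero → slotPart (proj₂ (where-is z)) ≡ suc (suc zero) → edge H x y z ≡ true
      edges x y z i ex ey ez px py pz = trans (cong₂ (λ u w → edge H u w z) (sym (at ex)) (sym (at ey))) (trans (cong (edge H _ _) (sym (at ez)))
          (proj₁ (proper-edge H (proj₂ tiling i _ _ _ px py pz))))
        where
        at : ∀ {v} → proj₁ (where-is v) ≡ i → β i (proj₂ (where-is v)) ≡ v
        at {v} q = trans (cong (λ B → β B (proj₂ (where-is v))) (sym q)) (β-where v)

  large : ℕ
  large = proj₁ improvement * k

  theorem : ∀ n → large ≤ n → k ∣ n → (H : ThreeGraph n) → (∀ v → suc P * (n * n) ≤ Q * (2 * degree H v)) → KFactor (suc a′) b c H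
  theorem _ h (divides N refl) H deg = factor {N} (*-cancelʳ-≤ (proj₁ improvement) N k h) H deg

upper-bound : ∀ a b c P Q → 1 ≤ a → a ≤ b → b ≤ c → Good P Q a b c →
  ∃ λ n₀ → ∀ n → n₀ ≤ n → (a + b + c) ∣ n → (H : ThreeGraph n) → (∀ v → P * (n * n) ≤ Q * (2 * degree H v)) → KFactor a b c H
upper-bound (suc a′) b c P Q _ a≤b b≤c good =
  let P′ , g , sP , good′ = Good-slack {P} {Q} good
  in Augment.large a′ b c P′ (Q * g) a≤b b≤c good′ , λ n h d H deg → Augment.theorem a′ b c P′ (Q * g) a≤b b≤c good′ n h d H λ v →
    subst₂ _≤_ (trans (upper-bound-ring₁ g P (n * n)) (cong (_* (n * n)) (sym sP))) (upper-bound-ring₂ g Q (2 * degree H v)) (g ⊛ deg v)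

-- The lower bounds

classes : ∀ r (s : Fin r → ℕ) n → sum s ≡ n → Σ (Fin n → Fin r) λ cl → ∀ i → sum (λ x → ⟦ cl x == i ⟧) ≡ s i
classes zero s n e with trans (sym e) (sum-nil s)
... | refl = (λ ()) , λ ()
classes (suc r) s n e with trans (sym e) (sum-suc s)
... | refl with classes r (s ∘ suc) (sum (s ∘ suc)) refl
...   | cl′ , h = cl , sizes
  where
  f : Fin (s zero) ⊎ Fin (sum (s ∘ suc)) → Fin (suc r)
  f = [ (λ _ → zero) , (λ y → suc (cl′ y)) ]′
  cl : Fin (s zero + sum (s ∘ suc)) → Fin (suc r)
  cl x = f (splitAt (s zero) x)
  split : ∀ i → sum (λ x → ⟦ cl x == i ⟧) ≡ s zero * ⟦ zero == i ⟧ + sum (λ y → ⟦ Fin.suc (cl′ y) == i ⟧)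
  split i = trans (sum-split (s zero) _) (cong₂ _+_ (trans (sum-cong-≗ λ x → cong (λ u → ⟦ f u == i ⟧) (splitAt-↑ˡ (s zero) x _)) (sum-const (s zero) _))
    (sum-cong-≗ λ y → cong (λ u → ⟦ f u == i ⟧) (splitAt-↑ʳ (s zero) _ y)))
  sizes : ∀ i → sum (λ x → ⟦ cl x == i ⟧) ≡ s i
  sizes zero = trans (split zero) (trans (cong₂ _+_ (trans (cong (λ b → s zero * ⟦ b ⟧) (==-refl {suc r} zero)) (*-identityʳ (s zero)))
     (trans (sum-cong-≗ λ y → cong ⟦_⟧ (==-≢ λ ())) (trans (sum-const (sum (s ∘ suc)) 0) (*-zeroʳ (sum (s ∘ suc)))))) (+-identityʳ (s zero)))
  sizes (suc i) = trans (split (suc i)) (trans (cong₂ _+_ (trans (cong (λ b → s zero * ⟦ b ⟧) (==-≢ {suc r} {zero} {suc i} λ ())) (*-zeroʳ (s zero)))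
     (sum-cong-≗ λ y → cong ⟦_⟧ (==-suc (cl′ y) i))) (h i))

module ClassGraph {n r : ℕ} (cl : Fin n → Fin r) (φ : Fin r → Fin r → Fin r → Bool)
  (φ₁₂ : ∀ x y z → φ x y z ≡ φ y x z) (φ₂₃ : ∀ x y z → φ x y z ≡ φ x z y) where

  graph : ThreeGraph n
  graph = record { edge = λ x y z → φ (cl x) (cl y) (cl z) ; sym₁₂ = λ x y z → φ₁₂ _ _ _ ; sym₂₃ = λ x y z → φ₂₃ _ _ _ }

  size : Fin r → ℕ
  size i = sum λ x → ⟦ cl x == i ⟧

  links : Fin r → ℕ
  links c = sum λ i → sum λ j → ⟦ φ c i j ⟧ * (size i * size j)

  -- `links` counts ordered pairs through the class sizes; at most 3n of these pairs repeat a vertex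
  -- or contain v.
  degree≥ : ∀ v → links (cl v) ≤ 2 * degree graph v + 3 * n
  degree≥ v = begin
    sum (λ i → sum λ j → ⟦ φ c i j ⟧ * (size i * size j))
      ≡⟨ sum-cong-≗ (λ i → sum-cong-≗ λ j → trans (cong (⟦ φ c i j ⟧ *_) (sym (sum-prod _ _))) (trans (sym (sum-*ˡ ⟦ φ c i j ⟧ _)) (sum-cong-≗ λ x → sym (sum-*ˡ ⟦ φ c i j ⟧ _)))) ⟩
    sum (λ i → sum λ j → sum λ x → sum λ y → ⟦ φ c i j ⟧ * (⟦ cl x == i ⟧ * ⟦ cl y == j ⟧))
      ≡⟨ trans (sum-cong-≗ λ i → trans (sum-swap _) (sum-cong-≗ λ x → sum-swap _)) (trans (sum-swap _) (sum-cong-≗ λ x → sum-swap _)) ⟩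
    sum (λ x → sum λ y → sum λ i → sum λ j → ⟦ φ c i j ⟧ * (⟦ cl x == i ⟧ * ⟦ cl y == j ⟧))
      ≡⟨ sum-cong-≗ (λ x → sum-cong-≗ λ y → collapse (cl x) (cl y)) ⟩
    sum (λ x → sum λ y → ⟦ φ c (cl x) (cl y) ⟧) ≤⟨ sum-mono (λ x → sum-mono λ y → pw x y) ⟩
    sum (λ x → sum λ y → ⟦ proper graph v x y ⟧ + (⟦ v == x ⟧ + ⟦ v == y ⟧ + ⟦ x == y ⟧))
      ≡⟨ trans (sum-cong-≗ λ x → trans (sum-+ _ _) (cong (sum (λ y → ⟦ proper graph v x y ⟧) +_) (trans (sum-+ _ _) (cong₂ _+_ (trans (sum-+ _ _) (cong₂ _+_ (sum-const n _) (sum-δ′ v))) (sum-δ′ x)))))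
           (trans (sum-+ _ _) (cong (link (proper graph v) +_) (trans (sum-+ _ _) (cong₂ _+_ (trans (sum-+ _ _) (cong₂ _+_ (trans (sum-*ˡ n _) (cong (n *_) (sum-δ′ v))) (sum-const n 1))) (sum-const n 1))))) ⟩
    link (proper graph v) + (n * 1 + n * 1 + n * 1) ≡⟨ cong₂ _+_ (link-degree graph v) (degree≥-ring₁ n) ⟩
    2 * degree graph v + 3 * n ∎
    where
    open ≤-Reasoning
    c : Fin r
    c = cl v
    collapse : ∀ p q → sum (λ i → sum λ j → ⟦ φ c i j ⟧ * (⟦ p == i ⟧ * ⟦ q == j ⟧)) ≡ ⟦ φ c p q ⟧
    collapse p q = trans (sum-cong-≗ λ i → trans (sum-cong-≗ λ j → trans (degree≥-ring₂ ⟦ φ c i j ⟧ ⟦ p == i ⟧ ⟦ q == j ⟧) (cong (λ b → ⟦ b ⟧ * (⟦ p == i ⟧ * ⟦ φ c i j ⟧)) (==-sym q j))) (sum-delta q (λ j → ⟦ p == i ⟧ * ⟦ φ c i j ⟧)))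
      (trans (sum-cong-≗ λ i → cong (λ b → ⟦ b ⟧ * ⟦ φ c i q ⟧) (==-sym p i)) (sum-delta p (λ i → ⟦ φ c i q ⟧)))
    pw : ∀ x y → ⟦ φ c (cl x) (cl y) ⟧ ≤ ⟦ proper graph v x y ⟧ + (⟦ v == x ⟧ + ⟦ v == y ⟧ + ⟦ x == y ⟧)
    pw x y = go (φ c (cl x) (cl y)) (v == x) (v == y) (x == y)
      where
      go : ∀ e x y z → ⟦ e ⟧ ≤ ⟦ e ∧ not x ∧ not y ∧ not z ⟧ + (⟦ x ⟧ + ⟦ y ⟧ + ⟦ z ⟧)
      go false x y z = z≤n
      go true true y z = s≤s z≤n
      go true false true z = s≤s z≤n
      go true false false true = s≤s z≤n
      go true false false false = s≤s z≤n

  minimum : ∀ V t → (∀ c → V ≤ links c) → 2 * t + 3 * n ≤ V → MinDegGE graph t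
  minimum V t hV ht v = *-cancelˡ-≤ 2 (+-cancelʳ-≤ (3 * n) _ _ (≤-trans ht (≤-trans (hV (cl v)) (degree≥ v))))

module Factor {a b c n : ℕ} (a≥1 : 1 ≤ a) (a≤b : a ≤ b) (b≤c : b ≤ c) (H : ThreeGraph n) (K : KFactor a b c H) where
  m : ℕ
  m = proj₁ K
  copy : Fin n → Fin m
  copy = proj₁ (proj₂ K)
  part : Fin n → Fin 3
  part = proj₁ (proj₂ (proj₂ K))

  p₀ p₁ p₂ : Fin 3
  p₀ = zero
  p₁ = suc zero
  p₂ = suc (suc zero)

  sum₃ : (f : Fin 3 → ℕ) → sum f ≡ f p₀ + f p₁ + f p₂
  sum₃ f = trans (sum-suc f) (trans (cong (f zero +_) (trans (sum-suc _) (cong (f (suc zero) +_) (trans (sum-suc _) (trans (cong (f (suc (suc zero)) +_) (sum-nil _)) (+-identityʳ _))))))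
    (sym (+-assoc (f zero) _ _)))

  piece : (Fin n → Bool) → Fin m → Fin 3 → ℕ
  piece X i j = sum λ v → ⟦ copy v == i ⟧ * ⟦ part v == j ⟧ * ⟦ X v ⟧

  piece-all : ∀ i j → sum (λ v → ⟦ copy v == i ⟧ * ⟦ part v == j ⟧) ≡ partSize a b c j
  piece-all i j = trans (sum-cong-≗ λ v → trans (sym (⟦∧⟧ (copy v == i) (part v == j))) (cong₂ (λ x y → ⟦ x ∧ y ⟧) (==-does (copy v) i) (==-does (part v) j)))
    (trans (sym (countTrue-tabulate _ id)) (proj₁ (proj₂ (proj₂ (proj₂ K))) i j))

  total : ∀ X → sum (λ i → sum λ j → piece X i j) ≡ sum (λ v → ⟦ X v ⟧)
  total X = trans (trans (sum-cong-≗ λ i → sum-swap _) (sum-swap _)) (sum-cong-≗ λ v → trans (sum-cong-≗ λ i → sum-*ʳ ⟦ X v ⟧ _)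
    (trans (sum-*ʳ ⟦ X v ⟧ _) (trans (cong (_* ⟦ X v ⟧) (trans (sum-prod (λ i → ⟦ copy v == i ⟧) (λ j → ⟦ part v == j ⟧)) (cong₂ _*_ (sum-δ′ (copy v)) (sum-δ′ (part v))))) (+-identityʳ _))))

  copies : m * (a + b + c) ≡ n
  copies = trans (sym (sum-const m (a + b + c))) (trans (sum-cong-≗ λ i → trans (sym (trans (sum₃ (partSize a b c)) refl)) (sum-cong-≗ λ j →
      trans (sym (piece-all i j)) (sum-cong-≗ λ v → sym (*-identityʳ _)))) (trans (total (λ _ → true)) (trans (sum-const n 1) (*-identityʳ n))))

  part≥1 : ∀ j → 1 ≤ partSize a b c j
  part≥1 zero = a≥1
  part≥1 (suc zero) = ≤-trans a≥1 a≤b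
  part≥1 (suc (suc zero)) = ≤-trans a≥1 (≤-trans a≤b b≤c)

  In : Fin m → Fin 3 → Fin n → Set
  In i j v = copy v ≡ i × part v ≡ j

  Edge : Fin n → Fin n → Fin n → Set
  Edge x y z = edge H x y z ≡ true

  edge-in : ∀ {i x y z} → In i p₀ x → In i p₁ y → In i p₂ z → Edge x y z
  edge-in (cx , px) (cy , py) (cz , pz) = proj₂ (proj₂ (proj₂ (proj₂ K))) _ _ _ _ cx cy cz px py pz

  two-⟦⟧ : ∀ {i j v} {t : ℕ} → t < ⟦ copy v == i ⟧ * ⟦ part v == j ⟧ → In i j v
  two-⟦⟧ {i} {j} {v} h = let u , w = ∧-true {copy v == i} (⟦⟧-pos (≤-trans (≤-trans (s≤s z≤n) h) (≤-reflexive (sym (⟦∧⟧ (copy v == i) (part v == j)))))) in ==-sound u , ==-sound w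

  member : ∀ i j → ∃ (In i j)
  member i j = let v , h = sum-pigeon (λ _ → 0) (λ v → ⟦ copy v == i ⟧ * ⟦ part v == j ⟧) (subst₂ _<_ (sym (trans (sum-const n 0) (*-zeroʳ n))) (sym (piece-all i j)) (part≥1 j)) in v , two-⟦⟧ h

  other-member : ∀ i j v → 2 ≤ partSize a b c j → ∃ λ w → In i j w × w ≢ v
  other-member i j v h = let w , l = sum-pigeon (λ w → ⟦ w == v ⟧) (λ v → ⟦ copy v == i ⟧ * ⟦ part v == j ⟧) (subst₂ _<_ (sym (sum-δ v)) (sym (piece-all i j)) h)
    in w , two-⟦⟧ l , λ e → <⇒≱ l (≤-trans (≤-reflexive (sym (⟦∧⟧ (copy w == i) (part w == j)))) (≤-trans (⟦⟧≤1 _) (≤-reflexive (sym (trans (cong (λ u → ⟦ u == v ⟧) e) (cong ⟦_⟧ (==-refl v)))))))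

  piece-const : ∀ X i j e → (∀ v → In i j v → X v ≡ e) → piece X i j ≡ ⟦ e ⟧ * partSize a b c j
  piece-const X i j e h = trans (sum-cong-≗ λ v → trans (pw v (copy v == i) (part v == j) (λ u w → h v (==-sound u , ==-sound w))) (*-comm _ ⟦ e ⟧)) (trans (sum-*ˡ ⟦ e ⟧ _) (cong (⟦ e ⟧ *_) (piece-all i j)))
    where
    pw : ∀ v x y → (x ≡ true → y ≡ true → X v ≡ e) → ⟦ x ⟧ * ⟦ y ⟧ * ⟦ X v ⟧ ≡ ⟦ x ⟧ * ⟦ y ⟧ * ⟦ e ⟧
    pw v true true h = cong (λ b → 1 * ⟦ b ⟧) (h refl refl)
    pw v true false h = refl
    pw v false y h = refl

  full-or-not : ∀ X i j → (∃ λ v → In i j v × X v ≡ false) ⊎ (piece X i j ≡ partSize a b c j)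
  full-or-not X i j with any? (λ v → ((copy v ≟F i) ×-dec (part v ≟F j)) ×-dec (X v ≟B false))
  ... | yes p = inj₁ p
  ... | no n = inj₂ (trans (piece-const X i j true λ v w → not-false (λ e → n (v , w , e))) (+-identityʳ _))
    where
    not-false : ∀ {b} → b ≢ false → b ≡ true
    not-false {true} _ = refl
    not-false {false} h = ⊥-elim (h refl)

  -- Every edge meets X, hence some part of every copy lies in X
  meets⇒≥ : ∀ X → (∀ x y z → Edge x y z → X x ≡ false → X y ≡ false → X z ≡ false → ⊥) → m * a ≤ sum (λ v → ⟦ X v ⟧)
  meets⇒≥ X h = subst₂ _≤_ (sum-const m a) (total X) (sum-mono λ i → ≤-trans (go i (full-or-not X i p₀) (full-or-not X i p₁) (full-or-not X i p₂)) (≤-reflexive (sym (sum₃ _))))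
    where
    go : ∀ i → (∃ λ v → In i p₀ v × X v ≡ false) ⊎ (piece X i p₀ ≡ a) → (∃ λ v → In i p₁ v × X v ≡ false) ⊎ (piece X i p₁ ≡ b) → (∃ λ v → In i p₂ v × X v ≡ false) ⊎ (piece X i p₂ ≡ c) →
      a ≤ piece X i p₀ + piece X i p₁ + piece X i p₂
    go i (inj₂ e) _ _ = ≤-trans (≤-reflexive (sym e)) (≤-trans (m≤m+n _ _) (m≤m+n _ _))
    go i _ (inj₂ e) _ = ≤-trans (≤-trans a≤b (≤-reflexive (sym e))) (≤-trans (m≤n+m _ (piece X i p₀)) (m≤m+n _ _))
    go i _ _ (inj₂ e) = ≤-trans (≤-trans (≤-trans a≤b b≤c) (≤-reflexive (sym e))) (m≤n+m _ _)
    go i (inj₁ (x , ix , fx)) (inj₁ (y , iy , fy)) (inj₁ (z , iz , fz)) = ⊥-elim (h x y z (edge-in ix iy iz) fx fy fz)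

  -- If two parts of a copy had vertices outside X, an edge through both would meet X at most once.
  -- So two whole parts of each copy lie in X, and the two smallest have a + b vertices.
  meets-twice⇒≥ : ∀ X → (∀ x y z → Edge x y z → (X x ≡ false → X y ≡ false → ⊥) × (X x ≡ false → X z ≡ false → ⊥) × (X y ≡ false → X z ≡ false → ⊥)) →
    m * (a + b) ≤ sum (λ v → ⟦ X v ⟧)
  meets-twice⇒≥ X h = subst₂ _≤_ (sum-const m (a + b)) (total X) (sum-mono λ i → ≤-trans (go i (full-or-not X i p₀) (full-or-not X i p₁) (full-or-not X i p₂)) (≤-reflexive (sym (sum₃ _))))
    where
    go : ∀ i → (∃ λ v → In i p₀ v × X v ≡ false) ⊎ (piece X i p₀ ≡ a) → (∃ λ v → In i p₁ v × X v ≡ false) ⊎ (piece X i p₁ ≡ b) → (∃ λ v → In i p₂ v × X v ≡ false) ⊎ (piece X i p₂ ≡ c) →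
      a + b ≤ piece X i p₀ + piece X i p₁ + piece X i p₂
    go i (inj₂ e) (inj₂ e′) _ = ≤-trans (≤-reflexive (sym (cong₂ _+_ e e′))) (m≤m+n _ _)
    go i (inj₂ e) _ (inj₂ e″) = ≤-trans (+-mono-≤ (≤-reflexive (sym e)) (≤-trans b≤c (≤-reflexive (sym e″)))) (+-monoˡ-≤ _ (m≤m+n (piece X i p₀) (piece X i p₁)))
    go i _ (inj₂ e′) (inj₂ e″) = ≤-trans (+-mono-≤ (≤-trans a≤b (≤-reflexive (sym e′))) (≤-trans b≤c (≤-reflexive (sym e″)))) (+-monoˡ-≤ _ (m≤n+m (piece X i p₁) (piece X i p₀)))
    go i (inj₁ (x , ix , fx)) (inj₁ (y , iy , fy)) _ = let z , iz = member i p₂ in ⊥-elim (proj₁ (h x y z (edge-in ix iy iz)) fx fy)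
    go i (inj₁ (x , ix , fx)) (inj₂ _) (inj₁ (z , iz , fz)) = let y , iy = member i p₁ in ⊥-elim (proj₁ (proj₂ (h x y z (edge-in ix iy iz))) fx fz)
    go i (inj₂ _) (inj₁ (y , iy , fy)) (inj₁ (z , iz , fz)) = let x , ix = member i p₀ in ⊥-elim (proj₂ (proj₂ (h x y z (edge-in ix iy iz))) fy fz)

  -- When two vertices of an edge determine the X-status of the third, parts are homogeneous.
  rigid : ∀ X (ρ : Bool → Bool → Bool → Bool) → (∀ x y z → Edge x y z → ρ (X x) (X y) (X z) ≡ true) →
    (∀ u u′ v w → ρ u v w ≡ true → ρ u′ v w ≡ true → u ≡ u′) → (∀ u v v′ w → ρ u v w ≡ true → ρ u v′ w ≡ true → v ≡ v′) → (∀ u v w w′ → ρ u v w ≡ true → ρ u v w′ ≡ true → w ≡ w′) →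
    ∀ u g → (∀ e₀ e₁ e₂ → ρ e₀ e₁ e₂ ≡ true → ∃ λ q → ⟦ e₀ ⟧ * a + ⟦ e₁ ⟧ * b + ⟦ e₂ ⟧ * c ≡ u + g * q) →
    ∃ λ q → sum (λ v → ⟦ X v ⟧) ≡ m * u + g * q
  rigid X ρ hρ r₀ r₁ r₂ u g hq = sum q , trans (sym (total X)) (trans (sum-cong-≗ λ i → trans (sum₃ _) (proj₂ (each i))) (trans (sum-+ _ _) (cong₂ _+_ (sum-const m u) (sum-*ˡ g _))))
    where
    each : ∀ i → ∃ λ q → piece X i p₀ + piece X i p₁ + piece X i p₂ ≡ u + g * q
    each i = let q , e = hq (X x) (X y) (X z) here in q , trans (cong₂ _+_ (cong₂ _+_
         (piece-const X i p₀ (X x) λ v iv → r₀ _ _ _ _ (hρ v y z (edge-in iv iy iz)) here)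
         (piece-const X i p₁ (X y) λ v iv → r₁ _ _ _ _ (hρ x v z (edge-in ix iv iz)) here))
         (piece-const X i p₂ (X z) λ v iv → r₂ _ _ _ _ (hρ x y v (edge-in ix iy iv)) here)) e
      where
      x = proj₁ (member i p₀)
      ix = proj₂ (member i p₀)
      y = proj₁ (member i p₁)
      iy = proj₂ (member i p₁)
      z = proj₁ (member i p₂)
      iz = proj₂ (member i p₂)
      here : ρ (X x) (X y) (X z) ≡ true
      here = hρ x y z (edge-in ix iy iz)
    q : Fin m → ℕ
    q i = proj₁ (each i)

all₃ : (Bool → Bool → Bool → Bool) → Bool
all₃ p = (p true true true ∧ p true true false ∧ p true false true ∧ p true false false)
       ∧ (p false true true ∧ p false true false ∧ p false false true ∧ p false false false)

all₃-sound : ∀ p → all₃ p ≡ true → ∀ x y z → p x y z ≡ true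
all₃-sound p h x y z = let t , f = ∧-true {p true true true ∧ p true true false ∧ p true false true ∧ p true false false} h in pick x (four t) (four f) y z
  where
  four : ∀ {a b c d} → a ∧ b ∧ c ∧ d ≡ true → (a ≡ true × b ≡ true) × (c ≡ true × d ≡ true)
  four {true} {true} {true} {true} _ = (refl , refl) , (refl , refl)
  pick : ∀ x → (p true true true ≡ true × p true true false ≡ true) × (p true false true ≡ true × p true false false ≡ true) →
    (p false true true ≡ true × p false true false ≡ true) × (p false false true ≡ true × p false false false ≡ true) → ∀ y z → p x y z ≡ true
  pick true ((a , b) , c , d) _ true true = a
  pick true ((a , b) , c , d) _ true false = b
  pick true ((a , b) , c , d) _ false true = c
  pick true ((a , b) , c , d) _ false false = d
  pick false _ ((a , b) , c , d) true true = a
  pick false _ ((a , b) , c , d) true false = b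
  pick false _ ((a , b) , c , d) false true = c
  pick false _ ((a , b) , c , d) false false = d

record Symmetric₃ (ρ : Bool → Bool → Bool → Bool) : Set where
  field
    s₁₂ : ∀ x y z → ρ x y z ≡ ρ y x z
    s₂₃ : ∀ x y z → ρ x y z ≡ ρ x z y

symmetric₃ : ∀ ρ → all₃ (λ x y z → does (ρ x y z ≟B ρ y x z)) ≡ true → all₃ (λ x y z → does (ρ x y z ≟B ρ x z y)) ≡ true → Symmetric₃ ρ
symmetric₃ ρ h h′ = record
  { s₁₂ = λ x y z → does-true (_ ≟B _) (all₃-sound (λ x y z → does (ρ x y z ≟B ρ y x z)) h x y z)
  ; s₂₃ = λ x y z → does-true (_ ≟B _) (all₃-sound (λ x y z → does (ρ x y z ≟B ρ x z y)) h′ x y z) }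

-- Graphs on a set of s vertices and its complement, of size s′.
module TwoClasses₂ (ρ : Bool → Bool → Bool → Bool) (ρ-sym : Symmetric₃ ρ) where

  links₂ : Bool → ℕ → ℕ → ℕ
  links₂ e s s′ = ⟦ ρ e false false ⟧ * (s′ * s′) + ⟦ ρ e false true ⟧ * (s′ * s) + ⟦ ρ e true false ⟧ * (s * s′) + ⟦ ρ e true true ⟧ * (s * s)

  record Coloured (a b c n s : ℕ) : Set where
    field
      H : ThreeGraph n
      factor : KFactor a b c H
      X : Fin n → Bool
      coloured : ∀ x y z → edge H x y z ≡ true → ρ (X x) (X y) (X z) ≡ true
      size : sum (λ v → ⟦ X v ⟧) ≡ s

  two-classes : ∀ {a b c n t} s s′ V → s + s′ ≡ n → (∀ e → V ≤ links₂ e s s′) → Forces a b c n t → 2 * t + 3 * n ≤ V → Coloured a b c n s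
  two-classes {a} {b} {c} {n} {t} s s′ V e hV forces ht = record
    { H = G.graph ; factor = forces G.graph (G.minimum V t bound ht) ; X = λ v → is₁ (cl v) ; coloured = λ x y z h → h
    ; size = trans (sum-cong-≗ λ v → cong ⟦_⟧ (is₁-== (cl v))) (proj₂ cls (suc zero)) }
    where
    sizes : Fin 2 → ℕ
    sizes zero = s′
    sizes (suc zero) = s
    sum₂ : (f : Fin 2 → ℕ) → sum f ≡ f zero + f (suc zero)
    sum₂ f = trans (sum-suc f) (cong (f zero +_) (trans (sum-suc _) (trans (cong (f (suc zero) +_) (sum-nil _)) (+-identityʳ _))))
    cls = classes 2 sizes n (trans (sum₂ sizes) (trans (+-comm s′ s) e))
    cl : Fin n → Fin 2
    cl = proj₁ cls
    is₁ : Fin 2 → Bool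
    is₁ zero = false
    is₁ (suc zero) = true
    is₁-== : ∀ i → is₁ i ≡ (i == suc zero)
    is₁-== zero = sym (==-≢ λ ())
    is₁-== (suc zero) = sym (==-refl {2} (suc zero))
    module G = ClassGraph cl (λ x y z → ρ (is₁ x) (is₁ y) (is₁ z)) (λ x y z → Symmetric₃.s₁₂ ρ-sym _ _ _) (λ x y z → Symmetric₃.s₂₃ ρ-sym _ _ _)
    bound : ∀ i → V ≤ G.links i
    bound i = ≤-trans (hV (is₁ i)) (≤-reflexive (sym (trans (sum-cong-≗ λ u → sum-cong-≗ λ w → cong₂ (λ x y → ⟦ ρ (is₁ i) (is₁ u) (is₁ w) ⟧ * (x * y)) (proj₂ cls u) (proj₂ cls w))
      (trans (sum₂ _) (trans (cong₂ _+_ (sum₂ _) (sum₂ _)) (sym (+-assoc (⟦ ρ (is₁ i) false false ⟧ * (s′ * s′) + ⟦ ρ (is₁ i) false true ⟧ * (s′ * s)) _ _)))))))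

by-contra-< : ∀ {m n} → (n ≤ m → ⊥) → m < n
by-contra-< h = ≰⇒> h

module Space (a b c : ℕ) (a≥1 : 1 ≤ a) (a≤b : a ≤ b) (b≤c : b ≤ c) where
  k : ℕ
  k = a + b + c

  k>0 : 0 < k
  k>0 = ≤-trans a≥1 (≤-trans (m≤m+n a b) (m≤m+n (a + b) c))

  -- The number of vertices of an edge in X is at least 1, at least 2, 0 or 3, even, and exactly 1,
  -- respectively. The first two are the space barriers; the other three are the divisibility
  -- barriers for 1/4, 1/2 and 4/9.
  ρ₁ ρ₂ ρ₃ ρ₄ ρ₅ : Bool → Bool → Bool → Bool
  ρ₁ x y z = x ∨ y ∨ z
  ρ₂ x y z = (x ∧ y) ∨ (x ∧ z) ∨ (y ∧ z)
  ρ₃ x y z = (x ∧ y ∧ z) ∨ (not x ∧ not y ∧ not z)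
  ρ₄ x y z = (not x ∧ not y ∧ not z) ∨ (x ∧ y ∧ not z) ∨ (x ∧ not y ∧ z) ∨ (not x ∧ y ∧ z)
  ρ₅ x y z = (x ∧ not y ∧ not z) ∨ (not x ∧ y ∧ not z) ∨ (not x ∧ not y ∧ z)

  module T₁ = TwoClasses₂ ρ₁ (symmetric₃ ρ₁ refl refl)
  module T₂ = TwoClasses₂ ρ₂ (symmetric₃ ρ₂ refl refl)

  same-copies : ∀ {n N} (H : ThreeGraph n) (K : KFactor a b c H) → n ≡ N * k → proj₁ K ≡ N
  same-copies H K e = *-cancelʳ-≡ _ _ k {{>-nonZero k>0}} (trans (Factor.copies a≥1 a≤b b≤c H K) e)

  lower₁ : ∀ {N t} → 0 < N → Forces a b c (N * k) t → k * k * (N * k * (N * k)) ≤ (b + c) * (b + c) * (N * k * (N * k)) + k * k * (2 * t + 5 * (N * k))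
  lower₁ {N} {t} N>0 forces = ≤-trans (≤-reflexive n²) (cert (k * k * (2 * (N * a))) (ring k N a (b + c) (+-assoc a b c) V t) ((k * k) ⊛ V<))
    where
    n s s′ V : ℕ
    n = N * k
    -- One vertex fewer than the N copies of a factor need in X.
    s = N * a ∸ 1
    s′ = N * (b + c) + 1
    V = s * s + 2 * (s * s′)
    s+1 : s + 1 ≡ N * a
    s+1 = m∸n+n≡m (*-mono-≤ N>0 a≥1)
    total : s + s′ ≡ n
    total = trans (lower₁-ring₁ s (N * (b + c))) (trans (cong (_+ N * (b + c)) s+1) (trans (sym (*-distribˡ-+ N a (b + c))) (cong (N *_) (sym (+-assoc a b c)))))
    V< : V < 2 * t + 3 * n
    V< = by-contra-< λ h → contra (T₁.two-classes s s′ V total bound forces h)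
      where
      bound : ∀ e → V ≤ T₁.links₂ e s s′
      bound true = ≤-trans (m≤n+m V (s′ * s′)) (≤-reflexive (lower₁-ring₂ s s′))
      bound false = ≤-reflexive (lower₁-ring₃ s s′)
      contra : T₁.Coloured a b c n s → ⊥
      contra C = <⇒≱ (≤-reflexive (trans (+-comm 1 s) s+1)) (≤-trans (≤-reflexive (cong (_* a) (sym (same-copies {n} {N} (T₁.Coloured.H C) (T₁.Coloured.factor C) refl))))
          (≤-trans (Factor.meets⇒≥ a≥1 a≤b b≤c (T₁.Coloured.H C) (T₁.Coloured.factor C) (T₁.Coloured.X C) λ x y z e fx fy fz → none _ _ _ (T₁.Coloured.coloured C x y z e) fx fy fz) (≤-reflexive (T₁.Coloured.size C))))
        where
        none : ∀ x y z → ρ₁ x y z ≡ true → x ≡ false → y ≡ false → z ≡ false → ⊥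
        none false false false () _ _ _
    n² : k * k * (n * n) ≡ k * k * (V + s′ * s′)
    n² = cong (k * k *_) (trans (cong (λ z → z * z) (sym total)) (lower₁-ring₄ s s′))
    ring : ∀ k N a x → k ≡ a + x → ∀ V t → k * k * (V + (N * x + 1) * (N * x + 1)) + k * k * (2 * t + 3 * (N * k)) + k * k * (2 * (N * a)) ≡ x * x * (N * k * (N * k)) + k * k * (2 * t + 5 * (N * k)) + k * k * (1 + V)
    ring _ N a x refl = lower₁-ring₅ N a x

  lower₂ : ∀ {N t} → 0 < N → Forces a b c (N * k) t → (a + b) * (a + b) * (N * k * (N * k)) ≤ k * k * (2 * t + 5 * (N * k))
  lower₂ {N} {t} N>0 forces = cert (k * k * (2 * (N * c) + 2)) (trans (cong (_+ k * k * (2 * (N * c) + 2)) (cong (_+ k * k * (2 * t + 3 * (N * k))) (trans (lower₂-ring₁ (a + b) N k) (cong (λ z → k * k * (z * z)) (sym s+1))))) (ring k s t n (N * c) nk)) ((k * k) ⊛ V<)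
    where
    n s s′ V : ℕ
    n = N * k
    s = N * (a + b) ∸ 1
    s′ = N * c + 1
    V = s * s
    s+1 : s + 1 ≡ N * (a + b)
    s+1 = m∸n+n≡m (*-mono-≤ N>0 (≤-trans a≥1 (m≤m+n a b)))
    nk : n ≡ s + 1 + N * c
    nk = trans (*-distribˡ-+ N (a + b) c) (cong (_+ N * c) (sym s+1))
    total : s + s′ ≡ n
    total = trans (lower₂-ring₂ s (N * c)) (sym nk)
    V< : V < 2 * t + 3 * n
    V< = by-contra-< λ h → contra (T₂.two-classes s s′ V total bound forces h)
      where
      bound : ∀ e → V ≤ T₂.links₂ e s s′
      bound true = ≤-trans (m≤n+m V (s′ * s + s * s′)) (≤-reflexive (lower₂-ring₃ s s′))
      bound false = ≤-reflexive (lower₂-ring₄ (s * s))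
      contra : T₂.Coloured a b c n s → ⊥
      contra C = <⇒≱ (≤-reflexive (trans (+-comm 1 s) s+1)) (≤-trans (≤-reflexive (cong (_* (a + b)) (sym (same-copies {n} {N} (T₂.Coloured.H C) (T₂.Coloured.factor C) refl))))
          (≤-trans (Factor.meets-twice⇒≥ a≥1 a≤b b≤c (T₂.Coloured.H C) (T₂.Coloured.factor C) (T₂.Coloured.X C) λ x y z e → none _ _ _ (T₂.Coloured.coloured C x y z e)) (≤-reflexive (T₂.Coloured.size C))))
        where
        none : ∀ x y z → ρ₂ x y z ≡ true → (x ≡ false → y ≡ false → ⊥) × (x ≡ false → z ≡ false → ⊥) × (y ≡ false → z ≡ false → ⊥)
        none true true z _ = (λ ()) , (λ ()) , λ ()
        none true false true _ = (λ ()) , (λ ()) , λ _ ()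
        none false true true _ = (λ _ ()) , (λ _ ()) , λ ()
        none true false false ()
        none false true false ()
        none false false true ()
        none false false false ()
    ring : ∀ k s t n x → n ≡ s + 1 + x → k * k * ((s + 1) * (s + 1)) + k * k * (2 * t + 3 * n) + k * k * (2 * x + 2) ≡ k * k * (2 * t + 5 * n) + k * k * (1 + s * s)
    ring k s t _ x refl = lower₂-ring₅ k s t x

  -- Each of the N copies of a factor meets X in u vertices modulo g, so the size of X is N u modulo
  -- g. By symmetry of ρ it suffices that two vertices of an edge determine on which side the first
  -- one lies.
  module Rigid (ρ : Bool → Bool → Bool → Bool) (ρ-sym : Symmetric₃ ρ) (r₀ : ∀ u u′ v w → ρ u v w ≡ true → ρ u′ v w ≡ true → u ≡ u′)
    (u g : ℕ) (g≢1 : g ≢ 1) (weights : ∀ e₀ e₁ e₂ → ρ e₀ e₁ e₂ ≡ true → ∃ λ q → ⟦ e₀ ⟧ * a + ⟦ e₁ ⟧ * b + ⟦ e₂ ⟧ * c ≡ u + g * q) where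

    open TwoClasses₂ ρ ρ-sym
    open Symmetric₃ ρ-sym

    residue : ∀ {N s} → Coloured a b c (N * k) s → ∃ λ q → s ≡ N * u + g * q
    residue {N} C = let q , e = Factor.rigid a≥1 a≤b b≤c H factor X ρ coloured r₀
                              (λ x y y′ z h h′ → r₀ _ _ x z (trans (s₁₂ y x z) h) (trans (s₁₂ y′ x z) h′))
                              (λ x y z z′ h h′ → r₀ _ _ x y (trans (s₁₂ z x y) (trans (s₂₃ x z y) h)) (trans (s₁₂ z′ x y) (trans (s₂₃ x z′ y) h′))) u g weights
                    in q , trans (sym size) (trans e (cong (λ m → m * u + g * q) (same-copies {N * k} {N} H factor refl)))
      where open Coloured C

    -- Two consecutive sizes cannot both be N u modulo g.
    bound : ∀ {N t} h V → suc h ≤ N * k → (∀ s s′ → s + s′ ≡ N * k → s ≡ h ⊎ s ≡ suc h → ∀ e → V ≤ links₂ e s s′) → Forces a b c (N * k) t → V < 2 * t + 3 * (N * k)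
    bound {N} {t} h V h< hV forces = by-contra-< λ ht → clash (residue {N} (at h (<⇒≤ h<) (inj₁ refl) ht)) (residue {N} (at (suc h) h< (inj₂ refl) ht))
      where
      at : ∀ s → s ≤ N * k → s ≡ h ⊎ s ≡ suc h → 2 * t + 3 * (N * k) ≤ V → Coloured a b c (N * k) s
      at s s≤ w ht = two-classes s (N * k ∸ s) V (m+[n∸m]≡n s≤) (hV s _ (m+[n∸m]≡n s≤) w) forces ht
      clash : (∃ λ q → h ≡ N * u + g * q) → (∃ λ q → suc h ≡ N * u + g * q) → ⊥
      clash (q , e) (q′ , e′) = g≢1 (∣1⇒≡1 (∣m+n∣m⇒∣n {m = g * q} (subst (g ∣_) step (m∣m*n q′)) (m∣m*n q)))
        where
        step : g * q′ ≡ g * q + 1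
        step = +-cancelˡ-≡ (N * u) _ _ (trans (sym e′) (trans (cong suc e) (trans (+-comm 1 _) (+-assoc (N * u) (g * q) 1))))

  unique : (ρ : Bool → Bool → Bool → Bool) → all₃ (λ x y z → not (ρ true y z) ∨ not (ρ false y z)) ≡ true → ∀ u u′ v w → ρ u v w ≡ true → ρ u′ v w ≡ true → u ≡ u′
  unique ρ h true true v w _ _ = refl
  unique ρ h false false v w _ _ = refl
  unique ρ h true false v w e e′ = ⊥-elim (clash (all₃-sound (λ x y z → not (ρ true y z) ∨ not (ρ false y z)) h true v w) e e′)
    where
    clash : ∀ {x y} → not x ∨ not y ≡ true → x ≡ true → y ≡ true → ⊥
    clash () refl refl
  unique ρ h false true v w e e′ = sym (unique ρ h true false v w e′ e)

  module R₃ = Rigid ρ₃ (symmetric₃ ρ₃ refl refl) (unique ρ₃ refl) 0 k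

  half : ℕ → ℕ
  half n = ⌊ n /2⌋

  halves : ∀ n → n ≡ half n + half n ⊎ n ≡ suc (half n + half n)
  halves zero = inj₁ refl
  halves (suc zero) = inj₂ refl
  halves (suc (suc n)) = [ (λ e → inj₁ (cong suc (trans (cong suc e) (sym (+-suc _ _))))) , (λ e → inj₂ (cong suc (trans (cong suc e) (cong suc (sym (+-suc _ _)))))) ]′ (halves n)

  -- w = ⌊n/2⌋ ∸ 1 bounds both classes from below
  module Halves (n : ℕ) (n≥3 : 3 ≤ n) where
    h w : ℕ
    h = half n
    w = h ∸ 1

    n≤ : n ≤ suc (h + h)
    n≤ = [ (λ e → ≤-trans (≤-reflexive e) (n≤1+n _)) , ≤-reflexive ]′ (halves n)

    h+h≤ : h + h ≤ n
    h+h≤ = [ (λ e → ≤-reflexive (sym e)) , (λ e → ≤-trans (n≤1+n _) (≤-reflexive (sym e))) ]′ (halves n)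

    h≥1 : 1 ≤ h
    h≥1 = n≢0⇒n>0 λ e → <⇒≱ n≥3 (≤-trans n≤ (≤-trans (≤-reflexive (cong (λ h → suc (h + h)) e)) (s≤s z≤n)))

    w+1 : w + 1 ≡ h
    w+1 = m∸n+n≡m h≥1

    suc-h≤ : suc h ≤ n
    suc-h≤ = ≤-trans (+-monoˡ-≤ h h≥1) h+h≤

    large : ∀ s s′ → s + s′ ≡ n → s ≡ h ⊎ s ≡ suc h → w ≤ s × w ≤ s′
    large s s′ e (inj₁ refl) = m∸n≤m h 1 , ≤-trans (m∸n≤m h 1) (+-cancelˡ-≤ h h s′ (≤-trans h+h≤ (≤-reflexive (sym e))))
    large s s′ e (inj₂ refl) = ≤-trans (m∸n≤m h 1) (n≤1+n h) , +-cancelˡ-≤ (suc h) w s′ (≤-trans (≤-reflexive (trans (large-ring₃ h w) (cong (h +_) w+1))) (≤-trans h+h≤ (≤-reflexive (sym e))))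

    square : n * n ≤ 4 * (w * w) + 15 * n
    square = ≤-trans (sq-mono n≤2w+3) (cert 0 (square-ring₂ w n) (6 ⊛ 2w≤n ⊕ 9 ⊛ ≤-trans (s≤s z≤n) n≥3))
      where
      n≤2w+3 : n ≤ 2 * w + 3
      n≤2w+3 = ≤-trans n≤ (≤-reflexive (trans (cong (λ h → suc (h + h)) (sym w+1)) (square-ring₁ w)))
      2w≤n : 2 * w ≤ n
      2w≤n = ≤-trans (+-mono-≤ (m∸n≤m h 1) (≤-trans (≤-reflexive (+-identityʳ w)) (m∸n≤m h 1))) h+h≤

  k≥3 : 3 ≤ k
  k≥3 = +-mono-≤ (+-mono-≤ a≥1 (≤-trans a≥1 a≤b)) (≤-trans a≥1 (≤-trans a≤b b≤c))

  nk≥3 : ∀ {N} → 0 < N → 3 ≤ N * k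
  nk≥3 {N} N>0 = ≤-trans k≥3 (m≤n*m k N {{>-nonZero N>0}})

  -- Every copy lies inside X or outside it, so k would divide the size of X. With X about half of
  -- the vertices, all links have density about 1/4.
  lower₃ : ∀ {N t} → 0 < N → Forces a b c (N * k) t → 1 * (N * k * (N * k)) ≤ 4 * (2 * t + 14 * (N * k))
  lower₃ {N} {t} N>0 forces = ≤-trans (≤-reflexive (*-identityˡ _)) (≤-trans square (cert (29 * n + 4) (lower₃-ring₄ (w * w) t n) (4 ⊛ V<)))
    where
    n : ℕ
    n = N * k
    open Halves n (nk≥3 {N} N>0)
    V< : w * w < 2 * t + 3 * n
    V< = R₃.bound (λ e → <⇒≱ k≥3 (≤-trans (≤-reflexive e) (s≤s z≤n))) weights {N} {t} h (w * w) suc-h≤ (λ s s′ e q → let ws , ws′ = large s s′ e q in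
        λ { true → ≤-trans (sq-mono ws) (m≤n+m _ 0 |> (lower₃-ring₁ s s′)) ; false → ≤-trans (sq-mono ws′) (≤-reflexive (lower₃-ring₂ s s′)) }) forces
      where
      infixl 0 _|>_
      _|>_ : ∀ {x y z : ℕ} → x ≤ y → y ≡ z → x ≤ z
      p |> q = ≤-trans p (≤-reflexive q)
      weights : ∀ e₀ e₁ e₂ → ρ₃ e₀ e₁ e₂ ≡ true → ∃ λ q → ⟦ e₀ ⟧ * a + ⟦ e₁ ⟧ * b + ⟦ e₂ ⟧ * c ≡ 0 + k * q
      weights true true true _ = 1 , lower₃-ring₃ a b c
      weights false false false _ = 0 , sym (*-zeroʳ k)

  -- Every copy has two whole parts in X or none. This is applied with g = gcd(a, b, c) and, when d
  -- is even, with g = 2.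
  lower₄ : ∀ g → g ≢ 1 → g ∣ a + b → g ∣ a + c → g ∣ b + c → ∀ {N t} → 0 < N → Forces a b c (N * k) t → 1 * (N * k * (N * k)) ≤ 2 * (2 * t + 14 * (N * k))
  lower₄ g g≢1 (divides q₁ e₁) (divides q₂ e₂) (divides q₃ e₃) {N} {t} N>0 forces = ≤-trans (≤-reflexive (*-identityˡ _)) (≤-trans square (cert (7 * n + 2) (lower₄-ring₆ (w * w) t n) (2 ⊛ V<)))
    where
    n : ℕ
    n = N * k
    open Halves n (nk≥3 {N} N>0)
    weights : ∀ e₀ e₁ e₂ → ρ₄ e₀ e₁ e₂ ≡ true → ∃ λ q → ⟦ e₀ ⟧ * a + ⟦ e₁ ⟧ * b + ⟦ e₂ ⟧ * c ≡ 0 + g * q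
    weights false false false _ = 0 , sym (*-zeroʳ g)
    weights true true false _ = q₁ , trans (lower₄-ring₁ a b) (trans e₁ (*-comm q₁ g))
    weights true false true _ = q₂ , trans (lower₄-ring₂ a c) (trans e₂ (*-comm q₂ g))
    weights false true true _ = q₃ , trans (lower₄-ring₃ b c) (trans e₃ (*-comm q₃ g))
    module R₄ = Rigid ρ₄ (symmetric₃ ρ₄ refl refl) (unique ρ₄ refl) 0 g g≢1 weights
    V< : 2 * (w * w) < 2 * t + 3 * n
    V< = R₄.bound {N} {t} h (2 * (w * w)) suc-h≤ (λ s s′ e q → let ws , ws′ = large s s′ e q in
        λ { true → ≤-trans (+-mono-≤ (*-mono-≤ ws′ ws) (≤-trans (≤-reflexive (+-identityʳ (w * w))) (*-mono-≤ ws ws′))) (≤-reflexive (lower₄-ring₄ s s′))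
          ; false → ≤-trans (+-mono-≤ (sq-mono ws′) (≤-trans (≤-reflexive (+-identityʳ (w * w))) (sq-mono ws))) (≤-reflexive (lower₄-ring₅ s s′)) }) forces

  -- X contains exactly one part of each copy, whose size is a modulo d. With a third of the
  -- vertices in X, the links of both kinds of vertices have density about 4/9.
  lower₅ : dval a b c ≢ 1 → ∀ {N t} → 0 < N → Forces a b c (N * k) t → 4 * (N * k * (N * k)) ≤ 9 * (2 * t + 14 * (N * k))
  lower₅ d≢1 {N} {t} N>0 forces = ≤-trans big (cert (8 * n + 9) (lower₅-ring₁₂ (w * w) t n) (9 ⊛ V<))
    where
    n h w : ℕ
    n = N * k
    h = n / 3
    w = 2 * h ∸ 1
    n≥3 : 3 ≤ n
    n≥3 = nk≥3 {N} N>0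
    n≤ : n ≤ 3 * h + 2
    n≤ = ≤-trans (≤-reflexive (trans (m≡m%n+[m/n]*n n 3) (+-comm (n % 3) _))) (+-mono-≤ (≤-reflexive (*-comm h 3)) (s≤s⁻¹ (m%n<n n 3)))
    3h≤ : 3 * h ≤ n
    3h≤ = ≤-trans (≤-reflexive (*-comm 3 h)) (m/n*n≤m n 3)
    h≥1 : 1 ≤ h
    h≥1 = n≢0⇒n>0 λ e → <⇒≱ n≥3 (≤-trans n≤ (≤-reflexive (cong (λ h → 3 * h + 2) e)))
    w+1 : w + 1 ≡ 2 * h
    w+1 = m∸n+n≡m (≤-trans h≥1 (m≤m+n h _))
    suc-h≤ : suc h ≤ n
    suc-h≤ = ≤-trans (+-monoˡ-≤ h h≥1) (≤-trans (+-monoʳ-≤ h (m≤m+n h (h + 0))) 3h≤)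
    large : ∀ s s′ → s + s′ ≡ n → s ≡ h ⊎ s ≡ suc h → w ≤ 2 * s × w ≤ s′
    large s s′ e (inj₁ refl) = m∸n≤m (2 * h) 1 , ≤-trans (m∸n≤m (2 * h) 1) (+-cancelˡ-≤ h (2 * h) s′ (≤-trans 3h≤ (≤-reflexive (sym e))))
    large s s′ e (inj₂ refl) = ≤-trans (m∸n≤m (2 * h) 1) (2 ⊛ n≤1+n h) , +-cancelˡ-≤ (suc h) w s′ (≤-trans (≤-reflexive (trans (lower₅-ring₁ h w) (cong (h +_) w+1))) (≤-trans 3h≤ (≤-reflexive (sym e))))
    w≤n : w ≤ n
    w≤n = ≤-trans (m∸n≤m (2 * h) 1) (≤-trans (*-monoˡ-≤ h (m≤m+n 2 1)) 3h≤)
    big : 4 * (n * n) ≤ 9 * (w * w) + 91 * n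
    big = ≤-trans (≤-reflexive (lower₅-ring₄ n)) (≤-trans (sq-mono 2n≤) (cert 0 (lower₅-ring₅ w n) (42 ⊛ w≤n ⊕ 49 ⊛ ≤-trans (s≤s z≤n) n≥3)))
      where
      2n≤ : 2 * n ≤ 3 * w + 7
      2n≤ = ≤-trans (2 ⊛ n≤) (≤-reflexive (trans (lower₅-ring₂ h) (trans (cong (λ z → 3 * z + 4) (sym w+1)) (lower₅-ring₃ w))))
    d : ℕ
    d = dval a b c
    weights : ∀ e₀ e₁ e₂ → ρ₅ e₀ e₁ e₂ ≡ true → ∃ λ q → ⟦ e₀ ⟧ * a + ⟦ e₁ ⟧ * b + ⟦ e₂ ⟧ * c ≡ a + d * q
    weights true false false _ = 0 , lower₅-ring₆ a d
    weights false true false _ = go (gcd[m,n]∣m (b ∸ a) (c ∸ b))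
      where
      go : d ∣ b ∸ a → ∃ λ q → 0 + 1 * b + 0 ≡ a + d * q
      go (divides q e) = q , trans (lower₅-ring₇ b) (trans (sym (m+[n∸m]≡n a≤b)) (cong (a +_) (trans e (*-comm q d))))
    weights false false true _ = go (gcd[m,n]∣m (b ∸ a) (c ∸ b)) (gcd[m,n]∣n (b ∸ a) (c ∸ b))
      where
      go : d ∣ b ∸ a → d ∣ c ∸ b → ∃ λ q → 0 + 0 + 1 * c ≡ a + d * q
      go (divides q e) (divides q′ e′) = q + q′ , trans (lower₅-ring₈ c) (trans (sym (m+[n∸m]≡n b≤c)) (trans (cong₂ _+_ (sym (m+[n∸m]≡n a≤b)) e′) (trans (cong (λ z → a + z + q′ * d) e) (lower₅-ring₉ a q q′ d))))
    module R₅ = Rigid ρ₅ (symmetric₃ ρ₅ refl refl) (unique ρ₅ refl) a d d≢1 weights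
    V< : w * w < 2 * t + 3 * n
    V< = R₅.bound {N} {t} h (w * w) suc-h≤ (λ s s′ e q → let ws , ws′ = large s s′ e q in
        λ { true → ≤-trans (sq-mono ws′) (≤-reflexive (lower₅-ring₁₀ s s′)) ; false → ≤-trans (*-mono-≤ ws ws′) (≤-reflexive (lower₅-ring₁₁ s s′)) }) forces

-- A vertex whose link avoids the shadow of the other edges

last-below : ∀ {P : ℕ → Set} → (∀ x → Dec (P x)) → P 0 → ∀ m → ¬ P m → ∃ λ x → P x × ¬ P (suc x)
last-below P? p0 zero n = ⊥-elim (n p0)
last-below P? p0 (suc m) n with P? m
... | yes p = m , p , n
... | no n′ = last-below P? p0 m n′

is₀ is₁ is₂ in₁₃ in₂₃ : Fin 4 → Bool
is₀ zero = true
is₀ (suc _) = false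
is₁ (suc zero) = true
is₁ _ = false
is₂ (suc (suc zero)) = true
is₂ _ = false
in₁₃ zero = false
in₁₃ (suc zero) = true
in₁₃ (suc (suc zero)) = false
in₁₃ (suc (suc (suc zero))) = true
in₂₃ zero = false
in₂₃ (suc zero) = false
in₂₃ (suc (suc zero)) = true
in₂₃ (suc (suc (suc zero))) = true

-- Class 0 is a single vertex with link A × B; the other edges are the triples inside A ∪ C
-- or inside B ∪ C, where A, B, C are the classes 1, 2, 3.
tripod : Fin 4 → Fin 4 → Fin 4 → Bool
tripod x y z = (in₁₃ x ∧ in₁₃ y ∧ in₁₃ z) ∨ (in₂₃ x ∧ in₂₃ y ∧ in₂₃ z)
  ∨ (is₀ x ∧ is₁ y ∧ is₂ z) ∨ (is₀ x ∧ is₂ y ∧ is₁ z) ∨ (is₁ x ∧ is₀ y ∧ is₂ z)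
  ∨ (is₂ x ∧ is₀ y ∧ is₁ z) ∨ (is₁ x ∧ is₂ y ∧ is₀ z) ∨ (is₂ x ∧ is₁ y ∧ is₀ z)

tripod₁₂ : ∀ x y z → tripod x y z ≡ tripod y x z
tripod₁₂ = does-true (all? λ x → all? λ y → all? λ z → tripod x y z ≟B tripod y x z) refl

tripod₂₃ : ∀ x y z → tripod x y z ≡ tripod x z y
tripod₂₃ = does-true (all? λ x → all? λ y → all? λ z → tripod x y z ≟B tripod x z y) refl

-- A pair of A × B lies in no edge except the one through the special vertex.
tripod-unique : ∀ x y z → tripod zero y z ≡ true → tripod x y z ≡ true → x ≡ zero
tripod-unique = does-true (all? λ x → all? λ y → all? λ z → (tripod zero y z ≟B true) →-dec ((tripod x y z ≟B true) →-dec (x ≟F zero))) refl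

module Tripod (a b c : ℕ) (a≥2 : 2 ≤ a) (a≤b : a ≤ b) (b≤c : b ≤ c) where
  k : ℕ
  k = a + b + c

  a≥1 : 1 ≤ a
  a≥1 = ≤-trans (s≤s z≤n) a≥2

  -- Up to lower order terms the special vertex has 2x² ordered link pairs and a vertex of A has (n
  -- - x)². These balance at x = (√2 - 1) n, where x² + 2xn = n² and 2x² = (6 - 4√2) n². In a factor
  -- the special vertex would share its part with another vertex, and both would have the same pair
  -- of A × B in their links.
  lower₆ : ∀ {n t} → 0 < n → Forces a b c n t → ∃ λ x → x ≤ n × n * n ≤ x * x + 2 * (x * n) × 2 * (x * x) ≤ 2 * t + 9 * n
  lower₆ {n} {t} n>0 forces = from (last-below (λ x → x * x + 2 * (x * n) <? n * n) (*-mono-≤ n>0 n>0) n (≤⇒≯ (m≤m+n (n * n) _)))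
    where
    from : (∃ λ x → x * x + 2 * (x * n) < n * n × ¬ (suc x * suc x + 2 * (suc x * n) < n * n)) → ∃ λ x → x ≤ n × n * n ≤ x * x + 2 * (x * n) × 2 * (x * x) ≤ 2 * t + 9 * n
    from (x , below , above) = suc x , ≤-trans (s≤s (m≤m+n x x)) (≤-trans (≤-reflexive (cong (λ z → suc (x + z)) (sym (+-identityʳ x)))) 2x<n) , ≮⇒≥ above ,
        cert (2 * n + 1) (lower₆-ring₇ x t n) (x² ⊕ 2 ⊛ 2x<n)
      where
      2x<n : 2 * x < n
      2x<n = *-cancelʳ-< _ (2 * x) n (≤-<-trans (≤-trans (≤-reflexive (*-assoc 2 x n)) (m≤n+m _ (x * x))) below)
      C V : ℕ
      C = n ∸ suc (2 * x)
      -- The pairs in the link of a vertex of A come from A ∪ C, which has n - x - 1 elements rather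
      -- than n - x; the subtracted 2n covers the difference of the squares.
      V = 2 * (x * x) ∸ 2 * n
      C+ : 1 + (x + (x + C)) ≡ n
      C+ = trans (lower₆-ring₁ x C) (m+[n∸m]≡n 2x<n)
      V≤ : V ≤ (x + C) * (x + C)
      V≤ = m≤n+o⇒m∸n≤o (2 * (x * x)) (2 * n) (subst (λ n → 2 * (x * x) ≤ 2 * n + (x + C) * (x + C)) C+ (cert (2 * x + 2) (lower₆-ring₂ x C) (subst (λ n → x * x + 2 * (x * n) < n * n) (sym C+) below)))
      sizes : Fin 4 → ℕ
      sizes zero = 1
      sizes (suc zero) = x
      sizes (suc (suc zero)) = x
      sizes (suc (suc (suc zero))) = C
      sum₄ : (f : Fin 4 → ℕ) → sum f ≡ f zero + (f (suc zero) + (f (suc (suc zero)) + f (suc (suc (suc zero)))))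
      sum₄ f = trans (sum-suc f) (cong (f zero +_) (trans (sum-suc _) (cong (f (suc zero) +_) (trans (sum-suc _) (cong (f (suc (suc zero)) +_) (trans (sum-suc _) (trans (cong (f (suc (suc (suc zero))) +_) (sum-nil _)) (+-identityʳ _))))))))
      cls = classes 4 sizes n (trans (sum₄ sizes) C+)
      cl : Fin n → Fin 4
      cl = proj₁ cls
      module G = ClassGraph cl tripod tripod₁₂ tripod₂₃
      links≡ : ∀ i → G.links i ≡ (let f = λ u w → ⟦ tripod i u w ⟧ * (sizes u * sizes w) ; g = λ u → f u zero + (f u (suc zero) + (f u (suc (suc zero)) + f u (suc (suc (suc zero)))))
                        in g zero + (g (suc zero) + (g (suc (suc zero)) + g (suc (suc (suc zero))))))
      links≡ i = trans (sum-cong-≗ λ u → sum-cong-≗ λ w → cong₂ (λ y z → ⟦ tripod i u w ⟧ * (y * z)) (proj₂ cls u) (proj₂ cls w))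
        (trans (sum₄ _) (cong₂ _+_ (sum₄ _) (cong₂ _+_ (sum₄ _) (cong₂ _+_ (sum₄ _) (sum₄ _)))))
      bound : ∀ i → V ≤ G.links i
      bound i = ≤-trans (go i) (≤-reflexive (sym (links≡ i)))
        where
        go : ∀ i → V ≤ (let f = λ u w → ⟦ tripod i u w ⟧ * (sizes u * sizes w) ; g = λ u → f u zero + (f u (suc zero) + (f u (suc (suc zero)) + f u (suc (suc (suc zero)))))
                        in g zero + (g (suc zero) + (g (suc (suc zero)) + g (suc (suc (suc zero))))))
        go zero = ≤-trans (m∸n≤m (2 * (x * x)) (2 * n)) (≤-reflexive (lower₆-ring₃ x C))
        go (suc zero) = ≤-trans V≤ (cert _ (lower₆-ring₄ x C) (z≤n {0}))
        go (suc (suc zero)) = ≤-trans V≤ (cert _ (lower₆-ring₅ x C) (z≤n {0}))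
        go (suc (suc (suc zero))) = ≤-trans V≤ (cert _ (lower₆-ring₆ x C) (z≤n {0}))
      no-factor : KFactor a b c G.graph → ⊥
      no-factor K = go (part v₀) refl
        where
        open Factor a≥1 a≤b b≤c G.graph K
        root : ∃ λ v → 0 < ⟦ cl v == zero ⟧
        root = sum-pigeon (λ _ → 0) (λ v → ⟦ cl v == zero ⟧) (subst₂ _<_ (sym (trans (sum-const n 0) (*-zeroʳ n))) (sym (proj₂ cls zero)) z<s)
        v₀ : Fin n
        v₀ = proj₁ root
        cl₀ : cl v₀ ≡ zero
        cl₀ = ==-sound (⟦⟧-pos (proj₂ root))
        part≥2 : ∀ j → 2 ≤ partSize a b c j
        part≥2 zero = a≥2
        part≥2 (suc zero) = ≤-trans a≥2 a≤b
        part≥2 (suc (suc zero)) = ≤-trans a≥2 (≤-trans a≤b b≤c)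
        alone : ∀ {v} → v ≢ v₀ → cl v ≡ zero → ⊥
        alone ne e = ne (two-in (λ v → cl v == zero) _ v₀ (subst (λ i → (i == zero) ≡ true) (sym e) (==-refl {4} zero)) (subst (λ i → (i == zero) ≡ true) (sym cl₀) (==-refl {4} zero)) (≤-reflexive (proj₂ cls zero)))
        shared : ∀ {v y z} → v ≢ v₀ → tripod (cl v₀) (cl y) (cl z) ≡ true → tripod (cl v) (cl y) (cl z) ≡ true → ⊥
        shared {v} {y} {z} ne e e′ = alone ne (tripod-unique (cl v) (cl y) (cl z) (subst (λ i → tripod i (cl y) (cl z) ≡ true) cl₀ e) e′)
        go : ∀ j → part v₀ ≡ j → ⊥
        go zero pj =
          let v , iv , ne = other-member (copy v₀) zero v₀ (part≥2 zero)
              y , iy = member (copy v₀) p₁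
              z , iz = member (copy v₀) p₂
          in shared {v} {y} {z} ne (edge-in (refl , pj) iy iz) (edge-in iv iy iz)
        go (suc zero) pj =
          let v , iv , ne = other-member (copy v₀) (suc zero) v₀ (part≥2 (suc zero))
              y , iy = member (copy v₀) p₀
              z , iz = member (copy v₀) p₂
              turn = λ w e → trans (tripod₁₂ (cl w) (cl y) (cl z)) e
          in shared {v} {y} {z} ne (turn v₀ (edge-in iy (refl , pj) iz)) (turn v (edge-in iy iv iz))
        go (suc (suc zero)) pj =
          let v , iv , ne = other-member (copy v₀) (suc (suc zero)) v₀ (part≥2 (suc (suc zero)))
              y , iy = member (copy v₀) p₀
              z , iz = member (copy v₀) p₁
              turn = λ w e → trans (tripod₁₂ (cl w) (cl y) (cl z)) (trans (tripod₂₃ (cl y) (cl w) (cl z)) e)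
          in shared {v} {y} {z} ne (turn v₀ (edge-in iy iz (refl , pj))) (turn v (edge-in iy iz iv))
      V< : V < 2 * t + 3 * n
      V< = by-contra-< λ h → no-factor (forces G.graph (G.minimum V t bound h))
      x² : 2 * (x * x) < 2 * t + 5 * n
      x² = ≤-trans (s≤s (m≤n+m∸n (2 * (x * x)) (2 * n))) (cert 0 (lower₆-ring₈ n V t) V<)

-- Rational form of the bounds

frac-unnormalised : ∀ m d → ℚ.toℚᵘ (frac m (suc d)) ℚᵘ.≃ ℚᵘ.mkℚᵘ (pos m) d
frac-unnormalised m d = ℚP.toℚᵘ-fromℚᵘ (ℚᵘ.mkℚᵘ (pos m) d)

ℕtoℚ-+ : ∀ m n → ℕtoℚ (m + n) ≡ ℕtoℚ m ℚ.+ ℕtoℚ n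
ℕtoℚ-+ m n = ℚP.toℚᵘ-injective (ℚᵘP.≃-trans (frac-unnormalised (m + n) 0) (ℚᵘP.≃-sym (ℚᵘP.≃-trans (ℚP.toℚᵘ-homo-+ (ℕtoℚ m) (ℕtoℚ n))
  (ℚᵘP.≃-trans (ℚᵘP.+-cong (frac-unnormalised m 0) (frac-unnormalised n 0)) (ℚᵘ.*≡* (trans (ℕtoℚ-+-ring (pos m) (pos n)) (cong (ℤ._* (pos 1 ℤ.* pos 1)) (sym (ℤP.pos-+ m n)))))))))

ℕtoℚ-* : ∀ m n → ℕtoℚ (m * n) ≡ ℕtoℚ m ℚ.* ℕtoℚ n
ℕtoℚ-* m n = ℚP.toℚᵘ-injective (ℚᵘP.≃-trans (frac-unnormalised (m * n) 0) (ℚᵘP.≃-sym (ℚᵘP.≃-trans (ℚP.toℚᵘ-homo-* (ℕtoℚ m) (ℕtoℚ n))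
  (ℚᵘP.≃-trans (ℚᵘP.*-cong (frac-unnormalised m 0) (frac-unnormalised n 0)) (ℚᵘ.*≡* (trans (ℕtoℚ-*-ring (pos m) (pos n)) (cong (ℤ._* (pos 1 ℤ.* pos 1)) (sym (ℤP.pos-* m n)))))))))

ℕtoℚ-mono : ∀ {m n} → m ≤ n → ℕtoℚ m ℚ.≤ ℕtoℚ n
ℕtoℚ-mono {m} {n} h = ℚP.toℚᵘ-cancel-≤ (ℚᵘP.≤-respʳ-≃ (ℚᵘP.≃-sym (frac-unnormalised n 0)) (ℚᵘP.≤-respˡ-≃ (ℚᵘP.≃-sym (frac-unnormalised m 0))
  (ℚᵘ.*≤* (subst₂ ℤ._≤_ (sym (ℤP.*-identityʳ (pos m))) (sym (ℤP.*-identityʳ (pos n))) (ℤ.+≤+ h)))))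

frac-cancel : ∀ m d → ℕtoℚ (suc d) ℚ.* frac m (suc d) ≡ ℕtoℚ m
frac-cancel m d = ℚP.toℚᵘ-injective (ℚᵘP.≃-trans (ℚP.toℚᵘ-homo-* (ℕtoℚ (suc d)) (frac m (suc d)))
  (ℚᵘP.≃-trans (ℚᵘP.*-cong (frac-unnormalised (suc d) 0) (frac-unnormalised m d)) (ℚᵘP.≃-trans (ℚᵘ.*≡* (trans (frac-cancel-ring (pos (suc d)) (pos m)) (cong (pos m ℤ.*_) (sym (ℤP.pos-* 1 (suc d))))))  (ℚᵘP.≃-sym (frac-unnormalised m 0)))))

ℕtoℚ-pos : ∀ {n} → 0 < n → 0ℚ ℚ.< ℕtoℚ n
ℕtoℚ-pos {suc n} _ = ℚP.positive⁻¹ (ℕtoℚ (suc n)) {{ℚP.normalize-pos (suc n) 1}}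

archimedean : ∀ γ → 0ℚ ℚ.< γ → ∃ λ g → 0 < g × 1ℚ ℚ.≤ ℕtoℚ g ℚ.* γ
archimedean γ@(ℚ.mkℚ (pos (suc m)) d _) _ = suc d , z<s , ℚP.toℚᵘ-cancel-≤ (ℚᵘP.≤-respʳ-≃ (ℚᵘP.≃-sym (ℚᵘP.≃-trans (ℚP.toℚᵘ-homo-* (ℕtoℚ (suc d)) γ)
    (ℚᵘP.*-cong (frac-unnormalised (suc d) 0) (ℚᵘP.≃-refl {ℚ.toℚᵘ γ})))) (ℚᵘ.*≤* (subst₂ ℤ._≤_ (sym (trans (ℤP.*-identityˡ _) (sym (ℤP.pos-* 1 (suc d))) )) (sym (trans (ℤP.*-identityʳ _) (sym (ℤP.pos-* (suc d) (suc m)))))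
      (ℤ.+≤+ (≤-trans (≤-reflexive (*-identityˡ (suc d))) (m≤m*n (suc d) (suc m)))))))
archimedean (ℚ.mkℚ (pos zero) d _) (*<* (ℤ.+<+ ()))
archimedean (ℚ.mkℚ ℤ.-[1+ m ] d _) (*<* ())

*-monoˡ : ∀ {r p q} → 0ℚ ℚ.≤ r → p ℚ.≤ q → r ℚ.* p ℚ.≤ r ℚ.* q
*-monoˡ {r} h = ℚP.*-monoˡ-≤-nonNeg r {{ℚ.nonNegative h}}

*-cancelˡ : ∀ {r p q} → 0ℚ ℚ.< r → r ℚ.* p ℚ.≤ r ℚ.* q → p ℚ.≤ q
*-cancelˡ {r} h = ℚP.*-cancelˡ-≤-pos r {{ℚ.positive h}}

0≤ℕtoℚ : ∀ n → 0ℚ ℚ.≤ ℕtoℚ n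
0≤ℕtoℚ n = ℕtoℚ-mono {0} {n} z≤n

*-mono-sq : ∀ {p q} → 0ℚ ℚ.≤ p → p ℚ.≤ q → p ℚ.* p ℚ.≤ q ℚ.* q
*-mono-sq {p} {q} h l = ℚP.≤-trans (*-monoˡ h l) (subst₂ ℚ._≤_ (ℚP.*-comm q p) refl (*-monoˡ (ℚP.≤-trans h l) l))

*-pos : ∀ {r p} → 0ℚ ℚ.< r → 0ℚ ℚ.< p → 0ℚ ℚ.< r ℚ.* p
*-pos {r} {p} h h′ = subst (ℚ._< r ℚ.* p) (ℚP.*-zeroʳ r) (ℚP.*-monoʳ-<-pos r {{ℚ.positive h}} h′)

sub-≤ : ∀ {p q r} → p ℚ.≤ q ℚ.+ r → p ℚ.- r ℚ.≤ q
sub-≤ {p} {q} {r} h = subst (p ℚ.- r ℚ.≤_) (sub-≤-ring q r) (ℚP.+-monoˡ-≤ (ℚ.- r) h)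

0≤-sub : ∀ {p q} → p ℚ.≤ q → 0ℚ ℚ.≤ q ℚ.- p
0≤-sub {p} {q} h = subst (ℚ._≤ q ℚ.- p) (ℚP.+-inverseʳ p) (ℚP.+-monoˡ-≤ (ℚ.- p) h)

record Represents (x : ℚ) (p q : ℕ) : Set where
  constructor represents
  field
    q>0 : 0 < q
    eq : ℕtoℚ q ℚ.* x ≡ ℕtoℚ p
open Represents

-- Since 1 ≤ gγ, an integer inequality with error N/g, cleared of denominators, yields the rational
-- one with error γN.
module Bounds {γ : ℚ} {g : ℕ} (g>0 : 0 < g) (1≤gγ : 1ℚ ℚ.≤ ℕtoℚ g ℚ.* γ) (N t : ℕ) where

  private
    n̂ t̂ ĝ : ℚ
    n̂ = ℕtoℚ N
    t̂ = ℕtoℚ t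
    ĝ = ℕtoℚ g

  r⁺ r⁻ : ℚ
  r⁺ = t̂ ℚ.+ γ ℚ.* n̂
  r⁻ = t̂ ℚ.- γ ℚ.* n̂

  below : ∀ {x p q} → Represents x p q → p * (g * N) ≤ q * (g * t + N) → x ℚ.* n̂ ℚ.≤ r⁺
  below {x} {p} {q} (represents q>0 eq) h = *-cancelˡ (*-pos (ℕtoℚ-pos q>0) (ℕtoℚ-pos g>0)) (subst₂ ℚ._≤_ lhs (below-ring₂ q̂ ĝ t̂ γ n̂)
      (ℚP.≤-trans (ℕtoℚ-mono h) (subst (ℚ._≤ q̂ ℚ.* (ĝ ℚ.* t̂ ℚ.+ ĝ ℚ.* γ ℚ.* n̂)) (sym rhs) (*-monoˡ (0≤ℕtoℚ q) (ℚP.+-monoʳ-≤ (ĝ ℚ.* t̂) gγ)))))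
    where
    q̂ : ℚ
    q̂ = ℕtoℚ q
    gγ : n̂ ℚ.≤ ĝ ℚ.* γ ℚ.* n̂
    gγ = subst₂ ℚ._≤_ (ℚP.*-identityʳ n̂) (ℚP.*-comm n̂ (ĝ ℚ.* γ)) (*-monoˡ (0≤ℕtoℚ N) 1≤gγ)
    lhs : ℕtoℚ (p * (g * N)) ≡ q̂ ℚ.* ĝ ℚ.* (x ℚ.* n̂)
    lhs = trans (ℕtoℚ-* p (g * N)) (trans (cong₂ ℚ._*_ (sym eq) (ℕtoℚ-* g N)) (below-ring₁ q̂ x ĝ n̂))
    rhs : ℕtoℚ (q * (g * t + N)) ≡ q̂ ℚ.* (ĝ ℚ.* t̂ ℚ.+ n̂)
    rhs = trans (ℕtoℚ-* q (g * t + N)) (cong (q̂ ℚ.*_) (trans (ℕtoℚ-+ (g * t) N) (cong (ℚ._+ n̂) (ℕtoℚ-* g t))))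

  below-ℕ : ∀ {w} → g * w ≤ g * t + N → ℕtoℚ w ℚ.≤ r⁺
  below-ℕ {w} h = *-cancelˡ (ℕtoℚ-pos g>0) (subst₂ ℚ._≤_ (ℕtoℚ-* g w) (below-ℕ-ring ĝ t̂ γ n̂)
      (ℚP.≤-trans (ℕtoℚ-mono h) (subst (ℚ._≤ ĝ ℚ.* t̂ ℚ.+ n̂ ℚ.* (ĝ ℚ.* γ)) (sym (trans (ℕtoℚ-+ (g * t) N) (cong₂ ℚ._+_ (ℕtoℚ-* g t) (sym (ℚP.*-identityʳ n̂)))))
        (ℚP.+-monoʳ-≤ (ĝ ℚ.* t̂) (*-monoˡ (0≤ℕtoℚ N) 1≤gγ)))))

  above : ∀ {x p q} → Represents x p q → q * (g * t) ≤ p * (g * N) + q * N → r⁻ ℚ.≤ x ℚ.* n̂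
  above {x} {p} {q} (represents q>0 eq) h = sub-≤ (*-cancelˡ (*-pos (ℕtoℚ-pos q>0) (ℕtoℚ-pos g>0)) (subst₂ ℚ._≤_ lhs (above-ring q̂ ĝ x γ n̂)
      (ℚP.≤-trans (ℕtoℚ-mono h) (subst (ℚ._≤ q̂ ℚ.* x ℚ.* (ĝ ℚ.* n̂) ℚ.+ q̂ ℚ.* (ĝ ℚ.* γ ℚ.* n̂)) (sym rhs) (ℚP.+-monoʳ-≤ (q̂ ℚ.* x ℚ.* (ĝ ℚ.* n̂)) (*-monoˡ (0≤ℕtoℚ q) gγ))))))
    where
    q̂ : ℚ
    q̂ = ℕtoℚ q
    gγ : n̂ ℚ.≤ ĝ ℚ.* γ ℚ.* n̂
    gγ = subst₂ ℚ._≤_ (ℚP.*-identityʳ n̂) (ℚP.*-comm n̂ (ĝ ℚ.* γ)) (*-monoˡ (0≤ℕtoℚ N) 1≤gγ)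
    lhs : ℕtoℚ (q * (g * t)) ≡ q̂ ℚ.* ĝ ℚ.* t̂
    lhs = trans (ℕtoℚ-* q (g * t)) (trans (cong (q̂ ℚ.*_) (ℕtoℚ-* g t)) (sym (ℚP.*-assoc q̂ ĝ t̂)))
    rhs : ℕtoℚ (p * (g * N) + q * N) ≡ q̂ ℚ.* x ℚ.* (ĝ ℚ.* n̂) ℚ.+ q̂ ℚ.* n̂
    rhs = trans (ℕtoℚ-+ (p * (g * N)) (q * N)) (cong₂ ℚ._+_ (trans (ℕtoℚ-* p (g * N)) (cong₂ ℚ._*_ (sym eq) (ℕtoℚ-* g N))) (ℕtoℚ-* q N))

  surd-below-rational : ∀ {x} → x ℚ.* n̂ ℚ.≤ r⁺ → scaleˢ n̂ (x +√2· 0ℚ) ≤ˢ r⁺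
  surd-below-rational {x} h = inj₁ (0≤-sub (subst (ℚ._≤ r⁺) (ℚP.*-comm x n̂) h) , ℚP.≤-reflexive (sym (cong ℚ.-_ (ℚP.*-zeroʳ n̂))))

  surd-above-rational : ∀ {x} → r⁻ ℚ.≤ x ℚ.* n̂ → scaleˢ n̂ (x +√2· 0ℚ) ˢ≥ r⁻
  surd-above-rational {x} h = inj₁ (0≤-sub (subst (r⁻ ℚ.≤_) (ℚP.*-comm x n̂) h) , ℚP.≤-reflexive (sym (ℚP.*-zeroʳ n̂)))

  private
    four : ∀ n → n ℚ.* (ℚ.- ℕtoℚ 4) ≡ ℚ.- (ℕtoℚ 4 ℚ.* n)
    four n = four-ring n (ℕtoℚ 4)

  -- w lies above (6 - 4√2) N because 6N - w is at most 4√2 N, which is tested by squares. If `r⁺`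
  -- reaches 6N, the signs alone decide.
  surd-below : ∀ {w} → 0 < N → ℕtoℚ w ℚ.≤ r⁺ → (6 * N ∸ w) * (6 * N ∸ w) ≤ 32 * (N * N) → scaleˢ n̂ (ℕtoℚ 6 +√2· (ℚ.- ℕtoℚ 4)) ≤ˢ r⁺
  surd-below {w} N>0 hw hy = go (0ℚ ℚP.≤? r⁺ ℚ.- n̂ ℚ.* ℕtoℚ 6)
    where
    p q s : ℚ
    p = r⁺ ℚ.- n̂ ℚ.* ℕtoℚ 6
    q = ℚ.- (n̂ ℚ.* (ℚ.- ℕtoℚ 4))
    s = n̂ ℚ.* ℕtoℚ 6 ℚ.- r⁺
    y : ℕ
    y = 6 * N ∸ w
    q≡ : q ≡ ℕtoℚ 4 ℚ.* n̂
    q≡ = surd-below-ring₁ n̂ (ℕtoℚ 4)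
    q̂>0 : 0ℚ ℚ.< q
    q̂>0 = subst (0ℚ ℚ.<_) (sym q≡) (*-pos (ℕtoℚ-pos {4} z<s) (ℕtoℚ-pos N>0))
    s≤ : s ℚ.≤ ℕtoℚ y
    s≤ = sub-≤ (ℚP.≤-trans (subst (ℚ._≤ ℕtoℚ (y + w)) (trans (ℕtoℚ-* 6 N) (ℚP.*-comm (ℕtoℚ 6) n̂)) (ℕtoℚ-mono (≤-trans (m≤n+m∸n (6 * N) w) (≤-reflexive (+-comm w y)))))
           (subst (ℚ._≤ ℕtoℚ y ℚ.+ r⁺) (sym (ℕtoℚ-+ y w)) (ℚP.+-monoʳ-≤ (ℕtoℚ y) hw)))
    go : Dec (0ℚ ℚ.≤ p) → Nonneg√ p q
    go (yes h) = inj₁ (h , ℚP.<⇒≤ q̂>0)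
    go (no h) = inj₂ (inj₂ (p<0 , q̂>0 , subst₂ ℚ._≤_ (surd-below-ring₃ r⁺ (n̂ ℚ.* ℕtoℚ 6)) 2q² (ℚP.≤-trans (*-mono-sq 0≤s s≤) (subst (ℚ._≤ ℕtoℚ (32 * (N * N))) (ℕtoℚ-* y y) (ℕtoℚ-mono hy)))))
      where
      p<0 : p ℚ.< 0ℚ
      p<0 = ℚP.≰⇒> h
      0≤s : 0ℚ ℚ.≤ s
      0≤s = subst (0ℚ ℚ.≤_) (sym (surd-below-ring₂ r⁺ (n̂ ℚ.* ℕtoℚ 6))) (ℚP.neg-antimono-≤ (ℚP.<⇒≤ p<0))
      2q² : ℕtoℚ (32 * (N * N)) ≡ (1ℚ ℚ.+ 1ℚ) ℚ.* (q ℚ.* q)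
      2q² = trans (cong ℕtoℚ (surd-below-ring₄ N)) (trans (ℕtoℚ-* 2 (4 * N * (4 * N))) (cong (ℕtoℚ 2 ℚ.*_) (trans (ℕtoℚ-* (4 * N) (4 * N)) (cong (λ z → z ℚ.* z) (trans (ℕtoℚ-* 4 N) (sym q≡))))))

  -- J/G is a rational upper bound for 4√2, and the error term 4N is paid for by `4 ≤ Gγ`.
  surd-above : ∀ {G J} → 0 < N → 0 < G → G * t + J * N ≤ 6 * (G * N) + 4 * N → ℕtoℚ 4 ℚ.≤ ℕtoℚ G ℚ.* γ → 32 * (G * G) ≤ J * J →
    scaleˢ n̂ (ℕtoℚ 6 +√2· (ℚ.- ℕtoℚ 4)) ˢ≥ r⁻
  surd-above {G} {J} N>0 G>0 h 4≤ hJ = inj₂ (inj₁ (0≤p , q<0 , *-cancelˡ (*-pos Ĝ>0 Ĝ>0) (subst₂ ℚ._≤_ lhs (surd-above-ring₄ Ĝ p) (ℚP.≤-trans (ℕtoℚ-mono ints) (subst (ℚ._≤ (Ĝ ℚ.* p) ℚ.* (Ĝ ℚ.* p)) (sym (trans (ℕtoℚ-* (J * N) (J * N)) refl)) (*-mono-sq (0≤ℕtoℚ (J * N)) JN≤))))))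
    where
    Ĝ p q : ℚ
    Ĝ = ℕtoℚ G
    p = n̂ ℚ.* ℕtoℚ 6 ℚ.- r⁻
    q = n̂ ℚ.* (ℚ.- ℕtoℚ 4)
    Ĝ>0 : 0ℚ ℚ.< Ĝ
    Ĝ>0 = ℕtoℚ-pos G>0
    JN≤ : ℕtoℚ (J * N) ℚ.≤ Ĝ ℚ.* p
    JN≤ = ℚP.≤-trans step (ℚP.≤-reflexive (surd-above-ring₂ Ĝ t̂ γ n̂ (ℕtoℚ 6)))
      where
      sums : ℕtoℚ (G * t + J * N) ≡ ℕtoℚ (J * N) ℚ.+ Ĝ ℚ.* t̂
      sums = trans (ℕtoℚ-+ (G * t) (J * N)) (trans (ℚP.+-comm (ℕtoℚ (G * t)) (ℕtoℚ (J * N))) (cong (ℕtoℚ (J * N) ℚ.+_) (ℕtoℚ-* G t)))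
      sums′ : ℕtoℚ (6 * (G * N) + 4 * N) ≡ ℕtoℚ 6 ℚ.* (Ĝ ℚ.* n̂) ℚ.+ n̂ ℚ.* ℕtoℚ 4
      sums′ = trans (ℕtoℚ-+ (6 * (G * N)) (4 * N)) (cong₂ ℚ._+_ (trans (ℕtoℚ-* 6 (G * N)) (cong (ℕtoℚ 6 ℚ.*_) (ℕtoℚ-* G N))) (trans (ℕtoℚ-* 4 N) (ℚP.*-comm (ℕtoℚ 4) n̂)))
      step : ℕtoℚ (J * N) ℚ.≤ (ℕtoℚ 6 ℚ.* (Ĝ ℚ.* n̂) ℚ.+ n̂ ℚ.* (Ĝ ℚ.* γ)) ℚ.- Ĝ ℚ.* t̂
      step = subst (ℚ._≤ (ℕtoℚ 6 ℚ.* (Ĝ ℚ.* n̂) ℚ.+ n̂ ℚ.* (Ĝ ℚ.* γ)) ℚ.- Ĝ ℚ.* t̂) (surd-above-ring₁ (ℕtoℚ (J * N)) (Ĝ ℚ.* t̂))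
        (ℚP.+-monoˡ-≤ (ℚ.- (Ĝ ℚ.* t̂)) (ℚP.≤-trans (subst₂ ℚ._≤_ sums sums′ (ℕtoℚ-mono h)) (ℚP.+-monoʳ-≤ (ℕtoℚ 6 ℚ.* (Ĝ ℚ.* n̂)) (*-monoˡ (0≤ℕtoℚ N) 4≤))))
    0≤p : 0ℚ ℚ.≤ p
    0≤p = *-cancelˡ Ĝ>0 (subst (ℚ._≤ Ĝ ℚ.* p) (sym (ℚP.*-zeroʳ Ĝ)) (ℚP.≤-trans (0≤ℕtoℚ (J * N)) JN≤))
    q<0 : q ℚ.< 0ℚ
    q<0 = subst (ℚ._< 0ℚ) (sym (four n̂)) (ℚP.neg-antimono-< (*-pos (ℕtoℚ-pos {4} z<s) (ℕtoℚ-pos N>0)))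
    ints : 32 * (G * G) * (N * N) ≤ J * N * (J * N)
    ints = ≤-trans (*-monoˡ-≤ (N * N) hJ) (≤-reflexive (surd-above-ring₃ J N))
    lhs : ℕtoℚ (32 * (G * G) * (N * N)) ≡ Ĝ ℚ.* Ĝ ℚ.* ((1ℚ ℚ.+ 1ℚ) ℚ.* (q ℚ.* q))
    lhs = trans (cong ℕtoℚ (surd-above-ring₅ G N)) (trans (ℕtoℚ-* (G * G) _) (cong₂ ℚ._*_ (ℕtoℚ-* G G) (trans (ℕtoℚ-* 2 (4 * N * (4 * N))) (cong (ℕtoℚ 2 ℚ.*_) (trans (ℕtoℚ-* (4 * N) (4 * N)) (trans (cong (λ z → z ℚ.* z) (ℕtoℚ-* 4 N)) (neg² (ℕtoℚ 4 ℚ.* n̂) q (four n̂))))))))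
      where
      neg² : ∀ x q → q ≡ ℚ.- x → x ℚ.* x ≡ q ℚ.* q
      neg² x _ refl = surd-above-ring₆ x

-- From n² to the binomial coefficient

open import Data.Nat.Combinatorics using (_C_; nC1≡n; nCk+nC[k+1]≡[n+1]C[k+1])

pairs : ∀ n → 2 * (n C 2) + n ≡ n * n
pairs zero = refl
pairs (suc n) = trans (cong (λ x → 2 * x + suc n) (sym (nCk+nC[k+1]≡[n+1]C[k+1] n 1))) (trans (cong (λ x → 2 * (x + n C 2) + suc n) (nC1≡n n))
  (trans (pairs-ring₁ n (n C 2)) (trans (cong (λ z → z + 2 * n + 1) (pairs n)) (pairs-ring₂ n))))

pairs>0 : ∀ {n} → 2 ≤ n → 0 < n C 2
pairs>0 {n} h = n≢0⇒n>0 λ e → <⇒≱ (*-monoʳ-< n {{>-nonZero (≤-trans (s≤s z≤n) h)}} h) (≤-reflexive (trans (sym (pairs n)) (trans (cong (λ z → 2 * z + n) e) (sym (*-identityʳ n)))))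

-- In the next three lemmas 2 N + n stands for n².
below-int : ∀ {p q g n t N} → p * (2 * N + n) ≤ q * (2 * t + 14 * n) → suc (14 * g) * n ≤ 2 * N + n → p * (g * N) ≤ q * (g * t + N)
below-int {p} {q} {g} {n} {t} {N} h hn = *-cancelˡ-≤ 2 (cert (g * p * n) (below-int-ring p q g n t N) (g ⊛ h ⊕ q ⊛ hn))

above-int : ∀ {p q g n t N} → 2 * (2 * g * q * t) < (2 * g * p + q) * (2 * N + n) + 2 * (2 * g * q) → (6 * g + 2) * n ≤ 2 * N + n → 1 ≤ n → p ≤ q →
  q * (g * t) ≤ p * (g * N) + q * N
above-int {p} {q} {g} {n} {t} {N} h hn n≥1 p≤q = *-cancelˡ-≤ 4 (cert 1 (above-int-ring p q g n t N) (h ⊕ q ⊛ hn ⊕ (2 * g * n) ⊛ p≤q ⊕ (4 * g * q) ⊛ n≥1))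

above-surd-int : ∀ {P j G n t N} → P + j ≡ 6 * G → 2 * (G * t) < P * (2 * N + n) + 2 * G → (1 + 3 * G) * n ≤ 2 * N + n → 1 ≤ n →
  G * t + suc j * N ≤ 6 * (G * N) + 4 * N
above-surd-int {P} {j} {G} {n} {t} {N} e h hn n≥1 = *-cancelˡ-≤ 2 (cert (G + 1) (above-surd-int-ring P j G n t N)
    (h ⊕ 3 ⊛ hn ⊕ (2 * N) ⊛ ≤-reflexive e ⊕ n ⊛ ≤-trans (m≤m+n P j) (≤-reflexive e) ⊕ (3 * G) ⊛ n≥1))

-- The quadratic u² − 6uw + w² is nonpositive at u = n², hence at every u between w and n².
surd-square : ∀ {N n x} → 2 * N + n ≡ n * n → n * n ≤ x * x + 2 * (x * n) → (6 * N ∸ x * x) * (6 * N ∸ x * x) ≤ 32 * (N * N)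
surd-square {N} {n} {x} e h = go (≤-total (2 * N) w)
  where
  w M : ℕ
  w = x * x
  M = n * n
  go : 2 * N ≤ w ⊎ w ≤ 2 * N → (6 * N ∸ w) * (6 * N ∸ w) ≤ 32 * (N * N)
  go (inj₁ u≤w) = ≤-trans (sq-mono (m≤n+o⇒m∸n≤o (6 * N) w (cert 0 (surd-square-ring₁ N w) u≤w))) (cert (16 * (N * N)) (surd-square-ring₂ N) (z≤n {0}))
  go (inj₂ w≤u) = with-δ (m≤n⇒∃[o]m+o≡n w≤u) (m≤n⇒∃[o]m+o≡n (≤-trans (m≤m+n (2 * N) n) (≤-reflexive e)))
    where
    with-δ : (∃ λ δ → w + δ ≡ 2 * N) → (∃ λ η → 2 * N + η ≡ M) → (6 * N ∸ w) * (6 * N ∸ w) ≤ 32 * (N * N)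
    with-δ (δ , eδ) (η , eη) = ≤-trans (sq-mono (≤-reflexive 6N-w)) (≤-trans (cert 0 (surd-square-ring₅ w δ) key) (≤-reflexive (trans (cong (λ u → 8 * (u * u)) eδ) (surd-square-ring₆ N))))
      where
      M≡ : M ≡ w + δ + η
      M≡ = trans (sym eη) (cong (_+ η) (sym eδ))
      6N-w : 6 * N ∸ w ≡ 3 * δ + 2 * w
      6N-w = trans (cong (_∸ w) (trans (surd-square-ring₃ N) (trans (cong (3 *_) (sym eδ)) (surd-square-ring₄ w δ)))) (m+n∸m≡n w (3 * δ + 2 * w))
      ε≤ : δ + η ≤ 2 * (x * n)
      ε≤ = +-cancelˡ-≤ w (δ + η) _ (≤-trans (≤-reflexive (trans (sym (+-assoc w δ η)) (sym M≡))) h)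
      ε² : (δ + η) * (δ + η) ≤ 4 * w * (w + δ + η)
      ε² = ≤-trans (sq-mono ε≤) (≤-reflexive (trans (surd-square-ring₇ x n) (cong (4 * w *_) M≡)))
      key : δ * δ ≤ 4 * w * (w + δ)
      key = case ≤-total δ (4 * w) of λ
        { (inj₁ l) → ≤-trans (*-monoˡ-≤ δ l) (*-monoʳ-≤ (4 * w) (m≤n+m δ w))
        ; (inj₂ l) → cert (η * δ + η * η) (surd-square-ring₈ w δ η) (ε² ⊕ η ⊛ l) }

ratio-< : ∀ {u v P P′ Q Q′} → 0 < Q → u * Q′ < v * P′ → P′ * Q ≤ P * Q′ → u * Q < v * P
ratio-< {u} {v} {P} {P′} {Q} {Q′} Q>0 h l = *-cancelʳ-< Q′ _ _ (<-≤-trans (subst₂ _<_ (ratio-<-ring u Q′ Q) refl (*-monoˡ-< Q {{>-nonZero Q>0}} h)) (≤-trans (≤-reflexive (*-assoc v P′ Q)) (≤-trans (v ⊛ l) (≤-reflexive (sym (*-assoc v P Q′))))))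

ratio-trans : ∀ {P P′ P″ Q Q′ Q″} → 0 < Q′ → P″ * Q′ ≤ P′ * Q″ → P′ * Q ≤ P * Q′ → P″ * Q ≤ P * Q″
ratio-trans {P} {P′} {P″} {Q} {Q′} {Q″} Q′>0 h l = *-cancelʳ-≤ _ _ Q′ {{>-nonZero Q′>0}} (subst₂ _≤_ (ratio-trans-ring P″ Q′ Q) (ratio-trans-ring P Q′ Q″) (≤-trans (*-monoˡ-≤ Q h) (≤-trans (≤-reflexive (ratio-trans-ring P′ Q″ Q)) (*-monoˡ-≤ Q″ l))))

-- θ² − 12θ + 4 decreases for θ ≤ 2.
C₃-mono : ∀ {P P′ Q Q′} → 0 < Q → 4 * (Q′ * Q′) + P′ * P′ < 12 * (P′ * Q′) → P′ * Q ≤ P * Q′ → P ≤ 2 * Q → 4 * (Q * Q) + P * P < 12 * (P * Q)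
C₃-mono {P} {P′} {Q} {Q′} Q>0 h l P≤ = *-cancelʳ-< (Q′ * Q′) _ _ (subst₂ _<_ (C₃-mono-ring₁ P Q Q′) (C₃-mono-ring₂ P Q Q′) (with-δ (m≤n⇒∃[o]m+o≡n l)))
  where
  x z : ℕ
  x = P′ * Q
  z = Q * Q′
  h′ : 4 * (z * z) + x * x < 12 * (x * z)
  h′ = ≤-trans (+-monoˡ-≤ (4 * (z * z) + x * x) (*-mono-≤ Q>0 Q>0)) (subst₂ _≤_ (C₃-mono-ring₃ P′ Q Q′) (C₃-mono-ring₄ P′ Q Q′) ((Q * Q) ⊛ h))
  y≤ : P * Q′ ≤ 2 * z
  y≤ = ≤-trans (*-monoˡ-≤ Q′ P≤) (≤-reflexive (*-assoc 2 Q Q′))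
  with-δ : (∃ λ δ → x + δ ≡ P * Q′) → 4 * (z * z) + P * Q′ * (P * Q′) < 12 * (P * Q′ * z)
  with-δ (δ , e) = subst (λ y → 4 * (z * z) + y * y < 12 * (y * z)) e (cert (8 * (δ * z) + δ * δ) (C₃-mono-ring₅ x z δ) (h′ ⊕ (2 * δ) ⊛ ≤-trans (≤-reflexive e) y≤))

frac-cancel′ : ∀ m {q} → 0 < q → ℕtoℚ q ℚ.* frac m q ≡ ℕtoℚ m
frac-cancel′ m {suc q} _ = frac-cancel m q

-- 4/9 lies above 6 - 4√2, and θ² - 12θ + 4 stays negative from there up to θ = 2; so in the cases
-- with f at least 4/9 the shadow condition comes for free.
C₃-from : ∀ {P Q} → 4 * Q < 9 * P → P ≤ 2 * Q → 0 < Q → 4 * (Q * Q) + P * P < 12 * (P * Q)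
C₃-from {P} {Q} h P≤ Q>0 = cert (P * Q) (C₃-from-ring P Q) (Q ⊛ h ⊕ P ⊛ P≤ ⊕ Q>0)

-- P/Q lies strictly above one of the three terms of M, by an amount that γ absorbs.
record Candidate (Above : ℕ → ℕ → Set) : Set where
  field
    P Q : ℕ
    Q>0 : 0 < Q
    P≤2Q : P ≤ 2 * Q
    n₁ : ℕ
    conclude : ∀ n → n₁ ≤ n → ∀ t → 2 * (Q * t) < P * (n * n) + 2 * Q → Above n t

module _ {Above : ℕ → ℕ → Set} where
  open Candidate

  infix 4 _≼_
  _≼_ : Candidate Above → Candidate Above → Set
  x ≼ y = P x * Q y ≤ P y * Q x

  ≼-trans : ∀ x y z → x ≼ y → y ≼ z → x ≼ z
  ≼-trans x y z h l = ratio-trans {P z} {P y} {P x} {Q z} {Q y} {Q x} (Q>0 y) h l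

  upper-bound₃ : ∀ x y z → ∃ λ m → x ≼ m × y ≼ m × z ≼ m
  upper-bound₃ x y z with ≤-total (P x * Q y) (P y * Q x)
  ... | inj₁ h with ≤-total (P y * Q z) (P z * Q y)
  ...   | inj₁ h′ = z , ≼-trans x y z h h′ , h′ , ≤-refl
  ...   | inj₂ h′ = y , h , ≤-refl , h′
  upper-bound₃ x y z | inj₂ h with ≤-total (P x * Q z) (P z * Q x)
  ...   | inj₁ h′ = z , h′ , ≼-trans y x z h h′ , ≤-refl
  ...   | inj₂ h′ = x , ≤-refl , h , h′

-- The cases of f and the final assembly

record FCase (k : ℕ) (Above Below Conditions : ℕ → ℕ → Set) : Set where
  open Candidate
  field
    cand : Candidate Above
    -- Asked for every larger ratio, since the conditions are used at the largest of the three
    -- candidates.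
    conditions : ∀ {P′ Q′} → 0 < Q′ → P cand * Q′ ≤ P′ * Q cand → P′ ≤ 2 * Q′ → Conditions P′ Q′
    n₂ : ℕ
    lower : ∀ {N t} → n₂ ≤ N * k → 0 < N → Below (N * k) t

-- By minimality t - 1 does not force a factor, so 2Q(t - 1) < P n²; the summand 2Q is this shift by
-- one.
threshold-≤ : ∀ {a b c n} P {Q} → 0 < Q → (∀ (H : ThreeGraph n) → (∀ v → P * (n * n) ≤ Q * (2 * degree H v)) → KFactor a b c H) →
  ∀ {t} → IsT1 a b c n t → 2 * (Q * t) < P * (n * n) + 2 * Q
threshold-≤ {n = n} P {Q} Q>0 U {zero} _ = <-≤-trans (subst (_< 2 * Q) (sym (cong (2 *_) (*-zeroʳ Q))) (*-mono-≤ {1} {2} (s≤s z≤n) Q>0)) (m≤n+m (2 * Q) (P * (n * n)))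
threshold-≤ {n = n} P {Q} Q>0 U {suc t} (_ , least) = subst (_< P * (n * n) + 2 * Q) (sym (threshold-≤-ring Q t)) (+-monoˡ-< (2 * Q)
  (≰⇒> λ h → least t (n<1+n t) λ H deg → U H λ v → ≤-trans h (Q ⊛ 2 ⊛ deg v)))

module Final (a b c : ℕ) (a≥1 : 1 ≤ a) (a≤b : a ≤ b) (b≤c : b ≤ c) (γ : ℚ) (g : ℕ) (g>0 : 0 < g) (1≤gγ : 1ℚ ℚ.≤ ℕtoℚ g ℚ.* γ) where

  open Space a b c a≥1 a≤b b≤c
  module Bd = Bounds {γ} {g} g>0 1≤gγ

  r⁺ r⁻ : ℕ → ℕ → ℚ
  r⁺ n t = ℕtoℚ t ℚ.+ γ ℚ.* ℕtoℚ (n C 2)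
  r⁻ n t = ℕtoℚ t ℚ.- γ ℚ.* ℕtoℚ (n C 2)

  Above Below Conditions : ℕ → ℕ → Set
  Above n t = ≤MN a b c (n C 2) (r⁻ n t)
  Below n t = Forces a b c n t → scaleˢ (ℕtoℚ (n C 2)) (fval a b c) ≤ˢ r⁺ n t
  Conditions P Q = (a ≡ 1 ⊎ 4 * (Q * Q) + P * P < 12 * (P * Q)) × Connecting P Q a b c

  n-large : ∀ {m n} → m ≤ n → m * n ≤ 2 * (n C 2) + n
  n-large {m} {n} h = ≤-trans (*-monoˡ-≤ n h) (≤-reflexive (sym (pairs n)))

  -- The ratio is p/q + 1/(2g): strictly above the term of M, yet by less than the 1/g that γ is
  -- known to allow.
  rational : ∀ {x p q} → Represents x p q → p ≤ q → (∀ n t → r⁻ n t ℚ.≤ x ℚ.* ℕtoℚ (n C 2) → Above n t) → Candidate Above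
  rational {x} {p} {q} rep p≤q into = record
    { P = 2 * g * p + q ; Q = 2 * g * q ; Q>0 = *-mono-≤ (*-mono-≤ {1} {2} (s≤s z≤n) g>0) (Represents.q>0 rep)
    ; P≤2Q = ≤-trans (+-mono-≤ ((2 * g) ⊛ p≤q) (m≤n*m q (2 * g) {{>-nonZero (*-mono-≤ {1} {2} (s≤s z≤n) g>0)}})) (≤-reflexive (cong (2 * g * q +_) (sym (+-identityʳ _))))
    ; n₁ = 6 * g + 2
    ; conclude = λ n hn t h → into n t (Bd.above (n C 2) t rep (above-int {p} {q} {g} {n} {t} {n C 2}
        (subst (λ m → 2 * (2 * g * q * t) < (2 * g * p + q) * m + 2 * (2 * g * q)) (sym (pairs n)) h) (n-large hn) (≤-trans (≤-trans (s≤s z≤n) (m≤n+m 2 (6 * g))) hn) p≤q)) }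

  ratio-strict : ∀ {p q} → 0 < q → p * (2 * g * q) < q * (2 * g * p + q)
  ratio-strict {p} {q} q>0 = ≤-trans (s≤s (≤-reflexive (ratio-strict-ring p q g))) (≤-trans (≤-reflexive (+-comm 1 _)) (≤-trans (+-monoʳ-≤ (q * (2 * g * p)) (*-mono-≤ q>0 q>0)) (≤-reflexive (sym (*-distribˡ-+ q (2 * g * p) q)))))

  s : ℕ
  s = b + c

  k²>0 : 0 < k * k
  k²>0 = *-mono-≤ k>0 k>0

  s≤k : s ≤ k
  s≤k = ≤-trans (m≤n+m s a) (≤-reflexive (sym (+-assoc a b c)))

  k²-s² : k * k ∸ s * s + s * s ≡ k * k
  k²-s² = m∸n+n≡m (sq-mono s≤k)

  rep₂ : Represents (q₂ a b c) (k * k ∸ s * s) (k * k)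
  rep₂ = represents k²>0 (trans (cong (ℚ._* q₂ a b c) (ℕtoℚ-* k k)) (trans (r₁ (ℕtoℚ k) (frac s k) 1ℚ refl) (trans (cong (λ z → ℕtoℚ k ℚ.* ℕtoℚ k ℚ.- z ℚ.* z) (frac-cancel′ s k>0))
      (trans (cong₂ ℚ._-_ (sym (ℕtoℚ-* k k)) (sym (ℕtoℚ-* s s))) (trans (cong (λ z → ℕtoℚ z ℚ.- ℕtoℚ (s * s)) (sym k²-s²)) (trans (cong (ℚ._- ℕtoℚ (s * s)) (ℕtoℚ-+ (k * k ∸ s * s) (s * s))) (rep₂-ring₂ (ℕtoℚ (k * k ∸ s * s)) (ℕtoℚ (s * s)))))))))
    where
    r₀ : ∀ k f → k ℚ.* k ℚ.* (1ℚ ℚ.- f ℚ.* f) ≡ k ℚ.* k ℚ.* 1ℚ ℚ.- (k ℚ.* f) ℚ.* (k ℚ.* f)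
    r₀ k f = rep₂-ring₁ k f 1ℚ
    r₁ : ∀ k f o → o ≡ 1ℚ → k ℚ.* k ℚ.* (o ℚ.- f ℚ.* f) ≡ k ℚ.* k ℚ.- (k ℚ.* f) ℚ.* (k ℚ.* f)
    r₁ k f _ refl = trans (r₀ k f) (cong (ℚ._- (k ℚ.* f) ℚ.* (k ℚ.* f)) (ℚP.*-identityʳ (k ℚ.* k)))

  rep₃ : Represents (q₃ a b c) ((a + b) * (a + b)) (k * k)
  rep₃ = represents k²>0 (trans (cong (ℚ._* q₃ a b c) (ℕtoℚ-* k k)) (trans (rep₃-ring (ℕtoℚ k) (frac (a + b) k)) (trans (cong (λ z → z ℚ.* z) (frac-cancel′ (a + b) k>0)) (sym (ℕtoℚ-* (a + b) (a + b))))))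

  cand₂ cand₃ : Candidate Above
  cand₂ = rational rep₂ (m∸n≤m (k * k) (s * s)) λ n t h → inj₂ (inj₁ h)
  cand₃ = rational rep₃ (sq-mono (m≤m+n (a + b) c)) λ n t h → inj₂ (inj₂ h)

  lower-rational : ∀ {x p q} n t → Represents x p q → suc (14 * g) ≤ n → p * (n * n) ≤ q * (2 * t + 14 * n) → x ℚ.* ℕtoℚ (n C 2) ℚ.≤ r⁺ n t
  lower-rational {x} {p} {q} n t rep hn h = Bd.below (n C 2) t rep (below-int {p} {q} {g} {n} {t} {n C 2} (subst (λ m → p * m ≤ q * (2 * t + 14 * n)) (sym (pairs n)) h) (n-large hn))

  rational-case : ∀ p q → 0 < q → p ≤ q → fval a b c ≡ (frac p q +√2· 0ℚ) →
    (∀ {P Q} → 0 < Q → p * Q < q * P → P ≤ 2 * Q → Conditions P Q) →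
    (∀ {N t} → 0 < N → Forces a b c (N * k) t → p * (N * k * (N * k)) ≤ q * (2 * t + 14 * (N * k))) → FCase k Above Below Conditions
  rational-case p q q>0 p≤q f≡ cond low = record
    { cand = rational rep p≤q λ n t h → inj₁ (subst (λ f → scaleˢ (ℕtoℚ (n C 2)) f ˢ≥ r⁻ n t) (sym f≡) (Bd.surd-above-rational (n C 2) t h))
    ; conditions = λ {P′} {Q′} Q>0 l P≤ → cond Q>0 (ratio-< {p} {q} {P′} {2 * g * p + q} {Q′} {2 * g * q} Q>0 (ratio-strict {p} {q} q>0) l) P≤
    ; n₂ = suc (14 * g)
    ; lower = λ {N} {t} hn N>0 forces → subst (λ f → scaleˢ (ℕtoℚ ((N * k) C 2)) f ≤ˢ r⁺ (N * k) t) (sym f≡)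
        (Bd.surd-below-rational ((N * k) C 2) t (lower-rational (N * k) t rep hn (low {N} {t} N>0 forces))) }
    where
    rep : Represents (frac p q) p q
    rep = represents q>0 (frac-cancel′ p q>0)

  -- Let j be the last integer with j² < 32G², so that j is just below 4√2 G. Then P₀ = 6G - j makes
  -- P₀/G exceed 6 - 4√2 by at most 1/G, and the shadow condition is j² < 32G² itself, because 32G²
  -- - j² = 12P₀G - P₀² - 4G².
  surd-case : dval a b c ≡ 1 → 2 ≤ a → fval a b c ≡ (ℕtoℚ 6 +√2· (ℚ.- ℕtoℚ 4)) → FCase k Above Below Conditions
  surd-case d a≥2 f≡ = from (last-below (λ j → j * j <? 32 * (G * G)) (*-mono-≤ {1} {32} (s≤s z≤n) (*-mono-≤ G>0 G>0)) (6 * G) (≤⇒≯ (cert (4 * (G * G)) (surd-case-ring₁ G) (z≤n {0}))))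
    where
    G : ℕ
    G = 4 * g
    G>0 : 0 < G
    G>0 = *-mono-≤ {1} {4} (s≤s z≤n) g>0
    4≤Gγ : ℕtoℚ 4 ℚ.≤ ℕtoℚ G ℚ.* γ
    4≤Gγ = subst₂ ℚ._≤_ (ℚP.*-identityʳ (ℕtoℚ 4)) (trans (sym (ℚP.*-assoc (ℕtoℚ 4) (ℕtoℚ g) γ)) (cong (ℚ._* γ) (sym (ℕtoℚ-* 4 g)))) (*-monoˡ (0≤ℕtoℚ 4) 1≤gγ)
    from : (∃ λ j → j * j < 32 * (G * G) × ¬ (suc j * suc j < 32 * (G * G))) → FCase k Above Below Conditions
    from (j , j²< , above) = record
      { cand = record { P = P₀ ; Q = G ; Q>0 = G>0 ; P≤2Q = P₀≤ ; n₁ = 2 + 3 * G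
                      ; conclude = λ n hn t h → inj₁ (subst (λ f → scaleˢ (ℕtoℚ (n C 2)) f ˢ≥ r⁻ n t) (sym f≡) (Bd.surd-above (n C 2) t {G} {suc j} (pairs>0 (≤-trans (m≤m+n 2 (3 * G)) hn)) G>0
                          (above-surd-int {P₀} {j} {G} {n} {t} {n C 2} P₀+j (subst (λ m → 2 * (G * t) < P₀ * m + 2 * G) (sym (pairs n)) h)
                             (n-large (≤-trans (n≤1+n _) hn)) (≤-trans (s≤s z≤n) hn)) 4≤Gγ (≮⇒≥ above))) }
      ; conditions = λ {P′} {Q′} Q>0 l P≤ → inj₂ (C₃-mono {P′} {P₀} {Q′} {G} Q>0 c₃ l P≤) , inj₁ (d , subst (_< 4 * P′) (*-identityˡ Q′) (ratio-< {1} {4} {P′} {P₀} {Q′} {G} Q>0 (subst (_< 4 * P₀) (sym (*-identityˡ G)) G<4P₀) l))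
      ; n₂ = 2 + 9 * g
      ; lower = λ {N} {t} hn N>0 forces → subst (λ f → scaleˢ (ℕtoℚ ((N * k) C 2)) f ≤ˢ r⁺ (N * k) t) (sym f≡) (low (N * k) t hn forces) }
      where
      P₀ : ℕ
      P₀ = 6 * G ∸ j
      j<6G : j < 6 * G
      j<6G = sq-cancel-< (<-≤-trans j²< (cert (4 * (G * G)) (surd-case-ring₁ G) (z≤n {0})))
      P₀+j : P₀ + j ≡ 6 * G
      P₀+j = m∸n+n≡m (<⇒≤ j<6G)
      4G≤j : 4 * G ≤ j
      4G≤j = s≤s⁻¹ (sq-cancel-< (<-≤-trans (≤-trans (≤-reflexive (+-comm 1 _)) (≤-trans (+-monoʳ-≤ (4 * G * (4 * G)) (*-mono-≤ {1} {16} (s≤s z≤n) (*-mono-≤ G>0 G>0))) (≤-reflexive (surd-case-ring₂ G)))) (≮⇒≥ above)))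
      P₀≤ : P₀ ≤ 2 * G
      P₀≤ = m≤n+o⇒m∸n≤o (6 * G) j (≤-trans (≤-reflexive (surd-case-ring₃ G)) (+-monoˡ-≤ (2 * G) 4G≤j))
      c₃ : 4 * (G * G) + P₀ * P₀ < 12 * (P₀ * G)
      c₃ = cert 0 (trans (surd-case-ring₄ P₀ G j) (trans (cong (λ z → 1 + P₀ * P₀ + z * z) (sym P₀+j)) (trans (surd-case-ring₅ P₀ j) (trans (cong (λ z → 1 + j * j + 2 * (P₀ * z)) P₀+j) (surd-case-ring₆ P₀ G j))))) j²<
      -- This is 6 - 4√2 > 1/4, or 16√2 < 23, which holds as 16 · 32 < 23².
      G<4P₀ : G < 4 * P₀
      G<4P₀ = +-cancelʳ-< (4 * j) G (4 * P₀) (≤-trans (+-monoʳ-< G 4j<) (≤-reflexive (trans (surd-case-ring₇ G) (trans (cong (4 *_) (sym P₀+j)) (*-distribˡ-+ 4 P₀ j)))))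
        where
        4j< : 4 * j < 23 * G
        4j< = sq-cancel-< (≤-trans (s≤s (≤-reflexive (surd-case-ring₈ j))) (≤-trans (*-monoʳ-< 16 j²<) (cert (17 * (G * G)) (surd-case-ring₉ G) (z≤n {0}))))
      low : ∀ n t → 2 + 9 * g ≤ n → Forces a b c n t → scaleˢ (ℕtoℚ (n C 2)) (ℕtoℚ 6 +√2· (ℚ.- ℕtoℚ 4)) ≤ˢ r⁺ n t
      low n t hn forces =
        let x , _ , h , h′ = Tripod.lower₆ a b c a≥2 a≤b b≤c {n} {t} (≤-trans (s≤s z≤n) hn) forces
        in Bd.surd-below (n C 2) t {x * x} (pairs>0 (≤-trans (m≤m+n 2 (9 * g)) hn))
             (Bd.below-ℕ (n C 2) t (*-cancelˡ-≤ 2 (cert 0 (surd-case-ring₁₀ g (x * x) t n (n C 2)) (g ⊛ h′ ⊕ n-large (≤-trans (n≤1+n _) hn)))))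
             (surd-square {n C 2} {n} {x} (pairs n) h)

module Assemble (a b c : ℕ) (a≥1 : 1 ≤ a) (a≤b : a ≤ b) (b≤c : b ≤ c) (γ : ℚ) (g : ℕ) (g>0 : 0 < g) (1≤gγ : 1ℚ ℚ.≤ ℕtoℚ g ℚ.* γ) where

  open Space a b c a≥1 a≤b b≤c
  open Final a b c a≥1 a≤b b≤c γ g g>0 1≤gγ

  private
    -- The branches of `fval` with the outcomes of the tests as arguments, so that a case reduces as
    -- soon as the outcomes are known.
    f-of : Bool → Bool → Bool → Bool → Surd
    f-of u v w x = if u then (if v then (if w then (frac 1 4 +√2· 0ℚ) else (ℕtoℚ 6 +√2· (ℚ.- ℕtoℚ 4)))
        else (if x then (frac 4 9 +√2· 0ℚ) else (frac 1 2 +√2· 0ℚ))) else (frac 1 2 +√2· 0ℚ)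

    d : ℕ
    d = dval a b c

    gcd? : Dec (gcd3 a b c ≡ 1)
    gcd? = gcd3 a b c ≟ℕ 1
    d? : Dec (d ≡ 1)
    d? = d ≟ℕ 1
    a? : Dec (a ≡ 1)
    a? = a ≟ℕ 1
    odd? : Dec (3 ≤ d × d % 2 ≡ 1)
    odd? = (3 ≤? d) ×-dec (d % 2 ≟ℕ 1)

    f≡ : ∀ {u v w x} → does gcd? ≡ u → does d? ≡ v → does a? ≡ w → does odd? ≡ x → fval a b c ≡ f-of u v w x
    f≡ refl refl refl refl = refl

    4Q<9P : ∀ {P Q} → Q < 2 * P → 4 * Q < 9 * P
    4Q<9P {P} {Q} h = cert (3 + P) (4Q<9P-ring P Q) (4 ⊛ h)

    half-case : fval a b c ≡ (frac 1 2 +√2· 0ℚ) → (∃ λ e → e ≢ 1 × e ∣ a + b × e ∣ a + c × e ∣ b + c) → FCase k Above Below Conditions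
    half-case q (e , e≢1 , h₁ , h₂ , h₃) = rational-case 1 2 z<s (s≤s z≤n) q
      (λ {P} {Q} Q>0 h P≤ → let h′ = subst (_< 2 * P) (*-identityˡ Q) h in inj₂ (C₃-from {P} {Q} (4Q<9P {P} {Q} h′) P≤ Q>0) , inj₂ (inj₂ h′))
      (λ {N} {t} → lower₄ e e≢1 h₁ h₂ h₃ {N} {t})

    common-divisor : ∀ e → e ∣ a → e ∣ b → e ∣ c → e ∣ a + b × e ∣ a + c × e ∣ b + c
    common-divisor e ea eb ec = ∣m∣n⇒∣m+n ea eb , ∣m∣n⇒∣m+n ea ec , ∣m∣n⇒∣m+n eb ec

    even-differences : 2 ∣ d → 2 ∣ a + b × 2 ∣ a + c × 2 ∣ b + c
    even-differences h = pair a≤b p , pair (≤-trans a≤b b≤c) (subst (2 ∣_) (trans (sym (+-∸-assoc (c ∸ b) a≤b)) (cong (_∸ a) (m∸n+n≡m b≤c))) (∣m∣n⇒∣m+n q p)) , pair b≤c q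
      where
      p : 2 ∣ b ∸ a
      p = ∣-trans h (gcd[m,n]∣m (b ∸ a) (c ∸ b))
      q : 2 ∣ c ∸ b
      q = ∣-trans h (gcd[m,n]∣n (b ∸ a) (c ∸ b))
      pair : ∀ {x y} → x ≤ y → 2 ∣ y ∸ x → 2 ∣ x + y
      pair {x} {y} l h = subst (2 ∣_) (trans (even-differences-ring x (y ∸ x)) (cong (x +_) (m+[n∸m]≡n l))) (∣m∣n⇒∣m+n (m∣m*n x) h)

    -- This includes d = 0, that is a = b = c, by the convention gcd(0, 0) = 0.
    even : ¬ (3 ≤ d × d % 2 ≡ 1) → d ≢ 1 → 2 ∣ d
    even h n = go (d % 2) refl (m%n<n d 2)
      where
      d≡ : d ≡ d % 2 + d / 2 * 2
      d≡ = m≡m%n+[m/n]*n d 2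
      small : ∀ x → x ≢ 1 → x % 2 ≡ 1 → 3 ≤ x
      small zero _ ()
      small (suc zero) n _ = ⊥-elim (n refl)
      small (suc (suc zero)) _ ()
      small (suc (suc (suc x))) _ _ = s≤s (s≤s (s≤s z≤n))
      go : ∀ r → d % 2 ≡ r → r < 2 → 2 ∣ d
      go zero e _ = divides (d / 2) (trans d≡ (cong (_+ d / 2 * 2) e))
      go (suc zero) e _ = ⊥-elim (h (small d n e , e))
      go (suc (suc _)) _ (s≤s (s≤s ()))

    fcase : FCase k Above Below Conditions
    fcase = go gcd? refl d? refl a? refl odd? refl
      where
      go : (u : Dec (gcd3 a b c ≡ 1)) → does gcd? ≡ does u → (v : Dec (d ≡ 1)) → does d? ≡ does v → (w : Dec (a ≡ 1)) → does a? ≡ does w →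
        (x : Dec (3 ≤ d × d % 2 ≡ 1)) → does odd? ≡ does x → FCase k Above Below Conditions
      go (no u) eu v ev w ew x ex = half-case (f≡ eu ev ew ex) (gcd3 a b c , u , common-divisor _ (gcd[m,n]∣m a (gcd b c))
        (∣-trans (gcd[m,n]∣n a (gcd b c)) (gcd[m,n]∣m b c)) (∣-trans (gcd[m,n]∣n a (gcd b c)) (gcd[m,n]∣n b c)))
      go (yes u) eu (yes v) ev (yes w) ew x ex = rational-case 1 4 z<s (s≤s z≤n) (f≡ eu ev ew ex)
        (λ {P} {Q} Q>0 h P≤ → inj₁ w , inj₁ (v , subst (_< 4 * P) (*-identityˡ Q) h)) (λ {N} {t} → lower₃ {N} {t})
      go (yes u) eu (yes v) ev (no w) ew x ex = surd-case v (≤∧≢⇒< a≥1 (w ∘ sym)) (f≡ eu ev ew ex)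
      go (yes u) eu (no v) ev w ew (yes x) ex = rational-case 4 9 z<s (m≤m+n 4 5) (f≡ eu ev ew ex)
        (λ {P} {Q} Q>0 h P≤ → inj₂ (C₃-from {P} {Q} h P≤ Q>0) , inj₂ (inj₁ (u , (d / 2 , trans (m≡m%n+[m/n]*n d 2) (cong₂ _+_ (proj₂ x) (*-comm (d / 2) 2))) , h)))
        (λ {N} {t} → lower₅ v {N} {t})
      go (yes u) eu (no v) ev w ew (no x) ex = half-case (f≡ eu ev ew ex) (2 , (λ ()) , even-differences (even x v))

  open Candidate
  open FCase fcase renaming (cand to cand₁)

  best : ∃ λ m → cand₁ ≼ m × cand₂ ≼ m × cand₃ ≼ m
  best = upper-bound₃ cand₁ cand₂ cand₃

  θ : Candidate Above
  θ = proj₁ best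

  θ-good : Good (P θ) (Q θ) a b c
  θ-good = g₁ , g₂ , conditions (Q>0 θ) (proj₁ (proj₂ best)) (P≤2Q θ)
    where
    p₂ : ℕ
    p₂ = k * k ∸ s * s
    g₁ : Q θ * (k * k) < P θ * (k * k) + Q θ * (s * s)
    g₁ = subst₂ _<_ (trans (θ-good-ring p₂ (Q θ) (s * s)) (cong (Q θ *_) k²-s²)) (cong (_+ Q θ * (s * s)) (*-comm (k * k) (P θ)))
      (+-monoˡ-< (Q θ * (s * s)) (ratio-< {p₂} {k * k} {P θ} {P cand₂} {Q θ} {Q cand₂} (Q>0 θ) (ratio-strict {p₂} {k * k} k²>0) (proj₁ (proj₂ (proj₂ best)))))
    g₂ : Q θ * ((a + b) * (a + b)) < P θ * (k * k)
    g₂ = subst₂ _<_ (*-comm ((a + b) * (a + b)) (Q θ)) (*-comm (k * k) (P θ))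
      (ratio-< {(a + b) * (a + b)} {k * k} {P θ} {P cand₃} {Q θ} {Q cand₃} (Q>0 θ) (ratio-strict {(a + b) * (a + b)} {k * k} k²>0) (proj₂ (proj₂ (proj₂ best))))

  upper : ∃ λ n₀ → ∀ n → n₀ ≤ n → (a + b + c) ∣ n → (H : ThreeGraph n) → (∀ v → P θ * (n * n) ≤ Q θ * (2 * degree H v)) → KFactor a b c H
  upper = upper-bound a b c (P θ) (Q θ) a≥1 a≤b b≤c θ-good

  conclusion : ∃ λ n₀ → ∀ n → n₀ ≤ n → (a + b + c) ∣ n → ∀ t → IsT1 a b c n t → ≤MN a b c (n C 2) (r⁻ n t) × MN≤ a b c (n C 2) (r⁺ n t)
  conclusion = proj₁ upper ⊔ (n₁ θ ⊔ (n₂ ⊔ suc (14 * g))) , main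
    where
    main : ∀ n → proj₁ upper ⊔ (n₁ θ ⊔ (n₂ ⊔ suc (14 * g))) ≤ n → (a + b + c) ∣ n → ∀ t → IsT1 a b c n t → ≤MN a b c (n C 2) (r⁻ n t) × MN≤ a b c (n C 2) (r⁺ n t)
    main n hn kn@(divides N refl) t T@(forces , _) =
      conclude θ n (m⊔n≤o⇒m≤o (n₁ θ) _ h₁) t (threshold-≤ (P θ) (Q>0 θ) (proj₂ upper n (m⊔n≤o⇒m≤o (proj₁ upper) _ hn) kn) T) ,
      lower {N} {t} (m⊔n≤o⇒m≤o n₂ _ h₂) N>0 forces ,
      lower-rational {p = k * k ∸ s * s} {k * k} n t rep₂ h₃ low₂ ,
      lower-rational {p = (a + b) * (a + b)} {k * k} n t rep₃ h₃ low₃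
      where
      h₁ : n₁ θ ⊔ (n₂ ⊔ suc (14 * g)) ≤ n
      h₁ = m⊔n≤o⇒n≤o (proj₁ upper) _ hn
      h₂ : n₂ ⊔ suc (14 * g) ≤ n
      h₂ = m⊔n≤o⇒n≤o (n₁ θ) _ h₁
      h₃ : suc (14 * g) ≤ n
      h₃ = m⊔n≤o⇒n≤o n₂ _ h₂
      N>0 : 0 < N
      N>0 = n≢0⇒n>0 λ e → <⇒≱ (≤-trans (s≤s z≤n) h₃) (≤-reflexive (cong (_* k) e))
      5≤14 : 2 * t + 5 * n ≤ 2 * t + 14 * n
      5≤14 = +-monoʳ-≤ (2 * t) (*-monoˡ-≤ n (m≤m+n 5 9))
      low₂ : (k * k ∸ s * s) * (n * n) ≤ k * k * (2 * t + 14 * n)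
      low₂ = +-cancelˡ-≤ (s * s * (n * n)) _ _ (subst (_≤ s * s * (n * n) + k * k * (2 * t + 14 * n)) (trans (cong (_* (n * n)) (trans (sym k²-s²) (+-comm _ (s * s)))) (*-distribʳ-+ (n * n) (s * s) (k * k ∸ s * s)))
        (≤-trans (lower₁ {N} {t} N>0 forces) (+-monoʳ-≤ (s * s * (n * n)) ((k * k) ⊛ 5≤14))))
      low₃ : (a + b) * (a + b) * (n * n) ≤ k * k * (2 * t + 14 * n)
      low₃ = ≤-trans (lower₂ {N} {t} N>0 forces) ((k * k) ⊛ 5≤14)

theorem1p1 : (a b c : ℕ) → 1 ≤ a → a ≤ b → b ≤ c →
    (γ : ℚ) → 0ℚ ℚ.< γ →
    ∃[ n₀ ] ((n : ℕ) → n₀ ≤ n → (a + b + c) ∣ n →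
      (t : ℕ) → IsT1 a b c n t →
        ≤MN a b c (n C 2) (ℕtoℚ t ℚ.- γ ℚ.* ℕtoℚ (n C 2))
        × MN≤ a b c (n C 2) (ℕtoℚ t ℚ.+ γ ℚ.* ℕtoℚ (n C 2)))
theorem1p1 a b c a≥1 a≤b b≤c γ γ>0 =
  let g , g>0 , 1≤gγ = archimedean γ γ>0
  in Assemble.conclusion a b c a≥1 a≤b b≤c γ g g>0 1≤gγ
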